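{- Let $n$ and $r$ be integers with $3 \leq r < n$, let $t=\lfloor (n-1)/2 \rfloor$, and let $H$ be an $n$-vertex $r$-uniform hypergraph. If either (a) $r\leq t$ and $\delta(H) \geq \binom{t}{r-1} +1$, or (b) $r\geq n/2$ and $\delta(H) \geq r$, then $H$ contains a hamiltonian Berge cycle, i.e. a Berge cycle of length $n$.
   Context: A hypergraph is a family of (distinct) subsets, called edges, of a vertex set; it is $r$-uniform if every edge has exactly $r$ vertices. The degree of a vertex is the number of edges containing it, and $\delta(H)$ is the minimum degree. A Berge cycle of length $\ell$ is a list $v_1, e_1, v_2, \ldots, v_\ell, e_\ell, v_1$ of $\ell$ distinct vertices and $\ell$ distinct edges with $\{v_i, v_{i+1}\} \subseteq e_i$ for all $i$ (indices modulo $\ell$). -}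

module Defs where

open import Data.Nat using (ℕ; zero; suc)
open import Data.Fin using (Fin; zero; suc; fromℕ; inject₁)
open import Data.Fin.Subset using (Subset; ∣_∣; _∈_)
open import Data.Vec using (tabulate; lookup)
open import Data.Product using (_×_; Σ)
open import Data.Empty using (⊥)
open import Function.Definitions using (Injective)
open import Relation.Binary.PropositionalEquality using (_≡_)

record UniformHypergraph (n r : ℕ) : Set where
  field
    m        : ℕ
    edge     : Fin m → Subset n
    distinct : Injective _≡_ _≡_ edge
    uniform  : (j : Fin m) → ∣ edge j ∣ ≡ r

open UniformHypergraph public

degree : ∀ {n r} → UniformHypergraph n r → Fin n → ℕ
degree H v = ∣ tabulate (λ j → lookup (edge H j) v) ∣

MinDegreeAtLeast : ∀ {n r} → UniformHypergraph n r → ℕ → Set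
MinDegreeAtLeast {n} H d = (v : Fin n) → d Data.Nat.≤ degree H v

-- cyclic successor on Fin (suc k): i ↦ i+1 mod (k+1)
next : ∀ {k} → Fin (suc k) → Fin (suc k)
next {zero}  zero    = zero
next {suc k} zero    = suc zero
next {suc k} (suc i) with next {k} i
... | zero   = zero
... | suc j  = suc (suc j)

-- A Berge cycle of length ℓ = suc k: distinct vertices v_0..v_k, distinct
-- edges e_0..e_k, with {v_i, v_{i+1 mod ℓ}} ⊆ e_i.
record BergeCycle {n r : ℕ} (H : UniformHypergraph n r) (k : ℕ) : Set where
  field
    vtx      : Fin (suc k) → Fin n
    edg      : Fin (suc k) → Fin (m H)
    vtx-inj  : Injective _≡_ _≡_ vtx
    edg-inj  : Injective _≡_ _≡_ edg
    consec   : (i : Fin (suc k)) →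
               (vtx i ∈ edge H (edg i)) × (vtx (next i) ∈ edge H (edg i))

HamiltonianBergeCycle : ∀ {n r} → UniformHypergraph n r → Set
HamiltonianBergeCycle {zero}  H = ⊥
HamiltonianBergeCycle {suc k} H = BergeCycle H k

-- Write r = q + 1 and ℓ + 1 for the number of vertices, and suppose that there is no
-- Hamiltonian Berge cycle.  A Hamiltonian path x 0, …, x ℓ has edges y i ∋ x i, x (i + 1);
-- the remaining edges are free.  If an edge through x 0 and x (i + 1) is free or equal to
-- y i, the first i + 1 vertices can be reversed, which moves the front to x i.  Let A be the
-- set of these indices i and U the set of i for which no free edge joins x i and x ℓ.  Since
-- no path closes up, A ⊆ U; since there is no cycle of length ℓ either, U is closed under
-- predecessors at the elements of A.  The degree condition makes A large, because the free
-- edges at x 0 are subsets of x 0 and the successors of A.  If U is too small, A = U is an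
-- initial segment that no front ever leaves, so x 0 and its neighbours form a clique too
-- small for the degree of x 0.  Hence every end has few free edges, so it lies on many edges
-- of the path, and the path edges have too small a total size for that; the remaining
-- configurations with |A| ≤ |U| ≤ |A| + 1 are excluded by moving both ends.
--
-- Cycles of length ℓ are excluded in the same way, by looking at the edges through the
-- missing vertex, and a Hamiltonian path exists because the hypergraph can be completed to
-- one that contains the cyclic intervals: taking a single edge away from a hypergraph with a
-- Hamiltonian cycle leaves a Hamiltonian path.

module Submission where

open import Data.Bool using (Bool; true; false; not; _∧_; _∨_)
open import Data.Bool.Properties using (∧-comm; ∧-identityʳ) renaming (_≟_ to _≟ᵇ_)
open import Data.Empty using (⊥; ⊥-elim)
open import Data.Fin using (Fin)
import Data.Fin.Properties as FP
open import Data.List using (List; []; _∷_; downFrom; allFin; length; tabulate)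
open import Data.List.Membership.Propositional using (_∈_)
open import Data.List.Membership.Propositional.Properties using (∈-downFrom⁺; ∈-downFrom⁻; ∈-allFin)
open import Data.List.Properties using (length-downFrom; length-tabulate)
open import Data.List.Relation.Unary.All as All using (All; []; _∷_)
open import Data.List.Relation.Unary.AllPairs using ([]; _∷_)
open import Data.List.Relation.Unary.Any using (here; there)
open import Data.List.Relation.Unary.Unique.Propositional using (Unique)
open import Data.List.Relation.Unary.Unique.Propositional.Properties using (allFin⁺; downFrom⁺)
open import Data.Nat using (ℕ; zero; suc; _+_; _*_; _∸_; _≤_; _<_; z≤n; s≤s; _≤ᵇ_; _<ᵇ_; _≤?_; _<?_; _≟_)
open import Data.Nat.Properties hiding (_≟_; _≤?_; _<?_)
open import Data.Nat.Tactic.RingSolver using (solve-∀)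
open import Data.Product using (_×_; _,_; Σ; proj₁; proj₂)
open import Data.Sum using (_⊎_; inj₁; inj₂)
open import Data.Unit using (tt)
open import Relation.Binary.Definitions using (tri<; tri≈; tri>)
open import Relation.Binary.PropositionalEquality using (_≡_; _≢_; refl; sym; trans; cong; cong₂; subst; subst₂)
open import Relation.Nullary using (¬_; Dec; yes; no; contradiction)
open import Relation.Nullary.Decidable using (⌊_⌋)

-- The threshold in (a) is met by two non-Hamiltonian shapes of minimum degree `bin t q`: two
-- complete hypergraphs on `t + 1` vertices, disjoint or sharing one vertex according to the parity
-- of `n`, and the hypergraph of all edges meeting a fixed set of `n ∸ t` vertices at most once.
-- `Clique` answers the first shape and `Alternating` the second. Since `D` exceeds `bin t q` only
-- by one, many counts stop one short of a contradiction. The missing unit comes from exchanging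
-- `y 0` for a free edge: the vertex order stays the same, so both edges obey one neighbourhood
-- bound. The estimates live on the growth of `bin t q` in `t`. It is weakest at `q + 1 = t`, where
-- `bin t q = t`; for even `n` this forces the separate arguments `Critical` and `AllBad`. The
-- numbers `t = 3`, `q = 2` escape the cycle estimate and give the single case `n = 8`, `r = 3`. A
-- closed path is always an assumption to be refuted, so the result stays doubly negated until a
-- finite search at the very end.

Is : Bool → Set
Is b = b ≡ true

is? : ∀ b → Dec (Is b)
is? true  = yes refl
is? false = no λ ()

∧⁺ : ∀ {a b} → Is a → Is b → Is (a ∧ b)
∧⁺ refl refl = refl

∧⁻¹ : ∀ {a b} → Is (a ∧ b) → Is a
∧⁻¹ {true} _ = refl

∧⁻² : ∀ {a b} → Is (a ∧ b) → Is b
∧⁻² {true} p = p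

∨⁺¹ : ∀ {a b} → Is a → Is (a ∨ b)
∨⁺¹ refl = refl

∨⁺² : ∀ {a b} → Is b → Is (a ∨ b)
∨⁺² {true}  _ = refl
∨⁺² {false} p = p

∨⁻ : ∀ {a b} → Is (a ∨ b) → Is a ⊎ Is b
∨⁻ {true}  _ = inj₁ refl
∨⁻ {false} p = inj₂ p

not⁺ : ∀ {a} → ¬ Is a → Is (not a)
not⁺ {true}  n = ⊥-elim (n refl)
not⁺ {false} _ = refl

not⁻ : ∀ {a} → Is (not a) → ¬ Is a
not⁻ {false} _ ()

stable : ∀ {b} → ¬ ¬ Is b → Is b
stable {true}  _ = refl
stable {false} n = ⊥-elim (n λ ())

b≡ : ∀ {a b} → (Is a → Is b) → (Is b → Is a) → a ≡ b
b≡ {true}          f _ = sym (f refl)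
b≡ {false} {true}  _ g = g refl
b≡ {false} {false} _ _ = refl

-- Linear arithmetic over ℕ: inequalities are refuted by searching for a
-- combination with multipliers 0, 1, 2 whose left side exceeds the right one.

infixr 7 _⊕_
infixr 8 _⊗_
infix  6 _≼_

data Ex : Set where
  ν   : ℕ → Ex
  κ   : ℕ → Ex
  _⊕_ : Ex → Ex → Ex
  _⊗_ : ℕ → Ex → Ex

data Ineq : Set where
  _≼_ : Ex → Ex → Ineq

nth : List ℕ → ℕ → ℕ
nth []       _       = 0
nth (a ∷ _)  zero    = a
nth (_ ∷ as) (suc i) = nth as i

⟦_⟧ : Ex → List ℕ → ℕ
⟦ ν i ⟧   ρ = nth ρ i
⟦ κ c ⟧   ρ = c
⟦ a ⊕ b ⟧ ρ = ⟦ a ⟧ ρ + ⟦ b ⟧ ρ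
⟦ c ⊗ a ⟧ ρ = c * ⟦ a ⟧ ρ

Holds : List ℕ → Ineq → Set
Holds ρ (a ≼ b) = ⟦ a ⟧ ρ ≤ ⟦ b ⟧ ρ

dot : List ℕ → List ℕ → ℕ
dot []       _        = 0
dot (_ ∷ _)  []       = 0
dot (c ∷ cs) (a ∷ as) = c * a + dot cs as

addL : List ℕ → List ℕ → List ℕ
addL []       ds       = ds
addL cs       []       = cs
addL (c ∷ cs) (d ∷ ds) = c + d ∷ addL cs ds

scaleL : ℕ → List ℕ → List ℕ
scaleL k []       = []
scaleL k (c ∷ cs) = k * c ∷ scaleL k cs

unitL : ℕ → List ℕ
unitL zero    = 1 ∷ []
unitL (suc i) = 0 ∷ unitL i

-- Entry 0 is the constant term, so vectors are paired with the environment `1 ∷ ρ`, and variable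
-- `i` sits at entry `i + 1`.
lin : Ex → List ℕ
lin (ν i)   = unitL (suc i)
lin (κ c)   = c ∷ []
lin (a ⊕ b) = addL (lin a) (lin b)
lin (c ⊗ a) = scaleL c (lin a)

private
  +-interchange : ∀ a b c d x → (a + b) * x + (c + d) ≡ (a * x + c) + (b * x + d)
  +-interchange = solve-∀

  scale-step : ∀ k c x d → k * c * x + k * d ≡ k * (c * x + d)
  scale-step = solve-∀

dot-add : ∀ cs ds ρ → dot (addL cs ds) ρ ≡ dot cs ρ + dot ds ρ
dot-add []       ds       ρ        = refl
dot-add (c ∷ cs) []       []       = refl
dot-add (c ∷ cs) []       (a ∷ ρ)  = sym (+-identityʳ _)
dot-add (c ∷ cs) (d ∷ ds) []       = refl
dot-add (c ∷ cs) (d ∷ ds) (a ∷ ρ)  =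
  trans (cong ((c + d) * a +_) (dot-add cs ds ρ)) (+-interchange c d (dot cs ρ) (dot ds ρ) a)

dot-scale : ∀ k cs ρ → dot (scaleL k cs) ρ ≡ k * dot cs ρ
dot-scale k []       ρ       = sym (*-zeroʳ k)
dot-scale k (c ∷ cs) []      = sym (*-zeroʳ k)
dot-scale k (c ∷ cs) (a ∷ ρ) = trans (cong (k * c * a +_) (dot-scale k cs ρ)) (scale-step k c a (dot cs ρ))

dot-unit : ∀ i ρ → dot (unitL i) ρ ≡ nth ρ i
dot-unit zero    []      = refl
dot-unit zero    (a ∷ ρ) = trans (+-identityʳ _) (+-identityʳ a)
dot-unit (suc i) []      = refl
dot-unit (suc i) (a ∷ ρ) = dot-unit i ρ

dot-lin : ∀ e ρ → dot (lin e) (1 ∷ ρ) ≡ ⟦ e ⟧ ρ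
dot-lin (ν i)   ρ = dot-unit i ρ
dot-lin (κ c)   ρ = trans (+-identityʳ _) (*-identityʳ c)
dot-lin (a ⊕ b) ρ = trans (dot-add (lin a) (lin b) _) (cong₂ _+_ (dot-lin a ρ) (dot-lin b ρ))
dot-lin (c ⊗ a) ρ = trans (dot-scale c (lin a) _) (cong (c *_) (dot-lin a ρ))

leqL : List ℕ → List ℕ → Bool
leqL []       _        = true
leqL (c ∷ cs) []       = (c ≤ᵇ 0) ∧ leqL cs []
leqL (c ∷ cs) (d ∷ ds) = (c ≤ᵇ d) ∧ leqL cs ds

≤ᵇ⁻ : ∀ {a b} → Is (a ≤ᵇ b) → a ≤ b
≤ᵇ⁻ {a} {b} p = ≤ᵇ⇒≤ a b (subst Data.Bool.T (sym p) tt)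

≤ᵇ⁺ : ∀ {a b} → a ≤ b → Is (a ≤ᵇ b)
≤ᵇ⁺ {a} {b} p with a ≤ᵇ b | ≤⇒≤ᵇ p
... | true | _ = refl

dot-leq : ∀ cs ds ρ → Is (leqL cs ds) → dot cs ρ ≤ dot ds ρ
dot-leq []       ds       ρ       h = z≤n
dot-leq (c ∷ cs) ds       []      h = z≤n
dot-leq (c ∷ cs) []       (a ∷ ρ) h with ≤ᵇ⁻ {c} {0} (∧⁻¹ h)
... | z≤n = dot-leq cs [] ρ (∧⁻² h)
dot-leq (c ∷ cs) (d ∷ ds) (a ∷ ρ) h =
  +-mono-≤ (*-monoˡ-≤ a (≤ᵇ⁻ {c} {d} (∧⁻¹ h))) (dot-leq cs ds ρ (∧⁻² h))

-- `L` and `R` accumulate the two sides of the combination. The test at a leaf compares coefficients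
-- one by one, which is sound because all variables take natural values.
search : List Ineq → List ℕ → List ℕ → Bool
search []             L R = leqL (addL (1 ∷ []) R) L
search ((a ≼ b) ∷ is) L R =
  search is (addL (lin a) L) (addL (lin b) R) ∨
  (search is L R ∨
   search is (addL (lin a) (addL (lin a) L)) (addL (lin b) (addL (lin b) R)))

search-sound : ∀ is L R ρ → Is (search is L R) → dot L (1 ∷ ρ) ≤ dot R (1 ∷ ρ) → All (Holds ρ) is → ⊥
search-sound [] L R ρ h le [] = 1+n≰n (begin
  suc (dot R (1 ∷ ρ))                  ≡⟨ sym (dot-add (1 ∷ []) R (1 ∷ ρ)) ⟩
  dot (addL (1 ∷ []) R) (1 ∷ ρ)        ≤⟨ dot-leq (addL (1 ∷ []) R) L (1 ∷ ρ) h ⟩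
  dot L (1 ∷ ρ)                        ≤⟨ le ⟩
  dot R (1 ∷ ρ)                        ∎)
  where open ≤-Reasoning
search-sound ((a ≼ b) ∷ is) L R ρ h le (ab ∷ hs) with ∨⁻ h
... | inj₁ h₁ = search-sound is _ _ ρ h₁ (add L R le) hs
  where
  add : ∀ L R → dot L (1 ∷ ρ) ≤ dot R (1 ∷ ρ) → dot (addL (lin a) L) (1 ∷ ρ) ≤ dot (addL (lin b) R) (1 ∷ ρ)
  add L R le rewrite dot-add (lin a) L (1 ∷ ρ) | dot-add (lin b) R (1 ∷ ρ) | dot-lin a ρ | dot-lin b ρ = +-mono-≤ ab le
... | inj₂ h₂ with ∨⁻ {search is L R} h₂
...   | inj₁ h₃ = search-sound is L R ρ h₃ le hs
...   | inj₂ h₃ = search-sound is _ _ ρ h₃ (add _ _ (add L R le)) hs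
  where
  add : ∀ L R → dot L (1 ∷ ρ) ≤ dot R (1 ∷ ρ) → dot (addL (lin a) L) (1 ∷ ρ) ≤ dot (addL (lin b) R) (1 ∷ ρ)
  add L R le rewrite dot-add (lin a) L (1 ∷ ρ) | dot-add (lin b) R (1 ∷ ρ) | dot-lin a ρ | dot-lin b ρ = +-mono-≤ ab le

opaque
  refute : ∀ (ρ : List ℕ) is → All (Holds ρ) is → Is (search is [] []) → ⊥
  refute ρ is hs h = search-sound is [] [] ρ h z≤n hs

-- Counting

b2n : Bool → ℕ
b2n false = 0
b2n true  = 1

b2n-mono : ∀ {a b} → (Is a → Is b) → b2n a ≤ b2n b
b2n-mono {false}        _ = z≤n
b2n-mono {true} {true}  _ = ≤-refl
b2n-mono {true} {false} f with f refl
... | ()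

cnt : ∀ {A : Set} → List A → (A → Bool) → ℕ
cnt []       p = 0
cnt (a ∷ as) p = b2n (p a) + cnt as p

# : ℕ → (ℕ → Bool) → ℕ
# k p = cnt (downFrom k) p

module _ {A : Set} where

  cnt-⊆ : ∀ (as : List A) {p q} → (∀ a → a ∈ as → Is (p a) → Is (q a)) → cnt as p ≤ cnt as q
  cnt-⊆ []       h = z≤n
  cnt-⊆ (a ∷ as) h = +-mono-≤ (b2n-mono (h a (here refl))) (cnt-⊆ as (λ b b∈ → h b (there b∈)))

  cnt-disj : ∀ (as : List A) {p q o} → (∀ a → a ∈ as → Is (p a) → Is (o a)) →
             (∀ a → a ∈ as → Is (q a) → Is (o a)) → (∀ a → a ∈ as → Is (p a) → Is (q a) → ⊥) →
             cnt as p + cnt as q ≤ cnt as o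
  cnt-disj []       f g h = z≤n
  cnt-disj (a ∷ as) {p} {q} {o} f g h =
    subst (_≤ cnt (a ∷ as) o) (eq (b2n (p a)) (b2n (q a)) _ _)
      (+-mono-≤ (head (f a (here refl)) (g a (here refl)) (h a (here refl)))
                (cnt-disj as (λ b b∈ → f b (there b∈)) (λ b b∈ → g b (there b∈)) (λ b b∈ → h b (there b∈))))
    where
    eq : ∀ x y u v → (x + y) + (u + v) ≡ (x + u) + (y + v)
    eq = solve-∀
    head : ∀ {x y z} → (Is x → Is z) → (Is y → Is z) → (Is x → Is y → ⊥) → b2n x + b2n y ≤ b2n z
    head {false} {y}     f g h = b2n-mono g
    head {true}  {false} f g h = ≤-trans (≤-reflexive (+-identityʳ 1)) (b2n-mono f)
    head {true}  {true}  f g h = ⊥-elim (h refl refl)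

  cnt-cov : ∀ (as : List A) {o p q} → (∀ a → a ∈ as → Is (o a) → Is (p a) ⊎ Is (q a)) →
            cnt as o ≤ cnt as p + cnt as q
  cnt-cov []       h = z≤n
  cnt-cov (a ∷ as) {o} {p} {q} h =
    subst (cnt (a ∷ as) o ≤_) (eq (b2n (p a)) (b2n (q a)) _ _)
      (+-mono-≤ (head (h a (here refl))) (cnt-cov as (λ b b∈ → h b (there b∈))))
    where
    eq : ∀ x y u v → (x + y) + (u + v) ≡ (x + u) + (y + v)
    eq = solve-∀
    head : ∀ {x y z} → (Is x → Is y ⊎ Is z) → b2n x ≤ b2n y + b2n z
    head {false}                 h = z≤n
    head {true} {true}           h = s≤s z≤n
    head {true} {false} {true}   h = ≤-refl
    head {true} {false} {false}  h with h refl
    ... | inj₁ ()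
    ... | inj₂ ()

  cnt-pos : ∀ (as : List A) {p a} → a ∈ as → Is (p a) → 1 ≤ cnt as p
  cnt-pos (a ∷ as) {p} (here refl) pa rewrite pa = s≤s z≤n
  cnt-pos (b ∷ as) {p} (there a∈)  pa = ≤-trans (cnt-pos as a∈ pa) (m≤n+m _ (b2n (p b)))

  cnt-wit : ∀ (as : List A) {p} → 1 ≤ cnt as p → Σ A λ a → a ∈ as × Is (p a)
  cnt-wit (a ∷ as) {p} h with p a in eq
  ... | true  = a , here refl , eq
  ... | false with cnt-wit as h
  ...   | b , b∈ , pb = b , there b∈ , pb

  cnt-none : ∀ (as : List A) {p} → (∀ a → a ∈ as → ¬ Is (p a)) → cnt as p ≡ 0
  cnt-none as {p} h with cnt as p in eq
  ... | zero  = refl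
  ... | suc _ with cnt-wit as {p} (subst (1 ≤_) (sym eq) (s≤s z≤n))
  ...   | a , a∈ , pa = ⊥-elim (h a a∈ pa)

  cnt-sub1 : ∀ (as : List A) {p} → Unique as → (∀ a b → a ∈ as → b ∈ as → Is (p a) → Is (p b) → a ≡ b) → cnt as p ≤ 1
  cnt-sub1 []       u        h = z≤n
  cnt-sub1 (a ∷ as) {p} (a∉ ∷ u) h with p a in eq
  ... | false = cnt-sub1 as u (λ b c b∈ c∈ → h b c (there b∈) (there c∈))
  ... | true  = ≤-reflexive (cong suc (cnt-none as λ b b∈ pb → All.lookup a∉ b∈ (h a b (here refl) (there b∈) eq pb)))

  cnt-ext : ∀ (as : List A) {p q} → (∀ a → a ∈ as → p a ≡ q a) → cnt as p ≡ cnt as q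
  cnt-ext []       h = refl
  cnt-ext (a ∷ as) h = cong₂ _+_ (cong b2n (h a (here refl))) (cnt-ext as (λ b b∈ → h b (there b∈)))

module _ where

  #-⊆ : ∀ k {p q} → (∀ i → i < k → Is (p i) → Is (q i)) → # k p ≤ # k q
  #-⊆ k h = cnt-⊆ (downFrom k) (λ i i∈ → h i (∈-downFrom⁻ i∈))

  #-disj : ∀ k {p q o} → (∀ i → i < k → Is (p i) → Is (o i)) → (∀ i → i < k → Is (q i) → Is (o i)) →
           (∀ i → i < k → Is (p i) → Is (q i) → ⊥) → # k p + # k q ≤ # k o
  #-disj k f g h = cnt-disj (downFrom k) (λ i i∈ → f i (∈-downFrom⁻ i∈)) (λ i i∈ → g i (∈-downFrom⁻ i∈)) (λ i i∈ → h i (∈-downFrom⁻ i∈))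

  #-cov : ∀ k {o p q} → (∀ i → i < k → Is (o i) → Is (p i) ⊎ Is (q i)) → # k o ≤ # k p + # k q
  #-cov k h = cnt-cov (downFrom k) (λ i i∈ → h i (∈-downFrom⁻ i∈))

  #-≤ : ∀ k p → # k p ≤ k
  #-≤ zero    p = z≤n
  #-≤ (suc k) p with p k
  ... | true  = s≤s (#-≤ k p)
  ... | false = m≤n⇒m≤1+n (#-≤ k p)

  #-pos : ∀ k {p i} → i < k → Is (p i) → 1 ≤ # k p
  #-pos k i<k = cnt-pos (downFrom k) (∈-downFrom⁺ i<k)

  #-wit : ∀ k {p} → 1 ≤ # k p → Σ ℕ λ i → i < k × Is (p i)
  #-wit k h with cnt-wit (downFrom k) h
  ... | i , i∈ , pi = i , ∈-downFrom⁻ i∈ , pi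

  #-none : ∀ k {p} → (∀ i → i < k → ¬ Is (p i)) → # k p ≡ 0
  #-none k h = cnt-none (downFrom k) (λ i i∈ → h i (∈-downFrom⁻ i∈))

  #-sub1 : ∀ k {p} → (∀ i j → i < k → j < k → Is (p i) → Is (p j) → i ≡ j) → # k p ≤ 1
  #-sub1 k h = cnt-sub1 (downFrom k) (downFrom⁺ k) (λ i j i∈ j∈ → h i j (∈-downFrom⁻ i∈) (∈-downFrom⁻ j∈))

  #-ext : ∀ k {p q} → (∀ i → i < k → p i ≡ q i) → # k p ≡ # k q
  #-ext k h = cnt-ext (downFrom k) (λ i i∈ → h i (∈-downFrom⁻ i∈))

  #-all : ∀ k {p} → (∀ i → i < k → Is (p i)) → # k p ≡ k
  #-all zero    h = refl
  #-all (suc k) h rewrite h k ≤-refl = cong suc (#-all k (λ i i<k → h i (m≤n⇒m≤1+n i<k)))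

  #-not : ∀ k p → # k p + # k (λ i → not (p i)) ≡ k
  #-not zero    p = refl
  #-not (suc k) p with p k
  ... | true  = cong suc (#-not k p)
  ... | false = trans (+-suc _ _) (cong suc (#-not k p))

  -- If `p` missed an element of `q`, then `q` would be larger. Every tight count below becomes a
  -- statement about individual positions through this lemma.
  #-⊇ : ∀ k {p q} → (∀ i → i < k → Is (p i) → Is (q i)) → # k q ≤ # k p → ∀ i → i < k → Is (q i) → Is (p i)
  #-⊇ zero    f le i ()
  #-⊇ (suc k) {p} {q} f le i i<k qi with p k in pk | q k in qk
  ... | true  | true  = go (m≤n⇒m<n∨m≡n (≤-pred i<k))
    where
    go : i < k ⊎ i ≡ k → Is (p i)
    go (inj₁ lt)   = #-⊇ k (λ j j<k → f j (m≤n⇒m≤1+n j<k)) (≤-pred le) i lt qi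
    go (inj₂ refl) = pk
  ... | true  | false = contradiction (trans (sym qk) (f k ≤-refl pk)) λ ()
  ... | false | true  = ⊥-elim (1+n≰n (≤-trans le (#-⊆ k (λ j j<k → f j (m≤n⇒m≤1+n j<k)))))
  ... | false | false = go (m≤n⇒m<n∨m≡n (≤-pred i<k))
    where
    go : i < k ⊎ i ≡ k → Is (p i)
    go (inj₁ lt)   = #-⊇ k (λ j j<k → f j (m≤n⇒m≤1+n j<k)) le i lt qi
    go (inj₂ refl) = contradiction (trans (sym qk) qi) λ ()

  #-shift : ∀ k p → # (suc k) p ≡ b2n (p 0) + # k (λ i → p (suc i))
  #-shift zero    p = refl
  #-shift (suc k) p = trans (cong (b2n (p (suc k)) +_) (#-shift k p)) (eq (b2n (p (suc k))) (b2n (p 0)) _)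
    where
    eq : ∀ a b c → a + (b + c) ≡ b + (a + c)
    eq = solve-∀

  #-rev : ∀ k p → # k (λ i → p (k ∸ suc i)) ≡ # k p
  #-rev zero    p = refl
  #-rev (suc k) p = trans (#-shift k (λ i → p (k ∸ i))) (cong (b2n (p k) +_) (#-rev k p))

  -- The topmost element pulls in everything below it, so such a set is an initial segment and
  -- membership is comparison with the size.
  closed-init : ∀ k {p} → (∀ i → suc i < k → Is (p (suc i)) → Is (p i)) →
                ∀ i → i < k → (Is (p i) → i < # k p) × (i < # k p → Is (p i))
  closed-init (suc k) {p} cl i i<k with p k in pk
  ... | true  = (λ _ → subst (i <_) (cong suc (sym tot)) i<k) , (λ _ → all k ≤-refl pk i (≤-pred i<k))
    where
    all : ∀ j → j < suc k → Is (p j) → ∀ i → i ≤ j → Is (p i)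
    all j       j<  pj i i≤j with m≤n⇒m<n∨m≡n i≤j
    all j       j<  pj i i≤j | inj₂ refl = pj
    all (suc j) j<  pj i i≤j | inj₁ lt   = all j (≤-trans (n≤1+n _) j<) (cl j j< pj) i (≤-pred lt)
    tot : # k p ≡ k
    tot = #-all k (λ j j<k → all k ≤-refl pk j (<⇒≤ j<k))
  ... | false with m≤n⇒m<n∨m≡n (≤-pred i<k)
  ...   | inj₁ lt   = closed-init k (λ j j< → cl j (m≤n⇒m≤1+n j<)) i lt
  ...   | inj₂ refl = (λ pi → contradiction (trans (sym pk) pi) λ ()) ,
                      (λ lt → ⊥-elim (1+n≰n (≤-trans lt (#-≤ k p))))

<ᵇ⁺ : ∀ {a b} → a < b → Is (a <ᵇ b)
<ᵇ⁺ {a} {b} p with a <ᵇ b | <⇒<ᵇ p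
... | true | _ = refl

<ᵇ⁻ : ∀ {a b} → Is (a <ᵇ b) → a < b
<ᵇ⁻ {a} {b} p = <ᵇ⇒< a b (subst Data.Bool.T (sym p) _)

⌊⌋⁺ : ∀ {P : Set} {d : Dec P} → P → Is ⌊ d ⌋
⌊⌋⁺ {d = yes _} _ = refl
⌊⌋⁺ {d = no n}  p = ⊥-elim (n p)

⌊⌋⁻ : ∀ {P : Set} {d : Dec P} → Is ⌊ d ⌋ → P
⌊⌋⁻ {d = yes p} _ = p

single : ℕ → ℕ → Bool
single j k = ⌊ k ≟ j ⌋

#-single : ∀ k j → # k (single j) ≤ 1
#-single k j = #-sub1 k (λ a b _ _ p p' → trans (⌊⌋⁻ p) (sym (⌊⌋⁻ p')))

#-add1 : ∀ k {p o j} → (∀ i → i < k → Is (p i) → Is (o i)) → j < k → Is (o j) → ¬ Is (p j) → suc (# k p) ≤ # k o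
#-add1 k {p} {o} {j} sub j< oj pj = ≤-trans (+-monoˡ-≤ (# k p) (#-pos k j< (⌊⌋⁺ {d = j ≟ j} refl)))
  (#-disj k {single j} {p} {o} (λ i _ h → subst (λ z → Is (o z)) (sym (⌊⌋⁻ h)) oj) sub
     (λ i _ h h' → pj (subst (λ z → Is (p z)) (⌊⌋⁻ h) h')))

#-drop : ∀ k {p j b} → j < k → Is (p j) → # k p ≤ suc b → # k (λ i → p i ∧ not (single j i)) ≤ b
#-drop k {p} {j} j< pj h = ≤-pred (≤-trans (#-add1 k {λ i → p i ∧ not (single j i)} {p} (λ i _ → ∧⁻¹) j< pj (λ b → not⁻ (∧⁻² {p j} b) (⌊⌋⁺ refl))) h)

#-two : ∀ k {p i j} → i < k → j < k → i ≢ j → Is (p i) → Is (p j) → 2 ≤ # k p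
#-two k {p} {i} {j} i< j< i≢j pi pj = ≤-trans (s≤s (#-pos k i< (⌊⌋⁺ {d = i ≟ i} refl)))
  (#-add1 k {single i} {p} (λ z _ h → subst (λ z → Is (p z)) (sym (⌊⌋⁻ h)) pi) j< pj (λ h → i≢j (sym (⌊⌋⁻ h))))

#-three : ∀ k {p i j l} → i < k → j < k → l < k → i ≢ j → i ≢ l → j ≢ l → Is (p i) → Is (p j) → Is (p l) → 3 ≤ # k p
#-three k {p} {i} {j} {l} i< j< l< i≢j i≢l j≢l pi pj pl =
  ≤-trans (s≤s (#-two k {p'} i< j< i≢j (∧⁺ pi (not⁺ (λ h → i≢l (⌊⌋⁻ h)))) (∧⁺ pj (not⁺ (λ h → j≢l (⌊⌋⁻ h))))))
    (#-add1 k {p'} {p} (λ z _ h → ∧⁻¹ h) l< pl (λ h → not⁻ (∧⁻² {p l} h) (⌊⌋⁺ refl)))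
  where
  p' : ℕ → Bool
  p' z = p z ∧ not (single l z)

#-below : ∀ k t → # k (λ i → i <ᵇ t) ≤ t
#-below k zero    = ≤-reflexive (#-none k (λ i _ ()))
#-below zero (suc t) = z≤n
#-below (suc k) (suc t) = ≤-trans (≤-reflexive (#-shift k (λ i → i <ᵇ suc t))) (s≤s (#-below k t))

#-below≥ : ∀ n {s} → s ≤ n → s ≤ # n (_<ᵇ s)
#-below≥ n {s} s≤ with m≤n⇒m<n∨m≡n s≤
... | inj₂ refl = ≤-reflexive (sym (#-all s (λ i i< → <ᵇ⁺ i<)))
#-below≥ (suc n) {s} s≤ | inj₁ (s≤s lt) = ≤-trans (#-below≥ n lt) (m≤n+m _ (b2n (n <ᵇ s)))

closedOr : ∀ k (p : ℕ → Bool) → (∀ i → suc i < k → Is (p (suc i)) → Is (p i)) ⊎ (Σ ℕ λ z → suc z < k × Is (p (suc z)) × ¬ Is (p z))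
closedOr zero    p = inj₁ λ i ()
closedOr (suc k) p with closedOr k p
... | inj₂ (z , z< , h , n) = inj₂ (z , m≤n⇒m≤1+n z< , h , n)
closedOr (suc zero)    p | inj₁ cl = inj₁ λ { i (s≤s ()) }
closedOr (suc (suc k)) p | inj₁ cl with is? (p (suc k)) | is? (p k)
... | yes h | no n  = inj₂ (k , ≤-refl , h , n)
... | no h  | _     = inj₁ λ i i< pi → go i (m≤n⇒m<n∨m≡n (≤-pred i<)) pi
  where
  go : ∀ i → suc i < suc k ⊎ suc i ≡ suc k → Is (p (suc i)) → Is (p i)
  go i (inj₁ lt)   pi = cl i lt pi
  go i (inj₂ refl) pi = ⊥-elim (h pi)
... | yes _ | yes h = inj₁ λ i i< pi → go i (m≤n⇒m<n∨m≡n (≤-pred i<)) pi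
  where
  go : ∀ i → suc i < suc k ⊎ suc i ≡ suc k → Is (p (suc i)) → Is (p i)
  go i (inj₁ lt)   pi = cl i lt pi
  go i (inj₂ refl) pi = h

-- Binomial coefficients

-- Pascal's rule as a recursion, in step with the induction in `famBound`; `C≡bin` identifies it
-- with the coefficient of the theorem.
bin : ℕ → ℕ → ℕ
bin _       zero    = 1
bin zero    (suc _) = 0
bin (suc n) (suc k) = bin n k + bin n (suc k)

bin-zero : ∀ {n k} → n < k → bin n k ≡ 0
bin-zero {zero}  {suc k} _       = refl
bin-zero {suc n} {suc k} (s≤s h) rewrite bin-zero h | bin-zero (m≤n⇒m≤1+n h) = refl

bin-nn : ∀ n → bin n n ≡ 1
bin-nn zero    = refl
bin-nn (suc n) rewrite bin-nn n | bin-zero (n<1+n n) = refl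

bin-mono : ∀ {m n} k → m ≤ n → bin m k ≤ bin n k
bin-mono zero    _             = ≤-refl
bin-mono (suc k) z≤n           = z≤n
bin-mono (suc k) (s≤s {m} {n} h) = +-mono-≤ (bin-mono k h) (bin-mono (suc k) h)

bin-pos : ∀ {n k} → k ≤ n → 1 ≤ bin n k
bin-pos {n}     {zero}  _       = ≤-refl
bin-pos {suc n} {suc k} (s≤s h) = ≤-trans (bin-pos h) (m≤m+n _ _)

bin-≥n : ∀ {n k} → 1 ≤ k → suc k ≤ n → n ≤ bin n k
bin-≥n {suc zero}    {suc k}       1≤k (s≤s ())
bin-≥n {suc (suc n)} {suc zero}    1≤k h = s≤s (bin1 (suc n))
  where
  bin1 : ∀ n → n ≤ bin n 1
  bin1 zero    = z≤n
  bin1 (suc n) = s≤s (bin1 n)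
bin-≥n {suc n} {suc (suc k)} 1≤k (s≤s h) = ≤-trans (≤-reflexive (+-comm 1 n))
  (+-mono-≤ (bin-≥n {n} {suc k} (s≤s z≤n) h) (bin-pos h))

bin-≥2n : ∀ {n k} → 2 ≤ k → 2 + k ≤ suc n → 2 * n ≤ bin (suc n) k
bin-≥2n {n} {suc zero}    (s≤s ()) h
bin-≥2n {n} {suc (suc k)} 2≤k      (s≤s h) =
  +-mono-≤ (bin-≥n {n} {suc k} (s≤s z≤n) (≤-trans (n≤1+n _) h))
           (≤-trans (≤-reflexive (+-identityʳ n)) (bin-≥n {n} {suc (suc k)} (s≤s z≤n) h))

-- The edges satisfying Q trace distinct a-subsets of N ∩ [0,k).
famBound : ∀ {m} (row : Fin m → ℕ → Bool) k a (N : ℕ → Bool) (Q : Fin m → Bool) →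
  (∀ e → Is (Q e) → ∀ i → i < k → Is (row e i) → Is (N i)) →
  (∀ e → Is (Q e) → # k (row e) ≡ a) →
  (∀ e e' → Is (Q e) → Is (Q e') → (∀ i → i < k → row e i ≡ row e' i) → e ≡ e') →
  cnt (allFin m) Q ≤ bin (# k N) a
famBound {m} row zero zero N Q sub size inj =
  cnt-sub1 (allFin m) (allFin⁺ m) (λ e e' _ _ q q' → inj e e' q q' (λ _ ()))
famBound {m} row zero (suc a) N Q sub size inj =
  ≤-reflexive (cnt-none (allFin m) (λ e _ q → contradiction (size e q) λ ()))
famBound {m} row (suc k) a N Q sub size inj with N k in Nk
... | false = famBound row k a N Q
        (λ e q i i<k → sub e q i (m≤n⇒m≤1+n i<k))
        (λ e q → trans (sym (cong (λ b → b2n b + # k (row e)) (off e q))) (size e q))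
        (λ e e' q q' h → inj e e' q q' (λ i i<k → ext e e' q q' h i (m≤n⇒m<n∨m≡n (≤-pred i<k))))
  where
  off : ∀ e → Is (Q e) → row e k ≡ false
  off e q with row e k in rk
  ... | false = refl
  ... | true  = contradiction (trans (sym Nk) (sub e q k ≤-refl rk)) λ ()
  ext : ∀ e e' → Is (Q e) → Is (Q e') → (∀ i → i < k → row e i ≡ row e' i) → ∀ i → i < k ⊎ i ≡ k → row e i ≡ row e' i
  ext e e' q q' h i (inj₁ lt)   = h i lt
  ext e e' q q' h i (inj₂ refl) = trans (off e q) (sym (off e' q'))
-- Pascal's rule: the traces that contain `k` and those that avoid it.
... | true  = ≤-trans (cnt-cov (allFin m) {p = Q₁} {q = Q₀} (λ e _ q → dec e q)) (bound a size)
  where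
  Q₁ Q₀ : Fin m → Bool
  Q₁ e = Q e ∧ row e k
  Q₀ e = Q e ∧ not (row e k)
  dec : ∀ e → Is (Q e) → Is (Q₁ e) ⊎ Is (Q₀ e)
  dec e q with row e k
  ... | true  = inj₁ (∧⁺ q refl)
  ... | false = inj₂ (∧⁺ q refl)
  ext : ∀ {e e'} → row e k ≡ row e' k → (∀ i → i < k → row e i ≡ row e' i) → ∀ i → i < suc k → row e i ≡ row e' i
  ext rk h i i<k with m≤n⇒m<n∨m≡n (≤-pred i<k)
  ... | inj₁ lt   = h i lt
  ... | inj₂ refl = rk
  not-true : ∀ {b} → Is (not b) → b ≡ false
  not-true {false} _ = refl
  sub' : ∀ e → Is (Q e) → ∀ i → i < k → Is (row e i) → Is (N i)
  sub' e q i i<k = sub e q i (m≤n⇒m≤1+n i<k)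
  size₁ : ∀ {a} e → Is (Q₁ e) → # (suc k) (row e) ≡ a → suc (# k (row e)) ≡ a
  size₁ e q h rewrite ∧⁻² {Q e} q = h
  size₀ : ∀ {a} e → Is (Q₀ e) → # (suc k) (row e) ≡ a → # k (row e) ≡ a
  size₀ e q h rewrite not-true {row e k} (∧⁻² {Q e} q) = h
  b₀ : ∀ a → (∀ e → Is (Q e) → # (suc k) (row e) ≡ a) → cnt (allFin m) Q₀ ≤ bin (# k N) a
  b₀ a size = famBound row k a N Q₀ (λ e q → sub' e (∧⁻¹ q)) (λ e q → size₀ e q (size e (∧⁻¹ q)))
       (λ e e' q q' h → inj e e' (∧⁻¹ q) (∧⁻¹ q') (ext (trans (not-true (∧⁻² {Q e} q)) (sym (not-true (∧⁻² {Q e'} q')))) h))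
  bound : ∀ a → (∀ e → Is (Q e) → # (suc k) (row e) ≡ a) → cnt (allFin m) Q₁ + cnt (allFin m) Q₀ ≤ bin (suc (# k N)) a
  bound zero    size = +-mono-≤ (≤-reflexive (cnt-none (allFin m) (λ e _ q → contradiction (size₁ e q (size e (∧⁻¹ q))) λ ()))) (b₀ 0 size)
  bound (suc a) size = +-mono-≤
    (famBound row k a N Q₁ (λ e q → sub' e (∧⁻¹ q)) (λ e q → suc-injective (size₁ e q (size e (∧⁻¹ q))))
       (λ e e' q q' h → inj e e' (∧⁻¹ q) (∧⁻¹ q') (ext (trans (∧⁻² {Q e} q) (sym (∧⁻² {Q e'} q'))) h)))
    (b₀ (suc a) size)

bin-pred : ∀ n → bin (suc n) n ≡ suc n
bin-pred zero    = refl
bin-pred (suc n) = trans (cong₂ _+_ (bin-pred n) (bin-nn (suc n))) (+-comm (suc n) 1)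

-- One application of Pascal's rule to `bin t q` splits off a summand of size at least `t ∸ 1`. With
-- `D = bin t q + 1`, a first vertex with fewer than `t` free neighbours must lie on at least `t`
-- path edges.
binA : ∀ {s t q} → 2 ≤ q → q < t → s < t → bin s q + t ≤ suc (bin t q)
binA {s} {suc t} {suc (suc q)} _ (s≤s q<) (s≤s s≤) = ≮⇒≥ λ lt →
  refute (bin s (2 + q) ∷ t ∷ bin t (suc q) ∷ bin t (2 + q) ∷ [])
    (κ 2 ⊕ (ν 2 ⊕ ν 3) ≼ ν 0 ⊕ (κ 1 ⊕ ν 1) ∷ ν 1 ≼ ν 2 ∷ ν 0 ≼ ν 3 ∷ [])
    (lt ∷ bin-≥n {t} {suc q} (s≤s z≤n) q< ∷ bin-mono (2 + q) s≤ ∷ []) refl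
binA {q = suc zero} (s≤s ()) _ _

-- Applying Pascal's rule twice gains one more than `binA`.
binB : ∀ {s t q} → 2 ≤ q → q < t → suc s < t → bin s q + t ≤ bin t q
binB {s} {suc (suc t)} {suc (suc q)} _ (s≤s q<) (s≤s (s≤s s≤)) = ≮⇒≥ λ lt →
  refute (bin s (2 + q) ∷ t ∷ bin (suc t) (suc q) ∷ bin t (suc q) ∷ bin t (2 + q) ∷ [])
    (κ 1 ⊕ (ν 2 ⊕ (ν 3 ⊕ ν 4)) ≼ ν 0 ⊕ (κ 2 ⊕ ν 1) ∷ κ 1 ⊕ ν 1 ≼ ν 2 ∷ κ 1 ≼ ν 3 ∷ ν 0 ≼ ν 4 ∷ [])
    (lt ∷ bin-≥n {suc t} {suc q} (s≤s z≤n) q< ∷ bin-pos (≤-pred q<) ∷ bin-mono (2 + q) s≤ ∷ []) refl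
binB {t = suc zero} {q = suc (suc q)} _ _ (s≤s ())
binB {q = suc zero} (s≤s ()) _ _

-- Each increase of the upper index adds at least 2 to the binomial. This meets the price on a
-- cycle, where each of the `a` free neighbours of the missing vertex occupies two positions.
binC : ∀ {a t q} → 2 ≤ q → q ≤ a → a ≤ t → bin a q + (t + t) ≤ bin t q + (a + a)
binC {a} {t} {q} 2≤q q≤a a≤t with m≤n⇒m<n∨m≡n a≤t
... | inj₂ refl = ≤-refl
binC {a} {suc b} {suc (suc q)} 2≤q q≤a a≤t | inj₁ (s≤s a≤b) = ≮⇒≥ λ lt →
  refute (bin a (2 + q) ∷ b ∷ bin b (suc q) ∷ bin b (2 + q) ∷ a ∷ q ∷ [])
    (κ 1 ⊕ ((ν 2 ⊕ ν 3) ⊕ (ν 4 ⊕ ν 4)) ≼ ν 0 ⊕ ((κ 1 ⊕ ν 1) ⊕ (κ 1 ⊕ ν 1)) ∷ ν 1 ≼ ν 2 ∷ κ 2 ⊕ ν 5 ≼ ν 4 ∷ ν 4 ≼ ν 1 ∷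
     ν 0 ⊕ (ν 1 ⊕ ν 1) ≼ ν 3 ⊕ (ν 4 ⊕ ν 4) ∷ [])
    (lt ∷ bin-≥n {b} {suc q} (s≤s z≤n) (≤-trans q≤a a≤b) ∷ q≤a ∷ a≤b ∷ binC 2≤q q≤a a≤b ∷ []) refl
binC {a} {suc b} {suc zero} (s≤s ()) q≤a a≤t | inj₁ _

-- The last increment is at least `t ∸ 1`, hence above 2 once `4 ≤ t`. At `a = 2`, `q = 2`, `t = 3`
-- the inequality fails, which is the source of `Exceptional`.
binC< : ∀ {a t q} → 2 ≤ q → q ≤ a → a < t → 4 ≤ t → bin a q + suc (t + t) ≤ bin t q + (a + a)
binC< {a} {suc b} {suc (suc q)} 2≤q q≤a (s≤s a≤b) (s≤s 3≤b) = ≮⇒≥ λ lt →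
  refute (bin a (2 + q) ∷ b ∷ bin b (suc q) ∷ bin b (2 + q) ∷ a ∷ [])
    (κ 1 ⊕ ((ν 2 ⊕ ν 3) ⊕ (ν 4 ⊕ ν 4)) ≼ ν 0 ⊕ (κ 1 ⊕ ((κ 1 ⊕ ν 1) ⊕ (κ 1 ⊕ ν 1))) ∷ ν 1 ≼ ν 2 ∷ κ 3 ≼ ν 1 ∷
     ν 0 ⊕ (ν 1 ⊕ ν 1) ≼ ν 3 ⊕ (ν 4 ⊕ ν 4) ∷ [])
    (lt ∷ bin-≥n {b} {suc q} (s≤s z≤n) (≤-trans q≤a a≤b) ∷ 3≤b ∷ binC 2≤q q≤a a≤b ∷ []) refl
binC< {q = suc zero} (s≤s ()) _ _ _

-- The numerical hypotheses of the theorem: t = ⌊(n − 1) / 2⌋ and r = q + 1.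

data Kind (ℓ q D t : ℕ) : Set where
  odd  : ℓ ≡ t + t       → 2 ≤ q → q < t → D ≡ suc (bin t q) → Kind ℓ q D t
  even : ℓ ≡ suc (t + t) → 2 ≤ q → q < t → D ≡ suc (bin t q) → Kind ℓ q D t
  half : ℓ ≡ suc (t + t) → 2 ≤ t → q ≡ t → D ≡ suc t         → Kind ℓ q D t

-- Double counting and weighted sums

total : ∀ {A : Set} → List A → (A → ℕ) → ℕ
total []       f = 0
total (a ∷ as) f = f a + total as f

total-≥ : ∀ {A : Set} (as : List A) {f b} → (∀ a → b ≤ f a) → length as * b ≤ total as f
total-≥ []       h = z≤n
total-≥ (a ∷ as) h = +-mono-≤ (h a) (total-≥ as h)

total-≡ : ∀ {A : Set} (as : List A) {f b} → (∀ a → f a ≡ b) → total as f ≡ length as * b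
total-≡ []       h = refl
total-≡ (a ∷ as) h = cong₂ _+_ (h a) (total-≡ as h)

total-+ : ∀ {A : Set} (as : List A) f g → total as (λ a → f a + g a) ≡ total as f + total as g
total-+ []       f g = refl
total-+ (a ∷ as) f g = trans (cong (f a + g a +_) (total-+ as f g)) (eq (f a) (g a) (total as f) (total as g))
  where
  eq : ∀ a b c d → (a + b) + (c + d) ≡ (a + c) + (b + d)
  eq = solve-∀

total-b2n : ∀ {A : Set} (as : List A) p → total as (λ a → b2n (p a)) ≡ cnt as p
total-b2n []       p = refl
total-b2n (a ∷ as) p = cong (b2n (p a) +_) (total-b2n as p)

doubleCount : ∀ {A B : Set} (as : List A) (bs : List B) (P : A → B → Bool) →
              total as (λ a → cnt bs (P a)) ≡ total bs (λ b → cnt as (λ a → P a b))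
doubleCount as []       P = zeros as
  where
  zeros : ∀ {A : Set} (as : List A) → total as (λ _ → 0) ≡ 0
  zeros []       = refl
  zeros (a ∷ as) = zeros as
doubleCount as (b ∷ bs) P = trans (total-+ as (λ a → b2n (P a b)) (λ a → cnt bs (P a)))
  (cong₂ _+_ (total-b2n as (λ a → P a b)) (doubleCount as bs P))

total-# : ∀ k (f : ℕ → ℕ) p w v → v ≤ w → (∀ i → i < k → Is (p i) → w ≤ f i) → (∀ i → i < k → v ≤ f i) →
          # k p * w + (k ∸ # k p) * v ≤ total (downFrom k) f
total-# zero    f p w v v≤w h h' = z≤n
total-# (suc k) f p w v v≤w h h' with p k in pk
... | true  = ≤-trans (≤-reflexive (+-assoc w (# k p * w) ((k ∸ # k p) * v)))
                (+-mono-≤ (h k ≤-refl pk) (total-# k f p w v v≤w (λ i i< → h i (m≤n⇒m≤1+n i<)) (λ i i< → h' i (m≤n⇒m≤1+n i<))))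
... | false = ≤-trans (≤-reflexive (trans (cong (λ z → # k p * w + z * v) (+-∸-assoc 1 (#-≤ k p))) (eq (# k p * w) v _)))
                (+-mono-≤ (h' k ≤-refl) (total-# k f p w v v≤w (λ i i< → h i (m≤n⇒m≤1+n i<)) (λ i i< → h' i (m≤n⇒m≤1+n i<))))
  where
  eq : ∀ a b c → a + (b + c) ≡ b + (a + c)
  eq = solve-∀

#-sp : ∀ k (p o : ℕ → Bool) → # k p ≡ # k (λ i → p i ∧ o i) + # k (λ i → p i ∧ not (o i))
#-sp zero    p o = refl
#-sp (suc k) p o with p k | o k
... | false | _     = #-sp k p o
... | true  | true  = cong suc (#-sp k p o)
... | true  | false = trans (cong suc (#-sp k p o)) (sym (+-suc _ _))

-- Parity patterns

ev : ℕ → Bool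
ev zero    = true
ev (suc k) = not (ev k)

ev-dbl : ∀ t → Is (ev (t + t))
ev-dbl zero    = refl
ev-dbl (suc t) rewrite +-suc t t | ev-dbl t = refl

ev-∸ : ∀ i k → k ≤ i → Is (ev i) → ev (i ∸ k) ≡ ev k
ev-∸ i k k≤ h = go (i ∸ k) k (subst (λ z → Is (ev z)) (sym (m∸n+n≡m k≤)) h)
  where
  nn : ∀ b → not (not b) ≡ b
  nn true  = refl
  nn false = refl
  go : ∀ a b → Is (ev (a + b)) → ev a ≡ ev b
  go a zero    h = trans (cong ev (sym (+-identityʳ a))) h
  go a (suc b) h = trans (sym (nn (ev a))) (cong not (go (suc a) b (subst (λ z → Is (ev z)) (+-suc a b) h)))

#-ev : ∀ t → # (suc (t + t)) ev ≡ suc t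
#-ev zero    = refl
#-ev (suc t) = trans (cong (λ z → # (suc (suc z)) ev) (+-suc t t)) (trans (two (t + t) (ev-dbl t)) (cong suc (#-ev t)))
  where
  two : ∀ u → Is (ev u) → # (3 + u) ev ≡ suc (# (suc u) ev)
  two u h rewrite h = refl

-- Each pair `2s`, `2s + 1` holds at most one element and position `2t` holds none, so every pair
-- holds exactly one. As `0` is excluded, the first pair holds `1`, which excludes `2`, and so on.
oddPattern : ∀ t {p} → (∀ i → i < t + t → Is (p i) → Is (p (suc i)) → ⊥) → ¬ Is (p 0) → ¬ Is (p (t + t)) →
             t ≤ # (suc (t + t)) p → ∀ k → k ≤ t + t → p k ≡ not (ev k)
oddPattern t {p} nc p0 pt t≤ = λ k k≤ → proj₁ (pat k k≤)
  where
  pair : ∀ s → s ≤ t → # (s + s) p ≤ s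
  pair zero    _  = z≤n
  pair (suc s) s< rewrite +-suc s s with p (s + s) in e₀ | p (suc (s + s)) in e₁
  ... | true  | true  = ⊥-elim (nc (s + s) (≤-trans (s≤s (n≤1+n _)) (≤-trans (≤-reflexive (sym (cong suc (+-suc s s)))) (+-mono-≤ s< s<))) e₀ e₁)
  ... | true  | false = s≤s (pair s (<⇒≤ s<))
  ... | false | true  = s≤s (pair s (<⇒≤ s<))
  ... | false | false = m≤n⇒m≤1+n (pair s (<⇒≤ s<))
  tot : t ≤ # (t + t) p
  tot with p (t + t) in e
  ... | true  = ⊥-elim (pt refl)
  ... | false = t≤
  step : ∀ s → s < t → suc s ≤ # (suc s + suc s) p → s ≤ # (s + s) p × (Is (p (s + s)) ⊎ Is (p (suc (s + s))))
  step s s< h rewrite +-suc s s with p (s + s) in e₀ | p (suc (s + s)) in e₁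
  ... | true  | true  = ⊥-elim (nc (s + s) (≤-trans (s≤s (n≤1+n _)) (≤-trans (≤-reflexive (sym (cong suc (+-suc s s)))) (+-mono-≤ s< s<))) e₀ e₁)
  ... | true  | false = ≤-pred h , inj₁ refl
  ... | false | true  = ≤-pred h , inj₂ refl
  ... | false | false = ⊥-elim (1+n≰n (≤-trans h (pair s (<⇒≤ s<))))
  full : ∀ d s → s + d ≡ t → s ≤ # (s + s) p
  full zero    s eq rewrite +-identityʳ s | eq = tot
  full (suc d) s eq = proj₁ (step s (≤-trans (≤-trans (≤-reflexive (+-comm 1 s)) (+-monoʳ-≤ s (s≤s z≤n))) (≤-reflexive eq)) (full d (suc s) (trans (sym (+-suc s d)) eq)))
  one : ∀ s → s < t → Is (p (s + s)) ⊎ Is (p (suc (s + s)))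
  one s s< = proj₂ (step s s< (full (t ∸ suc s) (suc s) (m+[n∸m]≡n s<)))
  off : ∀ {b} → ¬ Is b → b ≡ false
  off {true}  n = ⊥-elim (n refl)
  off {false} _ = refl
  evens : ∀ s → s ≤ t → ¬ Is (p (s + s))
  odds  : ∀ s → s < t → Is (p (suc (s + s)))
  evens zero    _  h = p0 h
  evens (suc s) s< h = nc (suc (s + s)) (subst (_≤ t + t) (cong suc (+-suc s s)) (+-mono-≤ s< s<)) (odds s s<) (subst (λ z → Is (p z)) (cong suc (+-suc s s)) h)
  odds s s< with one s s<
  ... | inj₁ h = ⊥-elim (evens s (<⇒≤ s<) h)
  ... | inj₂ h = h
  half' : ∀ k → Σ ℕ λ s → (k ≡ s + s) ⊎ (k ≡ suc (s + s))
  half' zero    = 0 , inj₁ refl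
  half' (suc k) with half' k
  ... | s , inj₁ refl = s , inj₂ refl
  ... | s , inj₂ refl = suc s , inj₁ (cong suc (sym (+-suc s s)))
  pat : ∀ k → k ≤ t + t → (p k ≡ not (ev k)) × k ≤ t + t
  pat k k≤ with half' k
  ... | s , inj₁ refl = trans (off (evens s (≮⇒≥ λ lt → <⇒≱ (+-mono-< lt lt) k≤))) (sym (cong not (ev-dbl s))) , k≤
  ... | s , inj₂ refl = trans (odds s (≰⇒> λ le → <⇒≱ (s≤s (+-mono-≤ le le)) k≤)) (sym (cong (λ b → not (not b)) (ev-dbl s))) , k≤

-- Reversal of the positions 0, …, i and of the indices 0, …, i − 1 of the edges between them

opaque
  ρ : ℕ → ℕ → ℕ
  ρ i k with k ≤? i
  ... | yes _ = i ∸ k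
  ... | no  _ = k

  ρ≤ : ∀ {i k} → k ≤ i → ρ i k ≡ i ∸ k
  ρ≤ {i} {k} h with k ≤? i
  ... | yes _ = refl
  ... | no n  = contradiction h n

  ρ> : ∀ {i k} → i < k → ρ i k ≡ k
  ρ> {i} {k} h with k ≤? i
  ... | yes p = contradiction p (<⇒≱ h)
  ... | no _  = refl

  ρρ : ∀ i k → ρ i (ρ i k) ≡ k
  ρρ i k with k ≤? i
  ... | yes p = trans (ρ≤ (m∸n≤m i k)) (m∸[m∸n]≡n p)
  ... | no n  = ρ> (≰⇒> n)

  ρ-bound : ∀ {i k b} → i ≤ b → k ≤ b → ρ i k ≤ b
  ρ-bound {i} {k} i≤ k≤ with k ≤? i
  ... | yes _ = ≤-trans (m∸n≤m i k) i≤
  ... | no _  = k≤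

ρ-inj : ∀ i {j k} → ρ i j ≡ ρ i k → j ≡ k
ρ-inj i {j} {k} h = trans (sym (ρρ i j)) (trans (cong (ρ i) h) (ρρ i k))

∸suc-< : ∀ i k → k < i → i ∸ suc k < i
∸suc-< (suc i) k h = s≤s (m∸n≤m i k)

suc-∸suc : ∀ {i k} → k < i → suc (i ∸ suc k) ≡ i ∸ k
suc-∸suc {suc i} {k} (s≤s h) = sym (+-∸-assoc 1 h)

∸-invol : ∀ {i k} → k < i → i ∸ suc (i ∸ suc k) ≡ k
∸-invol {i} {k} h = trans (cong (i ∸_) (suc-∸suc h)) (m∸[m∸n]≡n (<⇒≤ h))

opaque
  τ : ℕ → ℕ → ℕ
  τ i k with k <? i
  ... | yes _ = i ∸ suc k
  ... | no  _ = k

  τ< : ∀ {i k} → k < i → τ i k ≡ i ∸ suc k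
  τ< {i} {k} h with k <? i
  ... | yes _ = refl
  ... | no n  = contradiction h n

  τ≥ : ∀ {i k} → i ≤ k → τ i k ≡ k
  τ≥ {i} {k} h with k <? i
  ... | yes p = contradiction p (≤⇒≯ h)
  ... | no _  = refl

  ττ : ∀ i k → τ i (τ i k) ≡ k
  ττ i k with k <? i
  ... | yes p = trans (τ< (∸suc-< i k p)) (∸-invol p)
  ... | no n  = τ≥ (≮⇒≥ n)

  τ-bound : ∀ {i k b} → i < b → k < b → τ i k < b
  τ-bound {i} {k} i< k< with k <? i
  ... | yes p = <-trans (∸suc-< i k p) i<
  ... | no _  = k<

τ-inj : ∀ i {j k} → τ i j ≡ τ i k → j ≡ k
τ-inj i {j} {k} h = trans (sym (ττ i j)) (trans (cong (τ i) h) (ττ i k))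

τ-fix : ∀ i {k} → τ i k ≡ i → k ≡ i
τ-fix i {k} h = τ-inj i (trans h (sym (τ≥ ≤-refl)))

ρ≡τ : ∀ i k → ρ i k ≡ τ (suc i) k
ρ≡τ i k with k ≤? i
... | yes p = trans (ρ≤ p) (sym (τ< (s≤s p)))
... | no n  = trans (ρ> (≰⇒> n)) (sym (τ≥ (≰⇒> n)))

#-τ : ∀ n k (p : ℕ → Bool) → k ≤ n → # n (λ i → p (τ k i)) ≡ # n p
#-τ n k p k≤n with m≤n⇒m<n∨m≡n k≤n
... | inj₂ refl = trans (#-ext n (λ i i< → cong p (τ< i<))) (#-rev n p)
#-τ (suc n) k p k≤n | inj₁ (s≤s k≤) = cong₂ _+_ (cong (λ z → b2n (p z)) (τ≥ k≤)) (#-τ n k p k≤)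

-- Hamiltonian Berge paths and their modifications

module Paths (V : Set) (m ℓ : ℕ) (inc : Fin m → V → Bool) where

  -- Hamiltonian Berge paths.  Positions run over 0, …, ℓ and y i joins the
  -- positions i and i + 1; values of x and y outside these ranges are junk.

  XInj : (ℕ → V) → Set
  XInj x = ∀ {i j} → i ≤ ℓ → j ≤ ℓ → x i ≡ x j → i ≡ j

  record Path : Set where
    field
      x    : ℕ → V
      y    : ℕ → Fin m
      xinj : XInj x
      yinj : ∀ {i j} → i < ℓ → j < ℓ → y i ≡ y j → i ≡ j
      lkˡ  : ∀ {i} → i < ℓ → Is (inc (y i) (x i))
      lkʳ  : ∀ {i} → i < ℓ → Is (inc (y i) (x (suc i)))
  open Path public

  M : Path → Fin m → ℕ → Bool
  M c e k = inc e (x c k)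

  Free : Path → Fin m → Set
  Free c e = ∀ i → i < ℓ → y c i ≢ e

  someE : (Fin m → Bool) → Bool
  someE p = 1 ≤ᵇ cnt (allFin m) p

  someE⁺ : ∀ {p} e → Is (p e) → Is (someE p)
  someE⁺ e pe = ≤ᵇ⁺ (cnt-pos (allFin m) (∈-allFin e) pe)

  someE⁻ : ∀ {p} → Is (someE p) → Σ (Fin m) λ e → Is (p e)
  someE⁻ h with cnt-wit (allFin m) (≤ᵇ⁻ h)
  ... | e , _ , pe = e , pe

  on : Path → Fin m → Bool
  on c e = 1 ≤ᵇ # ℓ (λ i → ⌊ y c i FP.≟ e ⌋)

  fr : Path → Fin m → Bool
  fr c e = not (on c e)

  on⁻ : ∀ c {e} → Is (on c e) → Σ ℕ λ i → i < ℓ × y c i ≡ e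
  on⁻ c h with #-wit ℓ (≤ᵇ⁻ h)
  ... | i , i< , q = i , i< , ⌊⌋⁻ q

  on⁺ : ∀ c {e i} → i < ℓ → y c i ≡ e → Is (on c e)
  on⁺ c i< q = ≤ᵇ⁺ (#-pos ℓ i< (⌊⌋⁺ q))

  fr⁺ : ∀ c {e} → Free c e → Is (fr c e)
  fr⁺ c f = not⁺ (λ h → let (i , i< , q) = on⁻ c h in f i i< q)

  fr⁻ : ∀ c {e} → Is (fr c e) → Free c e
  fr⁻ c h i i< q = not⁻ h (on⁺ c i< q)

  free? : ∀ c e → Free c e ⊎ Σ ℕ λ i → i < ℓ × y c i ≡ e
  free? c e with on c e in eq
  ... | true  = inj₂ (on⁻ c eq)
  ... | false = inj₁ (fr⁻ c (cong not eq))

  opaque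
    override : ℕ → Fin m → (ℕ → Fin m) → ℕ → Fin m
    override i e f k with k ≟ i
    ... | yes _ = e
    ... | no  _ = f k

    ov≡ : ∀ {i k e f} → k ≡ i → override i e f k ≡ e
    ov≡ {i} {k} h with k ≟ i
    ... | yes _ = refl
    ... | no n  = contradiction h n

    ov≢ : ∀ {i k e f} → k ≢ i → override i e f k ≡ f k
    ov≢ {i} {k} h with k ≟ i
    ... | yes p = contradiction p h
    ... | no _  = refl

  -- A path edge `y c i` that happens to contain the vertex to be attached can be used again at the
  -- same index, so it counts on a par with the free edges.
  Usable : Path → ℕ → Fin m → Set
  Usable c i e = e ≡ y c i ⊎ Free c e

  opaque
    unfolding override

    ov-inj : ∀ c i e → i < ℓ → Usable c i e → (t : ℕ → ℕ) → (∀ {k} → k < ℓ → t k < ℓ) →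
             (∀ {j k} → t j ≡ t k → j ≡ k) → (∀ {k} → t k ≡ i → k ≡ i) →
             ∀ {j k} → j < ℓ → k < ℓ → override i e (λ k → y c (t k)) j ≡ override i e (λ k → y c (t k)) k → j ≡ k
    ov-inj c i e i<ℓ u t tb tinj tfix {j} {k} j< k< h with j ≟ i | k ≟ i
    ... | yes refl | yes refl = refl
    ... | yes refl | no k≢    = contradiction (bad u) k≢
      where
      bad : Usable c i e → k ≡ i
      bad (inj₁ q) = tfix (yinj c (tb k<) i<ℓ (trans (sym h) q))
      bad (inj₂ f) = ⊥-elim (f _ (tb k<) (sym h))
    ... | no j≢    | yes refl = contradiction (bad u) j≢
      where
      bad : Usable c i e → j ≡ i
      bad (inj₁ q) = tfix (yinj c (tb j<) i<ℓ (trans h q))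
      bad (inj₂ f) = ⊥-elim (f _ (tb j<) h)
    ... | no j≢    | no k≢    = tinj (yinj c (tb j<) (tb k<) h)

  -- An edge through the positions 0 and i + 1 (resp. i and i + 1) that may be
  -- used between them in place of y i.
  record Front (c : Path) (i : ℕ) : Set where
    constructor front
    field
      {e} : Fin m
      i<ℓ : i < ℓ
      e0  : Is (M c e 0)
      ei  : Is (M c e (suc i))
      u   : Usable c i e

  record Link (c : Path) (i : ℕ) : Set where
    constructor link
    field
      {e} : Fin m
      i<ℓ : i < ℓ
      ei  : Is (M c e i)
      ei' : Is (M c e (suc i))
      u   : Usable c i e

  -- Pósa's rotation for Berge paths: the new vertex order is `x i, …, x 0, x (i + 1), …, x ℓ`. If
  -- `e` is free, it trades places with `y c i`.
  Rot : ∀ c {i} → Front c i → Path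
  Rot c {i} (front {e} i<ℓ e0 ei u) = record
    { x    = λ k → x c (ρ i k)
    ; y    = override i e (λ k → y c (τ i k))
    ; xinj = λ p q h → ρ-inj i (xinj c (ρ-bound (<⇒≤ i<ℓ) p) (ρ-bound (<⇒≤ i<ℓ) q) h)
    ; yinj = ov-inj c i e i<ℓ u (τ i) (τ-bound i<ℓ) (τ-inj i) (τ-fix i)
    ; lkˡ  = λ {k} k< → left k k<
    ; lkʳ  = λ {k} k< → right k k<
    }
    where
    left : ∀ k → k < ℓ → Is (inc (override i e (λ k → y c (τ i k)) k) (x c (ρ i k)))
    left k k< with <-cmp k i
    ... | tri< k<i k≢i _ rewrite ov≢ {i} {k} {e} {λ k → y c (τ i k)} k≢i | ρ≤ (<⇒≤ k<i) | τ< k<i | sym (suc-∸suc k<i) =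
            lkʳ c (<-trans (∸suc-< i k k<i) i<ℓ)
    ... | tri≈ _ refl _ rewrite ov≡ {i} {i} {e} {λ k → y c (τ i k)} refl | ρ≤ (≤-refl {i}) | n∸n≡0 i = e0
    ... | tri> _ k≢i i<k rewrite ov≢ {i} {k} {e} {λ k → y c (τ i k)} k≢i | ρ> i<k | τ≥ (<⇒≤ i<k) = lkˡ c k<
    right : ∀ k → k < ℓ → Is (inc (override i e (λ k → y c (τ i k)) k) (x c (ρ i (suc k))))
    right k k< with <-cmp k i
    ... | tri< k<i k≢i _ rewrite ov≢ {i} {k} {e} {λ k → y c (τ i k)} k≢i | ρ≤ k<i | τ< k<i =
            lkˡ c (<-trans (∸suc-< i k k<i) i<ℓ)
    ... | tri≈ _ refl _ rewrite ov≡ {i} {i} {e} {λ k → y c (τ i k)} refl | ρ> (n<1+n i) = ei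
    ... | tri> _ k≢i i<k rewrite ov≢ {i} {k} {e} {λ k → y c (τ i k)} k≢i | ρ> (m<n⇒m<1+n i<k) | τ≥ (<⇒≤ i<k) = lkʳ c k<

  Swap : ∀ c {i} → Link c i → Path
  Swap c {i} (link {e} i<ℓ ei ei' u) = record
    { x    = x c
    ; y    = override i e (y c)
    ; xinj = xinj c
    ; yinj = ov-inj c i e i<ℓ u (λ k → k) (λ p → p) (λ p → p) (λ p → p)
    ; lkˡ  = λ {k} k< → left k k<
    ; lkʳ  = λ {k} k< → right k k<
    }
    where
    left : ∀ k → k < ℓ → Is (inc (override i e (y c) k) (x c k))
    left k k< with k ≟ i
    ... | yes refl rewrite ov≡ {i} {i} {e} {y c} refl = ei
    ... | no k≢    rewrite ov≢ {i} {k} {e} {y c} k≢   = lkˡ c k<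
    right : ∀ k → k < ℓ → Is (inc (override i e (y c) k) (x c (suc k)))
    right k k< with k ≟ i
    ... | yes refl rewrite ov≡ {i} {i} {e} {y c} refl = ei'
    ... | no k≢    rewrite ov≢ {i} {k} {e} {y c} k≢   = lkʳ c k<

  Mir : Path → Path
  Mir c = record
    { x    = λ k → x c (ℓ ∸ k)
    ; y    = λ k → y c (ℓ ∸ suc k)
    ; xinj = λ {i} {j} p q h → ∸-cancelˡ-≡ p q (xinj c (m∸n≤m ℓ i) (m∸n≤m ℓ j) h)
    ; yinj = λ {i} {j} p q h → suc-injective (∸-cancelˡ-≡ p q (yinj c (∸suc-< ℓ i p) (∸suc-< ℓ j q) h))
    ; lkˡ  = λ {i} p → subst (λ k → Is (inc (y c (ℓ ∸ suc i)) (x c k))) (suc-∸suc p) (lkʳ c (∸suc-< ℓ i p))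
    ; lkʳ  = λ {i} p → lkˡ c (∸suc-< ℓ i p)
    }

  module _ {c i} (a : Front c i) where
    open Front a
    private c' = Rot c a

    Rot-y< : ∀ {k} → k < i → y c' k ≡ y c (i ∸ suc k)
    Rot-y< k<i = trans (ov≢ (<⇒≢ k<i)) (cong (y c) (τ< k<i))

    Rot-y≡ : y c' i ≡ e
    Rot-y≡ = ov≡ {i} {i} {e} {λ k → y c (τ i k)} refl

    Rot-y> : ∀ {k} → i < k → y c' k ≡ y c k
    Rot-y> i<k = trans (ov≢ (λ q → <⇒≢ i<k (sym q))) (cong (y c) (τ≥ (<⇒≤ i<k)))

    Rot-keep : ∀ {z} → Free c z → z ≢ e → Free c' z
    Rot-keep fz z≢e k k< q with k ≟ i
    ... | yes refl = z≢e (trans (sym q) Rot-y≡)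
    ... | no k≢    = fz _ (τ-bound i<ℓ k<) (trans (sym (ov≢ k≢)) q)

    Rot-new : Free c e → Free c' (y c i)
    Rot-new fe k k< q with k ≟ i
    ... | yes refl = fe i i<ℓ (trans (sym q) Rot-y≡)
    ... | no k≢    = k≢ (τ-fix i (yinj c (τ-bound i<ℓ k<) i<ℓ (trans (sym (ov≢ k≢)) q)))

    Rot-old : ∀ {z} → Free c' z → z ≢ y c i → Free c z
    Rot-old fz z≢ k k< q with k ≟ i
    ... | yes refl = z≢ (sym q)
    ... | no k≢    = fz (τ i k) (τ-bound i<ℓ k<)
            (trans (ov≢ (λ p → k≢ (trans (sym (ττ i k)) (trans (cong (τ i) p) (τ≥ ≤-refl))))) (trans (cong (y c) (ττ i k)) q))

  module _ {c i} (a : Link c i) where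
    open Link a
    private c' = Swap c a

    Swap-y≡ : y c' i ≡ e
    Swap-y≡ = ov≡ {i} {i} {e} {y c} refl

    Swap-y≢ : ∀ {k} → k ≢ i → y c' k ≡ y c k
    Swap-y≢ = ov≢

    Swap-keep : ∀ {z} → Free c z → z ≢ e → Free c' z
    Swap-keep fz z≢e k k< q with k ≟ i
    ... | yes refl = z≢e (trans (sym q) Swap-y≡)
    ... | no k≢    = fz k k< (trans (sym (ov≢ k≢)) q)

    Swap-new : Free c e → Free c' (y c i)
    Swap-new fe k k< q with k ≟ i
    ... | yes refl = fe i i<ℓ (trans (sym q) Swap-y≡)
    ... | no k≢    = k≢ (yinj c k< i<ℓ (trans (sym (ov≢ k≢)) q))

    Swap-old : ∀ {z} → Free c' z → z ≢ y c i → Free c z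
    Swap-old fz z≢ k k< q with k ≟ i
    ... | yes refl = z≢ (sym q)
    ... | no k≢    = fz k k< (trans (ov≢ k≢) q)

  Mir-free : ∀ c {z} → Free c z → Free (Mir c) z
  Mir-free c fz k k< q = fz _ (∸suc-< ℓ k k<) q

  Mir-free⁻ : ∀ c {z} → Free (Mir c) z → Free c z
  Mir-free⁻ c fz k k< q = fz (ℓ ∸ suc k) (∸suc-< ℓ k k<) (trans (cong (y c) (∸-invol k<)) q)

  -- Nf and Nb are the neighbourhoods of the first and the last vertex in the
  -- free edges; S, A and T', B record where the front and the back can be moved.

  opaque
    Nf Nb : Path → ℕ → Bool
    Nf c k = someE (λ e → fr c e ∧ (M c e 0 ∧ M c e k))
    Nb c k = someE (λ e → fr c e ∧ (M c e ℓ ∧ M c e k))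

    Nf⁺ : ∀ c {e k} → Free c e → Is (M c e 0) → Is (M c e k) → Is (Nf c k)
    Nf⁺ c {e} f p q = someE⁺ e (∧⁺ (fr⁺ c f) (∧⁺ p q))

    Nf⁻ : ∀ c {k} → Is (Nf c k) → Σ (Fin m) λ e → Free c e × Is (M c e 0) × Is (M c e k)
    Nf⁻ c {k} h with someE⁻ {λ e → fr c e ∧ (M c e 0 ∧ M c e k)} h
    ... | e , q = e , fr⁻ c (∧⁻¹ q) , ∧⁻¹ {M c e 0} (∧⁻² {fr c e} q) , ∧⁻² {M c e 0} (∧⁻² {fr c e} q)

    Nb⁺ : ∀ c {e k} → Free c e → Is (M c e ℓ) → Is (M c e k) → Is (Nb c k)
    Nb⁺ c {e} f p q = someE⁺ e (∧⁺ (fr⁺ c f) (∧⁺ p q))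

    Nb⁻ : ∀ c {k} → Is (Nb c k) → Σ (Fin m) λ e → Free c e × Is (M c e ℓ) × Is (M c e k)
    Nb⁻ c {k} h with someE⁻ {λ e → fr c e ∧ (M c e ℓ ∧ M c e k)} h
    ... | e , q = e , fr⁻ c (∧⁻¹ q) , ∧⁻¹ {M c e ℓ} (∧⁻² {fr c e} q) , ∧⁻² {M c e ℓ} (∧⁻² {fr c e} q)

  S S' A T' B : Path → ℕ → Bool
  S  c i = Nf c (suc i)
  S' c i = M c (y c i) 0
  A  c i = S c i ∨ S' c i
  T' c i = M c (y c i) ℓ
  B  c i = Nb c i ∨ T' c i

  A⁻ : ∀ c {i} → i < ℓ → Is (A c i) → Σ (Fin m) λ e → Is (M c e 0) × Is (M c e (suc i)) × Usable c i e
  A⁻ c {i} i< h with ∨⁻ {S c i} h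
  ... | inj₁ s  = let (e , f , p , q) = Nf⁻ c s in e , p , q , inj₂ f
  ... | inj₂ s' = y c i , s' , lkʳ c i< , inj₁ refl

  B⁻ : ∀ c {i} → i < ℓ → Is (B c i) → Σ (Fin m) λ e → Is (M c e ℓ) × Is (M c e i) × Usable c i e
  B⁻ c {i} i< h with ∨⁻ {Nb c i} h
  ... | inj₁ t  = let (e , f , p , q) = Nb⁻ c t in e , p , q , inj₂ f
  ... | inj₂ t' = y c i , t' , lkˡ c i< , inj₁ refl

-- A (q + 1)-uniform hypergraph of minimum degree ≥ D on ℓ + 1 vertices in
-- which no Hamiltonian path closes up.

record Setting : Set₁ where
  field
    V   : Set
    m ℓ q D : ℕ
    inc : Fin m → V → Bool
  open Paths V m ℓ inc public
  field
    rowX  : ∀ {x : ℕ → V} → XInj x → ∀ e → # (suc ℓ) (λ k → inc e (x k)) ≡ suc q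
    sepX  : ∀ {x : ℕ → V} → XInj x → ∀ {e e'} → (∀ k → k ≤ ℓ → inc e (x k) ≡ inc e' (x k)) → e ≡ e'
    deg   : ∀ v → D ≤ cnt (allFin m) (λ e → inc e v)
    noHam : ∀ c {e} → Free c e → Is (M c e 0) → Is (M c e ℓ) → ⊥

-- Degree counts and the consequences of having no closed path

module Analysis (G : Setting) where
  open Setting G public

  row : ∀ c e → # (suc ℓ) (M c e) ≡ suc q
  row c = rowX (xinj c)

  sep : ∀ c {e e'} → (∀ k → k ≤ ℓ → M c e k ≡ M c e' k) → e ≡ e'
  sep c = sepX (xinj c)

  fdeg : Path → ℕ → ℕ
  fdeg c k = cnt (allFin m) (λ e → fr c e ∧ M c e k)

  pdeg : Path → ℕ → ℕ
  pdeg c k = # ℓ (λ i → M c (y c i) k)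

  -- Stated for any finite list of edges, so that it serves paths and cycles alike.
  splitDeg : ∀ (y : ℕ → Fin m) (on? : Fin m → Bool) k → (∀ e → Is (on? e) → Σ ℕ λ i → i < k × y i ≡ e) →
             (P : Fin m → Bool) → cnt (allFin m) P ≤ cnt (allFin m) (λ e → not (on? e) ∧ P e) + # k (λ i → P (y i))
  splitDeg y on? k wit P = ≤-trans
    (cnt-cov (allFin m) {p = λ e → not (on? e) ∧ P e} {q = λ e → on? e ∧ P e} (λ e _ h → dec e h))
    (+-monoʳ-≤ (cnt (allFin m) (λ e → not (on? e) ∧ P e)) (go k (λ e → on? e ∧ P e) (λ e h → wit e (∧⁻¹ h) , ∧⁻² {on? e} h)))
    where
    dec : ∀ e → Is (P e) → Is (not (on? e) ∧ P e) ⊎ Is (on? e ∧ P e)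
    dec e h with on? e
    ... | true  = inj₂ h
    ... | false = inj₁ h
    go : ∀ k (Q : Fin m → Bool) → (∀ e → Is (Q e) → (Σ ℕ λ i → i < k × y i ≡ e) × Is (P e)) →
         cnt (allFin m) Q ≤ # k (λ i → P (y i))
    go zero    Q h = ≤-reflexive (cnt-none (allFin m) (λ e _ qe → noidx (proj₁ (h e qe))))
      where
      noidx : ∀ {e} → ¬ (Σ ℕ λ i → i < 0 × y i ≡ e)
      noidx (_ , () , _)
    go (suc k) Q h = ≤-trans
      (cnt-cov (allFin m) {p = λ e → ⌊ y k FP.≟ e ⌋ ∧ Q e} {q = λ e → not ⌊ y k FP.≟ e ⌋ ∧ Q e} (λ e _ qe → cases e qe))
      (+-mono-≤ one (go k (λ e → not ⌊ y k FP.≟ e ⌋ ∧ Q e) (λ e qe → smaller e qe)))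
      where
      cases : ∀ e → Is (Q e) → Is (⌊ y k FP.≟ e ⌋ ∧ Q e) ⊎ Is (not ⌊ y k FP.≟ e ⌋ ∧ Q e)
      cases e qe with ⌊ y k FP.≟ e ⌋
      ... | true  = inj₁ qe
      ... | false = inj₂ qe
      one : cnt (allFin m) (λ e → ⌊ y k FP.≟ e ⌋ ∧ Q e) ≤ b2n (P (y k))
      one with P (y k) in eq
      ... | true  = cnt-sub1 (allFin m) (allFin⁺ m)
              (λ e e' _ _ h h' → trans (sym (⌊⌋⁻ {d = y k FP.≟ e} (∧⁻¹ h))) (⌊⌋⁻ {d = y k FP.≟ e'} (∧⁻¹ h')))
      ... | false = ≤-reflexive (cnt-none (allFin m) (λ e _ h → contradiction
              (trans (sym eq) (subst (λ z → Is (P z)) (sym (⌊⌋⁻ {d = y k FP.≟ e} (∧⁻¹ h)))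
                 (proj₂ (h' e h)))) λ ()))
        where
        h' : ∀ e → Is (⌊ y k FP.≟ e ⌋ ∧ Q e) → (Σ ℕ λ i → i < suc k × y i ≡ e) × Is (P e)
        h' e g = h e (∧⁻² {⌊ y k FP.≟ e ⌋} g)
      smaller : ∀ e → Is (not ⌊ y k FP.≟ e ⌋ ∧ Q e) → (Σ ℕ λ i → i < k × y i ≡ e) × Is (P e)
      smaller e g with h e (∧⁻² {not ⌊ y k FP.≟ e ⌋} g)
      ... | (i , i< , eq) , pe with m≤n⇒m<n∨m≡n (≤-pred i<)
      ...   | inj₁ lt   = (i , lt , eq) , pe
      ...   | inj₂ refl = ⊥-elim (not⁻ {⌊ y k FP.≟ e ⌋} (∧⁻¹ g) (⌊⌋⁺ eq))

  degAt : ∀ c k → D ≤ fdeg c k + pdeg c k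
  degAt c k = ≤-trans (deg (x c k)) (splitDeg (y c) (on c) ℓ (λ e → on⁻ c) (λ e → inc e (x c k)))

  edgesX : ∀ {x} → XInj x → suc ℓ * D ≤ m * suc q
  edgesX {x} xi = subst₂ _≤_ (cong (_* D) (length-downFrom (suc ℓ)))
    (trans (doubleCount (downFrom (suc ℓ)) (allFin m) (λ k e → inc e (x k)))
           (trans (total-≡ (allFin m) (λ e → rowX xi e)) (cong (_* suc q) (length-tabulate {n = m} (λ i → i)))))
    (total-≥ (downFrom (suc ℓ)) (λ k → deg (x k)))

  unused : ∀ (y : ℕ → Fin m) (on? : Fin m → Bool) k → (∀ e → Is (on? e) → Σ ℕ λ i → i < k × y i ≡ e) →
           m ≤ cnt (allFin m) (λ e → not (on? e)) + k
  unused y on? k wit = subst₂ _≤_ (trans (cnt-true (allFin m)) (length-tabulate {n = m} (λ i → i)))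
      (cong₂ _+_ (cnt-ext (allFin m) (λ e _ → ∧-identityʳ (not (on? e)))) (#-all k (λ _ _ → refl)))
      (splitDeg y on? k wit (λ _ → true))
    where
    cnt-true : ∀ {A : Set} (as : List A) → cnt as (λ _ → true) ≡ length as
    cnt-true []       = refl
    cnt-true (a ∷ as) = cong suc (cnt-true as)

  -- Counting incidences gives `(ℓ + 1) * D ≤ m * (q + 1)`, so `D ≥ q + 1` forces more than `ℓ`
  -- edges.
  someUnused : ∀ {x} → XInj x → ∀ (y : ℕ → Fin m) (on? : Fin m → Bool) → (∀ e → Is (on? e) → Σ ℕ λ i → i < ℓ × y i ≡ e) →
               suc q ≤ D → Σ (Fin m) λ e → Is (not (on? e))
  someUnused xi y on? wit q<D = go (cnt-wit (allFin m) (≮⇒≥ λ lt → refute (m ∷ ℓ ∷ cnt (allFin m) (λ e → not (on? e)) ∷ [])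
      (κ 1 ⊕ ν 1 ≼ ν 0 ∷ ν 0 ≼ ν 2 ⊕ ν 1 ∷ κ 1 ⊕ ν 2 ≼ κ 1 ∷ [])
      (*-cancelʳ-≤ (suc ℓ) m (suc q) (≤-trans (*-monoʳ-≤ (suc ℓ) q<D) (edgesX xi)) ∷ unused y on? ℓ wit ∷ lt ∷ []) refl))
    where
    go : (Σ (Fin m) λ e → _ × Is (not (on? e))) → Σ (Fin m) λ e → Is (not (on? e))
    go (e , _ , p) = e , p

  -- Put `t = q + 1`. With at most three edges off the list, `m ≤ 2t + 4`, and then
  -- `m * t ≤ 2t² + 4t` falls short by 2 of the degree sum `(2t + 2)(t + 1)`.
  fourUnused : ∀ {x} → XInj x → ∀ (y : ℕ → Fin m) (on? : Fin m → Bool) → (∀ e → Is (on? e) → Σ ℕ λ i → i < ℓ × y i ≡ e) →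
               ℓ ≡ suc (suc q + suc q) → suc (suc q) ≤ D → 4 ≤ cnt (allFin m) (λ e → not (on? e))
  fourUnused xi y on? wit ℓ≡ D≥ = ≮⇒≥ λ lt → 1+n≰n
      (≤-trans (≤-trans (≤-reflexive (eq (suc q))) (≤-trans (*-mono-≤ (≤-reflexive (cong suc (sym ℓ≡))) D≥) (edgesX xi)))
        (≤-trans (*-monoˡ-≤ (suc q) (≤-trans (unused y on? ℓ wit) (+-mono-≤ (≤-pred lt) (≤-reflexive ℓ≡)))) (≤-trans (m≤n+m _ 1) (≤-reflexive (eq' (suc q))))))
    where
    eq : ∀ t → suc (suc (4 * t + (t + t) * t)) ≡ suc (suc (t + t)) * suc t
    eq = solve-∀
    eq' : ∀ t → 1 + (3 + suc (t + t)) * t ≡ suc (4 * t + (t + t) * t)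
    eq' = solve-∀

  freeEdge : ∀ c → suc q ≤ D → Σ (Fin m) (Free c)
  freeEdge c q<D = let (e , p) = someUnused (xinj c) (y c) (on c) (λ e → on⁻ c) q<D in e , fr⁻ c p

  famF : ∀ c (N : ℕ → Bool) (Q : Fin m → Bool) → (∀ e → Is (Q e) → Is (M c e 0)) →
         (∀ e → Is (Q e) → ∀ i → i < ℓ → Is (M c e (suc i)) → Is (N i)) →
         cnt (allFin m) Q ≤ bin (# ℓ N) q
  famF c N Q h0 hN = famBound (λ e i → M c e (suc i)) ℓ q N Q hN
    (λ e h → suc-injective (trans (sym (trans (#-shift ℓ (M c e)) (cong (λ b → b2n b + # ℓ (λ i → M c e (suc i))) (h0 e h)))) (row c e)))
    (λ e e' h h' ext → sep c (λ { zero _ → trans (h0 e h) (sym (h0 e' h')) ; (suc k) k< → ext k k< }))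

  famL : ∀ {x : ℕ → V} → XInj x → (N : ℕ → Bool) (Q : Fin m → Bool) → (∀ e → Is (Q e) → Is (inc e (x ℓ))) →
         (∀ e → Is (Q e) → ∀ i → i < ℓ → Is (inc e (x i)) → Is (N i)) →
         cnt (allFin m) Q ≤ bin (# ℓ N) q
  famL {x} xi N Q hℓ hN = famBound (λ e i → inc e (x i)) ℓ q N Q hN
    (λ e h → suc-injective (trans (sym (cong (λ b → b2n b + # ℓ (λ i → inc e (x i))) (hℓ e h))) (rowX xi e)))
    (λ e e' h h' ext → sepX xi (λ k k≤ → go h h' ext k (m≤n⇒m<n∨m≡n k≤)))
    where
    go : ∀ {e e'} → Is (Q e) → Is (Q e') → (∀ i → i < ℓ → inc e (x i) ≡ inc e' (x i)) →
         ∀ k → k < ℓ ⊎ k ≡ ℓ → inc e (x k) ≡ inc e' (x k)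
    go h h' ext k (inj₁ lt)   = ext k lt
    go h h' ext k (inj₂ refl) = trans (hℓ _ h) (sym (hℓ _ h'))

  famA : ∀ c (N : ℕ → Bool) (Q : Fin m → Bool) → (∀ e → Is (Q e) → ∀ k → k < suc ℓ → Is (M c e k) → Is (N k)) →
         cnt (allFin m) Q ≤ bin (# (suc ℓ) N) (suc q)
  famA c N Q hN = famBound (M c) (suc ℓ) (suc q) N Q hN (λ e _ → row c e) (λ e e' _ _ ext → sep c (λ k k≤ → ext k (s≤s k≤)))

  fdeg-bound : ∀ c → fdeg c 0 ≤ bin (# ℓ (S c)) q
  fdeg-bound c = famF c (S c) (λ e → fr c e ∧ M c e 0) (λ e h → ∧⁻² {fr c e} h)
    (λ e h i i< p → Nf⁺ c (fr⁻ c (∧⁻¹ h)) (∧⁻² {fr c e} h) p)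

  D≤ : ∀ c → D ≤ bin (# ℓ (S c)) q + # ℓ (S' c)
  D≤ c = ≤-trans (degAt c 0) (+-monoˡ-≤ _ (fdeg-bound c))

  leaving : ∀ c (N : ℕ → Bool) → suc (bin (# ℓ N) q) ≤ D →
            ¬ (∀ e → Is (M c e 0) → ∀ i → i < ℓ → Is (M c e (suc i)) → Is (N i))
  leaving c N lt h = 1+n≰n (≤-trans lt (≤-trans (deg (x c 0)) (famF c N (λ e → M c e 0) (λ e p → p) h)))

  module _ {c i} (a : Front c i) where
    open Front a
    private c' = Rot c a

    Rot-x0 : x c' 0 ≡ x c i
    Rot-x0 = cong (x c) (ρ≤ {i} {0} z≤n)

    Rot-xℓ : x c' ℓ ≡ x c ℓ
    Rot-xℓ = cong (x c) (ρ> i<ℓ)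

  -- After the front is moved to `x i`, the edge behind `Nb c i` joins both ends; if it is the very
  -- edge that was to be used for the move, it already joins the old ends.
  F1 : ∀ c {i} → i < ℓ → Is (A c i) → Is (Nb c i) → ⊥
  F1 c {i} i< h b with A⁻ c i< h | Nb⁻ c b
  ... | e , e0 , ei , u | g , fg , gℓ , gi with g FP.≟ e
  ...   | yes refl = noHam c fg e0 gℓ
  ...   | no g≢e   = noHam (Rot c a) (Rot-keep a fg g≢e)
                       (subst (λ v → Is (inc g v)) (sym (Rot-x0 a)) gi)
                       (subst (λ v → Is (inc g v)) (sym (Rot-xℓ a)) gℓ)
    where a = front i< e0 ei u

  Mir-xℓ : ∀ c → x (Mir c) ℓ ≡ x c 0
  Mir-xℓ c = cong (x c) (n∸n≡0 ℓ)

  MirNf⁺ : ∀ c {k} → Is (Nb c (ℓ ∸ k)) → Is (Nf (Mir c) k)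
  MirNf⁺ c h with Nb⁻ c h
  ... | e , f , p , p' = Nf⁺ (Mir c) (Mir-free c f) p p'

  MirNf⁻ : ∀ c {k} → Is (Nf (Mir c) k) → Is (Nb c (ℓ ∸ k))
  MirNf⁻ c h with Nf⁻ (Mir c) h
  ... | e , f , p , p' = Nb⁺ c (Mir-free⁻ c f) p p'

  MirNb⁺ : ∀ c {k} → Is (Nf c (ℓ ∸ k)) → Is (Nb (Mir c) k)
  MirNb⁺ c h with Nf⁻ c h
  ... | e , f , p , p' = Nb⁺ (Mir c) (Mir-free c f) (subst (λ v → Is (inc e v)) (sym (Mir-xℓ c)) p) p'

  MirNb⁻ : ∀ c {k} → Is (Nb (Mir c) k) → Is (Nf c (ℓ ∸ k))
  MirNb⁻ c h with Nb⁻ (Mir c) h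
  ... | e , f , p , p' = Nf⁺ c (Mir-free⁻ c f) (subst (λ v → Is (inc e v)) (Mir-xℓ c) p) p'

  ∸∸suc : ∀ {i} → i < ℓ → ℓ ∸ (ℓ ∸ suc i) ≡ suc i
  ∸∸suc i< = m∸[m∸n]≡n i<

  MirA⁺ : ∀ c {i} → i < ℓ → Is (B c (ℓ ∸ suc i)) → Is (A (Mir c) i)
  MirA⁺ c {i} i< h with ∨⁻ {Nb c (ℓ ∸ suc i)} h
  ... | inj₁ t  = ∨⁺¹ (MirNf⁺ c t)
  ... | inj₂ t' = ∨⁺² {S (Mir c) i} t'

  -- `F1` on the mirrored path, where `S` turns into `Nb` and `B` into `A`.
  F2 : ∀ c {i} → i < ℓ → Is (S c i) → Is (B c i) → ⊥
  F2 c {i} i< s b = F1 (Mir c) (∸suc-< ℓ i i<)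
    (MirA⁺ c (∸suc-< ℓ i i<) (subst (λ k → Is (B c k)) (sym (∸-invol i<)) b))
    (MirNb⁺ c (subst (λ k → Is (Nf c k)) (sym (∸∸suc i<)) s))

  S→A : ∀ c {i} → Is (S c i) → Is (A c i)
  S→A c = ∨⁺¹

  S'→A : ∀ c {i} → Is (S' c i) → Is (A c i)
  S'→A c {i} = ∨⁺² {S c i}

  module _ {c i} (a : Front c i) where
    open Front a
    private c' = Rot c a

    -- At most `y c i` becomes free, and by `F2` it does not contain `x ℓ` in that case. Together
    -- with `Rot-Nb⁺`, moving the front merely transports `Nb` by the reversal, so the size of `U`
    -- is invariant.
    Rot-Nb⁻ : ∀ {k} → Is (Nb c' k) → Is (Nb c (ρ i k))
    Rot-Nb⁻ {k} h with Nb⁻ c' h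
    ... | z , fz , zℓ , zk with z FP.≟ y c i
    ...   | no z≢    = Nb⁺ c (Rot-old a fz z≢) (subst (λ v → Is (inc z v)) (Rot-xℓ a) zℓ) zk
    ...   | yes refl = ⊥-elim (bad u)
      where
      bad : Usable c i e → ⊥
      bad (inj₁ refl) = fz i i<ℓ (Rot-y≡ a)
      bad (inj₂ fe)   = F2 c i<ℓ (Nf⁺ c fe e0 ei) (∨⁺² {Nb c i} (subst (λ v → Is (inc z v)) (Rot-xℓ a) zℓ))

    -- The only free edge that can be lost is `e`; it contains `x 0`, hence not `x ℓ`.
    Rot-Nb⁺ : ∀ {k} → Is (Nb c (ρ i k)) → Is (Nb c' k)
    Rot-Nb⁺ {k} h with Nb⁻ c h
    ... | z , fz , zℓ , zk with z FP.≟ e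
    ...   | no z≢    = Nb⁺ c' (Rot-keep a fz z≢) (subst (λ v → Is (inc z v)) (sym (Rot-xℓ a)) zℓ) zk
    ...   | yes refl = ⊥-elim (noHam c fz e0 zℓ)

  module _ {c e} (0<ℓ : 0 < ℓ) (e0 : Is (M c e 0)) (e1 : Is (M c e 1)) (fe : Free c e) where
    private
      a : Link c 0
      a = link 0<ℓ e0 e1 (inj₂ fe)
      c' = Swap c a

    Swap0-Nb⁻ : ∀ {k} → Is (Nb c' k) → Is (Nb c k)
    Swap0-Nb⁻ {k} h with Nb⁻ c' h
    ... | z , fz , zℓ , zk with z FP.≟ y c 0
    ...   | no z≢    = Nb⁺ c (Swap-old a fz z≢) zℓ zk
    ...   | yes refl = ⊥-elim (F2 c 0<ℓ (Nf⁺ c fe e0 e1) (∨⁺² {Nb c 0} zℓ))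

    Swap0-Nb⁺ : ∀ {k} → Is (Nb c k) → Is (Nb c' k)
    Swap0-Nb⁺ {k} h with Nb⁻ c h
    ... | z , fz , zℓ , zk with z FP.≟ e
    ...   | no z≢    = Nb⁺ c' (Swap-keep a fz z≢) zℓ zk
    ...   | yes refl = ⊥-elim (noHam c fz e0 zℓ)

  -- The free edges at the first vertex and y 0 lie in N once S does so both
  -- before and after exchanging y 0 for a free edge, which gives one more edge.
  Swap0-bound : ∀ c (N : ℕ → Bool) → 0 < ℓ → Is (S c 0) → (∀ i → i < ℓ → Is (S c i) → Is (N i)) →
    (∀ {e} (e0 : Is (M c e 0)) (e1 : Is (M c e 1)) (fe : Free c e) (l : 0 < ℓ) →
       ∀ i → i < ℓ → Is (S (Swap c (link l e0 e1 (inj₂ fe))) i) → Is (N i)) →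
    suc (fdeg c 0) ≤ bin (# ℓ N) q
  Swap0-bound c N l s sub sub' with Nf⁻ c s
  ... | e , fe , e0 , e1 = ≤-trans
      (≤-trans (+-monoˡ-≤ (fdeg c 0) (cnt-pos (allFin m) (∈-allFin (y c 0)) (⌊⌋⁺ {d = y c 0 FP.≟ y c 0} refl)))
        (cnt-disj (allFin m) {p = λ e → ⌊ y c 0 FP.≟ e ⌋} {q = λ e → fr c e ∧ M c e 0} {o = Q}
          (λ e _ h → ∨⁺¹ h) (λ e _ h → ∨⁺² {⌊ y c 0 FP.≟ e ⌋} h)
          (λ e _ h h' → fr⁻ c (∧⁻¹ h') 0 l (⌊⌋⁻ h))))
      (famF c N Q h0 hN)
    where
    a : Link c 0
    a  = link l e0 e1 (inj₂ fe)
    c' = Swap c a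
    Q : Fin m → Bool
    Q e = ⌊ y c 0 FP.≟ e ⌋ ∨ (fr c e ∧ M c e 0)
    h0 : ∀ z → Is (Q z) → Is (M c z 0)
    h0 z h with ∨⁻ {⌊ y c 0 FP.≟ z ⌋} h
    ... | inj₁ eq = subst (λ z → Is (M c z 0)) (⌊⌋⁻ eq) (lkˡ c l)
    ... | inj₂ g  = ∧⁻² {fr c z} g
    hN : ∀ z → Is (Q z) → ∀ i → i < ℓ → Is (M c z (suc i)) → Is (N i)
    hN z h i i< p with ∨⁻ {⌊ y c 0 FP.≟ z ⌋} h
    ... | inj₂ g  = sub i i< (Nf⁺ c (fr⁻ c (∧⁻¹ g)) (∧⁻² {fr c z} g) p)
    ... | inj₁ eq with ⌊⌋⁻ {d = y c 0 FP.≟ z} eq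
    ...   | refl = sub' e0 e1 fe l i i< (Nf⁺ c' (Swap-new a fe) (lkˡ c l) p)

  sFront : ∀ c {i} → i < ℓ → Is (S c i) → Σ (Front c i) λ a → Free c (Front.e a)
  sFront c i< s with Nf⁻ c s
  ... | e , f , p , p' = front i< p p' (inj₂ f) , f

  aFront : ∀ c {i} → i < ℓ → Is (A c i) → Front c i
  aFront c i< h with A⁻ c i< h
  ... | e , p , p' , u = front i< p p' u

  Rot-M⁺ : ∀ {c i} (a : Front c i) {z k} → Is (M c z k) → Is (M (Rot c a) z (ρ i k))
  Rot-M⁺ {c} {i} a {z} {k} = subst (λ j → Is (inc z (x c j))) (sym (ρρ i k))

  -- Moving the front along a free edge frees y i, whose vertices become
  -- neighbours of the new first vertex.
  Freed : ∀ {c i} (a : Front c i) → Free c (Front.e a) → ∀ {k} → Is (M c (y c i) k) → Is (Nf (Rot c a) (ρ i k))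
  Freed {c} {i} a fe p = Nf⁺ (Rot c a) (Rot-new a fe)
    (subst (λ v → Is (inc (y c i) v)) (sym (Rot-x0 a)) (lkˡ c (Front.i<ℓ a))) (Rot-M⁺ a {y c i} p)

  Freed0 : ∀ {c i} (a : Front c (suc i)) → Free c (Front.e a) → Is (S' c (suc i)) → Is (S (Rot c a) i)
  Freed0 {c} {i} a fe p = subst (λ k → Is (Nf (Rot c a) k)) (ρ≤ {suc i} {0} z≤n) (Freed a fe p)

  -- Even number of vertices: the last vertex has its free neighbours at the odd positions

  module Alternating (t : ℕ) (ℓ≡ : ℓ ≡ suc (t + t)) (2≤q : 2 ≤ q) (q<t : q < t) (D≡ : D ≡ suc (bin t q)) where

    Pat : Path → Set
    Pat c = ∀ k → k < ℓ → Nb c k ≡ not (ev k)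

    private
      t<ℓ : t + t < ℓ
      t<ℓ = ≤-reflexive (sym ℓ≡)

      1≤t : 1 ≤ t
      1≤t = ≤-trans (s≤s z≤n) q<t

      1<ℓ : 1 < ℓ
      1<ℓ = subst (1 <_) (sym ℓ≡) (s≤s (≤-trans 1≤t (m≤m+n t t)))

      #ev : # ℓ ev ≡ suc t
      #ev = trans (cong (λ z → # z ev) ℓ≡) (#-ev t)

    Pat-A : ∀ c → Pat c → ∀ {k} → k < ℓ → Is (A c k) → Is (ev k)
    Pat-A c pat k< h = stable (λ n → F1 c k< h (trans (pat _ k<) (not⁺ n)))

    Pat-S : ∀ c → ¬ Is (S c (t + t))
    Pat-S c h with Nf⁻ c h
    ... | e , f , p , p' = noHam c f p (subst (λ k → Is (M c e k)) (sym ℓ≡) p')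

    Pat-Rot : ∀ c → Pat c → ∀ {i} (a : Front c i) → Is (ev i) → Pat (Rot c a)
    Pat-Rot c pat {i} a h k k< = b≡ (λ p → trans (sym par) (trans (sym (pat _ (bd k k<))) (Rot-Nb⁻ a p)))
                                    (λ p → Rot-Nb⁺ a (trans (pat _ (bd k k<)) (trans par p)))
      where
      bd : ∀ k → k < ℓ → ρ i k < ℓ
      bd k k< with k ≤? i
      ... | yes p = subst (_< ℓ) (sym (ρ≤ p)) (≤-trans (s≤s (m∸n≤m i k)) (Front.i<ℓ a))
      ... | no n  = subst (_< ℓ) (sym (ρ> (≰⇒> n))) k<
      par : not (ev (ρ i k)) ≡ not (ev k)
      par with k ≤? i
      ... | yes p = cong not (trans (cong ev (ρ≤ p)) (ev-∸ i k p h))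
      ... | no n  = cong (λ z → not (ev z)) (ρ> (≰⇒> n))

    -- If both hold at `k + 1`, moving the front there along a free edge frees `y (k + 1)` and puts
    -- `k` into the new `A`. Position `k` then carries the old vertex at position `1`, a free
    -- neighbour of the last vertex, against `F1`.
    Pat-SS' : ∀ c → Pat c → ∀ {k} → k < ℓ → Is (S c k) → Is (S' c k) → k ≡ 0
    Pat-SS' c pat {zero}  k< s s' = refl
    Pat-SS' c pat {suc k} k< s s' with sFront c k< s
    ... | a , fe = ⊥-elim (F1 (Rot c a) (<⇒≤ k<) (S→A (Rot c a) (Freed0 a fe s'))
            (Rot-Nb⁺ a (subst (λ z → Is (Nb c z)) (sym (trans (ρ≤ (n≤1+n k)) (m+n∸n≡m 1 k))) (pat 1 1<ℓ))))

    -- `A` lies in the `t + 1` even indices. If one of them is missing, the sizes of `S` and `S'`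
    -- add up to at most `t + 1`, since the two sets share at most `0`. The degree of the first
    -- vertex then forces `S` to be all even indices below `2t`, and there the exchange of `y 0`
    -- yields the missing unit.
    Pat-full : ∀ c → Pat c → ∀ {i} → i < ℓ → Is (ev i) → Is (A c i)
    Pat-full c pat {i₀} i< evi = stable λ ¬A → contra ¬A
      where
      s = # ℓ (S c)
      s' = # ℓ (S' c)
      E₀ : ℕ → Bool
      E₀ k = ev k ∧ not (single (t + t) k)
      S⊂E₀ : ∀ k → k < ℓ → Is (S c k) → Is (E₀ k)
      S⊂E₀ k k< h = ∧⁺ (Pat-A c pat k< (S→A c h)) (not⁺ (λ e → Pat-S c (subst (λ z → Is (S c z)) (⌊⌋⁻ e) h)))
      #E₀ : # ℓ E₀ ≤ t
      #E₀ = ≤-pred (subst (suc (# ℓ E₀) ≤_) #ev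
        (#-add1 ℓ {E₀} {ev} {t + t} (λ k _ h → ∧⁻¹ h) t<ℓ (ev-dbl t) (λ h → not⁻ (∧⁻² {ev (t + t)} h) (⌊⌋⁺ refl))))
      contra : ¬ Is (A c i₀) → ⊥
      contra ¬A = go (m≤n⇒m<n∨m≡n s≤t)
        where
        #A : # ℓ (A c) ≤ t
        #A = ≤-pred (subst (suc (# ℓ (A c)) ≤_) #ev (#-add1 ℓ (λ k k< → Pat-A c pat k<) i< evi ¬A))
        s≤t : s ≤ t
        s≤t = ≤-trans (#-⊆ ℓ S⊂E₀) #E₀
        S'' : ℕ → Bool
        S'' k = S' c k ∧ not (single 0 k)
        s'≤ : s' ≤ # ℓ S'' + 1
        s'≤ = ≤-trans (#-cov ℓ {S' c} {S''} {single 0} cases) (+-monoʳ-≤ (# ℓ S'') (#-single ℓ 0))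
          where
          cases : ∀ k → k < ℓ → Is (S' c k) → Is (S'' k) ⊎ Is (single 0 k)
          cases k _ h with single 0 k
          ... | true  = inj₂ refl
          ... | false = inj₁ (∧⁺ h refl)
        s+s' : s + # ℓ S'' ≤ # ℓ (A c)
        s+s' = #-disj ℓ (λ k _ → S→A c) (λ k _ h → S'→A c {k} (∧⁻¹ h))
          (λ k k< h h' → not⁻ (∧⁻² {S' c k} h') (⌊⌋⁺ (Pat-SS' c pat k< h (∧⁻¹ h'))))
        s'≤A : s' ≤ # ℓ (A c)
        s'≤A = #-⊆ ℓ (λ k _ → S'→A c {k})
        D≥ : suc t ≤ D
        D≥ = subst (suc t ≤_) (sym D≡) (s≤s (bin-≥n (≤-trans (s≤s z≤n) 2≤q) q<t))
        go : s < t ⊎ s ≡ t → ⊥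
        go (inj₁ s<t) with q ≤? s
        ... | no q≰s = refute (D ∷ s' ∷ # ℓ (A c) ∷ t ∷ [])
                (κ 1 ⊕ ν 3 ≼ ν 0 ∷ ν 0 ≼ ν 1 ∷ ν 1 ≼ ν 2 ∷ ν 2 ≼ ν 3 ∷ [])
                (D≥ ∷ subst (λ z → D ≤ z + s') (bin-zero (≰⇒> q≰s)) (D≤ c) ∷ s'≤A ∷ #A ∷ []) refl
        ... | yes q≤s = refute (bin s q ∷ s' ∷ # ℓ (A c) ∷ t ∷ bin t q ∷ s ∷ # ℓ S'' ∷ [])
                (κ 1 ⊕ ν 4 ≼ ν 0 ⊕ ν 1 ∷ ν 0 ⊕ ν 3 ≼ κ 1 ⊕ ν 4 ∷ ν 1 ≼ ν 6 ⊕ κ 1 ∷ ν 5 ⊕ ν 6 ≼ ν 2 ∷ ν 2 ≼ ν 3 ∷ κ 2 ≼ ν 5 ∷ [])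
                (subst (_≤ bin s q + s') D≡ (D≤ c) ∷ binA 2≤q q<t s<t ∷ s'≤ ∷ s+s' ∷ #A ∷ ≤-trans 2≤q q≤s ∷ []) refl
        go (inj₂ s≡t) = refute (fdeg c 0 ∷ s' ∷ # ℓ S'' ∷ s ∷ # ℓ (A c) ∷ t ∷ bin t q ∷ [])
                (κ 1 ⊕ ν 6 ≼ ν 0 ⊕ ν 1 ∷ κ 1 ⊕ ν 0 ≼ ν 6 ∷ ν 1 ≼ ν 2 ⊕ κ 1 ∷ ν 3 ⊕ ν 2 ≼ ν 4 ∷ ν 4 ≼ ν 5 ∷ ν 5 ≼ ν 3 ∷ [])
                (subst (_≤ fdeg c 0 + s') D≡ (degAt c 0) ∷ ≤-trans sw (bin-mono q #E₀) ∷ s'≤ ∷ s+s' ∷ #A ∷ ≤-reflexive (sym s≡t) ∷ []) refl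
          where
          0<ℓ : 0 < ℓ
          0<ℓ = <⇒≤ 1<ℓ
          S0 : Is (S c 0)
          S0 = #-⊇ ℓ S⊂E₀ (≤-trans #E₀ (≤-reflexive (sym s≡t))) 0 0<ℓ
                 (∧⁺ refl (not⁺ (λ e → <⇒≢ (≤-trans 1≤t (m≤m+n t t)) (⌊⌋⁻ e))))
          sw : suc (fdeg c 0) ≤ bin (# ℓ E₀) q
          sw = Swap0-bound c E₀ 0<ℓ S0 S⊂E₀ (λ e0 e1 fe l k k< h →
                 let c' = Swap c (link l e0 e1 (inj₂ fe))
                     pat' : Pat c'
                     pat' = λ k k< → trans (b≡ (Swap0-Nb⁻ l e0 e1 fe) (Swap0-Nb⁺ l e0 e1 fe)) (pat k k<)
                 in ∧⁺ (Pat-A c' pat' k< (S→A c' h)) (not⁺ (λ e → Pat-S c' (subst (λ z → Is (S c' z)) (⌊⌋⁻ e) h))))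

    -- The front can be moved to every even position, and `A` is full there too. Index `2t` cannot
    -- come from a free edge, so the last path edge contains every even position besides `x ℓ`: at
    -- least `t + 2` vertices.
    alternating : ∀ c → Pat c → ⊥
    alternating c pat = refute (t ∷ q ∷ # ℓ (M c e) ∷ [])
        (κ 1 ⊕ ν 2 ≼ κ 1 ⊕ ν 1 ∷ κ 1 ⊕ ν 1 ≼ ν 0 ∷ κ 1 ⊕ ν 0 ≼ ν 2 ∷ [])
        (≤-reflexive rowe ∷ q<t ∷ subst (_≤ # ℓ (M c e)) #ev (#-⊆ ℓ mem) ∷ []) refl
      where
      e = y c (t + t)
      rowe : suc (# ℓ (M c e)) ≡ suc q
      rowe = trans (sym (cong (λ b → b2n b + # ℓ (M c e)) (subst (λ k → Is (M c e k)) (sym ℓ≡) (lkʳ c t<ℓ)))) (row c e)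
      mem : ∀ i → i < ℓ → Is (ev i) → Is (M c e i)
      mem i i< evi with m≤n⇒m<n∨m≡n (≤-pred (subst (i <_) ℓ≡ i<))
      ... | inj₂ refl = lkˡ c t<ℓ
      ... | inj₁ i<tt = go (∨⁻ {S c' (t + t)} (Pat-full c' (Pat-Rot c pat a evi) t<ℓ (ev-dbl t)))
        where
        a = aFront c i< (Pat-full c pat i< evi)
        c' = Rot c a
        go : Is (S c' (t + t)) ⊎ Is (S' c' (t + t)) → Is (M c e i)
        go (inj₁ s)  = ⊥-elim (Pat-S c' s)
        go (inj₂ s') = subst₂ (λ z v → Is (inc z v)) (Rot-y> a i<tt) (Rot-x0 a) s'

  -- Berge cycles of length ℓ

  module OnCycle (last : ℕ) (ℓ≡ : ℓ ≡ suc last) where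

    last<ℓ : last < ℓ
    last<ℓ = ≤-reflexive (sym ℓ≡)

    <ℓ→≤last : ∀ {i} → i < ℓ → i ≤ last
    <ℓ→≤last h = ≤-pred (subst (_ ≤_) ℓ≡ h)

    opaque
      nxt : ℕ → ℕ
      nxt i with i ≟ last
      ... | yes _ = 0
      ... | no  _ = suc i

      nxt-last : nxt last ≡ 0
      nxt-last with last ≟ last
      ... | yes _ = refl
      ... | no n  = contradiction refl n

      nxt-suc : ∀ {i} → i ≢ last → nxt i ≡ suc i
      nxt-suc {i} h with i ≟ last
      ... | yes p = contradiction p h
      ... | no _  = refl

    nxt-< : ∀ {i} → i < ℓ → nxt i < ℓ
    nxt-< {i} i< with i ≟ last
    ... | yes refl = subst (_< ℓ) (sym nxt-last) (≤-trans (s≤s z≤n) i<)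
    ... | no i≢    = subst (_< ℓ) (sym (nxt-suc i≢)) (subst (suc i <_) (sym ℓ≡) (s≤s (≤∧≢⇒< (<ℓ→≤last i<) i≢)))

    prv : ℕ → ℕ
    prv zero    = last
    prv (suc i) = i

    prv-< : ∀ {i} → i < ℓ → prv i < ℓ
    prv-< {zero}  _  = last<ℓ
    prv-< {suc i} i< = <⇒≤ i<

    nxt-prv : ∀ {i} → i < ℓ → nxt (prv i) ≡ i
    nxt-prv {zero}  _  = nxt-last
    nxt-prv {suc i} i< = nxt-suc (<⇒≢ (≤-pred (subst (_ ≤_) ℓ≡ i<)))

    prv-nxt : ∀ {i} → i < ℓ → prv (nxt i) ≡ i
    prv-nxt {i} i< with i ≟ last
    ... | yes refl = cong prv nxt-last
    ... | no i≢    = cong prv (nxt-suc i≢)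

    nxt-inj : ∀ {i j} → i < ℓ → j < ℓ → nxt i ≡ nxt j → i ≡ j
    nxt-inj i< j< h = trans (sym (prv-nxt i<)) (trans (cong prv h) (prv-nxt j<))

    #-nxt : ∀ p → # ℓ (λ i → p (nxt i)) ≡ # ℓ p
    #-nxt p = subst (λ k → # k (λ i → p (nxt i)) ≡ # k p) (sym ℓ≡)
      (trans (cong₂ _+_ (cong (λ i → b2n (p i)) nxt-last)
                        (#-ext last (λ i i< → cong p (nxt-suc (<⇒≢ i<)))))
             (sym (#-shift last p)))

    -- Berge cycles x 0, …, x (ℓ − 1) missing exactly the vertex x ℓ; the edge g i joins
    -- the positions i and nxt i.

    record Cyc : Set where
      field
        cx    : ℕ → V
        cg    : ℕ → Fin m
        cxinj : XInj cx
        cginj : ∀ {i j} → i < ℓ → j < ℓ → cg i ≡ cg j → i ≡ j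
        ckˡ   : ∀ {i} → i < ℓ → Is (inc (cg i) (cx i))
        ckʳ   : ∀ {i} → i < ℓ → Is (inc (cg i) (cx (nxt i)))
    open Cyc

    C : Cyc → Fin m → ℕ → Bool
    C c e k = inc e (cx c k)

    CFree : Cyc → Fin m → Set
    CFree c e = ∀ i → i < ℓ → cg c i ≢ e

    con : Cyc → Fin m → Bool
    con c e = 1 ≤ᵇ # ℓ (λ i → ⌊ cg c i FP.≟ e ⌋)

    con⁻ : ∀ c {e} → Is (con c e) → Σ ℕ λ i → i < ℓ × cg c i ≡ e
    con⁻ c h with #-wit ℓ (≤ᵇ⁻ h)
    ... | i , i< , h' = i , i< , ⌊⌋⁻ h'

    cfr : Cyc → Fin m → Bool
    cfr c e = not (con c e)

    cfr⁺ : ∀ c {e} → CFree c e → Is (cfr c e)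
    cfr⁺ c f = not⁺ (λ h → let (i , i< , h') = con⁻ c h in f i i< h')

    cfr⁻ : ∀ c {e} → Is (cfr c e) → CFree c e
    cfr⁻ c h i i< h' = not⁻ h (≤ᵇ⁺ (#-pos ℓ i< (⌊⌋⁺ h')))

    cUsable : Cyc → ℕ → Fin m → Set
    cUsable c i e = e ≡ cg c i ⊎ CFree c e

    -- Q: the cycle edges through the missing vertex; N: its free neighbours.

    Q : Cyc → ℕ → Bool
    Q c i = C c (cg c i) ℓ

    opaque
      N : Cyc → ℕ → Bool
      N c k = someE (λ e → cfr c e ∧ (C c e ℓ ∧ C c e k))

      N⁺ : ∀ c {e k} → CFree c e → Is (C c e ℓ) → Is (C c e k) → Is (N c k)
      N⁺ c {e} f p q = someE⁺ e (∧⁺ (cfr⁺ c f) (∧⁺ p q))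

      N⁻ : ∀ c {k} → Is (N c k) → Σ (Fin m) λ e → CFree c e × Is (C c e ℓ) × Is (C c e k)
      N⁻ c {k} h with someE⁻ {λ e → cfr c e ∧ (C c e ℓ ∧ C c e k)} h
      ... | e , h' = e , cfr⁻ c (∧⁻¹ h') , ∧⁻¹ {C c e ℓ} (∧⁻² {cfr c e} h') , ∧⁻² {C c e ℓ} (∧⁻² {cfr c e} h')

    cfdeg : Cyc → ℕ → ℕ
    cfdeg c k = cnt (allFin m) (λ e → cfr c e ∧ C c e k)

    cdegAt : ∀ c k → D ≤ cfdeg c k + # ℓ (λ i → C c (cg c i) k)
    cdegAt c k = ≤-trans (deg (cx c k)) (splitDeg (cg c) (con c) ℓ (λ e → con⁻ c) (λ e → inc e (cx c k)))

    cfdeg-bound : ∀ c → cfdeg c ℓ ≤ bin (# ℓ (N c)) q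
    cfdeg-bound c = famL (cxinj c) (N c) (λ e → cfr c e ∧ C c e ℓ) (λ e h → ∧⁻² {cfr c e} h)
      (λ e h i i< p → N⁺ c (cfr⁻ c (∧⁻¹ h)) (∧⁻² {cfr c e} h) p)

    crow : ∀ c e → # (suc ℓ) (C c e) ≡ suc q
    crow c = rowX (cxinj c)

    -- Cutting the cycle between `last` and `0` and attaching the missing vertex behind `last` gives
    -- a Hamiltonian path, on which `noHam` and `F2` can be used.
    toPath : ∀ c {e} → Is (C c e last) → Is (C c e ℓ) → cUsable c last e → Path
    toPath c {e} el eℓ u = record
      { x    = cx c
      ; y    = override last e (cg c)
      ; xinj = cxinj c
      ; yinj = inj
      ; lkˡ  = λ {k} → left k
      ; lkʳ  = λ {k} → right k
      }
      where
      inj : ∀ {j k} → j < ℓ → k < ℓ → override last e (cg c) j ≡ override last e (cg c) k → j ≡ k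
      inj {j} {k} j< k< h with j ≟ last | k ≟ last
      ... | yes refl | yes refl = refl
      ... | no j≢    | no k≢    = cginj c j< k< (trans (sym (ov≢ j≢)) (trans h (ov≢ k≢)))
      ... | yes refl | no k≢    = ⊥-elim (bad u)
        where
        h' : cg c k ≡ e
        h' = trans (sym (ov≢ k≢)) (trans (sym h) (ov≡ refl))
        bad : cUsable c last e → ⊥
        bad (inj₁ p) = k≢ (cginj c k< last<ℓ (trans h' p))
        bad (inj₂ f) = f k k< h'
      ... | no j≢    | yes refl = ⊥-elim (bad u)
        where
        h' : cg c j ≡ e
        h' = trans (sym (ov≢ j≢)) (trans h (ov≡ refl))
        bad : cUsable c last e → ⊥
        bad (inj₁ p) = j≢ (cginj c j< last<ℓ (trans h' p))
        bad (inj₂ f) = f j j< h'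
      left : ∀ k → k < ℓ → Is (inc (override last e (cg c) k) (cx c k))
      left k k< with k ≟ last
      ... | yes refl rewrite ov≡ {last} {last} {e} {cg c} refl = el
      ... | no k≢    rewrite ov≢ {last} {k} {e} {cg c} k≢      = ckˡ c k<
      right : ∀ k → k < ℓ → Is (inc (override last e (cg c) k) (cx c (suc k)))
      right k k< with k ≟ last
      ... | yes refl rewrite ov≡ {last} {last} {e} {cg c} refl = subst (λ k → Is (C c e k)) ℓ≡ eℓ
      ... | no k≢    rewrite ov≢ {last} {k} {e} {cg c} k≢      = subst (λ j → Is (C c (cg c k) j)) (nxt-suc k≢) (ckʳ c k<)

    module _ c {e} (el : Is (C c e last)) (eℓ : Is (C c e ℓ)) (u : cUsable c last e) where

      toPath-keep : ∀ {z} → CFree c z → z ≢ e → Free (toPath c el eℓ u) z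
      toPath-keep fz z≢e k k< h with k ≟ last
      ... | yes refl = z≢e (trans (sym h) (ov≡ refl))
      ... | no k≢    = fz k k< (trans (sym (ov≢ k≢)) h)

      toPath-new : CFree c e → Free (toPath c el eℓ u) (cg c last)
      toPath-new fe k k< h with k ≟ last
      ... | yes refl = fe last last<ℓ (trans (sym h) (ov≡ {last} {last} {e} {cg c} refl))
      ... | no k≢    = k≢ (cginj c k< last<ℓ (trans (sym (ov≢ k≢)) h))

    shf : ℕ → ℕ
    shf k with k <? ℓ
    ... | yes _ = nxt k
    ... | no  _ = k

    shf< : ∀ {k} → k < ℓ → shf k ≡ nxt k
    shf< {k} h with k <? ℓ
    ... | yes _ = refl
    ... | no n  = contradiction h n

    shfℓ : shf ℓ ≡ ℓ
    shfℓ with ℓ <? ℓ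
    ... | yes p = contradiction p (n≮n ℓ)
    ... | no _  = refl

    shift : Cyc → Cyc
    shift c = record
      { cx    = λ k → cx c (shf k)
      ; cg    = λ k → cg c (nxt k)
      ; cxinj = λ p p' h → inj p p' (cxinj c (bd p) (bd p') h)
      ; cginj = λ p p' h → nxt-inj p p' (cginj c (nxt-< p) (nxt-< p') h)
      ; ckˡ   = λ {k} k< → subst (λ j → Is (C c (cg c (nxt k)) j)) (sym (shf< k<)) (ckˡ c (nxt-< k<))
      ; ckʳ   = λ {k} k< → subst (λ j → Is (C c (cg c (nxt k)) j)) (sym (shf< (nxt-< k<))) (ckʳ c (nxt-< k<))
      }
      where
      bd : ∀ {k} → k ≤ ℓ → shf k ≤ ℓ
      bd {k} k≤ with k <? ℓ
      ... | yes p = <⇒≤ (nxt-< p)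
      ... | no _  = k≤
      inj : ∀ {j k} → j ≤ ℓ → k ≤ ℓ → shf j ≡ shf k → j ≡ k
      inj {j} {k} j≤ k≤ h with j <? ℓ | k <? ℓ
      ... | yes p | yes p' = nxt-inj p p' h
      ... | no p  | no p'  = h
      ... | yes p | no p'  = contradiction (subst (_< ℓ) h (nxt-< p)) p'
      ... | no p  | yes p' = contradiction (subst (_< ℓ) (sym h) (nxt-< p')) p

    shift-free : ∀ c {z} → CFree c z → CFree (shift c) z
    shift-free c fz k k< = fz (nxt k) (nxt-< k<)

    -- Every position can be shifted to `last`, the place where `toPath` cuts, so statements about
    -- one position need a proof only there.
    cycInd : (P : Cyc → ℕ → Set) → (∀ c → P c last) → (∀ c i → i < ℓ → P (shift c) i → P c (nxt i)) →
             ∀ c i → i < ℓ → P c i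
    cycInd P base step c zero    i< = subst (P c) nxt-last (step c last last<ℓ (base (shift c)))
    cycInd P base step c (suc i) i< = subst (P c) (nxt-prv i<) (step c i (<⇒≤ i<) (cycInd P base step (shift c) i (<⇒≤ i<)))

    C-shf : ∀ c {e k} → k < ℓ → Is (C c e (nxt k)) → Is (C (shift c) e k)
    C-shf c {e} k< = subst (λ j → Is (C c e j)) (sym (shf< k<))

    C-shfℓ : ∀ c {e} → Is (C c e ℓ) → Is (C (shift c) e ℓ)
    C-shfℓ c {e} = subst (λ j → Is (C c e j)) (sym shfℓ)

    -- No free edge through the missing vertex meets the ends of a cycle edge
    -- through it, and distinct free edges do not reach consecutive vertices.

    k1ʳ : ∀ c i → i < ℓ → Is (Q c i) → ∀ {f} → CFree c f → Is (C c f ℓ) → Is (C c f (nxt i)) → ⊥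
    k1ʳ = cycInd (λ c i → Is (Q c i) → ∀ {f} → CFree c f → Is (C c f ℓ) → Is (C c f (nxt i)) → ⊥)
      (λ c qi {f} ff fℓ fi → noHam (toPath c (ckˡ c last<ℓ) qi (inj₁ refl))
         (toPath-keep c (ckˡ c last<ℓ) qi (inj₁ refl) ff (λ h → ff last last<ℓ (sym h)))
         (subst (λ j → Is (C c f j)) nxt-last fi) fℓ)
      (λ c i i< h qi ff fℓ fi → h (C-shfℓ c qi) (shift-free c ff) (C-shfℓ c fℓ) (C-shf c (nxt-< i<) fi))

    k1ˡ : ∀ c i → i < ℓ → Is (Q c i) → ∀ {f} → CFree c f → Is (C c f ℓ) → Is (C c f i) → ⊥
    k1ˡ = cycInd (λ c i → Is (Q c i) → ∀ {f} → CFree c f → Is (C c f ℓ) → Is (C c f i) → ⊥)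
      (λ c qi {f} ff fℓ fi → noHam (toPath c fi fℓ (inj₂ ff)) (toPath-new c fi fℓ (inj₂ ff) ff)
         (subst (λ j → Is (C c (cg c last) j)) nxt-last (ckʳ c last<ℓ)) qi)
      (λ c i i< h qi ff fℓ fi → h (C-shfℓ c qi) (shift-free c ff) (C-shfℓ c fℓ) (C-shf c i< fi))

    k2 : ∀ c i → i < ℓ → ∀ {f f'} → CFree c f → CFree c f' → f ≢ f' → Is (C c f ℓ) → Is (C c f' ℓ) →
         Is (C c f i) → Is (C c f' (nxt i)) → ⊥
    k2 = cycInd (λ c i → ∀ {f f'} → CFree c f → CFree c f' → f ≢ f' → Is (C c f ℓ) → Is (C c f' ℓ) →
         Is (C c f i) → Is (C c f' (nxt i)) → ⊥)
      (λ c {f} {f'} ff ff' f≢ fℓ fℓ' fi fi' → noHam (toPath c fi fℓ (inj₂ ff))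
         (toPath-keep c fi fℓ (inj₂ ff) ff' (λ h → f≢ (sym h))) (subst (λ j → Is (C c f' j)) nxt-last fi') fℓ')
      (λ c i i< h ff ff' f≢ fℓ fℓ' fi fi' → h (shift-free c ff) (shift-free c ff') f≢ (C-shfℓ c fℓ) (C-shfℓ c fℓ') (C-shf c i< fi) (C-shf c (nxt-< i<) fi'))

    -- Cut behind `i` and attach the missing vertex by the cycle edge at `i`. The free edge then
    -- gives `S` and the other cycle edge gives `T'` at index `j`, against `F2`.
    k3ʳ : ∀ c i → i < ℓ → ∀ j → j < ℓ → j ≢ i → Is (Q c i) → Is (Q c j) →
          ∀ {f} → CFree c f → Is (C c f (nxt i)) → Is (C c f (nxt j)) → ⊥
    k3ʳ = cycInd (λ c i → ∀ j → j < ℓ → j ≢ i → Is (Q c i) → Is (Q c j) → ∀ {f} → CFree c f → Is (C c f (nxt i)) → Is (C c f (nxt j)) → ⊥)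
      base
      (λ c i i< h j j< j≢ qi qj {f} ff fi fj → h (prv j) (prv-< j<)
         (λ p → j≢ (trans (sym (nxt-prv j<)) (cong nxt p)))
         (C-shfℓ c qi) (C-shfℓ c (subst (λ k → Is (Q c k)) (sym (nxt-prv j<)) qj)) (shift-free c ff)
         (C-shf c (nxt-< i<) fi)
         (C-shf c (subst (_< ℓ) (sym (nxt-prv j<)) j<) (subst (λ k → Is (C c f (nxt k))) (sym (nxt-prv j<)) fj)))
      where
      base : ∀ c j → j < ℓ → j ≢ last → Is (Q c last) → Is (Q c j) → ∀ {f} → CFree c f → Is (C c f (nxt last)) → Is (C c f (nxt j)) → ⊥
      base c j j< j≢ ql qj {f} ff fl fj = F2 p j<
        (Nf⁺ p (toPath-keep c (ckˡ c last<ℓ) ql (inj₁ refl) ff (λ h → ff last last<ℓ (sym h)))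
           (subst (λ k → Is (C c f k)) nxt-last fl) (subst (λ k → Is (C c f k)) (nxt-suc j≢) fj))
        (∨⁺² {Nb p j} (subst (λ e → Is (C c e ℓ)) (sym (ov≢ j≢)) qj))
        where p = toPath c (ckˡ c last<ℓ) ql (inj₁ refl)

    opaque
      rx : ℕ → ℕ
      rx k with k ≤? last
      ... | yes _ = last ∸ k
      ... | no  _ = k

      rx≤ : ∀ {k} → k ≤ last → rx k ≡ last ∸ k
      rx≤ {k} h with k ≤? last
      ... | yes _ = refl
      ... | no n  = contradiction h n

      rxℓ : rx ℓ ≡ ℓ
      rxℓ with ℓ ≤? last
      ... | yes p = contradiction p (<⇒≱ last<ℓ)
      ... | no _  = refl

      rxx : ∀ k → rx (rx k) ≡ k
      rxx k with k ≤? last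
      ... | no n  = go
        where
        go : rx k ≡ k
        go with k ≤? last
        ... | yes p = contradiction p n
        ... | no _  = refl
      ... | yes p = trans (rx≤ (m∸n≤m last k)) (m∸[m∸n]≡n p)

      rx-bd : ∀ {k} → k ≤ ℓ → rx k ≤ ℓ
      rx-bd {k} h with k ≤? last
      ... | yes _ = ≤-trans (m∸n≤m last k) (<⇒≤ last<ℓ)
      ... | no _  = h

    rx-inj : ∀ {j k} → rx j ≡ rx k → j ≡ k
    rx-inj {j} {k} h = trans (sym (rxx j)) (trans (cong rx h) (rxx k))

    rev : Cyc → Cyc
    rev c = record
      { cx    = λ k → cx c (rx k)
      ; cg    = λ k → cg c (τ last k)
      ; cxinj = λ p p' h → rx-inj (cxinj c (rx-bd p) (rx-bd p') h)
      ; cginj = λ p p' h → τ-inj last (cginj c (τ-bound last<ℓ p) (τ-bound last<ℓ p') h)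
      ; ckˡ   = λ {k} → left k
      ; ckʳ   = λ {k} → right k
      }
      where
      left : ∀ k → k < ℓ → Is (inc (cg c (τ last k)) (cx c (rx k)))
      left k k< with k ≟ last
      ... | yes refl rewrite τ≥ (≤-refl {last}) | rx≤ (≤-refl {last}) | n∸n≡0 last =
              subst (λ j → Is (C c (cg c last) j)) nxt-last (ckʳ c last<ℓ)
      ... | no k≢ rewrite τ< (≤∧≢⇒< (<ℓ→≤last k<) k≢) | rx≤ (<ℓ→≤last k<) | sym (suc-∸suc (≤∧≢⇒< (<ℓ→≤last k<) k≢)) =
              subst (λ j → Is (C c (cg c (last ∸ suc k)) j)) (nxt-suc (<⇒≢ lt)) (ckʳ c (<-trans lt last<ℓ))
        where
        lt : last ∸ suc k < last
        lt = ∸suc-< last k (≤∧≢⇒< (<ℓ→≤last k<) k≢)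
      right : ∀ k → k < ℓ → Is (inc (cg c (τ last k)) (cx c (rx (nxt k))))
      right k k< with k ≟ last
      ... | yes refl rewrite τ≥ (≤-refl {last}) | nxt-last | rx≤ (z≤n {last}) = ckˡ c last<ℓ
      ... | no k≢ rewrite τ< (≤∧≢⇒< (<ℓ→≤last k<) k≢) | nxt-suc k≢ | rx≤ (≤∧≢⇒< (<ℓ→≤last k<) k≢) =
              ckˡ c (<-trans (∸suc-< last k (≤∧≢⇒< (<ℓ→≤last k<) k≢)) last<ℓ)

    -- `k3ʳ` on the reversed cycle, where the two ends of each cycle edge change roles.
    k3ˡ : ∀ c i → i < ℓ → ∀ j → j < ℓ → j ≢ i → Is (Q c i) → Is (Q c j) →
          ∀ {f} → CFree c f → Is (C c f i) → Is (C c f j) → ⊥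
    k3ˡ = cycInd (λ c i → ∀ j → j < ℓ → j ≢ i → Is (Q c i) → Is (Q c j) → ∀ {f} → CFree c f → Is (C c f i) → Is (C c f j) → ⊥)
      base
      (λ c i i< h j j< j≢ qi qj {f} ff fi fj → h (prv j) (prv-< j<)
         (λ p → j≢ (trans (sym (nxt-prv j<)) (cong nxt p)))
         (C-shfℓ c qi) (C-shfℓ c (subst (λ k → Is (Q c k)) (sym (nxt-prv j<)) qj)) (shift-free c ff)
         (C-shf c i< fi)
         (C-shf c (prv-< j<) (subst (λ k → Is (C c f k)) (sym (nxt-prv j<)) fj)))
      where
      base : ∀ c j → j < ℓ → j ≢ last → Is (Q c last) → Is (Q c j) → ∀ {f} → CFree c f → Is (C c f last) → Is (C c f j) → ⊥
      base c j j< j≢ ql qj {f} ff fl fj = k3ʳ (rev c) last last<ℓ j' (<-trans j'< last<ℓ) (<⇒≢ j'<)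
          (subst₂ (λ e k → Is (C c e k)) (cong (cg c) (sym (τ≥ ≤-refl))) (sym rxℓ) ql)
          (subst₂ (λ e k → Is (C c e k)) (cong (cg c) (sym j'-τ)) (sym rxℓ) qj)
          (λ k k< → ff (τ last k) (τ-bound last<ℓ k<))
          (subst (λ k → Is (C c f k)) (sym (trans (cong rx nxt-last) (rx≤ z≤n))) fl)
          (subst (λ k → Is (C c f k)) (sym (trans (cong rx (nxt-suc (<⇒≢ j'<))) (trans (rx≤ j'<) (∸-invol j<l)))) fj)
        where
        j<l : j < last
        j<l = ≤∧≢⇒< (<ℓ→≤last j<) j≢
        j' = last ∸ suc j
        j'< : j' < last
        j'< = ∸suc-< last j j<l
        j'-τ : τ last j' ≡ j
        j'-τ = trans (τ< j'<) (∸-invol j<l)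

    swapC : ∀ c i {f} → i < ℓ → CFree c f → Is (C c f i) → Is (C c f (nxt i)) → Cyc
    swapC c i {f} i<ℓ ff fi fi' = record
      { cx    = cx c
      ; cg    = override i f (cg c)
      ; cxinj = cxinj c
      ; cginj = inj
      ; ckˡ   = λ {k} → left k
      ; ckʳ   = λ {k} → right k
      }
      where
      inj : ∀ {j k} → j < ℓ → k < ℓ → override i f (cg c) j ≡ override i f (cg c) k → j ≡ k
      inj {j} {k} j< k< h with j ≟ i | k ≟ i
      ... | yes refl | yes refl = refl
      ... | no j≢    | no k≢    = cginj c j< k< (trans (sym (ov≢ j≢)) (trans h (ov≢ k≢)))
      ... | yes refl | no k≢    = ⊥-elim (ff k k< (trans (sym (ov≢ k≢)) (trans (sym h) (ov≡ refl))))
      ... | no j≢    | yes refl = ⊥-elim (ff j j< (trans (sym (ov≢ j≢)) (trans h (ov≡ refl))))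
      left : ∀ k → k < ℓ → Is (inc (override i f (cg c) k) (cx c k))
      left k k< with k ≟ i
      ... | yes refl rewrite ov≡ {i} {i} {f} {cg c} refl = fi
      ... | no k≢    rewrite ov≢ {i} {k} {f} {cg c} k≢   = ckˡ c k<
      right : ∀ k → k < ℓ → Is (inc (override i f (cg c) k) (cx c (nxt k)))
      right k k< with k ≟ i
      ... | yes refl rewrite ov≡ {i} {i} {f} {cg c} refl = fi'
      ... | no k≢    rewrite ov≢ {i} {k} {f} {cg c} k≢   = ckʳ c k<

    module _ c {i f} (i<ℓ : i < ℓ) (ff : CFree c f) (fi : Is (C c f i)) (fi' : Is (C c f (nxt i))) where
      private c' = swapC c i i<ℓ ff fi fi'

      swapC-new : CFree c' (cg c i)
      swapC-new k k< h with k ≟ i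
      ... | yes refl = ff i i<ℓ (trans (sym h) (ov≡ {i} {i} {f} {cg c} refl))
      ... | no k≢    = k≢ (cginj c k< i<ℓ (trans (sym (ov≢ k≢)) h))

      swapC-old : ∀ {z} → CFree c' z → z ≢ cg c i → CFree c z
      swapC-old fz z≢ k k< h with k ≟ i
      ... | yes refl = z≢ (sym h)
      ... | no k≢    = fz k k< (trans (ov≢ k≢) h)

      swapC-nofree : ¬ CFree c' f
      swapC-nofree fz = fz i i<ℓ (ov≡ {i} {i} {f} {cg c} refl)

      swapC-Q≢ : ∀ {k} → k ≢ i → Q c' k ≡ Q c k
      swapC-Q≢ k≢ = cong (λ e → C c e ℓ) (ov≢ k≢)

      swapC-Q≡ : Q c' i ≡ C c f ℓ
      swapC-Q≡ = cong (λ e → C c e ℓ) (ov≡ {i} {i} {f} {cg c} refl)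

    opaque
      exch : ℕ → ℕ → ℕ
      exch j k with k ≟ j | k ≟ ℓ
      ... | yes _ | _     = ℓ
      ... | no _  | yes _ = j
      ... | no _  | no _  = k

      exch-j : ∀ j → exch j j ≡ ℓ
      exch-j j with j ≟ j
      ... | yes _ = refl
      ... | no n  = contradiction refl n

      exch-ℓ : ∀ {j} → j ≢ ℓ → exch j ℓ ≡ j
      exch-ℓ {j} j≢ with ℓ ≟ j | ℓ ≟ ℓ
      ... | yes p | _     = contradiction (sym p) j≢
      ... | no _  | yes _ = refl
      ... | no _  | no n  = contradiction refl n

      exch-≢ : ∀ {j k} → k ≢ j → k ≢ ℓ → exch j k ≡ k
      exch-≢ {j} {k} k≢j k≢ℓ with k ≟ j | k ≟ ℓ
      ... | yes p | _     = contradiction p k≢j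
      ... | no _  | yes p = contradiction p k≢ℓ
      ... | no _  | no _  = refl

      exch-exch : ∀ {j} k → j ≢ ℓ → exch j (exch j k) ≡ k
      exch-exch {j} k j≢ with k ≟ j | k ≟ ℓ
      ... | yes refl | _        = exch-ℓ j≢
      ... | no _     | yes refl = exch-j j
      ... | no k≢    | no k≢ℓ   = exch-≢ k≢ k≢ℓ

      exch-bd : ∀ {j k} → j ≤ ℓ → k ≤ ℓ → exch j k ≤ ℓ
      exch-bd {j} {k} j≤ k≤ with k ≟ j | k ≟ ℓ
      ... | yes _ | _     = ≤-refl
      ... | no _  | yes _ = j≤
      ... | no _  | no _  = k≤

    -- When both cycle edges at `x j` contain the missing vertex, it can take the place of `x j`.
    -- The cycle edges stay, and `x j` becomes the missing vertex.
    skip : ∀ c j → j < ℓ → Is (Q c j) → Is (Q c (prv j)) → Cyc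
    skip c j j<ℓ qj qp = record
      { cx    = λ k → cx c (exch j k)
      ; cg    = cg c
      ; cxinj = λ {a} {b} p p' h → trans (sym (exch-exch a (<⇒≢ j<ℓ))) (trans (cong (exch j) (cxinj c (exch-bd (<⇒≤ j<ℓ) p) (exch-bd (<⇒≤ j<ℓ) p') h)) (exch-exch b (<⇒≢ j<ℓ)))
      ; cginj = cginj c
      ; ckˡ   = λ {k} → left k
      ; ckʳ   = λ {k} → right k
      }
      where
      left : ∀ k → k < ℓ → Is (inc (cg c k) (cx c (exch j k)))
      left k k< with k ≟ j
      ... | yes refl rewrite exch-j j = qj
      ... | no k≢    rewrite exch-≢ k≢ (<⇒≢ k<) = ckˡ c k<
      right : ∀ k → k < ℓ → Is (inc (cg c k) (cx c (exch j (nxt k))))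
      right k k< with nxt k ≟ j
      ... | yes refl rewrite exch-j (nxt k) = subst (λ i → Is (Q c i)) (prv-nxt k<) qp
      ... | no k≢    rewrite exch-≢ k≢ (<⇒≢ (nxt-< k<)) = ckʳ c k<

    #-prv : ∀ p → # ℓ (λ k → p (prv k)) ≡ # ℓ p
    #-prv p = trans (sym (#-nxt (λ k → p (prv k)))) (#-ext ℓ (λ i i< → cong p (prv-nxt i<)))

    -- `prv` permutes the positions, so by size a set closed under `prv` is also closed under its
    -- inverse.
    closedAll : ∀ {p} → (∀ k → k < ℓ → Is (p k) → Is (p (prv k))) → ∀ {i} → i < ℓ → Is (p i) → ∀ k → k < ℓ → Is (p k)
    closedAll {p} cl i< pi k k< = up k k< (down _ i< pi)
      where
      cl' : ∀ k → k < ℓ → Is (p (prv k)) → Is (p k)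
      cl' = #-⊇ ℓ {p} {λ k → p (prv k)} cl (≤-reflexive (#-prv p))
      down : ∀ i → i < ℓ → Is (p i) → Is (p 0)
      down zero    _  h = h
      down (suc i) i< h = down i (<⇒≤ i<) (cl (suc i) i< h)
      up : ∀ k → k < ℓ → Is (p 0) → Is (p k)
      up zero    _  h = h
      up (suc k) k< h = cl' (suc k) k< (up k (<⇒≤ k<) h)

    -- Positions sorted by whether the cycle edges leaving and entering them contain the missing
    -- vertex: the runs of `Q` start in `X1` and continue in `W`, `X2` holds the positions just
    -- behind the runs, and `Z` is untouched. The number of runs is the size of `X1` and of `X2`.
    Qp X1 X2 W Z : Cyc → ℕ → Bool
    Qp c k = Q c (prv k)
    X1 c k = Q c k ∧ not (Qp c k)
    X2 c k = not (Q c k) ∧ Qp c k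
    W  c k = Q c k ∧ Qp c k
    Z  c k = not (Q c k) ∧ not (Qp c k)

    runStart : ∀ c → 1 ≤ # ℓ (Q c) → suc (# ℓ (Q c)) ≤ ℓ → 1 ≤ # ℓ (X1 c)
    runStart c h h' with is? (1 ≤ᵇ # ℓ (X1 c))
    ... | yes p = ≤ᵇ⁻ p
    ... | no n  = ⊥-elim (1+n≰n (≤-trans h' (≤-reflexive (sym (#-all ℓ all)))))
      where
      all : ∀ k → k < ℓ → Is (Q c k)
      all with #-wit ℓ h
      ... | i , i< , qi = closedAll (λ k k< qk → stable λ nq → n (≤ᵇ⁺ (#-pos ℓ k< (∧⁺ qk (not⁺ nq))))) i< qi

    sizeQ : ∀ c → # ℓ (Q c) ≡ # ℓ (W c) + # ℓ (X1 c)
    sizeQ c = #-sp ℓ (Q c) (Qp c)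

    sizeQp : ∀ c → # ℓ (Q c) ≡ # ℓ (W c) + # ℓ (X2 c)
    sizeQp c = trans (sym (#-prv (Q c))) (trans (#-sp ℓ (Qp c) (Q c))
      (cong₂ _+_ (#-ext ℓ (λ k _ → ∧-comm (Qp c k) (Q c k))) (#-ext ℓ (λ k _ → ∧-comm (Qp c k) (not (Q c k))))))

    sizeNot : ∀ c → # ℓ (λ k → not (Q c k)) ≡ # ℓ (X2 c) + # ℓ (Z c)
    sizeNot c = #-sp ℓ (λ k → not (Q c k)) (Qp c)

    -- Edges meeting the cycle edges through the missing vertex like a free edge does

    record Typ (c : Cyc) (f : Fin m) : Set where
      field
        off  : ¬ Is (C c f ℓ)
        one  : ∀ {i j} → i < ℓ → j < ℓ → Is (Q c i) → Is (Q c j) → Is (C c f i) → Is (C c f j) → i ≡ j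
        onep : ∀ {i j} → i < ℓ → j < ℓ → Is (Qp c i) → Is (Qp c j) → Is (C c f i) → Is (C c f j) → i ≡ j
    open Typ

    typ : ∀ c {f} → CFree c f → ¬ Is (C c f ℓ) → Typ c f
    typ c {f} ff no' = record { off = no' ; one = o ; onep = o' }
      where
      o : ∀ {i j} → i < ℓ → j < ℓ → Is (Q c i) → Is (Q c j) → Is (C c f i) → Is (C c f j) → i ≡ j
      o {i} {j} i< j< qi qj fi fj with i ≟ j
      ... | yes p = p
      ... | no n  = ⊥-elim (k3ˡ c i i< j j< (λ h → n (sym h)) qi qj ff fi fj)
      o' : ∀ {i j} → i < ℓ → j < ℓ → Is (Qp c i) → Is (Qp c j) → Is (C c f i) → Is (C c f j) → i ≡ j
      o' {i} {j} i< j< qi qj fi fj with i ≟ j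
      ... | yes p = p
      ... | no n  = ⊥-elim (k3ʳ c (prv i) (prv-< i<) (prv j) (prv-< j<)
              (λ h → n (trans (sym (nxt-prv i<)) (trans (cong nxt (sym h)) (nxt-prv j<)))) qi qj ff
              (subst (λ k → Is (C c f k)) (sym (nxt-prv i<)) fi) (subst (λ k → Is (C c f k)) (sym (nxt-prv j<)) fj))

    NoFree : Cyc → Set
    NoFree c = ∀ {f} → CFree c f → ¬ Is (C c f ℓ)

    off→ : ∀ {b} → ¬ Is b → b ≡ false
    off→ {true}  n = ⊥-elim (n refl)
    off→ {false} _ = refl

    sizeTyp : ∀ c {f} → Typ c f → # ℓ (C c f) ≡ suc q
    sizeTyp c {f} ty = trans (sym (cong (λ b → b2n b + # ℓ (C c f)) (off→ (off ty)))) (crow c f)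

    -- Neither the vertices nor `Q` change, so the cycle edge that becomes free satisfies the
    -- restrictions `Typ` for the original cycle as well.
    swapTyp : ∀ c → NoFree c → ∀ {i f} → i < ℓ → ¬ Is (Q c i) → CFree c f → Is (C c f i) → Is (C c f (nxt i)) →
              Σ Cyc λ c' → (cx c' ≡ cx c) × (∀ k → k < ℓ → Q c' k ≡ Q c k) × NoFree c' × CFree c' (cg c i)
    swapTyp c nf {i} {f} i< nqi ff fi fi' = c' , refl , Q≡ , nf' , swapC-new c i< ff fi fi'
      where
      c' = swapC c i i< ff fi fi'
      Q≡ : ∀ k → k < ℓ → Q c' k ≡ Q c k
      Q≡ k k< with k ≟ i
      ... | yes refl = trans (swapC-Q≡ c i< ff fi fi') (trans (off→ (nf ff)) (sym (off→ nqi)))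
      ... | no k≢    = swapC-Q≢ c i< ff fi fi' k≢
      nf' : NoFree c'
      nf' {z} fz h with z FP.≟ cg c i
      ... | yes refl = nqi h
      ... | no z≢    = nf (swapC-old c i< ff fi fi' fz z≢) h

    transTyp : ∀ c c' {f} → cx c' ≡ cx c → (∀ k → k < ℓ → Q c' k ≡ Q c k) → Typ c' f → Typ c f
    transTyp c c' refl Q≡ ty = record
      { off  = off ty
      ; one  = λ i< j< qi qj → one ty i< j< (trans (Q≡ _ i<) qi) (trans (Q≡ _ j<) qj)
      ; onep = λ i< j< qi qj → onep ty i< j< (trans (Q≡ _ (prv-< i<)) qi) (trans (Q≡ _ (prv-< j<)) qj)
      }

    someFree : ∀ c → suc q ≤ D → Σ (Fin m) (CFree c)
    someFree c q<D = let (e , p) = someUnused (cxinj c) (cg c) (con c) (λ e → con⁻ c) q<D in e , cfr⁻ c p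

    noFree-Q : ∀ c → NoFree c → D ≤ # ℓ (Q c)
    noFree-Q c nf = subst (λ z → D ≤ z + # ℓ (Q c)) (cnt-none (allFin m) (λ e _ h → nf (cfr⁻ c (∧⁻¹ h)) (∧⁻² {cfr c e} h))) (cdegAt c ℓ)

    -- A free edge contains at most one vertex of Q and of its successor set, so it
    -- nearly fills the complements of both.

    few : ∀ (p o : ℕ → Bool) → (∀ {i j} → i < ℓ → j < ℓ → Is (o i) → Is (o j) → Is (p i) → Is (p j) → i ≡ j) →
          # ℓ p ≤ 1 + # ℓ (λ k → p k ∧ not (o k))
    few p o h = ≤-trans (≤-reflexive (#-sp ℓ p o)) (+-monoˡ-≤ _
      (#-sub1 ℓ (λ i j i< j< a b → h i< j< (∧⁻² {p i} a) (∧⁻² {p j} b) (∧⁻¹ a) (∧⁻¹ b))))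

    fills : ∀ c (o : ℕ → Bool) → # ℓ (λ k → not (o k)) ≤ q → ∀ {f} → # ℓ (C c f) ≡ suc q →
            (∀ {i j} → i < ℓ → j < ℓ → Is (o i) → Is (o j) → Is (C c f i) → Is (C c f j) → i ≡ j) →
            ∀ k → k < ℓ → ¬ Is (o k) → Is (C c f k)
    fills c o le {f} sz h k k< no' = ∧⁻¹ {C c f k} (#-⊇ ℓ {λ k → C c f k ∧ not (o k)} {λ k → not (o k)} (λ i _ → ∧⁻² {C c f i})
      (≤-trans le (≤-pred (subst (_≤ 1 + # ℓ (λ k → C c f k ∧ not (o k))) sz (few (C c f) o h)))) k k< (not⁺ no'))

    -- A free edge must consist of the complement of `Q` and the run start `k₀`, so it is
    -- determined. But it contains both ends of the cycle edge at some `i` outside `Q`; after an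
    -- exchange, that cycle edge would have to be the same set.
    tight : ∀ c → NoFree c → suc q ≤ D → 1 ≤ q → # ℓ (Q c) + q ≡ ℓ → ⊥
    tight c nf q<D 1≤q eq with someFree c q<D
    ... | f , ff with #-wit ℓ {λ k → not (Q c k)} (subst (1 ≤_) (sym notQ) 1≤q)
      where
      notQ : # ℓ (λ k → not (Q c k)) ≡ q
      notQ = +-cancelˡ-≡ (# ℓ (Q c)) _ _ (trans (#-not ℓ (Q c)) (sym eq))
    ...   | i , i< , nqi = fin (swapTyp c nf i< (not⁻ nqi) ff (inQ (typ c ff (nf ff)) i i< (not⁻ nqi))
                                  (inQp (typ c ff (nf ff)) (nxt i) (nxt-< i<) (λ h → not⁻ nqi (subst (λ k → Is (Q c k)) (prv-nxt i<) h))))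
      where
      notQ : # ℓ (λ k → not (Q c k)) ≡ q
      notQ = +-cancelˡ-≡ (# ℓ (Q c)) _ _ (trans (#-not ℓ (Q c)) (sym eq))
      inQ : ∀ {f} → Typ c f → ∀ k → k < ℓ → ¬ Is (Q c k) → Is (C c f k)
      inQ ty = fills c (Q c) (≤-reflexive notQ) (sizeTyp c ty) (one ty)
      inQp : ∀ {f} → Typ c f → ∀ k → k < ℓ → ¬ Is (Qp c k) → Is (C c f k)
      inQp ty = fills c (Qp c) (≤-reflexive (trans (#-prv (λ k → not (Q c k))) notQ)) (sizeTyp c ty) (onep ty)
      Q≥1 : 1 ≤ # ℓ (Q c)
      Q≥1 = ≤-trans (≤-trans (s≤s z≤n) q<D) (noFree-Q c nf)
      wit = #-wit ℓ (runStart c Q≥1 (≤-trans (≤-trans (≤-reflexive (+-comm 1 _)) (+-monoʳ-≤ _ 1≤q)) (≤-reflexive eq)))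
      k₀ = proj₁ wit
      k₀< = proj₁ (proj₂ wit)
      k₀∈ = proj₂ (proj₂ wit)
      U : ℕ → Bool
      U k = not (Q c k) ∨ single k₀ k
      #U : suc q ≤ # ℓ U
      #U = subst (λ z → suc z ≤ # ℓ U) notQ (#-add1 ℓ (λ k _ h → ∨⁺¹ h) k₀< (∨⁺² {not (Q c k₀)} (⌊⌋⁺ refl)) (λ h → not⁻ h (∧⁻¹ k₀∈)))
      U⊂ : ∀ {f} → Typ c f → ∀ k → k < ℓ → Is (U k) → Is (C c f k)
      U⊂ {f} ty k k< h with ∨⁻ {not (Q c k)} h
      ... | inj₁ nq = inQ ty k k< (not⁻ nq)
      ... | inj₂ e  = subst (λ z → Is (C c f z)) (sym (⌊⌋⁻ e)) (inQp ty k₀ k₀< (not⁻ (∧⁻² {Q c k₀} k₀∈)))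
      ⊂U : ∀ {f} → Typ c f → ∀ k → k < ℓ → Is (C c f k) → Is (U k)
      ⊂U ty = #-⊇ ℓ (U⊂ ty) (≤-trans (≤-reflexive (sizeTyp c ty)) #U)
      fin : (Σ Cyc λ c' → (cx c' ≡ cx c) × (∀ k → k < ℓ → Q c' k ≡ Q c k) × NoFree c' × CFree c' (cg c i)) → ⊥
      fin (c' , x≡ , Q≡ , nf' , fg) = ff i i< (sym (sepX (cxinj c) (λ k k≤ → go k (m≤n⇒m<n∨m≡n k≤))))
        where
        tf = typ c ff (nf ff)
        tg = transTyp c c' x≡ Q≡ (typ c' fg (nf' fg))
        go : ∀ k → k < ℓ ⊎ k ≡ ℓ → C c f k ≡ C c (cg c i) k
        go k (inj₁ k<)  = b≡ (λ h → U⊂ tg k k< (⊂U tf k k< h)) (λ h → U⊂ tf k k< (⊂U tg k k< h))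
        go k (inj₂ refl) = trans (off→ (off tf)) (sym (off→ (off tg)))

    -- All vertices of W lie in exactly the edges indexed by Q; such an edge is too large.
    overfull : ∀ c → NoFree c → # ℓ (Q c) ≤ D → (∀ {f} → CFree c f → ∀ k → k < ℓ → Is (W c k) → ¬ Is (C c f k)) →
      (∀ i → i < ℓ → ¬ Is (Q c i) → ∀ k → k < ℓ → Is (W c k) → ¬ Is (C c (cg c i) k)) →
      1 ≤ # ℓ (X1 c) → q ≤ # ℓ (W c) → ⊥
    overfull c nf Q≤D nofree nocyc x1 w≥ with #-wit ℓ x1
    ... | k₀ , k₀< , k₀∈ = refute (q ∷ # ℓ (C c e) ∷ # ℓ (W c) ∷ [])
        (κ 1 ⊕ ν 2 ≼ ν 1 ∷ κ 1 ⊕ ν 1 ≼ κ 1 ⊕ ν 0 ∷ ν 0 ≼ ν 2 ∷ [])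
        (#-add1 ℓ W⊂ k₀< (ckˡ c k₀<) (λ h → not⁻ (∧⁻² {Q c k₀} k₀∈) (∧⁻² {Q c k₀} h)) ∷
         ≤-reflexive (trans (sym (cong (λ b → b2n b + # ℓ (C c e)) (∧⁻¹ {Q c k₀} k₀∈))) (crow c e)) ∷ w≥ ∷ []) refl
      where
      e = cg c k₀
      W⊂ : ∀ k → k < ℓ → Is (W c k) → Is (C c e k)
      W⊂ k k< wk = #-⊇ ℓ {λ i → C c (cg c i) k} {Q c}
        (λ i i< h → stable λ nq → nocyc i i< nq k k< wk h)
        (≤-trans Q≤D (subst (λ z → D ≤ z + # ℓ (λ i → C c (cg c i) k))
          (cnt-none (allFin m) (λ f _ h → nofree (cfr⁻ c (∧⁻¹ h)) k k< wk (∧⁻² {cfr c f} h))) (cdegAt c k)))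
        k₀ k₀< (∧⁻¹ k₀∈)

    -- The case r = t and n = 2 t + 2

    module Critical (ℓt : ℓ ≡ suc (suc q + suc q)) (2≤q : 2 ≤ q) (D≥ : suc (suc q) ≤ D) where

      sizes : ∀ c → # ℓ (Q c) ≡ suc (suc q) → ∀ w x → # ℓ (W c) ≡ w → w + x ≡ suc (suc q) →
              # ℓ (X1 c) ≡ x × # ℓ (X2 c) ≡ x × # ℓ (Z c) + x ≡ suc q
      sizes c hQ w x hW eq = x1 , x2 , suc-injective (+-cancelˡ-≡ (suc q) _ _ z)
        where
        x1 : # ℓ (X1 c) ≡ x
        x1 = +-cancelˡ-≡ w _ _ (trans (trans (cong (_+ # ℓ (X1 c)) (sym hW)) (trans (sym (sizeQ c)) hQ)) (sym eq))
        x2 : # ℓ (X2 c) ≡ x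
        x2 = +-cancelˡ-≡ w _ _ (trans (trans (cong (_+ # ℓ (X2 c)) (sym hW)) (trans (sym (sizeQp c)) hQ)) (sym eq))
        z : suc q + suc (# ℓ (Z c) + x) ≡ suc q + suc (suc q)
        z = trans (cong suc (trans (+-suc q _) (cong (λ y → suc (q + y)) (trans (+-comm (# ℓ (Z c)) x) (cong (_+ # ℓ (Z c)) (sym x2))))))
              (trans (cong (λ y → suc (suc q) + y) (sym (sizeNot c))) (trans (cong (_+ # ℓ (λ k → not (Q c k))) (sym hQ))
              (trans (#-not ℓ (Q c)) (trans ℓt (cong suc (sym (+-suc q (suc q))))))))

      -- Two runs of Q: each free edge is Z with one vertex of X1 and one of X2,
      -- and all four choices occur.
      twoRuns : ∀ c → NoFree c → # ℓ (Q c) ≡ suc (suc q) → # ℓ (W c) ≡ q → ⊥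
      twoRuns c nf hQ hW = overfull c nf (≤-trans (≤-reflexive hQ) D≥)
          (λ ff → noW (typ c ff (nf ff))) nocyc (subst (1 ≤_) (sym x1) (s≤s z≤n)) (≤-reflexive (sym hW))
        where
        sz = sizes c hQ q 2 hW (+-comm q 2)
        x1 = proj₁ sz
        x2 = proj₁ (proj₂ sz)
        z2 : # ℓ (Z c) + 2 ≡ suc q
        z2 = proj₂ (proj₂ sz)
        notZ : ∀ k → ¬ Is (Z c k) → Is (Q c k) ⊎ Is (Qp c k)
        notZ k n with is? (Q c k) | is? (Qp c k)
        ... | yes a | _     = inj₁ a
        ... | no _  | yes b = inj₂ b
        ... | no a  | no b  = ⊥-elim (n (∧⁺ (not⁺ a) (not⁺ b)))
        noW : ∀ {f} → Typ c f → ∀ k → k < ℓ → Is (W c k) → ¬ Is (C c f k)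
        noW {f} ty k k< wk fk = refute (# ℓ (Z c) ∷ q ∷ # ℓ (λ j → C c f j ∧ Z c j) ∷ # ℓ (λ j → C c f j ∧ not (Z c j)) ∷ [])
            (κ 1 ⊕ ν 1 ≼ ν 2 ⊕ ν 3 ∷ ν 2 ≼ ν 0 ∷ ν 3 ≼ κ 1 ∷ ν 0 ⊕ κ 2 ≼ κ 1 ⊕ ν 1 ∷ [])
            (≤-reflexive (trans (sym (sizeTyp c ty)) (#-sp ℓ (C c f) (Z c))) ∷ #-⊆ ℓ (λ j _ → ∧⁻² {C c f j}) ∷
             #-sub1 ℓ (λ i j i< j< a b → trans (isk i i< a) (sym (isk j j< b))) ∷ ≤-reflexive z2 ∷ []) refl
          where
          isk : ∀ j → j < ℓ → Is (C c f j ∧ not (Z c j)) → j ≡ k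
          isk j j< h with notZ j (not⁻ (∧⁻² {C c f j} h))
          ... | inj₁ qj = one ty j< k< qj (∧⁻¹ wk) (∧⁻¹ h) fk
          ... | inj₂ qj = onep ty j< k< qj (∧⁻² {Q c k} wk) (∧⁻¹ h) fk
        module _ {f} (ty : Typ c f) where
          fZ = # ℓ (λ j → C c f j ∧ Z c j)
          f1 = # ℓ (λ j → C c f j ∧ X1 c j)
          f2 = # ℓ (λ j → C c f j ∧ X2 c j)
          f1≤ : f1 ≤ 1
          f1≤ = #-sub1 ℓ (λ i j i< j< a b → one ty i< j< (∧⁻¹ (∧⁻² {C c f i} a)) (∧⁻¹ (∧⁻² {C c f j} b)) (∧⁻¹ a) (∧⁻¹ b))
          f2≤ : f2 ≤ 1
          f2≤ = #-sub1 ℓ (λ i j i< j< a b → onep ty i< j< (∧⁻² {not (Q c i)} (∧⁻² {C c f i} a)) (∧⁻² {not (Q c j)} (∧⁻² {C c f j} b)) (∧⁻¹ a) (∧⁻¹ b))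
          f≤ : suc q ≤ fZ + (f1 + f2)
          f≤ = ≤-trans (≤-reflexive (sym (sizeTyp c ty))) (≤-trans
            (#-cov ℓ {C c f} {λ j → C c f j ∧ Z c j} {λ j → (C c f j ∧ X1 c j) ∨ (C c f j ∧ X2 c j)} cases)
            (+-monoʳ-≤ fZ (#-cov ℓ {λ j → (C c f j ∧ X1 c j) ∨ (C c f j ∧ X2 c j)} (λ j _ h → ∨⁻ {C c f j ∧ X1 c j} h))))
            where
            cases : ∀ j → j < ℓ → Is (C c f j) → Is (C c f j ∧ Z c j) ⊎ Is ((C c f j ∧ X1 c j) ∨ (C c f j ∧ X2 c j))
            cases j j< fj with is? (Q c j) | is? (Qp c j)
            ... | yes a | yes b = ⊥-elim (noW ty j j< (∧⁺ a b) fj)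
            ... | yes a | no b  = inj₂ (∨⁺¹ (∧⁺ fj (∧⁺ a (not⁺ b))))
            ... | no a  | yes b = inj₂ (∨⁺² {C c f j ∧ X1 c j} (∧⁺ fj (∧⁺ (not⁺ a) b)))
            ... | no a  | no b  = inj₁ (∧⁺ fj (∧⁺ (not⁺ a) (not⁺ b)))
          fZ≤ : fZ ≤ # ℓ (Z c)
          fZ≤ = #-⊆ ℓ (λ j _ → ∧⁻² {C c f j})
          hasZ : ∀ k → k < ℓ → Is (Z c k) → Is (C c f k)
          hasZ k k< zk = ∧⁻¹ {C c f k} (#-⊇ ℓ {λ j → C c f j ∧ Z c j} {Z c} (λ j _ → ∧⁻² {C c f j})
            (≮⇒≥ λ lt → refute (# ℓ (Z c) ∷ q ∷ fZ ∷ f1 ∷ f2 ∷ [])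
              (κ 1 ⊕ ν 1 ≼ ν 2 ⊕ (ν 3 ⊕ ν 4) ∷ ν 3 ≼ κ 1 ∷ ν 4 ≼ κ 1 ∷ ν 0 ⊕ κ 2 ≼ κ 1 ⊕ ν 1 ∷ κ 1 ⊕ ν 2 ≼ ν 0 ∷ [])
              (f≤ ∷ f1≤ ∷ f2≤ ∷ ≤-reflexive z2 ∷ lt ∷ []) refl) k k< zk)
          hasX1 : Σ ℕ λ j → j < ℓ × Is (C c f j ∧ X1 c j)
          hasX1 = #-wit ℓ (≮⇒≥ λ lt → refute (# ℓ (Z c) ∷ q ∷ fZ ∷ f1 ∷ f2 ∷ [])
              (κ 1 ⊕ ν 1 ≼ ν 2 ⊕ (ν 3 ⊕ ν 4) ∷ ν 2 ≼ ν 0 ∷ ν 4 ≼ κ 1 ∷ ν 0 ⊕ κ 2 ≼ κ 1 ⊕ ν 1 ∷ κ 1 ⊕ ν 3 ≼ κ 1 ∷ [])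
              (f≤ ∷ fZ≤ ∷ f2≤ ∷ ≤-reflexive z2 ∷ lt ∷ []) refl)
          hasX2 : Σ ℕ λ j → j < ℓ × Is (C c f j ∧ X2 c j)
          hasX2 = #-wit ℓ (≮⇒≥ λ lt → refute (# ℓ (Z c) ∷ q ∷ fZ ∷ f1 ∷ f2 ∷ [])
              (κ 1 ⊕ ν 1 ≼ ν 2 ⊕ (ν 3 ⊕ ν 4) ∷ ν 2 ≼ ν 0 ∷ ν 3 ≼ κ 1 ∷ ν 0 ⊕ κ 2 ≼ κ 1 ⊕ ν 1 ∷ κ 1 ⊕ ν 4 ≼ κ 1 ∷ [])
              (f≤ ∷ fZ≤ ∷ f1≤ ∷ ≤-reflexive z2 ∷ lt ∷ []) refl)
        decided : ∀ {f f'} (X : ℕ → Bool) → # ℓ X ≡ 2 → (wit : ∀ {f} → Typ c f → Σ ℕ λ j → j < ℓ × Is (C c f j ∧ X j)) →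
                  (uni : ∀ {f} → Typ c f → ∀ {i j} → i < ℓ → j < ℓ → Is (X i) → Is (X j) → Is (C c f i) → Is (C c f j) → i ≡ j) →
                  Typ c f → Typ c f' → ∀ {b} → b < ℓ → Is (X b) → C c f b ≡ C c f' b → ∀ k → k < ℓ → Is (X k) → Is (C c f k) → Is (C c f' k)
        decided {f} {f'} X hX wit uni ty ty' {b} b< Xb eq k k< Xk fk with k ≟ b
        ... | yes refl = trans (sym eq) fk
        ... | no k≢b with wit ty'
        ...   | j , j< , h with j ≟ k
        ...     | yes refl = ∧⁻¹ h
        ...     | no j≢k with j ≟ b
        ...       | yes refl = ⊥-elim (k≢b (uni ty k< b< Xk Xb fk (trans eq (∧⁻¹ h))))
        ...       | no j≢b   = ⊥-elim (1+n≰n (≤-trans (#-three ℓ b< k< j< (λ e → k≢b (sym e)) (λ e → j≢b (sym e)) (λ e → j≢k (sym e)) Xb Xk (∧⁻² {C c f' j} h)) (≤-reflexive hX)))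
        uni1 : ∀ {f} → Typ c f → ∀ {i j} → i < ℓ → j < ℓ → Is (X1 c i) → Is (X1 c j) → Is (C c f i) → Is (C c f j) → i ≡ j
        uni1 ty i< j< a b = one ty i< j< (∧⁻¹ a) (∧⁻¹ b)
        uni2 : ∀ {f} → Typ c f → ∀ {i j} → i < ℓ → j < ℓ → Is (X2 c i) → Is (X2 c j) → Is (C c f i) → Is (C c f j) → i ≡ j
        uni2 ty {i} {j} i< j< a b = onep ty i< j< (∧⁻² {not (Q c i)} a) (∧⁻² {not (Q c j)} b)
        sub : ∀ {f f'} → Typ c f → Typ c f' → ∀ {α β} → α < ℓ → β < ℓ → Is (X2 c α) → Is (X1 c β) →
              C c f α ≡ C c f' α → C c f β ≡ C c f' β → ∀ k → k < ℓ → Is (C c f k) → Is (C c f' k)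
        sub {f} {f'} ty ty' α< β< Xα Xβ eα eβ k k< fk with is? (Q c k) | is? (Qp c k)
        ... | yes a | yes b = ⊥-elim (noW ty k k< (∧⁺ a b) fk)
        ... | yes a | no b  = decided (X1 c) x1 hasX1 uni1 ty ty' β< Xβ eβ k k< (∧⁺ a (not⁺ b)) fk
        ... | no a  | yes b = decided (X2 c) x2 hasX2 uni2 ty ty' α< Xα eα k k< (∧⁺ (not⁺ a) b) fk
        ... | no a  | no b  = hasZ ty' k k< (∧⁺ (not⁺ a) (not⁺ b))
        both : ∀ {α β} → α < ℓ → β < ℓ → Is (X2 c α) → Is (X1 c β) → Σ (Fin m) λ f → CFree c f × Is (C c f α) × Is (C c f β)
        both {α} {β} α< β< Xα Xβ with is? (1 ≤ᵇ cnt (allFin m) (λ f → cfr c f ∧ (C c f α ∧ C c f β)))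
        ... | yes h = let (f , _ , p) = cnt-wit (allFin m) (≤ᵇ⁻ h) in
                      f , cfr⁻ c (∧⁻¹ p) , ∧⁻¹ (∧⁻² {cfr c f} p) , ∧⁻² {C c f α} (∧⁻² {cfr c f} p)
        ... | no n  = ⊥-elim (refute (cnt (allFin m) (cfr c) ∷ cnt (allFin m) P₁ ∷ cnt (allFin m) P₂ ∷ cnt (allFin m) P₃ ∷ cnt (allFin m) P₂₃ ∷ [])
            (κ 4 ≼ ν 0 ∷ ν 0 ≼ ν 1 ⊕ ν 4 ∷ ν 4 ≼ ν 2 ⊕ ν 3 ∷ ν 1 ≼ κ 1 ∷ ν 2 ≼ κ 1 ∷ ν 3 ≼ κ 1 ∷ [])
            (fourUnused (cxinj c) (cg c) (con c) (λ e → con⁻ c) ℓt D≥ ∷ cnt-cov (allFin m) (λ f _ → cases f) ∷ cnt-cov (allFin m) {P₂₃} (λ f _ h → ∨⁻ {P₂ f} h) ∷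
             sub1 P₁ true false (λ f h → ∧⁻¹ h , ∧⁻¹ (∧⁻² {cfr c f} h) , not→ (∧⁻² {C c f α} (∧⁻² {cfr c f} h))) ∷
             sub1 P₂ false true (λ f h → ∧⁻¹ h , not→ (∧⁻¹ (∧⁻² {cfr c f} h)) , ∧⁻² {not (C c f α)} (∧⁻² {cfr c f} h)) ∷
             sub1 P₃ false false (λ f h → ∧⁻¹ h , not→ (∧⁻¹ (∧⁻² {cfr c f} h)) , not→ (∧⁻² {not (C c f α)} (∧⁻² {cfr c f} h))) ∷ []) refl)
          where
          P₁ P₂ P₃ P₂₃ : Fin m → Bool
          P₁ f = cfr c f ∧ (C c f α ∧ not (C c f β))
          P₂ f = cfr c f ∧ (not (C c f α) ∧ C c f β)
          P₃ f = cfr c f ∧ (not (C c f α) ∧ not (C c f β))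
          P₂₃ f = P₂ f ∨ P₃ f
          not→ : ∀ {b} → Is (not b) → b ≡ false
          not→ h = off→ (not⁻ h)
          none : ∀ f → Is (cfr c f) → ¬ Is (C c f α ∧ C c f β)
          none f ff h = n (≤ᵇ⁺ (cnt-pos (allFin m) (∈-allFin f) (∧⁺ ff h)))
          cases : ∀ f → Is (cfr c f) → Is (P₁ f) ⊎ Is (P₂₃ f)
          cases f ff with none f ff
          ... | nn with C c f α | C c f β
          ...   | true  | true  = ⊥-elim (nn refl)
          ...   | true  | false = inj₁ (∧⁺ ff refl)
          ...   | false | true  = inj₂ (∨⁺¹ (∧⁺ ff refl))
          ...   | false | false = inj₂ (∨⁺² {cfr c f ∧ false} (∧⁺ ff refl))
          sub1 : ∀ (P : Fin m → Bool) a b → (∀ f → Is (P f) → Is (cfr c f) × C c f α ≡ a × C c f β ≡ b) → cnt (allFin m) P ≤ 1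
          sub1 P a b h = cnt-sub1 (allFin m) (allFin⁺ m) (λ f f' _ _ p p' →
            let (r , rα , rβ) = h f p ; (r' , rα' , rβ') = h f' p'
                ty = typ c (cfr⁻ c r) (nf (cfr⁻ c r)) ; ty' = typ c (cfr⁻ c r') (nf (cfr⁻ c r'))
                eα = trans rα (sym rα') ; eβ = trans rβ (sym rβ') in
            sepX (cxinj c) (λ k k≤ → same ty ty' eα eβ k (m≤n⇒m<n∨m≡n k≤)))
            where
            same : ∀ {f f'} → Typ c f → Typ c f' → C c f α ≡ C c f' α → C c f β ≡ C c f' β → ∀ k → k < ℓ ⊎ k ≡ ℓ → C c f k ≡ C c f' k
            same ty ty' eα eβ k (inj₁ k<)   = b≡ (sub ty ty' α< β< Xα Xβ eα eβ k k<) (sub ty' ty α< β< Xα Xβ (sym eα) (sym eβ) k k<)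
            same ty ty' eα eβ k (inj₂ refl) = trans (off→ (off ty)) (sym (off→ (off ty')))
        pick : ∀ (X : ℕ → Bool) → # ℓ X ≡ 2 → Σ ℕ λ j → j < ℓ × Is (X j)
        pick X h = #-wit ℓ (subst (1 ≤_) (sym h) (s≤s z≤n))
        nocyc : ∀ i → i < ℓ → ¬ Is (Q c i) → ∀ k → k < ℓ → Is (W c k) → ¬ Is (C c (cg c i) k)
        nocyc i i< nqi with swapTyp c nf i< nqi (proj₁ (proj₂ ex)) (proj₁ (proj₂ (proj₂ ex))) (proj₂ (proj₂ (proj₂ ex)))
          where
          nqp : ¬ Is (Qp c (nxt i))
          nqp h = nqi (subst (λ k → Is (Q c k)) (prv-nxt i<) h)
          ex : Σ (Fin m) λ f → CFree c f × Is (C c f i) × Is (C c f (nxt i))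
          ex with is? (Qp c i) | is? (Q c (nxt i))
          ... | yes a | yes b = both i< (nxt-< i<) (∧⁺ (not⁺ nqi) a) (∧⁺ b (not⁺ nqp))
          ... | yes a | no b  = let (β , β< , Xβ) = pick (X1 c) x1 ; (f , ff , p , _) = both i< β< (∧⁺ (not⁺ nqi) a) Xβ in
                                f , ff , p , hasZ (typ c ff (nf ff)) _ (nxt-< i<) (∧⁺ (not⁺ b) (not⁺ nqp))
          ... | no a  | yes b = let (α , α< , Xα) = pick (X2 c) x2 ; (f , ff , _ , p) = both α< (nxt-< i<) Xα (∧⁺ b (not⁺ nqp)) in
                                f , ff , hasZ (typ c ff (nf ff)) _ i< (∧⁺ (not⁺ nqi) (not⁺ a)) , p
          ... | no a  | no b  = let (β , β< , Xβ) = pick (X1 c) x1 ; (α , α< , Xα) = pick (X2 c) x2 ; (f , ff , _) = both α< β< Xα Xβ in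
                                f , ff , hasZ (typ c ff (nf ff)) _ i< (∧⁺ (not⁺ nqi) (not⁺ a)) , hasZ (typ c ff (nf ff)) _ (nxt-< i<) (∧⁺ (not⁺ b) (not⁺ nqp))
        ... | c' , x≡ , Q≡ , nf' , fg = noW (transTyp c c' x≡ Q≡ (typ c' fg (nf' fg)))

      -- The degree bounds `Q` from below and `tight` bounds it from above. A free edge has at most
      -- two vertices outside `Z`, so `Z` has at least `q ∸ 1` of the `q + 1` positions outside `Q`;
      -- hence there are one or two runs.
      classify : ∀ c → NoFree c → # ℓ (Q c) ≡ suc (suc q) × (# ℓ (W c) ≡ q ⊎ # ℓ (W c) ≡ suc q)
      classify c nf with someFree c (≤-trans (n≤1+n _) D≥)
      ... | f , ff = hQ , hW
        where
        ty = typ c ff (nf ff)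
        nQ = # ℓ (Q c)
        nN = # ℓ (λ k → not (Q c k))
        tot : nQ + nN ≡ suc (suc q + suc q)
        tot = trans (#-not ℓ (Q c)) ℓt
        q≤ : suc q ≤ 1 + nN
        q≤ = ≤-trans (≤-reflexive (sym (sizeTyp c ty))) (≤-trans (few (C c f) (Q c) (one ty)) (+-monoʳ-≤ 1 (#-⊆ ℓ (λ k _ → ∧⁻² {C c f k}))))
        hQ : nQ ≡ suc (suc q)
        hQ with m≤n⇒m<n∨m≡n (≤-pred q≤)
        ... | inj₂ eq = ⊥-elim (tight c nf (≤-trans (n≤1+n _) D≥) (≤-trans (s≤s z≤n) 2≤q) (trans (cong (nQ +_) eq) (#-not ℓ (Q c))))
        ... | inj₁ lt = ≤-antisym (≮⇒≥ λ h → refute (nQ ∷ nN ∷ q ∷ [])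
                (ν 0 ⊕ ν 1 ≼ κ 1 ⊕ ((κ 1 ⊕ ν 2) ⊕ (κ 1 ⊕ ν 2)) ∷ κ 1 ⊕ ν 2 ≼ ν 1 ∷ κ 3 ⊕ ν 2 ≼ ν 0 ∷ []) (≤-reflexive tot ∷ lt ∷ h ∷ []) refl)
                (≤-trans D≥ (noFree-Q c nf))
        x1≥ : 1 ≤ # ℓ (X1 c)
        x1≥ = runStart c (subst (1 ≤_) (sym hQ) (s≤s z≤n)) (≮⇒≥ λ h → refute (nQ ∷ q ∷ ℓ ∷ [])
                (κ 1 ⊕ ν 2 ≼ κ 1 ⊕ ν 0 ∷ ν 0 ≼ κ 2 ⊕ ν 1 ∷ κ 1 ⊕ ((κ 1 ⊕ ν 1) ⊕ (κ 1 ⊕ ν 1)) ≼ ν 2 ∷ κ 2 ≼ ν 1 ∷ [])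
                (h ∷ ≤-reflexive hQ ∷ ≤-reflexive (sym ℓt) ∷ 2≤q ∷ []) refl)
        f≤ : suc q ≤ # ℓ (Z c) + 2
        f≤ = ≤-trans (≤-reflexive (sym (sizeTyp c ty))) (≤-trans (few (C c f) (Q c) (one ty))
          (≤-trans (+-monoʳ-≤ 1 (few (λ k → C c f k ∧ not (Q c k)) (Qp c) (λ i< j< a b p p' → onep ty i< j< a b (∧⁻¹ p) (∧⁻¹ p'))))
          (≤-trans (+-monoʳ-≤ 2 (#-⊆ ℓ {q = Z c} (λ k _ h → ∧⁺ (∧⁻² {C c f k} (∧⁻¹ h)) (∧⁻² {C c f k ∧ not (Q c k)} h)))) (≤-reflexive (+-comm 2 _)))))
        w≥ : q ≤ # ℓ (W c)
        w≥ = ≮⇒≥ {# ℓ (W c)} {q} λ h → refute (# ℓ (W c) ∷ # ℓ (X2 c) ∷ # ℓ (Z c) ∷ nQ ∷ nN ∷ q ∷ [])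
                (κ 1 ⊕ ν 0 ≼ ν 5 ∷ ν 3 ≼ ν 0 ⊕ ν 1 ∷ ν 1 ⊕ ν 2 ≼ ν 4 ∷ ν 3 ⊕ ν 4 ≼ κ 1 ⊕ ((κ 1 ⊕ ν 5) ⊕ (κ 1 ⊕ ν 5)) ∷ κ 2 ⊕ ν 5 ≼ ν 3 ∷ κ 1 ⊕ ν 5 ≼ ν 2 ⊕ κ 2 ∷ [])
                (h ∷ ≤-reflexive (sizeQp c) ∷ ≤-reflexive (sym (sizeNot c)) ∷ ≤-reflexive tot ∷ ≤-reflexive (sym hQ) ∷ f≤ ∷ []) refl
        hW : # ℓ (W c) ≡ q ⊎ # ℓ (W c) ≡ suc q
        hW with m≤n⇒m<n∨m≡n w≥
        ... | inj₂ eq = inj₁ (sym eq)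
        ... | inj₁ lt = inj₂ (≤-antisym (≮⇒≥ λ h → refute (# ℓ (W c) ∷ # ℓ (X1 c) ∷ nQ ∷ q ∷ [])
                (κ 2 ⊕ ν 3 ≼ ν 0 ∷ ν 0 ⊕ ν 1 ≼ ν 2 ∷ ν 2 ≼ κ 2 ⊕ ν 3 ∷ κ 1 ≼ ν 1 ∷ [])
                (h ∷ ≤-reflexive (sym (sizeQ c)) ∷ ≤-reflexive hQ ∷ x1≥ ∷ []) refl) lt)

      -- One run of Q and a free edge through a vertex x j of W: with x j as the
      -- missing vertex, that edge can be put on the cycle far from the run.
      oneRunW : ∀ c → NoFree c → # ℓ (Q c) ≡ suc (suc q) → # ℓ (W c) ≡ suc q →
                ∀ {f j} → CFree c f → j < ℓ → Is (W c j) → Is (C c f j) → ⊥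
      oneRunW c nf hQ hW {f} {j} ff j< wj fj =
        fin (proj₁ wit) (proj₁ (proj₂ wit)) (∧⁻¹ (proj₂ (proj₂ wit))) (∧⁻² {Z c (proj₁ wit)} (proj₂ (proj₂ wit)))
        where
        sz = sizes c hQ (suc q) 1 hW (cong suc (+-comm q 1))
        x1 = proj₁ sz
        z1 : # ℓ (Z c) ≡ q
        z1 = suc-injective (trans (+-comm 1 _) (proj₂ (proj₂ sz)))
        only : ∀ {f} → CFree c f → Is (C c f j) → ∀ k → k < ℓ → Is (C c f k) → Is (Z c k ∨ single j k)
        only {f} ff fj k k< fk with is? (Q c k) | is? (Qp c k)
        ... | no a  | no b  = ∨⁺¹ (∧⁺ (not⁺ a) (not⁺ b))
        ... | yes a | _     = ∨⁺² {Z c k} (⌊⌋⁺ (one (typ c ff (nf ff)) k< j< a (∧⁻¹ wj) fk fj))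
        ... | no _  | yes b = ∨⁺² {Z c k} (⌊⌋⁺ (onep (typ c ff (nf ff)) k< j< b (∧⁻² {Q c j} wj) fk fj))
        all : ∀ {f} → CFree c f → Is (C c f j) → ∀ k → k < ℓ → Is (Z c k ∨ single j k) → Is (C c f k)
        all {f} ff fj = #-⊇ ℓ (only ff fj) (≤-trans (#-cov ℓ (λ k _ h → ∨⁻ {Z c k} h))
          (≤-trans (+-mono-≤ (≤-reflexive z1) (#-single ℓ j)) (≤-reflexive (trans (+-comm q 1) (sym (sizeTyp c (typ c ff (nf ff))))))))
        uniq : ∀ {f'} → CFree c f' → Is (C c f' j) → f' ≡ f
        uniq {f'} ff' fj' = sepX (cxinj c) (λ k k≤ → go k (m≤n⇒m<n∨m≡n k≤))
          where
          go : ∀ k → k < ℓ ⊎ k ≡ ℓ → C c f' k ≡ C c f k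
          go k (inj₁ k<)   = b≡ (λ h → all ff fj k k< (only ff' fj' k k< h)) (λ h → all ff' fj' k k< (only ff fj k k< h))
          go k (inj₂ refl) = trans (off→ (nf ff')) (sym (off→ (nf ff)))
        ZZ : ℕ → Bool
        ZZ k = Z c k ∧ Z c (nxt k)
        wit : Σ ℕ λ k → k < ℓ × Is (ZZ k)
        wit = #-wit ℓ {ZZ} (≮⇒≥ λ lt → refute (# ℓ ZZ ∷ # ℓ (λ k → X1 c (nxt k)) ∷ # ℓ (Z c) ∷ q ∷ [])
          (κ 1 ⊕ ν 0 ≼ κ 1 ∷ ν 2 ≼ ν 0 ⊕ ν 1 ∷ ν 1 ≼ κ 1 ∷ ν 3 ≼ ν 2 ∷ κ 2 ≼ ν 3 ∷ [])
          (lt ∷ #-cov ℓ {Z c} {ZZ} {λ k → X1 c (nxt k)} cov ∷ ≤-reflexive (trans (#-nxt (X1 c)) x1) ∷ ≤-reflexive (sym z1) ∷ 2≤q ∷ []) refl)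
          where
          cov : ∀ k → k < ℓ → Is (Z c k) → Is (ZZ k) ⊎ Is (X1 c (nxt k))
          cov k k< zk with is? (Q c (nxt k)) | subst (λ i → ¬ Is (Q c i)) (sym (prv-nxt k<)) (not⁻ {Q c k} (∧⁻¹ zk))
          ... | yes a | n = inj₂ (∧⁺ a (not⁺ n))
          ... | no a  | n = inj₁ (∧⁺ zk (∧⁺ (not⁺ a) (not⁺ n)))
        module _ (i₀ : ℕ) (i₀< : i₀ < ℓ) (Zi : Is (Z c i₀)) (Zn : Is (Z c (nxt i₀))) where
          c₁ = skip c j j< (∧⁻¹ wj) (∧⁻² {Q c j} wj)
          j≢ : j ≢ ℓ
          j≢ = <⇒≢ j<
          to : ∀ {e k} → k < ℓ → k ≢ j → Is (C c e k) → Is (C c₁ e k)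
          to {e} k< k≢ = subst (λ z → Is (C c e z)) (sym (exch-≢ k≢ (<⇒≢ k<)))
          toℓ : ∀ {e} → Is (C c e j) → Is (C c₁ e ℓ)
          toℓ {e} = subst (λ z → Is (C c e z)) (sym (exch-ℓ j≢))
          fromℓ : ∀ {e} → Is (C c₁ e ℓ) → Is (C c e j)
          fromℓ {e} = subst (λ z → Is (C c e z)) (exch-ℓ j≢)
          z≢j : ∀ {k} → Is (Z c k) → k ≢ j
          z≢j zk refl = not⁻ (∧⁻¹ zk) (∧⁻¹ {Q c j} wj)
          fi : Is (C c₁ f i₀)
          fi = to i₀< (z≢j Zi) (all ff fj i₀ i₀< (∨⁺¹ Zi))
          fn : Is (C c₁ f (nxt i₀))
          fn = to (nxt-< i₀<) (z≢j Zn) (all ff fj (nxt i₀) (nxt-< i₀<) (∨⁺¹ Zn))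
          nQi : ¬ Is (Q c₁ i₀)
          nQi h = k1ˡ c₁ i₀ i₀< h ff (toℓ fj) fi
          nQn : ¬ Is (Q c₁ (nxt i₀))
          nQn h = k1ˡ c₁ (nxt i₀) (nxt-< i₀<) h ff (toℓ fj) fn
          nQp : ¬ Is (Q c₁ (prv i₀))
          nQp h = k1ʳ c₁ (prv i₀) (prv-< i₀<) h ff (toℓ fj) (subst (λ k → Is (C c₁ f k)) (sym (nxt-prv i₀<)) fi)
          c₂ = swapC c₁ i₀ i₀< ff fi fn
          nf₂ : NoFree c₂
          nf₂ {z} fz h with z FP.≟ cg c i₀
          ... | yes refl = nQi h
          ... | no z≢ with swapC-old c₁ i₀< ff fi fn fz z≢
          ...   | fz₁ = swapC-nofree c₁ i₀< ff fi fn (subst (CFree c₂) (uniq fz₁ (fromℓ h)) fz)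
          Q₂i : Is (Q c₂ i₀)
          Q₂i = trans (swapC-Q≡ c₁ i₀< ff fi fn) (toℓ fj)
          Q₂≢ : ∀ {k} → k ≢ i₀ → Is (Q c₂ k) → Is (Q c₁ k)
          Q₂≢ k≢ = trans (sym (swapC-Q≢ c₁ i₀< ff fi fn k≢))
          nQp₂ : ¬ Is (Q c₂ (prv i₀))
          nQp₂ h with prv i₀ ≟ i₀
          ... | no n  = nQp (Q₂≢ n h)
          ... | yes e = nQn (subst (λ k → Is (Q c₁ k)) e' (⊥-elim (z≢j' e)))
            where
            e' : i₀ ≡ nxt i₀
            e' = trans (sym (nxt-prv i₀<)) (cong nxt e)
            z≢j' : prv i₀ ≡ i₀ → ⊥
            z≢j' e = 1+n≰n (≤-trans (s≤s (subst (1 ≤_) (sym hQ) (s≤s z≤n))) (≤-trans (s≤s (≤-reflexive (#-none ℓ noQ))) z≤n'))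
              where
              fix : ∀ k → k < ℓ → Is (single i₀ k) → Is (single i₀ (prv k))
              fix k k< h = ⌊⌋⁺ (trans (cong prv (⌊⌋⁻ h)) e)
              noQ : ∀ k → k < ℓ → ¬ Is (Q c k)
              noQ k k< qk = not⁻ {Q c i₀} (∧⁻¹ Zi) (subst (λ z → Is (Q c z)) (⌊⌋⁻ (closedAll fix i₀< (⌊⌋⁺ refl) k k<)) qk)
              z≤n' : 1 ≤ 1
              z≤n' = ≤-refl
          nQn₂ : ¬ Is (Q c₂ (nxt i₀))
          nQn₂ h with nxt i₀ ≟ i₀
          ... | no n  = nQn (Q₂≢ n h)
          ... | yes e = nQp₂ (subst (λ k → Is (Q c₂ k)) (trans e (trans (sym (prv-nxt i₀<)) (cong prv e))) h)
          -- By itself `i₀` is a run of `Q c₂`. As `Q c₂` has further elements, a single run is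
          -- impossible.
          fin : ⊥
          fin with classify c₂ nf₂
          ... | hQ₂ , inj₁ w = twoRuns c₂ nf₂ hQ₂ w
          ... | hQ₂ , inj₂ w = go (#-wit ℓ {p} (≮⇒≥ λ lt → refute (# ℓ p ∷ # ℓ (Q c₂) ∷ # ℓ (single i₀) ∷ q ∷ [])
                  (κ 1 ⊕ ν 0 ≼ κ 1 ∷ ν 1 ≼ ν 0 ⊕ ν 2 ∷ ν 2 ≼ κ 1 ∷ κ 2 ⊕ ν 3 ≼ ν 1 ∷ [])
                  (lt ∷ #-cov ℓ {Q c₂} {p} {single i₀} cov ∷ #-single ℓ i₀ ∷ ≤-reflexive (sym hQ₂) ∷ []) refl))
            where
            x1₂ : # ℓ (X1 c₂) ≡ 1
            x1₂ = proj₁ (sizes c₂ hQ₂ (suc q) 1 w (cong suc (+-comm q 1)))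
            p : ℕ → Bool
            p k = Q c₂ k ∧ not (single i₀ k)
            cov : ∀ k → k < ℓ → Is (Q c₂ k) → Is (p k) ⊎ Is (single i₀ k)
            cov k _ h with is? (single i₀ k)
            ... | yes s = inj₂ s
            ... | no s  = inj₁ (∧⁺ h (not⁺ s))
            cl : ∀ k → k < ℓ → Is (p k) → Is (p (prv k))
            cl k k< pk = ∧⁺ {Q c₂ (prv k)} pq (not⁺ (λ s → nQn₂ (subst (λ z → Is (Q c₂ z)) (trans (sym (nxt-prv k<)) (cong nxt (⌊⌋⁻ {d = prv k ≟ i₀} s))) qk)))
              where
              qk : Is (Q c₂ k)
              qk = ∧⁻¹ {Q c₂ k} pk
              k≢ : i₀ ≢ k
              k≢ e = not⁻ {single i₀ k} (∧⁻² {Q c₂ k} pk) (⌊⌋⁺ (sym e))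
              pq : Is (Q c₂ (prv k))
              pq = stable λ n → 1+n≰n (≤-trans (#-two ℓ {X1 c₂} i₀< k< k≢ (∧⁺ {Q c₂ i₀} Q₂i (not⁺ nQp₂)) (∧⁺ {Q c₂ k} qk (not⁺ n))) (≤-reflexive x1₂))
            go : (Σ ℕ λ i → i < ℓ × Is (p i)) → ⊥
            go (i , i< , pi) = not⁻ {single i₀ i₀} (∧⁻² {Q c₂ i₀} (closedAll {p} cl i< pi i₀ i₀<)) (⌊⌋⁺ refl)

    module Critical' (ℓt : ℓ ≡ suc (suc q + suc q)) (2≤q : 2 ≤ q) (D≥ : suc (suc q) ≤ D) where
      open Critical ℓt 2≤q D≥

      -- No free edge meets `W`, so each one misses exactly one of the other `q + 2` positions, and
      -- different edges miss different positions. Among four free edges, some edge contains any two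
      -- given positions, so every cycle edge outside `Q` can be exchanged and then avoids `W` too.
      oneRun : ∀ c → NoFree c → # ℓ (Q c) ≡ suc (suc q) → # ℓ (W c) ≡ suc q → ⊥
      oneRun c nf hQ hW = overfull c nf (≤-trans (≤-reflexive hQ) D≥)
          (λ ff k k< wk fk → oneRunW c nf hQ hW ff k< wk fk) nocyc (subst (1 ≤_) (sym x1) (s≤s z≤n)) (≤-trans (n≤1+n _) (≤-reflexive (sym hW)))
        where
        x1 : # ℓ (X1 c) ≡ 1
        x1 = proj₁ (sizes c hQ (suc q) 1 hW (cong suc (+-comm q 1)))
        arc : ℕ → Bool
        arc k = not (W c k)
        inArc : ∀ {f} → CFree c f → ∀ k → k < ℓ → Is (C c f k) → Is (arc k)
        inArc ff k k< fk = not⁺ (λ wk → oneRunW c nf hQ hW ff k< wk fk)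
        missing : ∀ {a} → a < ℓ → Is (arc a) → cnt (allFin m) (λ f → cfr c f ∧ not (C c f a)) ≤ 1
        missing {a} a< arca = cnt-sub1 (allFin m) (allFin⁺ m) (λ f f' _ _ p p' → sepX (cxinj c) (λ k k≤ → same f f' p p' k (m≤n⇒m<n∨m≡n k≤)))
          where
          U : ℕ → Bool
          U k = arc k ∧ not (single a k)
          #U : # ℓ U ≤ suc q
          #U = ≮⇒≥ λ lt → refute (# ℓ U ∷ # ℓ arc ∷ # ℓ (W c) ∷ q ∷ [])
            (κ 2 ⊕ ν 3 ≼ ν 0 ∷ κ 1 ⊕ ν 0 ≼ ν 1 ∷ ν 2 ⊕ ν 1 ≼ κ 1 ⊕ ((κ 1 ⊕ ν 3) ⊕ (κ 1 ⊕ ν 3)) ∷ κ 1 ⊕ ν 3 ≼ ν 2 ∷ [])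
            (lt ∷ #-add1 ℓ {U} {arc} (λ k _ h → ∧⁻¹ h) a< arca (λ h → not⁻ (∧⁻² {arc a} h) (⌊⌋⁺ refl)) ∷
             ≤-reflexive (trans (#-not ℓ (W c)) ℓt) ∷ ≤-reflexive (sym hW) ∷ []) refl
          sub : ∀ f → Is (cfr c f ∧ not (C c f a)) → ∀ k → k < ℓ → Is (C c f k) → Is (U k)
          sub f p k k< fk = ∧⁺ (inArc (cfr⁻ c (∧⁻¹ p)) k k< fk) (not⁺ (λ s → not⁻ (∧⁻² {cfr c f} p) (subst (λ z → Is (C c f z)) (⌊⌋⁻ s) fk)))
          sup : ∀ f → Is (cfr c f ∧ not (C c f a)) → ∀ k → k < ℓ → Is (U k) → Is (C c f k)
          sup f p = #-⊇ ℓ (sub f p) (≤-trans #U (≤-reflexive (sym (sizeTyp c (typ c (cfr⁻ c (∧⁻¹ p)) (nf (cfr⁻ c (∧⁻¹ p))))))))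
          same : ∀ f f' → Is (cfr c f ∧ not (C c f a)) → Is (cfr c f' ∧ not (C c f' a)) → ∀ k → k < ℓ ⊎ k ≡ ℓ → C c f k ≡ C c f' k
          same f f' p p' k (inj₁ k<)   = b≡ (λ h → sup f' p' k k< (sub f p k k< h)) (λ h → sup f p k k< (sub f' p' k k< h))
          same f f' p p' k (inj₂ refl) = trans (off→ (nf (cfr⁻ c (∧⁻¹ p)))) (sym (off→ (nf (cfr⁻ c (∧⁻¹ p')))))
        both : ∀ {a b} → a < ℓ → b < ℓ → Is (arc a) → Is (arc b) → Σ (Fin m) λ f → CFree c f × Is (C c f a) × Is (C c f b)
        both {a} {b} a< b< ara arb = get (cnt-wit (allFin m) {P} (≮⇒≥ λ lt → refute (cnt (allFin m) (cfr c) ∷ cnt (allFin m) P ∷ cnt (allFin m) P' ∷ cnt (allFin m) Pa ∷ cnt (allFin m) Pb ∷ [])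
            (κ 4 ≼ ν 0 ∷ ν 0 ≼ ν 1 ⊕ ν 2 ∷ ν 2 ≼ ν 3 ⊕ ν 4 ∷ ν 3 ≼ κ 1 ∷ ν 4 ≼ κ 1 ∷ κ 1 ⊕ ν 1 ≼ κ 1 ∷ [])
            (fourUnused (cxinj c) (cg c) (con c) (λ e → con⁻ c) ℓt D≥ ∷ cnt-cov (allFin m) (λ f _ → cases f) ∷ cnt-cov (allFin m) {P'} (λ f _ h → ∨⁻ {Pa f} h) ∷ missing a< ara ∷ missing b< arb ∷ lt ∷ []) refl))
          where
          P Pa Pb P' : Fin m → Bool
          P f  = cfr c f ∧ (C c f a ∧ C c f b)
          Pa f = cfr c f ∧ not (C c f a)
          Pb f = cfr c f ∧ not (C c f b)
          P' f = Pa f ∨ Pb f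
          cases : ∀ f → Is (cfr c f) → Is (P f) ⊎ Is (P' f)
          cases f ff with is? (C c f a) | is? (C c f b)
          ... | yes p | yes p' = inj₁ (∧⁺ ff (∧⁺ p p'))
          ... | no p  | _      = inj₂ (∨⁺¹ (∧⁺ ff (not⁺ p)))
          ... | yes _ | no p'  = inj₂ (∨⁺² {Pa f} (∧⁺ ff (not⁺ p')))
          get : (Σ (Fin m) λ f → _ × Is (P f)) → Σ (Fin m) λ f → CFree c f × Is (C c f a) × Is (C c f b)
          get (f , _ , p) = f , cfr⁻ c (∧⁻¹ p) , ∧⁻¹ (∧⁻² {cfr c f} p) , ∧⁻² {C c f a} (∧⁻² {cfr c f} p)
        nocyc : ∀ i → i < ℓ → ¬ Is (Q c i) → ∀ k → k < ℓ → Is (W c k) → ¬ Is (C c (cg c i) k)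
        nocyc i i< nqi k k< wk gk = go (both i< (nxt-< i<) (not⁺ (λ h → nqi (∧⁻¹ h))) (not⁺ (λ h → nqi (subst (λ z → Is (Q c z)) (prv-nxt i<) (∧⁻² {Q c (nxt i)} h)))))
          where
          go' : (Σ Cyc λ c' → (cx c' ≡ cx c) × (∀ k → k < ℓ → Q c' k ≡ Q c k) × NoFree c' × CFree c' (cg c i)) → ⊥
          go' (c' , x≡ , Q≡ , nf' , fg) = oneRunW c' nf' (trans (#-ext ℓ Q≡) hQ)
                (trans (#-ext ℓ (λ j j< → cong₂ _∧_ (Q≡ j j<) (Q≡ (prv j) (prv-< j<)))) hW) fg k<
                (trans (cong₂ _∧_ (Q≡ k k<) (Q≡ (prv k) (prv-< k<))) wk)
                (subst (λ X → Is (inc (cg c i) (X k))) (sym x≡) gk)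
          go : (Σ (Fin m) λ f → CFree c f × Is (C c f i) × Is (C c f (nxt i))) → ⊥
          go (f , ff , fi , fi') = go' (swapTyp c nf i< nqi ff fi fi')

      critical : ∀ c → NoFree c → ⊥
      critical c nf with classify c nf
      ... | hQ , inj₁ w = twoRuns c nf hQ w
      ... | hQ , inj₂ w = oneRun c nf hQ w

    -- The missing vertex lies on at least `D` cycle edges, while a free edge needs `q` positions
    -- outside `Q`. The value of `D` gives `D + q ≥ ℓ`, so only equality is left, and that is
    -- `tight`. The exception is `q + 1 = t` for even `n`, where `D + q = ℓ ∸ 1`.
    noFree⊥ : ∀ {t} → Kind ℓ q D t → ∀ c → NoFree c → ⊥
    noFree⊥ {t} kd c nf with someFree c (q<D kd)
      where
      q<D : ∀ {t} → Kind ℓ q D t → suc q ≤ D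
      q<D {t} (odd  _ 2≤q q<t D≡)  = subst (suc q ≤_) (sym D≡) (s≤s (≤-trans (<⇒≤ q<t) (bin-≥n (≤-trans (s≤s z≤n) 2≤q) q<t)))
      q<D {t} (even _ 2≤q q<t D≡)  = subst (suc q ≤_) (sym D≡) (s≤s (≤-trans (<⇒≤ q<t) (bin-≥n (≤-trans (s≤s z≤n) 2≤q) q<t)))
      q<D {t} (half _ _ q≡ D≡)     = ≤-reflexive (trans (cong suc q≡) (sym D≡))
    ... | f , ff = go kd
      where
      ty = typ c ff (nf ff)
      nQ = # ℓ (Q c)
      nN = # ℓ (λ k → not (Q c k))
      q≤nN : q ≤ nN
      q≤nN = ≤-pred (≤-trans (≤-reflexive (sym (sizeTyp c ty))) (≤-trans (few (C c f) (Q c) (one ty)) (+-monoʳ-≤ 1 (#-⊆ ℓ (λ k _ → ∧⁻² {C c f k})))))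
      tot : nQ + nN ≡ ℓ
      tot = #-not ℓ (Q c)
      D≤Q = noFree-Q c nf
      close : 1 ≤ q → suc q ≤ D → ¬ (suc (D + q) ≤ ℓ) → ⊥
      close 1≤q q<D lt with m≤n⇒m<n∨m≡n q≤nN
      ... | inj₂ eq = tight c nf q<D 1≤q (trans (cong (nQ +_) eq) tot)
      ... | inj₁ l  = lt (≮⇒≥ λ h → refute (D ∷ q ∷ ℓ ∷ nQ ∷ nN ∷ [])
              (κ 1 ⊕ ν 2 ≼ κ 1 ⊕ (ν 0 ⊕ ν 1) ∷ ν 3 ⊕ ν 4 ≼ ν 2 ∷ ν 0 ≼ ν 3 ∷ κ 1 ⊕ ν 1 ≼ ν 4 ∷ [])
              (h ∷ ≤-reflexive tot ∷ D≤Q ∷ l ∷ []) refl)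
      binBig : ∀ {t} → 2 ≤ q → suc q < t → t + t ≤ bin t q + 2
      binBig {suc t} 2≤q (s≤s lt) = ≮⇒≥ λ h → refute (t ∷ bin (suc t) q ∷ [])
        (κ 1 ⊕ (ν 1 ⊕ κ 2) ≼ (κ 1 ⊕ ν 0) ⊕ (κ 1 ⊕ ν 0) ∷ 2 ⊗ ν 0 ≼ ν 1 ∷ []) (h ∷ bin-≥2n 2≤q (s≤s lt) ∷ []) refl
      go : ∀ {t} → Kind ℓ q D t → ⊥
      go {t} (odd ℓt 2≤q q<t D≡) = close (≤-trans (s≤s z≤n) 2≤q) (subst (suc q ≤_) (sym D≡) (s≤s (≤-trans (<⇒≤ q<t) b≥))) bad
        where
        b≥ = bin-≥n (≤-trans (s≤s z≤n) 2≤q) q<t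
        bad : ¬ (suc (D + q) ≤ ℓ)
        bad h with m≤n⇒m<n∨m≡n q<t
        ... | inj₁ lt   = refute (D ∷ q ∷ ℓ ∷ t ∷ bin t q ∷ []) (κ 1 ⊕ (ν 0 ⊕ ν 1) ≼ ν 2 ∷ ν 2 ≼ ν 3 ⊕ ν 3 ∷ κ 1 ⊕ ν 4 ≼ ν 0 ∷ ν 3 ⊕ ν 3 ≼ ν 4 ⊕ κ 2 ∷ κ 2 ≼ ν 1 ∷ [])
                            (h ∷ ≤-reflexive ℓt ∷ ≤-reflexive (sym D≡) ∷ binBig 2≤q lt ∷ 2≤q ∷ []) refl
        ... | inj₂ refl = refute (D ∷ q ∷ ℓ ∷ bin t q ∷ []) (κ 1 ⊕ (ν 0 ⊕ ν 1) ≼ ν 2 ∷ ν 2 ≼ (κ 1 ⊕ ν 1) ⊕ (κ 1 ⊕ ν 1) ∷ κ 1 ⊕ ν 3 ≼ ν 0 ∷ κ 1 ⊕ ν 1 ≼ ν 3 ∷ [])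
                            (h ∷ ≤-reflexive ℓt ∷ ≤-reflexive (sym D≡) ∷ b≥ ∷ []) refl
      go {t} (even ℓt 2≤q q<t D≡) with m≤n⇒m<n∨m≡n q<t
      ... | inj₂ refl = Critical'.critical ℓt 2≤q (subst (suc (suc q) ≤_) (sym D≡) (s≤s (bin-≥n (≤-trans (s≤s z≤n) 2≤q) q<t))) c nf
      ... | inj₁ lt   = close (≤-trans (s≤s z≤n) 2≤q) (subst (suc q ≤_) (sym D≡) (s≤s (≤-trans (<⇒≤ q<t) (bin-≥n (≤-trans (s≤s z≤n) 2≤q) q<t))))
          (λ h → refute (D ∷ q ∷ ℓ ∷ t ∷ bin t q ∷ []) (κ 1 ⊕ (ν 0 ⊕ ν 1) ≼ ν 2 ∷ ν 2 ≼ κ 1 ⊕ (ν 3 ⊕ ν 3) ∷ κ 1 ⊕ ν 4 ≼ ν 0 ∷ ν 3 ⊕ ν 3 ≼ ν 4 ⊕ κ 2 ∷ κ 2 ≼ ν 1 ∷ [])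
                            (h ∷ ≤-reflexive ℓt ∷ ≤-reflexive (sym D≡) ∷ binBig 2≤q lt ∷ 2≤q ∷ []) refl)
      go {t} (half ℓt 2≤t refl D≡) = close (≤-trans (s≤s z≤n) 2≤t) (≤-reflexive (sym D≡))
          (λ h → refute (D ∷ q ∷ ℓ ∷ []) (κ 1 ⊕ (ν 0 ⊕ ν 1) ≼ ν 2 ∷ ν 2 ≼ κ 1 ⊕ (ν 1 ⊕ ν 1) ∷ κ 1 ⊕ ν 1 ≼ ν 0 ∷ [])
                            (h ∷ ≤-reflexive ℓt ∷ ≤-reflexive (sym D≡) ∷ []) refl)

    -- Free neighbours of the missing vertex

    NonCons : Cyc → Set
    NonCons c = ∀ i → i < ℓ → Is (N c i) → Is (N c (nxt i)) → ⊥

    Q-N : ∀ c {i} → i < ℓ → Is (Q c i) → ¬ Is (N c i)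
    Q-N c i< qi h = let (f , ff , fℓ , fi) = N⁻ c h in k1ˡ c _ i< qi ff fℓ fi

    Q-Nn : ∀ c {i} → i < ℓ → Is (Q c i) → ¬ Is (N c (nxt i))
    Q-Nn c i< qi h = let (f , ff , fℓ , fi) = N⁻ c h in k1ʳ c _ i< qi ff fℓ fi

    -- `N`, the predecessors of `N`, and `Q` are pairwise disjoint.
    count-N : ∀ c → NonCons c → # ℓ (N c) + (# ℓ (N c) + # ℓ (Q c)) ≤ ℓ
    count-N c nc = ≤-trans (+-monoʳ-≤ (# ℓ (N c)) (≤-trans (≤-reflexive (cong (_+ # ℓ (Q c)) (sym (#-nxt (N c)))))
        (#-disj ℓ {λ k → N c (nxt k)} {Q c} {λ k → N c (nxt k) ∨ Q c k} (λ k _ → ∨⁺¹) (λ k _ → ∨⁺² {N c (nxt k)}) (λ k k< a b → Q-Nn c k< b a))))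
      (≤-trans (#-disj ℓ {N c} {λ k → N c (nxt k) ∨ Q c k} {λ _ → true} (λ _ _ _ → refl) (λ _ _ _ → refl)
         (λ k k< a b → no2 k k< a (∨⁻ {N c (nxt k)} b))) (≤-reflexive (#-all ℓ (λ _ _ → refl))))
      where
      no2 : ∀ k → k < ℓ → Is (N c k) → Is (N c (nxt k)) ⊎ Is (Q c k) → ⊥
      no2 k k< a (inj₁ b) = nc k k< a b
      no2 k k< a (inj₂ b) = Q-N c k< b a

    shift-free⁻ : ∀ c {z} → CFree (shift c) z → CFree c z
    shift-free⁻ c fz k k< h = fz (prv k) (prv-< k<) (trans (cong (cg c) (nxt-prv k<)) h)

    shiftN⁻ : ∀ c {k} → k < ℓ → Is (N (shift c) k) → Is (N c (nxt k))
    shiftN⁻ c {k} k< h = let (f , ff , fℓ , fk) = N⁻ (shift c) h in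
      N⁺ c (shift-free⁻ c ff) (subst (λ j → Is (C c f j)) shfℓ fℓ) (subst (λ j → Is (C c f j)) (shf< k<) fk)

    shiftN⁺ : ∀ c {k} → k < ℓ → Is (N c (nxt k)) → Is (N (shift c) k)
    shiftN⁺ c k< h = let (f , ff , fℓ , fk) = N⁻ c h in N⁺ (shift c) (shift-free c ff) (C-shfℓ c fℓ) (C-shf c k< fk)

    module EvenCyc (t : ℕ) (ℓt : ℓ ≡ suc (t + t)) (2≤q : 2 ≤ q) (q<t : q < t) (D≡ : D ≡ suc (bin t q)) where

      -- Cut at an edge of `Q`: neither of its ends is in `N`, so `oddPattern` turns the count into
      -- the shape refuted by `alternating`.
      altCyc : ∀ c i → i < ℓ → Is (Q c i) → NonCons c → t ≤ # ℓ (N c) → ⊥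
      altCyc = cycInd (λ c i → Is (Q c i) → NonCons c → t ≤ # ℓ (N c) → ⊥) base
        (λ c i i< h qi nc le → h (C-shfℓ c qi)
          (λ k k< a b → nc (nxt k) (nxt-< k<) (shiftN⁻ c k< a) (shiftN⁻ c (nxt-< k<) b))
          (≤-trans le (≤-trans (≤-reflexive (sym (#-nxt (N c)))) (#-⊆ ℓ (λ k k< → shiftN⁺ c k<)))))
        where
        base : ∀ c → Is (Q c last) → NonCons c → t ≤ # ℓ (N c) → ⊥
        base c ql nc le = Alternating.alternating t ℓt 2≤q q<t D≡ p (λ k k< → trans (b≡ (to k k<) (from k k<)) (pat k (≤-pred (subst (k <_) ℓt k<))))
          where
          l≡ : last ≡ t + t
          l≡ = suc-injective (trans (sym ℓ≡) ℓt)
          p = toPath c (ckˡ c last<ℓ) ql (inj₁ refl)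
          y≡ : ∀ k → y p k ≡ cg c k
          y≡ k with k ≟ last
          ... | yes refl = ov≡ {last} {last} {cg c last} {cg c} refl
          ... | no k≢    = ov≢ k≢
          to : ∀ k → k < ℓ → Is (Nb p k) → Is (N c k)
          to k k< h = let (e , f , eℓ , ek) = Nb⁻ p h in N⁺ c (λ i i< h → f i i< (trans (y≡ i) h)) eℓ ek
          from : ∀ k → k < ℓ → Is (N c k) → Is (Nb p k)
          from k k< h = let (e , f , eℓ , ek) = N⁻ c h in Nb⁺ p (λ i i< h → f i i< (trans (sym (y≡ i)) h)) eℓ ek
          pat : ∀ k → k ≤ t + t → N c k ≡ not (ev k)
          pat = oddPattern t
            (λ i i< a b → nc i (subst (i <_) (sym ℓt) (m≤n⇒m≤1+n i<)) a
               (subst (λ z → Is (N c z)) (sym (nxt-suc (λ e → <⇒≢ i< (trans e l≡)))) b))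
            (λ h → Q-Nn c last<ℓ ql (subst (λ z → Is (N c z)) (sym nxt-last) h))
            (λ h → Q-N c last<ℓ ql (subst (λ z → Is (N c z)) (sym l≡) h))
            (subst (λ z → t ≤ # z (N c)) ℓt le)

    -- The exceptional case n = 8, r = 3

    module Exceptional (ℓ7 : ℓ ≡ 7) (q2 : q ≡ 2) (D4 : D ≡ 4) where

      private
        D≡' : D ≡ suc (bin 3 q)
        D≡' = trans D4 (cong (λ z → suc (bin 3 z)) (sym q2))
        2≤q : 2 ≤ q
        2≤q = ≤-reflexive (sym q2)
        q<3 : q < 3
        q<3 = s≤s (≤-reflexive q2)
        last6 : last ≡ 6
        last6 = suc-injective (trans (sym ℓ≡) ℓ7)
        nxt-≢ : ∀ {k} → k < ℓ → nxt k ≢ k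
        nxt-≢ {k} k< h with k ≟ last
        ... | yes refl = contradiction (trans (sym last6) (trans (sym h) nxt-last)) λ ()
        ... | no k≢    = 1+n≢n (trans (sym (nxt-suc k≢)) h)
        nxt²-≢ : ∀ {k} → k < ℓ → nxt (nxt k) ≢ k
        nxt²-≢ {k} k< h with k ≟ last
        ... | yes refl = contradiction (trans (sym last6) (trans (sym h) (trans (cong nxt nxt-last) (nxt-suc (λ e → contradiction (trans e last6) λ ()))))) λ ()
        ... | no k≢ with suc k ≟ last
        ...   | yes e = contradiction (trans (cong suc (trans (sym (trans (cong nxt (trans (nxt-suc k≢) e)) nxt-last)) h)) (trans e last6)) λ ()
        ...   | no n  = m≢1+n+m k (sym (trans (sym (trans (cong nxt (nxt-suc k≢)) (nxt-suc n))) h))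

      module _ (c : Cyc) (nc : NonCons c) (hN : # ℓ (N c) ≡ 2) (hQ : # ℓ (Q c) ≡ 3)
               (bigger : ∀ c' → 4 ≤ # ℓ (Q c') → ⊥) where

        private
          tot : # ℓ (Q c) + # ℓ (λ k → not (Q c k)) ≡ 7
          tot = trans (#-not ℓ (Q c)) ℓ7

          N⊂Z : ∀ k → k < ℓ → Is (N c k) → Is (Z c k)
          N⊂Z k k< h = ∧⁺ (not⁺ (λ qk → Q-N c k< qk h))
            (not⁺ (λ qk → Q-Nn c (prv-< k<) qk (subst (λ z → Is (N c z)) (sym (nxt-prv k<)) h)))

          Z≥2 : 2 ≤ # ℓ (Z c)
          Z≥2 = ≤-trans (≤-reflexive (sym hN)) (#-⊆ ℓ N⊂Z)

          X1≥1 : 1 ≤ # ℓ (X1 c)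
          X1≥1 = runStart c (subst (1 ≤_) (sym hQ) (s≤s z≤n)) (subst₂ (λ a b → suc a ≤ b) (sym hQ) (sym ℓ7) (s≤s (s≤s (s≤s (s≤s z≤n)))))

          Z-nxt : ∀ {k} → k < ℓ → Is (Z c k) → Is (Z c (nxt k)) ⊎ Is (X1 c (nxt k))
          Z-nxt {k} k< zk with is? (Q c (nxt k))
          ... | yes a = inj₂ (∧⁺ a (not⁺ nqp))
            where
            nqp : ¬ Is (Qp c (nxt k))
            nqp h = not⁻ {Q c k} (∧⁻¹ zk) (subst (λ i → Is (Q c i)) (prv-nxt k<) h)
          ... | no a  = inj₁ (∧⁺ (not⁺ a) (not⁺ (λ h → not⁻ {Q c k} (∧⁻¹ zk) (subst (λ i → Is (Q c i)) (prv-nxt k<) h))))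

        module _ {j} (j< : j < ℓ) (wj : Is (W c j)) where

          private
            c₁ = skip c j j< (∧⁻¹ wj) (∧⁻² {Q c j} wj)
            j≢ : j ≢ ℓ
            j≢ = <⇒≢ j<
            fromℓ : ∀ {e} → Is (C c₁ e ℓ) → Is (C c e j)
            fromℓ {e} = subst (λ z → Is (C c e z)) (exch-ℓ j≢)
            from : ∀ {e k} → k < ℓ → k ≢ j → Is (C c₁ e k) → Is (C c e k)
            from {e} k< k≢ = subst (λ z → Is (C c e z)) (exch-≢ k≢ (<⇒≢ k<))
            fromj : ∀ {e} → Is (C c₁ e j) → Is (C c e ℓ)
            fromj {e} = subst (λ z → Is (C c e z)) (exch-j j)
            offℓ : ∀ {e} → CFree c e → Is (C c e j) → ¬ Is (C c e ℓ)
            offℓ fe ej eℓ = k1ˡ c j j< (∧⁻¹ wj) fe eℓ ej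
            inZ : ∀ {e} → CFree c e → Is (C c₁ e ℓ) → ∀ k → k < ℓ → Is (C c₁ e k) → Is (Z c k)
            inZ {e} fe eℓ k k< ek with k ≟ j
            ... | yes refl = ⊥-elim (offℓ fe (fromℓ eℓ) (fromj ek))
            ... | no k≢    = ∧⁺ (not⁺ (λ a → k≢ (one ty k< j< a (∧⁻¹ wj) (from k< k≢ ek) (fromℓ eℓ))))
                                (not⁺ (λ a → k≢ (onep ty k< j< a (∧⁻² {Q c j} wj) (from k< k≢ ek) (fromℓ eℓ))))
              where ty = typ c fe (offℓ fe (fromℓ eℓ))
            N₁⊂Z : ∀ k → k < ℓ → Is (N c₁ k) → Is (Z c k)
            N₁⊂Z k k< h = let (e , fe , eℓ , ek) = N⁻ c₁ h in inZ fe eℓ k k< ek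
            Q₁≤3 : # ℓ (Q c₁) ≤ 3
            Q₁≤3 = ≮⇒≥ (λ lt → bigger c₁ lt)
            size₁ : ∀ {e} → Is (C c₁ e ℓ) → # ℓ (C c₁ e) ≡ 2
            size₁ {e} eℓ = trans (suc-injective (trans (sym (cong (λ b → b2n b + # ℓ (C c₁ e)) eℓ)) (crow c₁ e))) q2
            -- Two free edges through x j give four neighbours in Z, or consecutive ones.
            clash : ∀ {i f f'} → i < ℓ → CFree c f → CFree c f' → f ≢ f' → Is (C c₁ f ℓ) → Is (C c₁ f' ℓ) →
                    Is (C c₁ f i) → Is (C c₁ f (nxt i)) → ⊥
            clash {i} {f} {f'} i< ff ff' f≢ fℓ fℓ' fi fi' = other (#-wit ℓ {o} o≥1)
              where
              n< = nxt-< i<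
              o : ℕ → Bool
              o k = C c₁ f' k ∧ not (C c₁ f k)
              o≥1 : 1 ≤ # ℓ o
              o≥1 = ≮⇒≥ λ lt → f≢ (sepX (cxinj c₁) (λ k k≤ → same lt k (m≤n⇒m<n∨m≡n k≤)))
                where
                sub : # ℓ o < 1 → ∀ k → k < ℓ → Is (C c₁ f' k) → Is (C c₁ f k)
                sub lt k k< h = stable (λ n → 1+n≰n (≤-trans (s≤s (#-pos ℓ {o} k< (∧⁺ h (not⁺ n)))) lt))
                same : # ℓ o < 1 → ∀ k → k < ℓ ⊎ k ≡ ℓ → C c₁ f k ≡ C c₁ f' k
                same lt k (inj₁ k<)   = b≡ (#-⊇ ℓ (sub lt) (≤-reflexive (trans (size₁ fℓ) (sym (size₁ fℓ')))) k k<) (sub lt k k<)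
                same lt k (inj₂ refl) = trans fℓ (sym fℓ')
              other : (Σ ℕ λ k → k < ℓ × Is (o k)) → ⊥
              other (k , k< , ok) = go (Z-nxt n< Zn) (Z-nxt k< Zk)
                where
                fk' : Is (C c₁ f' k)
                fk' = ∧⁻¹ ok
                k≢i : k ≢ i
                k≢i refl = not⁻ (∧⁻² {C c₁ f' k} ok) fi
                k≢n : k ≢ nxt i
                k≢n refl = not⁻ (∧⁻² {C c₁ f' k} ok) fi'
                Zi = inZ ff fℓ i i< fi
                Zn = inZ ff fℓ (nxt i) n< fi'
                Zk = inZ ff' fℓ' k k< fk'
                X1≤1 : # ℓ (X1 c) ≤ 1
                X1≤1 = ≮⇒≥ λ lt → refute (# ℓ (X1 c) ∷ # ℓ (X2 c) ∷ # ℓ (W c) ∷ # ℓ (Z c) ∷ # ℓ (Q c) ∷ # ℓ (λ k → not (Q c k)) ∷ [])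
                  (κ 2 ≼ ν 0 ∷ ν 2 ⊕ ν 0 ≼ ν 4 ∷ ν 4 ≼ ν 2 ⊕ ν 1 ∷ ν 1 ⊕ ν 3 ≼ ν 5 ∷ ν 4 ⊕ ν 5 ≼ κ 7 ∷ κ 3 ≼ ν 4 ∷ κ 3 ≼ ν 3 ∷ [])
                  (lt ∷ ≤-reflexive (sym (sizeQ c)) ∷ ≤-reflexive (sizeQp c) ∷ ≤-reflexive (sym (sizeNot c)) ∷ ≤-reflexive tot ∷ ≤-reflexive (sym hQ) ∷
                   #-three ℓ {Z c} k< i< n< k≢i k≢n (λ e → nxt-≢ i< (sym e)) Zk Zi Zn ∷ []) refl
                Z≤3 : # ℓ (Z c) ≤ 3
                Z≤3 = ≮⇒≥ λ lt → refute (# ℓ (X1 c) ∷ # ℓ (X2 c) ∷ # ℓ (W c) ∷ # ℓ (Z c) ∷ # ℓ (Q c) ∷ # ℓ (λ k → not (Q c k)) ∷ [])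
                  (κ 4 ≼ ν 3 ∷ ν 2 ⊕ ν 0 ≼ ν 4 ∷ ν 4 ≼ ν 2 ⊕ ν 1 ∷ ν 1 ⊕ ν 3 ≼ ν 5 ∷ ν 4 ⊕ ν 5 ≼ κ 7 ∷ κ 3 ≼ ν 4 ∷ κ 1 ≼ ν 0 ∷ [])
                  (lt ∷ ≤-reflexive (sym (sizeQ c)) ∷ ≤-reflexive (sizeQp c) ∷ ≤-reflexive (sym (sizeNot c)) ∷ ≤-reflexive tot ∷ ≤-reflexive (sym hQ) ∷ X1≥1 ∷ []) refl
                three : ∀ {z} → z < ℓ → Is (Z c z) → z ≢ i → z ≢ nxt i → z ≡ k
                three {z} z< Zz z≢i z≢n with z ≟ k
                ... | yes e  = e
                ... | no z≢k = ⊥-elim (1+n≰n (≤-trans (s≤s (#-three ℓ {Z'} k< i< n< k≢i k≢n (λ e → nxt-≢ i< (sym e))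
                        (∧⁺ Zk (not⁺ (λ s → z≢k (sym (⌊⌋⁻ s))))) (∧⁺ Zi (not⁺ (λ s → z≢i (sym (⌊⌋⁻ s))))) (∧⁺ Zn (not⁺ (λ s → z≢n (sym (⌊⌋⁻ s)))))))
                      (≤-trans (#-add1 ℓ {Z'} {Z c} (λ a _ h → ∧⁻¹ h) z< Zz (λ h → not⁻ {single z z} (∧⁻² {Z c z} h) (⌊⌋⁺ refl))) Z≤3)))
                  where
                  Z' : ℕ → Bool
                  Z' a = Z c a ∧ not (single z a)
                go : Is (Z c (nxt (nxt i))) ⊎ Is (X1 c (nxt (nxt i))) → Is (Z c (nxt k)) ⊎ Is (X1 c (nxt k)) → ⊥
                go (inj₁ a) _ = k2 c₁ (nxt i) n< ff ff' f≢ fℓ fℓ' fi' (subst (λ z → Is (C c₁ f' z)) (sym (three (nxt-< n<) a (nxt²-≢ i<) (nxt-≢ n<))) fk')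
                go (inj₂ a) (inj₁ b) with nxt k ≟ i
                ... | yes e = k2 c₁ k k< ff' ff (λ e' → f≢ (sym e')) fℓ' fℓ fk' (subst (λ z → Is (C c₁ f z)) (sym e) fi)
                ... | no n  = nxt-≢ k< (three (nxt-< k<) b n (λ e → k≢i (nxt-inj k< i< e)))
                go (inj₂ a) (inj₂ b) = 1+n≰n (≤-trans (#-two ℓ {X1 c} (nxt-< n<) (nxt-< k<) (λ e → k≢n (sym (nxt-inj n< k< e))) a b) X1≤1)
            -- Two different edges are excluded by `k2`. If one edge reaches both positions, putting
            -- it on the cycle enlarges `Q`; hence `Q c₁` has at most two elements, and the degree
            -- of `x j` supplies a second free edge for `clash`.
            nc₁ : NonCons c₁
            nc₁ i i< a b = go (N⁻ c₁ a) (N⁻ c₁ b)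
              where
              go : (Σ (Fin m) λ e → CFree c₁ e × Is (C c₁ e ℓ) × Is (C c₁ e i)) → (Σ (Fin m) λ e → CFree c₁ e × Is (C c₁ e ℓ) × Is (C c₁ e (nxt i))) → ⊥
              go (f , ff , fℓ , fi) (f' , ff' , fℓ' , fi') with f FP.≟ f'
              ... | no f≢    = k2 c₁ i i< ff ff' f≢ fℓ fℓ' fi fi'
              ... | yes refl = again (cnt-wit (allFin m) {P} P≥1)
                where
                c₂ = swapC c₁ i i< ff fi fi'
                nqi : ¬ Is (Q c₁ i)
                nqi h = k1ˡ c₁ i i< h ff fℓ fi
                Q₂ : suc (# ℓ (Q c₁)) ≤ # ℓ (Q c₂)
                Q₂ = #-add1 ℓ {Q c₁} {Q c₂} (λ k _ h → trans (swapC-Q≢ c₁ i< ff fi fi' (λ { refl → nqi h })) h) i< (trans (swapC-Q≡ c₁ i< ff fi fi') fℓ) nqi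
                P : Fin m → Bool
                P e = (cfr c₁ e ∧ C c₁ e ℓ) ∧ not ⌊ e FP.≟ f ⌋
                cov : ∀ e → Is (cfr c₁ e ∧ C c₁ e ℓ) → Is (P e) ⊎ Is ⌊ e FP.≟ f ⌋
                cov e h with e FP.≟ f
                ... | yes _ = inj₂ refl
                ... | no _  = inj₁ (∧⁺ h refl)
                P≥1 : 1 ≤ cnt (allFin m) P
                P≥1 = ≮⇒≥ λ lt → refute (D ∷ cfdeg c₁ ℓ ∷ # ℓ (Q c₁) ∷ # ℓ (Q c₂) ∷ cnt (allFin m) P ∷ cnt (allFin m) (λ e → ⌊ e FP.≟ f ⌋) ∷ [])
                  (κ 4 ≼ ν 0 ∷ ν 0 ≼ ν 1 ⊕ ν 2 ∷ κ 1 ⊕ ν 2 ≼ ν 3 ∷ ν 3 ≼ κ 3 ∷ ν 1 ≼ ν 4 ⊕ ν 5 ∷ ν 5 ≼ κ 1 ∷ κ 1 ⊕ ν 4 ≼ κ 1 ∷ [])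
                  (≤-reflexive (sym D4) ∷ cdegAt c₁ ℓ ∷ Q₂ ∷ ≮⇒≥ (λ l → bigger c₂ l) ∷ cnt-cov (allFin m) (λ e _ → cov e) ∷
                   cnt-sub1 (allFin m) (allFin⁺ m) (λ e e' _ _ h h' → trans (⌊⌋⁻ h) (sym (⌊⌋⁻ h'))) ∷ lt ∷ []) refl
                again : (Σ (Fin m) λ e → _ × Is (P e)) → ⊥
                again (e , _ , pe) = clash i< ff (cfr⁻ c₁ (∧⁻¹ (∧⁻¹ pe)))
                  (λ h → not⁻ {⌊ e FP.≟ f ⌋} (∧⁻² {cfr c₁ e ∧ C c₁ e ℓ} pe) (⌊⌋⁺ (sym h))) fℓ (∧⁻² {cfr c₁ e} (∧⁻¹ pe)) fi fi'
            free₁ : 1 ≤ cfdeg c₁ ℓ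
            free₁ = ≮⇒≥ λ lt → refute (D ∷ cfdeg c₁ ℓ ∷ # ℓ (Q c₁) ∷ [])
              (κ 4 ≼ ν 0 ∷ ν 0 ≼ ν 1 ⊕ ν 2 ∷ ν 2 ≼ κ 3 ∷ κ 1 ⊕ ν 1 ≼ κ 1 ∷ []) (≤-reflexive (sym D4) ∷ cdegAt c₁ ℓ ∷ Q₁≤3 ∷ lt ∷ []) refl
            N₁≥2 : 2 ≤ # ℓ (N c₁)
            N₁≥2 = ≮⇒≥ λ lt → 1+n≰n (≤-trans (≤-trans free₁ (cfdeg-bound c₁)) (≤-reflexive (bin-zero (≤-trans lt 2≤q))))
            cN = count-N c₁ nc₁
            N₁≤2 : # ℓ (N c₁) ≤ 2
            N₁≤2 = ≮⇒≥ λ lt → three lt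
              where
              three : 2 < # ℓ (N c₁) → ⊥
              three lt = go (#-wit ℓ {Q c₁} (≮⇒≥ λ l → refute (D ∷ cfdeg c₁ ℓ ∷ # ℓ (Q c₁) ∷ [])
                  (κ 4 ≼ ν 0 ∷ ν 0 ≼ ν 1 ⊕ ν 2 ∷ ν 1 ≼ κ 3 ∷ κ 1 ⊕ ν 2 ≼ κ 1 ∷ [])
                  (≤-reflexive (sym D4) ∷ cdegAt c₁ ℓ ∷ ≤-trans (cfdeg-bound c₁) (≤-trans (bin-mono q N≤3) (≤-reflexive (cong (bin 3) q2))) ∷ l ∷ []) refl))
                where
                N≤3 : # ℓ (N c₁) ≤ 3
                N≤3 = ≮⇒≥ λ l → refute (# ℓ (N c₁) ∷ # ℓ (Q c₁) ∷ ℓ ∷ []) (κ 4 ≼ ν 0 ∷ ν 0 ⊕ (ν 0 ⊕ ν 1) ≼ ν 2 ∷ ν 2 ≼ κ 7 ∷ []) (l ∷ cN ∷ ≤-reflexive ℓ7 ∷ []) refl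
                go : (Σ ℕ λ i → i < ℓ × Is (Q c₁ i)) → ⊥
                go (i , i< , qi) = EvenCyc.altCyc 3 ℓ7 2≤q q<3 D≡' c₁ i i< qi nc₁ lt
            Q₁≥3 : 3 ≤ # ℓ (Q c₁)
            Q₁≥3 = ≮⇒≥ λ lt → refute (D ∷ cfdeg c₁ ℓ ∷ # ℓ (Q c₁) ∷ []) (κ 4 ≼ ν 0 ∷ ν 0 ≼ ν 1 ⊕ ν 2 ∷ ν 1 ≼ κ 1 ∷ κ 1 ⊕ ν 2 ≼ κ 3 ∷ [])
              (≤-reflexive (sym D4) ∷ cdegAt c₁ ℓ ∷ ≤-trans (cfdeg-bound c₁) (≤-trans (bin-mono q N₁≤2) (≤-reflexive (cong (bin 2) q2))) ∷ lt ∷ []) refl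

          -- In the cycle that misses `x j`, the two free neighbours, their predecessors and the
          -- three elements of `Q c₁` fill all seven positions. A position of `Q c` is of neither of
          -- the first two kinds, because `N c₁` lies in `Z c`.
          exc-mem : ∀ k → k < ℓ → Is (Q c k) → Is (C c (cg c k) j)
          exc-mem k k< qk = fromℓ (stable λ n → refute (# ℓ (N c₁) ∷ # ℓ (λ i → N c₁ (nxt i)) ∷ # ℓ (Q c₁) ∷ # ℓ O₁ ∷ # ℓ O₂ ∷ ℓ ∷ [])
              (κ 2 ≼ ν 0 ∷ ν 0 ≼ ν 1 ∷ κ 3 ≼ ν 2 ∷ ν 1 ⊕ ν 2 ≼ ν 3 ∷ ν 0 ⊕ ν 3 ≼ ν 4 ∷ κ 1 ⊕ ν 4 ≼ ν 5 ∷ ν 5 ≼ κ 7 ∷ [])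
              (N₁≥2 ∷ ≤-reflexive (sym (#-nxt (N c₁))) ∷ Q₁≥3 ∷
               #-disj ℓ {λ i → N c₁ (nxt i)} {Q c₁} {O₁} (λ i _ → ∨⁺¹) (λ i _ → ∨⁺² {N c₁ (nxt i)}) (λ i i< a b → Q-Nn c₁ i< b a) ∷
               #-disj ℓ {N c₁} {O₁} {O₂} (λ i _ → ∨⁺¹) (λ i _ → ∨⁺² {N c₁ i}) (λ i i< a b → no2 i i< a (∨⁻ {N c₁ (nxt i)} b)) ∷
               ≤-trans (#-add1 ℓ {O₂} {λ _ → true} (λ _ _ _ → refl) k< refl (λ h → no3 n (∨⁻ {N c₁ k} h))) (≤-reflexive (#-all ℓ (λ _ _ → refl))) ∷ ≤-reflexive ℓ7 ∷ []) refl)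
            where
            O₁ O₂ : ℕ → Bool
            O₁ i = N c₁ (nxt i) ∨ Q c₁ i
            O₂ i = N c₁ i ∨ O₁ i
            no2 : ∀ i → i < ℓ → Is (N c₁ i) → Is (N c₁ (nxt i)) ⊎ Is (Q c₁ i) → ⊥
            no2 i i< a (inj₁ b) = nc₁ i i< a b
            no2 i i< a (inj₂ b) = Q-N c₁ i< b a
            no4 : Is (N c₁ (nxt k)) → ⊥
            no4 h = not⁻ {Qp c (nxt k)} (∧⁻² {not (Q c (nxt k))} (N₁⊂Z (nxt k) (nxt-< k<) h)) (subst (λ z → Is (Q c z)) (sym (prv-nxt k<)) qk)
            no5 : ¬ Is (Q c₁ k) → Is (N c₁ (nxt k)) ⊎ Is (Q c₁ k) → ⊥
            no5 n (inj₁ h) = no4 h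
            no5 n (inj₂ h) = n h
            no3 : ¬ Is (Q c₁ k) → Is (N c₁ k) ⊎ Is (O₁ k) → ⊥
            no3 n (inj₁ h) = not⁻ {Q c k} (∧⁻¹ (N₁⊂Z k k< h)) qk
            no3 n (inj₂ h) = no5 n (∨⁻ {N c₁ (nxt k)} h)

        private
          rowg : ∀ {k} → k < ℓ → Is (Q c k) → # ℓ (C c (cg c k)) ≡ 2
          rowg {k} k< qk = trans (suc-injective (trans (sym (cong (λ b → b2n b + # ℓ (C c (cg c k))) qk)) (crow c (cg c k)))) q2

          w1 : ∀ {k} → k < ℓ → Is (X1 c k) → suc (# ℓ (W c)) ≤ 2
          w1 {k} k< xk = ≤-trans (#-add1 ℓ {W c} {C c (cg c k)} (λ j j< wj → exc-mem j< wj k k< (∧⁻¹ xk)) k< (ckˡ c k<) (λ h → not⁻ {Qp c k} (∧⁻² {Q c k} xk) (∧⁻² {Q c k} h)))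
            (≤-reflexive (rowg k< (∧⁻¹ xk)))

          lone : ∀ {k} → k < ℓ → Is (X1 c k) → ¬ Is (Q c (nxt k)) → suc (suc (# ℓ (W c))) ≤ 2
          lone {k} k< xk nq = ≤-trans (s≤s (#-add1 ℓ {W c} {O} (λ j j< wj → ∧⁺ (exc-mem j< wj k k< (∧⁻¹ xk)) (not⁺ (λ s → nq (subst (λ z → Is (Q c z)) (⌊⌋⁻ s) (∧⁻¹ wj)))))
               k< (∧⁺ (ckˡ c k<) (not⁺ (λ s → nxt-≢ k< (sym (⌊⌋⁻ s))))) (λ h → not⁻ {Qp c k} (∧⁻² {Q c k} xk) (∧⁻² {Q c k} h))))
            (≤-trans (#-add1 ℓ {O} {C c (cg c k)} (λ j _ h → ∧⁻¹ h) (nxt-< k<) (ckʳ c k<) (λ h → not⁻ {single (nxt k) (nxt k)} (∧⁻² {C c (cg c k) (nxt k)} h) (⌊⌋⁺ refl)))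
              (≤-reflexive (rowg k< (∧⁻¹ xk))))
            where
            O : ℕ → Bool
            O j = C c (cg c k) j ∧ not (single (nxt k) j)

        -- An edge of `Q` has two vertices besides the missing one and contains all of `W`. At a run
        -- start this leaves room for one element of `W`, at a run of length one for none. As `Q`
        -- has three elements, some run has length one; so `W` is empty and `Z` has one element, but
        -- it contains the two elements of `N`.
        exceptional : ⊥
        exceptional = go (#-wit ℓ X1≥1)
          where
          go : (Σ ℕ λ k → k < ℓ × Is (X1 c k)) → ⊥
          go (k , k< , xk) = go' (#-wit ℓ {O} (≮⇒≥ λ lt → refute (# ℓ (X1 c) ∷ # ℓ (W c) ∷ # ℓ (Q c) ∷ # ℓ O ∷ # ℓ (λ k → W c (nxt k)) ∷ [])
              (κ 1 ⊕ ν 1 ≼ κ 2 ∷ ν 2 ≼ ν 1 ⊕ ν 0 ∷ κ 3 ≼ ν 2 ∷ ν 0 ≼ ν 3 ⊕ ν 4 ∷ ν 4 ≼ ν 1 ∷ κ 1 ⊕ ν 3 ≼ κ 1 ∷ [])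
              (w1 k< xk ∷ ≤-reflexive (sizeQ c) ∷ ≤-reflexive (sym hQ) ∷ #-cov ℓ {X1 c} {O} {λ k → W c (nxt k)} cov ∷ ≤-reflexive (#-nxt (W c)) ∷ lt ∷ []) refl))
            where
            O : ℕ → Bool
            O i = X1 c i ∧ not (Q c (nxt i))
            cov : ∀ i → i < ℓ → Is (X1 c i) → Is (O i) ⊎ Is (W c (nxt i))
            cov i i< xi with is? (Q c (nxt i))
            ... | yes a = inj₂ (∧⁺ a (subst (λ z → Is (Q c z)) (sym (prv-nxt i<)) (∧⁻¹ xi)))
            ... | no a  = inj₁ (∧⁺ xi (not⁺ a))
            go' : (Σ ℕ λ i → i < ℓ × Is (O i)) → ⊥
            go' (i , i< , oi) = refute (# ℓ (Z c) ∷ # ℓ (W c) ∷ # ℓ (X2 c) ∷ # ℓ (Q c) ∷ # ℓ (λ k → not (Q c k)) ∷ [])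
              (κ 2 ⊕ ν 1 ≼ κ 2 ∷ ν 3 ≼ ν 1 ⊕ ν 2 ∷ ν 2 ⊕ ν 0 ≼ ν 4 ∷ ν 3 ⊕ ν 4 ≼ κ 7 ∷ κ 3 ≼ ν 3 ∷ κ 2 ≼ ν 0 ∷ [])
              (lone i< (∧⁻¹ oi) (not⁻ (∧⁻² {X1 c i} oi)) ∷ ≤-reflexive (sizeQp c) ∷ ≤-reflexive (sym (sizeNot c)) ∷ ≤-reflexive tot ∷ ≤-reflexive (sym hQ) ∷ Z≥2 ∷ []) refl

  -- Exclusion of cycles of length ℓ

  module LongCycle {t : ℕ} (kd : Kind ℓ q D t) (last : ℕ) (ℓ≡ : ℓ ≡ suc last) where
    open OnCycle last ℓ≡
    open Cyc

    -- Induction on the number of cycle edges through the missing vertex: a free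
    -- edge through it and two consecutive vertices could be put on the cycle.
    noCyc′ : ∀ fuel c → ℓ ≤ # ℓ (Q c) + fuel → ⊥
    noCyc′ fuel c le = finish (is? (1 ≤ᵇ cfdeg c ℓ))
      where
      bigger : ∀ fuel → ℓ ≤ # ℓ (Q c) + fuel → ∀ c' → suc (# ℓ (Q c)) ≤ # ℓ (Q c') → ⊥
      bigger zero    le c' lt = refute (ℓ ∷ # ℓ (Q c) ∷ # ℓ (Q c') ∷ []) (ν 0 ≼ ν 1 ⊕ κ 0 ∷ κ 1 ⊕ ν 1 ≼ ν 2 ∷ ν 2 ≼ ν 0 ∷ []) (le ∷ lt ∷ #-≤ ℓ (Q c') ∷ []) refl
      bigger (suc f) le c' lt = noCyc′ f c' (≤-trans le (≤-trans (≤-reflexive (+-suc _ f)) (+-monoˡ-≤ f lt)))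
      nc : NonCons c
      nc i i< a b = go (N⁻ c a) (N⁻ c b)
        where
        go : (Σ (Fin m) λ e → CFree c e × Is (C c e ℓ) × Is (C c e i)) → (Σ (Fin m) λ e → CFree c e × Is (C c e ℓ) × Is (C c e (nxt i))) → ⊥
        go (f , ff , fℓ , fi) (f' , ff' , fℓ' , fi') with f FP.≟ f'
        ... | no f≢    = k2 c i i< ff ff' f≢ fℓ fℓ' fi fi'
        ... | yes refl = bigger fuel le (swapC c i i< ff fi fi')
                (#-add1 ℓ {Q c} (λ k _ h → trans (swapC-Q≢ c i< ff fi fi' (λ { refl → nqi h })) h) i< (trans (swapC-Q≡ c i< ff fi fi') fℓ) nqi)
          where
          nqi : ¬ Is (Q c i)
          nqi h = k1ˡ c i i< h ff fℓ fi
      a  = # ℓ (N c)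
      s' = # ℓ (Q c)
      D≤' : D ≤ bin a q + s'
      D≤' = ≤-trans (cdegAt c ℓ) (+-monoˡ-≤ s' (cfdeg-bound c))
      cN : a + (a + s') ≤ ℓ
      cN = count-N c nc
      -- `count-N` leaves `s' ≤ ℓ ∸ 2a`, which by `binC` is too little for the degree of the missing
      -- vertex. For odd `ℓ` the estimate is slack by one, which `binC<`, `Exceptional` and `altCyc`
      -- make up.
      cases : q ≤ a → ∀ {t} → Kind ℓ q D t → ⊥
      cases q≤a {t} (odd ℓt 2≤q q<t D≡) = refute (a ∷ s' ∷ ℓ ∷ t ∷ bin a q ∷ bin t q ∷ D ∷ [])
          (ν 6 ≼ ν 4 ⊕ ν 1 ∷ κ 1 ⊕ ν 5 ≼ ν 6 ∷ ν 0 ⊕ (ν 0 ⊕ ν 1) ≼ ν 2 ∷ ν 2 ≼ ν 3 ⊕ ν 3 ∷ ν 4 ⊕ (ν 3 ⊕ ν 3) ≼ ν 5 ⊕ (ν 0 ⊕ ν 0) ∷ [])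
          (D≤' ∷ ≤-reflexive (sym D≡) ∷ cN ∷ ≤-reflexive ℓt ∷ binC 2≤q q≤a a≤t ∷ []) refl
        where
        a≤t : a ≤ t
        a≤t = ≮⇒≥ λ lt → refute (a ∷ s' ∷ ℓ ∷ t ∷ []) (ν 0 ⊕ (ν 0 ⊕ ν 1) ≼ ν 2 ∷ ν 2 ≼ ν 3 ⊕ ν 3 ∷ κ 1 ⊕ ν 3 ≼ ν 0 ∷ []) (cN ∷ ≤-reflexive ℓt ∷ lt ∷ []) refl
      cases q≤a {t} (even ℓt 2≤q q<t D≡) = split (m≤n⇒m<n∨m≡n a≤t) (4 ≤? t)
        where
        a≤t : a ≤ t
        a≤t = ≮⇒≥ λ lt → refute (a ∷ s' ∷ ℓ ∷ t ∷ []) (ν 0 ⊕ (ν 0 ⊕ ν 1) ≼ ν 2 ∷ ν 2 ≼ κ 1 ⊕ (ν 3 ⊕ ν 3) ∷ κ 1 ⊕ ν 3 ≼ ν 0 ∷ []) (cN ∷ ≤-reflexive ℓt ∷ lt ∷ []) refl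
        small : ∀ {t} → ¬ (4 ≤ t) → q < t → t ≡ 3
        small n lt = ≤-antisym (≤-pred (≰⇒> n)) (≤-trans (s≤s 2≤q) lt)
        split : a < t ⊎ a ≡ t → Dec (4 ≤ t) → ⊥
        split (inj₁ a<t) (yes 4≤t) = refute (a ∷ s' ∷ ℓ ∷ t ∷ bin a q ∷ bin t q ∷ D ∷ [])
          (ν 6 ≼ ν 4 ⊕ ν 1 ∷ κ 1 ⊕ ν 5 ≼ ν 6 ∷ ν 0 ⊕ (ν 0 ⊕ ν 1) ≼ ν 2 ∷ ν 2 ≼ κ 1 ⊕ (ν 3 ⊕ ν 3) ∷ ν 4 ⊕ (κ 1 ⊕ (ν 3 ⊕ ν 3)) ≼ ν 5 ⊕ (ν 0 ⊕ ν 0) ∷ [])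
          (D≤' ∷ ≤-reflexive (sym D≡) ∷ cN ∷ ≤-reflexive ℓt ∷ binC< 2≤q q≤a a<t 4≤t ∷ []) refl
        split (inj₁ a<t) (no n) = Exceptional.exceptional ℓ7 q2 D4 c nc a2 s3 (λ c' l → bigger fuel le c' (subst (λ z → suc z ≤ # ℓ (Q c')) (sym s3) l))
          where
          t3 : t ≡ 3
          t3 = small n q<t
          ℓ7 : ℓ ≡ 7
          ℓ7 = trans ℓt (cong (λ z → suc (z + z)) t3)
          q2 : q ≡ 2
          q2 = ≤-antisym (≤-pred (subst (q <_) t3 q<t)) 2≤q
          D4 : D ≡ 4
          D4 = trans D≡ (cong suc (cong₂ bin t3 q2))
          a2 : a ≡ 2
          a2 = ≤-antisym (≤-pred (subst (a <_) t3 a<t)) (≤-trans 2≤q q≤a)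
          s3 : s' ≡ 3
          s3 = ≤-antisym (≮⇒≥ λ lt → refute (a ∷ s' ∷ ℓ ∷ []) (ν 0 ⊕ (ν 0 ⊕ ν 1) ≼ ν 2 ∷ ν 2 ≼ κ 7 ∷ κ 2 ≼ ν 0 ∷ κ 4 ≼ ν 1 ∷ []) (cN ∷ ≤-reflexive ℓ7 ∷ ≤-reflexive (sym a2) ∷ lt ∷ []) refl)
                 (≮⇒≥ λ lt → refute (D ∷ s' ∷ bin a q ∷ []) (ν 0 ≼ ν 2 ⊕ ν 1 ∷ κ 4 ≼ ν 0 ∷ ν 2 ≼ κ 1 ∷ κ 1 ⊕ ν 1 ≼ κ 3 ∷ [])
                   (D≤' ∷ ≤-reflexive (sym D4) ∷ ≤-reflexive (cong₂ bin a2 q2) ∷ lt ∷ []) refl)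
        split (inj₂ a≡t) _ = go (#-wit ℓ {Q c} (≮⇒≥ λ lt → refute (D ∷ s' ∷ bin a q ∷ bin t q ∷ [])
            (ν 0 ≼ ν 2 ⊕ ν 1 ∷ κ 1 ⊕ ν 3 ≼ ν 0 ∷ ν 2 ≼ ν 3 ∷ κ 1 ⊕ ν 1 ≼ κ 1 ∷ []) (D≤' ∷ ≤-reflexive (sym D≡) ∷ ≤-reflexive (cong (λ z → bin z q) a≡t) ∷ lt ∷ []) refl))
          where
          go : (Σ ℕ λ i → i < ℓ × Is (Q c i)) → ⊥
          go (i , i< , qi) = EvenCyc.altCyc t ℓt 2≤q q<t D≡ c i i< qi nc (≤-reflexive (sym a≡t))
      cases q≤a {t} (half ℓt 2≤t q≡ D≡) = refute (a ∷ s' ∷ ℓ ∷ t ∷ bin a q ∷ D ∷ [])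
          (ν 5 ≼ ν 4 ⊕ ν 1 ∷ κ 1 ⊕ ν 3 ≼ ν 5 ∷ ν 0 ⊕ (ν 0 ⊕ ν 1) ≼ ν 2 ∷ ν 2 ≼ κ 1 ⊕ (ν 3 ⊕ ν 3) ∷ ν 4 ≼ κ 1 ∷ ν 3 ≼ ν 0 ∷ κ 2 ≼ ν 3 ∷ [])
          (D≤' ∷ ≤-reflexive (sym D≡) ∷ cN ∷ ≤-reflexive ℓt ∷ ≤-trans (bin-mono q a≤t) (≤-reflexive (trans (cong (bin t) q≡) (bin-nn t))) ∷ t≤a ∷ 2≤t ∷ []) refl
        where
        t≤a : t ≤ a
        t≤a = subst (_≤ a) q≡ q≤a
        a≤t : a ≤ t
        a≤t = ≮⇒≥ λ lt → refute (a ∷ s' ∷ ℓ ∷ t ∷ []) (ν 0 ⊕ (ν 0 ⊕ ν 1) ≼ ν 2 ∷ ν 2 ≼ κ 1 ⊕ (ν 3 ⊕ ν 3) ∷ κ 1 ⊕ ν 3 ≼ ν 0 ∷ []) (cN ∷ ≤-reflexive ℓt ∷ lt ∷ []) refl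
      finish : Dec (Is (1 ≤ᵇ cfdeg c ℓ)) → ⊥
      finish (no n)  = noFree⊥ kd c (λ {f} ff fℓ → n (≤ᵇ⁺ (cnt-pos (allFin m) (∈-allFin f) (∧⁺ (cfr⁺ c ff) fℓ))))
      finish (yes h) = cases (≮⇒≥ λ lt → 1+n≰n (≤-trans (≤-trans (≤ᵇ⁻ h) (cfdeg-bound c)) (≤-reflexive (bin-zero lt)))) kd

    noCyc : Cyc → ⊥
    noCyc c = noCyc′ ℓ c (m≤n+m ℓ _)

    fromPath : ∀ c {e} → Is (M c e 0) → Is (M c e last) → Usable c last e → Cyc
    fromPath c {e} e0 el u = record
      { cx    = x c
      ; cg    = override last e (y c)
      ; cxinj = xinj c
      ; cginj = λ {j} {k} → inj j k
      ; ckˡ   = λ {k} → left k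
      ; ckʳ   = λ {k} → right k
      }
      where
      inj : ∀ j k → j < ℓ → k < ℓ → override last e (y c) j ≡ override last e (y c) k → j ≡ k
      inj j k j< k< h with j ≟ last | k ≟ last
      ... | yes refl | yes refl = refl
      ... | no j≢    | no k≢    = yinj c j< k< (trans (sym (ov≢ j≢)) (trans h (ov≢ k≢)))
      ... | yes refl | no k≢    = ⊥-elim (bad u)
        where
        h' : y c k ≡ e
        h' = trans (sym (ov≢ k≢)) (trans (sym h) (ov≡ refl))
        bad : Usable c last e → ⊥
        bad (inj₁ p) = k≢ (yinj c k< last<ℓ (trans h' p))
        bad (inj₂ f) = f k k< h'
      ... | no j≢    | yes refl = ⊥-elim (bad u)
        where
        h' : y c j ≡ e
        h' = trans (sym (ov≢ j≢)) (trans h (ov≡ refl))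
        bad : Usable c last e → ⊥
        bad (inj₁ p) = j≢ (yinj c j< last<ℓ (trans h' p))
        bad (inj₂ f) = f j j< h'
      left : ∀ k → k < ℓ → Is (inc (override last e (y c) k) (x c k))
      left k k< with k ≟ last
      ... | yes refl rewrite ov≡ {last} {last} {e} {y c} refl = el
      ... | no k≢    rewrite ov≢ {last} {k} {e} {y c} k≢      = lkˡ c k<
      right : ∀ k → k < ℓ → Is (inc (override last e (y c) k) (x c (nxt k)))
      right k k< with k ≟ last
      ... | yes refl rewrite ov≡ {last} {last} {e} {y c} refl | nxt-last = e0
      ... | no k≢    rewrite ov≢ {last} {k} {e} {y c} k≢ | nxt-suc k≢    = lkʳ c k<

    -- Moving the front to i + 1 and closing up through position i leaves out
    -- exactly the vertex at i + 1.
    noCross : ∀ c {i} → suc i < ℓ → Is (B c i) → Is (A c (suc i)) → ⊥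
    noCross c {i} i< b h = go (A⁻ c i< h) (B⁻ c (<⇒≤ i<) b)
      where
      go : (Σ (Fin m) λ e → Is (M c e 0) × Is (M c e (suc (suc i))) × Usable c (suc i) e) →
           (Σ (Fin m) λ e → Is (M c e ℓ) × Is (M c e i) × Usable c i e) → ⊥
      go (e , e0 , ei , u) (g , gℓ , gi , ug) with g FP.≟ e
      ... | yes refl = same u ug
        where
        same : Usable c (suc i) g → Usable c i g → ⊥
        same (inj₂ f) _        = noHam c f e0 gℓ
        same (inj₁ p) (inj₂ f) = f (suc i) i< (sym p)
        same (inj₁ p) (inj₁ p') = 1+n≢n (yinj c i< (<⇒≤ i<) (trans (sym p) p'))
      ... | no g≢e = noCyc (fromPath c'' g0 gl (use ug))
        where
        a  = front {c} {suc i} {e} i< e0 ei u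
        c' = Rot c a
        c'' = Mir c'
        last∸ : ℓ ∸ last ≡ 1
        last∸ = trans (cong (_∸ last) ℓ≡) (m+n∸n≡m 1 last)
        g0 : Is (M c'' g 0)
        g0 = subst (λ v → Is (inc g v)) (sym (Rot-xℓ a)) gℓ
        gl : Is (M c'' g last)
        gl = subst (λ k → Is (M c' g k)) (sym last∸) (subst (λ k → Is (M c g k)) (sym (trans (ρ≤ {suc i} {1} (s≤s z≤n)) refl)) gi)
        use : Usable c i g → Usable c'' last g
        use (inj₂ f)    = inj₂ (Mir-free c' (Rot-keep a f g≢e))
        use (inj₁ refl) = inj₁ (sym (trans (cong (y c') (trans (cong (_∸ suc last) ℓ≡) (n∸n≡0 last))) (Rot-y< a (s≤s z≤n))))

  -- Counting on Hamiltonian paths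

  S'0 : ∀ c → 0 < ℓ → Is (S' c 0)
  S'0 c l = lkˡ c l

  A⊂U : ∀ c {k} → k < ℓ → Is (A c k) → Is (not (Nb c k))
  A⊂U c k< h = not⁺ (λ n → F1 c k< h n)

  -- `S'` is too small for the degree, so the first vertex is on a free edge; that edge needs `q`
  -- elements of `S`, hence `S = U`. Now `bin q q = 1` allows one edge, but the exchange of `y 0`
  -- produces two.
  confined : ∀ c → suc q ≤ D → # ℓ (λ k → not (Nb c k)) ≤ q → 0 < ℓ → ⊥
  confined c q<D U≤ 0<ℓ = refute (suc (fdeg c 0) ∷ fdeg c 0 ∷ []) (κ 1 ⊕ ν 1 ≼ ν 0 ∷ ν 0 ≼ κ 1 ∷ κ 1 ≼ ν 1 ∷ [])
      (≤-refl ∷ ≤-trans sw (≤-trans (bin-mono q U≤) (≤-reflexive (bin-nn q))) ∷ f≥1 ∷ []) refl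
    where
    U : ℕ → Bool
    U k = not (Nb c k)
    S⊂U : ∀ k → k < ℓ → Is (S c k) → Is (U k)
    S⊂U k k< h = A⊂U c k< (S→A c h)
    f≥1 : 1 ≤ fdeg c 0
    f≥1 = ≮⇒≥ λ lt → refute (D ∷ q ∷ fdeg c 0 ∷ # ℓ (S' c) ∷ # ℓ U ∷ [])
      (κ 1 ⊕ ν 1 ≼ ν 0 ∷ ν 0 ≼ ν 2 ⊕ ν 3 ∷ ν 3 ≼ ν 4 ∷ ν 4 ≼ ν 1 ∷ κ 1 ⊕ ν 2 ≼ κ 1 ∷ [])
      (q<D ∷ degAt c 0 ∷ #-⊆ ℓ (λ k k< h → A⊂U c k< (S'→A c {k} h)) ∷ U≤ ∷ lt ∷ []) refl
    q≤s : q ≤ # ℓ (S c)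
    q≤s = ≮⇒≥ λ lt → 1+n≰n (≤-trans (≤-trans f≥1 (fdeg-bound c)) (≤-reflexive (bin-zero lt)))
    S0 : Is (S c 0)
    S0 = #-⊇ ℓ S⊂U (≤-trans U≤ q≤s) 0 0<ℓ (A⊂U c 0<ℓ (S'→A c {0} (S'0 c 0<ℓ)))
    sw : suc (fdeg c 0) ≤ bin (# ℓ U) q
    sw = Swap0-bound c U 0<ℓ S0 S⊂U (λ e0 e1 fe l k k< h → let c' = Swap c (link l e0 e1 (inj₂ fe)) in
           not⁺ (λ n → F1 c' k< (S→A c' h) (Swap0-Nb⁺ l e0 e1 fe n)))

  sumP : ∀ c → total (downFrom (suc ℓ)) (pdeg c) ≡ ℓ * suc q
  sumP c = trans (doubleCount (downFrom (suc ℓ)) (downFrom ℓ) (λ k i → M c (y c i) k))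
    (trans (total-≡ (downFrom ℓ) (λ i → row c (y c i))) (cong (_* suc q) (length-downFrom ℓ)))

  pdeg≥1 : ∀ c → 0 < ℓ → ∀ k → k < suc ℓ → 1 ≤ pdeg c k
  pdeg≥1 c 0<ℓ zero    _        = #-pos ℓ 0<ℓ (lkˡ c 0<ℓ)
  pdeg≥1 c 0<ℓ (suc k) (s≤s k<) = #-pos ℓ k< (lkʳ c k<)

  pdeg≥2 : ∀ c k → 0 < k → k < ℓ → 2 ≤ pdeg c k
  pdeg≥2 c (suc k) _ k< = ≤-trans (s≤s (#-pos ℓ (<⇒≤ k<) (⌊⌋⁺ {d = k ≟ k} refl)))
    (#-add1 ℓ {single k} {λ i → M c (y c i) (suc k)} (λ i _ h → subst (λ z → Is (M c (y c z) (suc k))) (sym (⌊⌋⁻ h)) (lkʳ c (<⇒≤ k<))) k< (lkˡ c k<)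
       (λ h → 1+n≢n (⌊⌋⁻ {d = suc k ≟ k} h)))

  pathFront : ∀ c {k} → k < ℓ → Is (S' c k) → Front c k
  pathFront c {k} k< s' = front k< s' (lkʳ c k<) (inj₁ refl)

  -- Moving along `y k` itself keeps the set of path edges, so the new `S'` counts the path edges
  -- through the old `x k`.
  Rot-S' : ∀ c {k} (k< : k < ℓ) (s' : Is (S' c k)) → # ℓ (S' (Rot c (pathFront c k< s'))) ≡ pdeg c k
  Rot-S' c {k} k< s' = trans (#-ext ℓ (λ i _ → cong₂ inc (y≡ i) (Rot-x0 (pathFront c k< s')))) (#-τ ℓ k (λ i → M c (y c i) k) (<⇒≤ k<))
    where
    y≡ : ∀ i → override k (y c k) (λ j → y c (τ k j)) i ≡ y c (τ k i)
    y≡ i with i ≟ k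
    ... | yes refl = trans (ov≡ {k} {k} {y c k} {λ j → y c (τ k j)} refl) (cong (y c) (sym (τ≥ ≤-refl)))
    ... | no i≢    = ov≢ i≢

  Mir-pdeg : ∀ c k → pdeg (Mir c) k ≡ pdeg c (ℓ ∸ k)
  Mir-pdeg c k = #-rev ℓ (λ i → M c (y c i) (ℓ ∸ k))

  LastFree : Path → Set
  LastFree c = Σ (Fin m) λ e → Free c e × Is (M c e ℓ)

  -- If no end of any path is on a free edge, the first vertex is on at least `q + 1` path edges. A
  -- free edge avoids all positions of `S'`, since the front can be moved to them, and the two sets
  -- together need `2q + 2` positions below `ℓ`.
  lastFree : suc q ≤ D → ℓ < suc q + suc q → (∀ c → LastFree c → ⊥) → Path → ⊥
  lastFree q<D ℓ< no' c = go (freeEdge c q<D)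
    where
    noFirst : ∀ c {e} → Free c e → Is (M c e 0) → ⊥
    noFirst c {e} f h = no' (Mir c) (e , Mir-free c f , subst (λ v → Is (inc e v)) (sym (Mir-xℓ c)) h)
    go : Σ (Fin m) (Free c) → ⊥
    go (f , ff) = refute (q ∷ D ∷ ℓ ∷ # ℓ (S' c) ∷ # ℓ (M c f) ∷ []) 
        (κ 1 ⊕ ν 0 ≼ ν 1 ∷ ν 1 ≼ ν 3 ∷ ν 3 ⊕ ν 4 ≼ ν 2 ∷ κ 1 ⊕ ν 0 ≼ ν 4 ∷ κ 1 ⊕ ν 2 ≼ (κ 1 ⊕ ν 0) ⊕ (κ 1 ⊕ ν 0) ∷ [])
        (q<D ∷ subst (λ z → D ≤ z + # ℓ (S' c)) (cnt-none (allFin m) (λ e _ h → noFirst c (fr⁻ c (∧⁻¹ h)) (∧⁻² {fr c e} h))) (degAt c 0) ∷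
         ≤-trans (#-disj ℓ {S' c} {M c f} {λ _ → true} (λ _ _ _ → refl) (λ _ _ _ → refl) apart) (≤-reflexive (#-all ℓ (λ _ _ → refl))) ∷
         ≤-trans (≤-reflexive (sym (row c f))) (+-monoˡ-≤ (# ℓ (M c f)) {b2n (M c f ℓ)} {0} (b2n-mono {M c f ℓ} {false} (λ h → ⊥-elim (no' c (f , ff , h))))) ∷ ℓ< ∷ []) refl
      where
      apart : ∀ k → k < ℓ → Is (S' c k) → Is (M c f k) → ⊥
      apart k k< s' fk = noFirst (Rot c a) (Rot-keep a ff (λ e → ff k k< (sym e))) (subst (λ v → Is (inc f v)) (sym (Rot-x0 a)) fk)
        where a = pathFront c k< s'

  last-U : ∀ c → LastFree c → # ℓ (λ k → not (Nb c k)) + q ≤ ℓ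
  last-U c (e , fe , eℓ) = ≤-trans (+-monoʳ-≤ (# ℓ (λ k → not (Nb c k))) q≤)
      (≤-reflexive (trans (+-comm (# ℓ (λ k → not (Nb c k))) _) (#-not ℓ (Nb c))))
    where
    q≤ : q ≤ # ℓ (Nb c)
    q≤ = ≤-trans (≤-pred (≤-reflexive (trans (sym (row c e)) (cong (λ b → b2n b + # ℓ (M c e)) eℓ)))) (#-⊆ ℓ (λ k _ h → Nb⁺ c fe eℓ h))

  NoCross : Set
  NoCross = ∀ c {i} → suc i < ℓ → Is (B c i) → Is (A c (suc i)) → ⊥

  cross : NoCross → ∀ c {i} → suc i < ℓ → Is (A c (suc i)) → ¬ Is (Nb c i)
  cross nc c i< a n = nc c i< (∨⁺¹ n) a

  module Range (t : ℕ) (2≤q : 2 ≤ q) (q<t : q < t) (D≡ : D ≡ suc (bin t q)) (t<ℓ : t < ℓ) (nc : NoCross) where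

    0<ℓ : 0 < ℓ
    0<ℓ = ≤-trans (s≤s z≤n) t<ℓ

    lowS : ∀ c → # ℓ (S c) < t → t ≤ # ℓ (S' c)
    lowS c lt = ≮⇒≥ λ l → refute (bin (# ℓ (S c)) q ∷ # ℓ (S' c) ∷ t ∷ bin t q ∷ D ∷ [])
      (ν 4 ≼ ν 0 ⊕ ν 1 ∷ κ 1 ⊕ ν 3 ≼ ν 4 ∷ ν 0 ⊕ ν 2 ≼ κ 1 ⊕ ν 3 ∷ κ 1 ⊕ ν 1 ≼ ν 2 ∷ [])
      (D≤ c ∷ ≤-reflexive (sym D≡) ∷ binA 2≤q q<t lt ∷ l ∷ []) refl

    lowS2 : ∀ c → suc (# ℓ (S c)) < t → suc t ≤ # ℓ (S' c)
    lowS2 c lt = ≮⇒≥ λ l → refute (bin (# ℓ (S c)) q ∷ # ℓ (S' c) ∷ t ∷ bin t q ∷ D ∷ [])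
      (ν 4 ≼ ν 0 ⊕ ν 1 ∷ κ 1 ⊕ ν 3 ≼ ν 4 ∷ ν 0 ⊕ ν 2 ≼ ν 3 ∷ κ 1 ⊕ ν 1 ≼ κ 1 ⊕ ν 2 ∷ [])
      (D≤ c ∷ ≤-reflexive (sym D≡) ∷ binB 2≤q q<t lt ∷ l ∷ []) refl

    S'≤A : ∀ c → # ℓ (S' c) ≤ # ℓ (A c)
    S'≤A c = #-⊆ ℓ (λ k _ → S'→A c {k})

    S≤A : ∀ c → # ℓ (S c) ≤ # ℓ (A c)
    S≤A c = #-⊆ ℓ (λ k _ → S→A c)

    A≥t : ∀ c → t ≤ # ℓ (A c)
    A≥t c = go (# ℓ (S c) <? t)
      where
      go : Dec (# ℓ (S c) < t) → t ≤ # ℓ (A c)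
      go (yes lt) = ≤-trans (lowS c lt) (S'≤A c)
      go (no n)   = ≤-trans (≮⇒≥ n) (S≤A c)

    -- Exchanging y 0 for a free edge shows that O has room for y 0 as well.
    swapClash : ∀ c (O : ℕ → Bool) → suc (# ℓ O) ≤ t → # ℓ (S' c) ≤ t → Is (S c 0) → (∀ i → i < ℓ → Is (S c i) → Is (O i)) →
      (∀ {e} (e0 : Is (M c e 0)) (e1 : Is (M c e 1)) (fe : Free c e) (l : 0 < ℓ) →
         ∀ i → i < ℓ → Is (S (Swap c (link l e0 e1 (inj₂ fe))) i) → Is (O i)) → ⊥
    swapClash c O O< s'≤ s0 sub sub' = refute (fdeg c 0 ∷ # ℓ (S' c) ∷ t ∷ bin (# ℓ O) q ∷ bin t q ∷ D ∷ [])
      (ν 5 ≼ ν 0 ⊕ ν 1 ∷ κ 1 ⊕ ν 4 ≼ ν 5 ∷ ν 3 ⊕ ν 2 ≼ κ 1 ⊕ ν 4 ∷ κ 1 ⊕ ν 0 ≼ ν 3 ∷ ν 1 ≼ ν 2 ∷ [])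
      (degAt c 0 ∷ ≤-reflexive (sym D≡) ∷ binA 2≤q q<t O< ∷ Swap0-bound c O 0<ℓ s0 sub sub' ∷ s'≤ ∷ []) refl

    -- P is a class of paths, closed under moving the front, on which the front
    -- can only be moved among the first t positions.
    module Clique (P : Path → Set)
      (P-A    : ∀ c → P c → ∀ {k} → k < ℓ → Is (A c k) → k < t)
      (P-Rot  : ∀ c → P c → ∀ {i} (a : Front c i) → i < t → P (Rot c a))
      (P-Swap : ∀ c → P c → ∀ {e} (l : 0 < ℓ) (e0 : Is (M c e 0)) (e1 : Is (M c e 1)) (fe : Free c e) → P (Swap c (link l e0 e1 (inj₂ fe))))
      where

      -- Moving the front to `x i` along a free edge frees `y i`. Its vertices become free
      -- neighbours of the new front, hence sit in the first `t + 1` positions, a set that the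
      -- reversal preserves.
      inK : ∀ c → P c → ∀ {i} → i < ℓ → Is (S c i) → ∀ {k} → k ≤ ℓ → Is (M c (y c i) k) → k ≤ t
      inK c p {i} i< s {k} k≤ h = go (sFront c i< s)
        where
        i<t : i < t
        i<t = P-A c p i< (S→A c s)
        go : (Σ (Front c i) λ a → Free c (Front.e a)) → k ≤ t
        go (a , fe) = subst (_≤ t) (ρρ i k) (ρ-bound (<⇒≤ i<t) (small (ρ i k) (ρ-bound (<⇒≤ i<) k≤) (Freed a fe h)))
          where
          small : ∀ j → j ≤ ℓ → Is (Nf (Rot c a) j) → j ≤ t
          small zero    _  _ = z≤n
          small (suc j) j< f = P-A (Rot c a) (P-Rot c p a i<t) j< (S→A (Rot c a) f)

      private
        below : ℕ → Bool
        below i = i <ᵇ t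

        A⊂ : ∀ c → P c → ∀ k → k < ℓ → Is (A c k) → Is (below k)
        A⊂ c p k k< a = <ᵇ⁺ (P-A c p k< a)

        -- By `inK`, `j` is not in `S`, and this makes all counts tight: `S'` is the set of all
        -- indices below `t`, and `S` is the same set without `j`.
        out : ∀ c → P c → ∀ {j k} → j < ℓ → Is (S' c j) → k ≤ ℓ → t < k → Is (M c (y c j) k) → ⊥
        out c p {j} {k} j< s'j k≤ t<k h = go (j ≟ 0)
          where
          j<t : j < t
          j<t = P-A c p j< (S'→A c {j} s'j)
          ¬Sj : ¬ Is (S c j)
          ¬Sj s = <⇒≱ t<k (inK c p j< s k≤ h)
          O : ℕ → Bool
          O i = below i ∧ not (single j i)
          S⊂O : ∀ i → i < ℓ → Is (S c i) → Is (O i)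
          S⊂O i i< s = ∧⁺ (A⊂ c p i i< (S→A c s)) (not⁺ (λ e → ¬Sj (subst (λ z → Is (S c z)) (⌊⌋⁻ e) s)))
          O< : suc (# ℓ O) ≤ t
          O< = ≤-trans (#-add1 ℓ {O} {below} (λ i _ b → ∧⁻¹ b) j< (<ᵇ⁺ j<t) (λ b → not⁻ {single j j} (∧⁻² {below j} b) (⌊⌋⁺ refl))) (#-below ℓ t)
          s'≤ : # ℓ (S' c) ≤ t
          s'≤ = ≤-trans (#-⊆ ℓ (λ i i< s → A⊂ c p i i< (S'→A c {i} s))) (#-below ℓ t)
          s≥ : t ≤ suc (# ℓ (S c))
          s≥ = ≮⇒≥ λ lt → 1+n≰n (≤-trans (lowS2 c lt) s'≤)
          S'≥t : t ≤ # ℓ (S' c)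
          S'≥t = lowS c (≤-trans (s≤s (#-⊆ ℓ S⊂O)) O<)
          S'all : ∀ i → i < ℓ → i < t → Is (S' c i)
          S'all i i< i<t = #-⊇ ℓ {S' c} {below} (λ i i< s → A⊂ c p i i< (S'→A c {i} s)) (≤-trans (#-below ℓ t) S'≥t) i i< (<ᵇ⁺ i<t)
          Sall : ∀ i → i < ℓ → i < t → i ≢ j → Is (S c i)
          Sall i i< i<t i≢ = #-⊇ ℓ S⊂O (≤-pred (≤-trans O< s≥)) i i< (∧⁺ (<ᵇ⁺ i<t) (not⁺ (λ e → i≢ (⌊⌋⁻ e))))
          0<t : 0 < t
          0<t = ≤-trans (s≤s z≤n) q<t
          1<t : 1 < t
          1<t = ≤-trans (s≤s (≤-trans (s≤s z≤n) 2≤q)) q<t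
          go : Dec (j ≡ 0) → ⊥
          go (no j≢) = swapClash c O O< s'≤ (Sall 0 0<ℓ 0<t (λ e → j≢ (sym e))) S⊂O
            (λ e0 e1 fe l i i< s → let a = link l e0 e1 (inj₂ fe) ; c' = Swap c a ; p' = P-Swap c p l e0 e1 fe in
               ∧⁺ (A⊂ c' p' i i< (S→A c' s)) (not⁺ (λ e → <⇒≱ t<k (inK c' p' j< (subst (λ z → Is (S c' z)) (⌊⌋⁻ e) s) k≤
                   (subst (λ z → Is (inc z (x c k))) (sym (Swap-y≢ a j≢)) h)))))
          -- An exchange would remove `y 0` itself. Moving the front to position `1` instead keeps
          -- `y 0` as the first edge and puts index `0` into `S`, so `inK` applies to it.
          go (yes refl) = go' (sFront c 1<ℓ (Sall 1 1<ℓ 1<t (λ ())))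
            where
            1<ℓ : 1 < ℓ
            1<ℓ = <-trans 1<t t<ℓ
            go' : (Σ (Front c 1) λ a → Free c (Front.e a)) → ⊥
            go' (a , fe) = <⇒≱ t<k (inK c' (P-Rot c p a 1<t) 0<ℓ (Freed0 a fe (S'all 1 1<ℓ 1<t)) k≤
                (subst₂ (λ e z → Is (inc e (x c z))) (sym (Rot-y< a (s≤s z≤n))) (sym (ρ> (<-trans 1<t t<k))) h))
              where c' = Rot c a

      clique : ∀ c → P c → ⊥
      clique c p = leaving c below (≤-trans (s≤s (bin-mono q (#-below ℓ t))) (≤-reflexive (sym D≡)))
          (λ e e0 i i< h → stable λ n → bad e e0 i i< h (≮⇒≥ (λ lt → n (<ᵇ⁺ lt))) (free? c e))
        where
        bad : ∀ e → Is (M c e 0) → ∀ i → i < ℓ → Is (M c e (suc i)) → t ≤ i → Free c e ⊎ (Σ ℕ λ j → j < ℓ × y c j ≡ e) → ⊥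
        bad e e0 i i< h t≤ (inj₁ f)              = <⇒≱ (P-A c p i< (S→A c (Nf⁺ c f e0 h))) t≤
        bad e e0 i i< h t≤ (inj₂ (j , j< , refl)) = out c p j< e0 i< (s≤s t≤) h

    -- The lone element `z` is never in `A`, for then `cross` would put `z ∸ 1` into `U`. So the
    -- front moves only among the first `t` positions.
    isolated : ∀ z → t < z → ∀ c → (∀ k → k < ℓ → ¬ Is (Nb c k) → k < t ⊎ k ≡ z) → ⊥
    isolated z t<z = Clique.clique P P-A P-Rot P-Swap
      where
      P : Path → Set
      P c = ∀ k → k < ℓ → ¬ Is (Nb c k) → k < t ⊎ k ≡ z
      no-z : ∀ c → P c → ∀ k → k < ℓ → Is (A c k) → t < k → k ≡ z → ⊥
      no-z c p (suc k) k< a lt e = go (p k (<⇒≤ k<) (cross nc c k< a))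
        where
        go : k < t ⊎ k ≡ z → ⊥
        go (inj₁ h)    = <⇒≱ h (≤-pred lt)
        go (inj₂ refl) = 1+n≢n e
      P-A : ∀ c → P c → ∀ {k} → k < ℓ → Is (A c k) → k < t
      P-A c p {k} k< a = go (p k k< (F1 c k< a))
        where
        go : k < t ⊎ k ≡ z → k < t
        go (inj₁ h)    = h
        go (inj₂ refl) = ⊥-elim (no-z c p k k< a t<z refl)
      P-Rot : ∀ c → P c → ∀ {i} (a : Front c i) → i < t → P (Rot c a)
      P-Rot c p {i} a i<t k k< n with k ≤? i
      ... | yes le = inj₁ (≤-trans (s≤s le) i<t)
      ... | no gt  = p k k< (λ h → n (Rot-Nb⁺ a (subst (λ z → Is (Nb c z)) (sym (ρ> (≰⇒> gt))) h)))
      P-Swap : ∀ c → P c → ∀ {e} (l : 0 < ℓ) (e0 : Is (M c e 0)) (e1 : Is (M c e 1)) (fe : Free c e) → P (Swap c (link l e0 e1 (inj₂ fe)))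
      P-Swap c p l e0 e1 fe k k< n = p k k< (λ h → n (Swap0-Nb⁺ l e0 e1 fe h))

    few-Nb : ∀ c → # ℓ (λ k → not (Nb c k)) ≤ t → ⊥
    -- Choosing `z = ℓ`, which is out of range, means that there is no lone element.
    few-Nb c U≤ = isolated ℓ t<ℓ c (λ k k< n → inj₁ (≤-trans (proj₁ (closed-init ℓ {U} cl k k<) (not⁺ n)) U≤))
      where
      U : ℕ → Bool
      U k = not (Nb c k)
      U⊂A : ∀ k → k < ℓ → Is (U k) → Is (A c k)
      U⊂A = #-⊇ ℓ (λ k k< → A⊂U c k<) (≤-trans U≤ (A≥t c))
      cl : ∀ i → suc i < ℓ → Is (U (suc i)) → Is (U i)
      cl i i< u = not⁺ (cross nc c i< (U⊂A (suc i) i< u))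

    -- Positions that can be moved to either end of the path without changing its edges
    ends : Path → ℕ → Bool
    ends c zero    = true
    ends c (suc k) = ((suc k <ᵇ ℓ) ∧ S' c (suc k)) ∨ T' c k

    -- `NoCross` keeps the two kinds of positions apart; position `0` accounts for index `0`, which
    -- is always in `S'`.
    #ends : ∀ c → # (suc ℓ) (ends c) ≡ # ℓ (S' c) + # ℓ (T' c) 
    #ends c = trans (#-shift ℓ (ends c)) (trans (cong suc (trans (eq ℓ ≤-refl) refl)) fin)
      where
      X : ℕ → Bool
      X k = (suc k <ᵇ ℓ) ∧ S' c (suc k)
      eq : ∀ n → n ≤ ℓ → # n (λ k → X k ∨ T' c k) ≡ # n X + # n (T' c)
      eq n n≤ = ≤-antisym (#-cov n (λ k _ h → ∨⁻ {X k} h))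
        (#-disj n (λ k _ → ∨⁺¹) (λ k _ → ∨⁺² {X k}) (λ k k< a b → nc c (<ᵇ⁻ (∧⁻¹ a)) (∨⁺² {Nb c k} b) (S'→A c {suc k} (∧⁻² {suc k <ᵇ ℓ} a))))
      shiftS : suc (# ℓ X) ≡ # ℓ (S' c)
      shiftS = go ℓ refl
        where
        go : ∀ n → n ≡ ℓ → suc (# n X) ≡ # n (S' c)
        go zero    e = ⊥-elim (<⇒≢ 0<ℓ e)
        go (suc n) e = trans (cong suc (cong₂ _+_ top (#-ext n (λ k k< → b≡ (∧⁻² {suc k <ᵇ ℓ}) (∧⁺ (<ᵇ⁺ (≤-trans (s≤s k<) (≤-reflexive e))))))))
                         (sym (trans (#-shift n (S' c)) (cong (λ b → b2n b + # n (λ k → S' c (suc k))) (S'0 c 0<ℓ))))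
          where
          top : b2n (X n) ≡ 0
          top = cong b2n (b≡ {X n} {false} (λ h → ⊥-elim (1+n≰n (≤-trans (<ᵇ⁻ {suc n} {ℓ} (∧⁻¹ h)) (≤-reflexive (sym e))))) (λ ()))
      fin : suc (# ℓ X + # ℓ (T' c)) ≡ # ℓ (S' c) + # ℓ (T' c)
      fin = cong (_+ # ℓ (T' c)) shiftS

    module Bad (bad : ∀ c → # ℓ (S c) < t) where

      T'≥t : ∀ c → t ≤ # ℓ (T' c)
      T'≥t c = ≤-trans (lowS (Mir c) (bad (Mir c))) (≤-reflexive (#-rev ℓ (T' c)))

      front≥t : ∀ c {k} → k < ℓ → Is (S' c k) → t ≤ pdeg c k
      front≥t c k< s' = subst (t ≤_) (Rot-S' c k< s') (lowS (Rot c (pathFront c k< s')) (bad (Rot c (pathFront c k< s'))))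

      ends≥t : ∀ c k → k < suc ℓ → Is (ends c k) → t ≤ pdeg c k
      ends≥t c zero    _        _ = lowS c (bad c)
      ends≥t c (suc k) (s≤s k<) h = go (∨⁻ {(suc k <ᵇ ℓ) ∧ S' c (suc k)} h)
        where
        go : Is ((suc k <ᵇ ℓ) ∧ S' c (suc k)) ⊎ Is (T' c k) → t ≤ pdeg c (suc k)
        go (inj₁ a) = front≥t c (<ᵇ⁻ (∧⁻¹ a)) (∧⁻² {suc k <ᵇ ℓ} a)
        go (inj₂ b) = subst (t ≤_) (trans (Mir-pdeg c (ℓ ∸ suc k)) (cong (pdeg c) (m∸[m∸n]≡n k<)))
          (front≥t (Mir c) (∸suc-< ℓ k k<) (subst (λ z → Is (M c (y c z) ℓ)) (sym (∸-invol k<)) b))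

      weight : ∀ c → # (suc ℓ) (ends c) * t + (suc ℓ ∸ # (suc ℓ) (ends c)) * 1 ≤ ℓ * suc q
      weight c = ≤-trans (total-# (suc ℓ) (pdeg c) (ends c) t 1 (≤-trans (s≤s z≤n) q<t) (ends≥t c) (pdeg≥1 c 0<ℓ)) (≤-reflexive (sumP c))

      ends≥ : ∀ c → t + t ≤ # (suc ℓ) (ends c)
      ends≥ c = ≤-trans (+-mono-≤ (lowS c (bad c)) (T'≥t c)) (≤-reflexive (sym (#ends c)))

      -- The path edges have `ℓ * (q + 1) ≤ ℓ * t` incidences, which `ℓ` ends of weight `t` and one
      -- further vertex already exceed.
      ends< : ∀ c → # (suc ℓ) (ends c) < ℓ
      ends< c = ≰⇒> λ ℓ≤ → count (# (suc ℓ) (ends c)) ℓ≤ (m≤n⇒m<n∨m≡n (#-≤ (suc ℓ) (ends c))) (≤-trans (weight c) (*-monoʳ-≤ ℓ q<t))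
        where
        count : ∀ E → ℓ ≤ E → E < suc ℓ ⊎ E ≡ suc ℓ → E * t + (suc ℓ ∸ E) * 1 ≤ ℓ * t → ⊥
        count E ℓ≤ (inj₁ lt)   w = 1+n≰n (≤-trans (≤-trans (≤-reflexive (+-comm 1 (ℓ * t))) (+-mono-≤ (*-monoˡ-≤ t ℓ≤)
                                     (≤-trans (m<n⇒0<n∸m lt) (≤-reflexive (sym (*-identityʳ _)))))) w)
        count E ℓ≤ (inj₂ refl) w = 1+n≰n (≤-trans (+-monoˡ-≤ (ℓ * t) (≤-trans (s≤s z≤n) q<t)) (≤-trans (m≤m+n (suc ℓ * t) _) w))

  -- Odd number of vertices, and edges with at least half of the vertices

  MirNb≡ : ∀ c {k} → k < ℓ → Nb (Mir c) k ≡ S c (ℓ ∸ suc k)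
  MirNb≡ c {k} k< = b≡ (λ h → subst (λ z → Is (Nf c z)) (sym (suc-∸suc k<)) (MirNb⁻ c h))
                       (λ h → MirNb⁺ c (subst (λ z → Is (Nf c z)) (suc-∸suc k<) h))

  Mir-#Nb : ∀ c → # ℓ (Nb (Mir c)) ≡ # ℓ (S c)
  Mir-#Nb c = trans (#-ext ℓ (λ k → MirNb≡ c)) (#-rev ℓ (S c))

  Mir-#U : ∀ c → # ℓ (S c) + # ℓ (λ k → not (Nb (Mir c) k)) ≡ ℓ
  Mir-#U c = trans (cong (_+ # ℓ (λ k → not (Nb (Mir c) k))) (sym (Mir-#Nb c))) (#-not ℓ (Nb (Mir c)))

  oddCase : ∀ t → ℓ ≡ t + t → 2 ≤ q → q < t → D ≡ suc (bin t q) → NoCross → Path → ⊥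
  -- There are at least `2t = ℓ` ends.
  oddCase t ℓ≡ 2≤q q<t D≡ nc c = <⇒≱ (ends< c) (≤-trans (≤-reflexive ℓ≡) (ends≥ c))
    where
    1≤t : 1 ≤ t
    1≤t = ≤-trans (s≤s z≤n) q<t
    open Range t 2≤q q<t D≡ (≤-trans (+-monoˡ-≤ t 1≤t) (≤-reflexive (sym ℓ≡))) nc
    bad : ∀ c → # ℓ (S c) < t
    bad c = ≰⇒> λ t≤ → few-Nb (Mir c) (≮⇒≥ λ lt → refute (# ℓ (S c) ∷ # ℓ (λ k → not (Nb (Mir c) k)) ∷ t ∷ ℓ ∷ [])
      (ν 2 ≼ ν 0 ∷ κ 1 ⊕ ν 2 ≼ ν 1 ∷ ν 0 ⊕ ν 1 ≼ ν 3 ∷ ν 3 ≼ ν 2 ⊕ ν 2 ∷ [])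
      (t≤ ∷ lt ∷ ≤-reflexive (Mir-#U c) ∷ ≤-reflexive ℓ≡ ∷ []) refl)
    open Bad bad

  bigCase : suc q ≤ D → ℓ ≤ q + q → 0 < ℓ → Path → ⊥
  bigCase q<D ℓ≤ 0<ℓ = lastFree q<D (≤-trans (s≤s ℓ≤) (≤-trans (n≤1+n _) (≤-reflexive (cong suc (sym (+-suc q q))))))
    (λ c lf → confined c q<D (+-cancelʳ-≤ q (# ℓ (λ k → not (Nb c k))) q (≤-trans (last-U c lf) ℓ≤)) 0<ℓ)

  U : Path → ℕ → Bool
  U c k = not (Nb c k)

  -- Stated for a second path `c'` so as to cover the path after the exchange of `y 0`.
  avoid : NoCross → ∀ c z → suc z < ℓ → ¬ Is (U c z) → ∀ c' → (∀ {k} → Is (Nb c k) → Is (Nb c' k)) →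
          ∀ k → k < ℓ → Is (A c' k) → Is (U c k ∧ not (single (suc z) k))
  avoid nc c z z< ¬u c' sub k k< a = ∧⁺ (not⁺ (λ n → F1 c' k< a (sub n)))
    (not⁺ (λ e → cross nc c' {z} z< (subst (λ w → Is (A c' w)) (⌊⌋⁻ e) a) (sub (stable (λ n → ¬u (not⁺ n))))))

  -- If the first vertex is on a free edge, `S` has at least `q` elements, so the mirrored `U` has
  -- at most `q + 1` and must be the segment `0, …, q`. This confines `S` to the indices below `q`,
  -- where `bin q q = 1` allows one edge, while the exchange of `y 0` gives two.
  halfCase : ℓ ≡ suc (q + q) → 0 < q → D ≡ suc q → NoCross → Path → ⊥
  halfCase ℓ≡ 0<q D≡ nc = lastFree q<D (≤-reflexive (cong suc (trans ℓ≡ (sym (+-suc q q)))))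
      (λ c (e , fe , eℓ) → noFirst (Mir c) (Mir-free c fe) eℓ)
    where
    q<D : suc q ≤ D
    q<D = ≤-reflexive (sym D≡)
    0<ℓ : 0 < ℓ
    0<ℓ = subst (0 <_) (sym ℓ≡) (s≤s z≤n)
    U+S : ∀ c → # ℓ (S c) + # ℓ (U (Mir c)) ≤ suc (q + q)
    U+S c = ≤-reflexive (trans (Mir-#U c) ℓ≡)
    bin≤1 : ∀ {s} → s ≤ q → bin s q ≤ 1
    bin≤1 h = ≤-trans (bin-mono q h) (≤-reflexive (bin-nn q))
    q≤S : ∀ c → 1 ≤ fdeg c 0 → q ≤ # ℓ (S c)
    q≤S c f≥1 = ≮⇒≥ λ lt → 1+n≰n (≤-trans f≥1 (≤-trans (fdeg-bound c) (≤-reflexive (bin-zero lt))))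
    gap : ∀ c → # ℓ (U c) ≤ suc q → ∀ z → suc z < ℓ → Is (U c (suc z)) → ¬ Is (U c z) → ⊥
    gap c U≤ z z< uz ¬uz = refute (fdeg c 0 ∷ []) (κ 1 ⊕ ν 0 ≼ κ 1 ∷ κ 1 ≼ ν 0 ∷ [])
        (≤-trans (Swap0-bound c O 0<ℓ S0 S⊂O (λ e0 e1 fe l k k< h → let c' = Swap c (link l e0 e1 (inj₂ fe)) in
            avoid nc c z z< ¬uz c' (Swap0-Nb⁺ l e0 e1 fe) k k< (S→A c' h))) (bin≤1 O≤) ∷ f≥1 ∷ []) refl
      where
      O : ℕ → Bool
      O k = U c k ∧ not (single (suc z) k)
      A⊂O : ∀ k → k < ℓ → Is (A c k) → Is (O k)
      A⊂O = avoid nc c z z< ¬uz c (λ n → n)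
      S⊂O : ∀ k → k < ℓ → Is (S c k) → Is (O k)
      S⊂O k k< s = A⊂O k k< (S→A c s)
      O≤ : # ℓ O ≤ q
      O≤ = #-drop ℓ {U c} z< uz U≤
      f≥1 : 1 ≤ fdeg c 0
      f≥1 = ≮⇒≥ λ lt → refute (D ∷ q ∷ fdeg c 0 ∷ # ℓ (S' c) ∷ # ℓ O ∷ [])
        (κ 1 ⊕ ν 1 ≼ ν 0 ∷ ν 0 ≼ ν 2 ⊕ ν 3 ∷ ν 3 ≼ ν 4 ∷ ν 4 ≼ ν 1 ∷ κ 1 ⊕ ν 2 ≼ κ 1 ∷ [])
        (q<D ∷ degAt c 0 ∷ #-⊆ ℓ (λ k k< h → A⊂O k k< (S'→A c {k} h)) ∷ O≤ ∷ lt ∷ []) refl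
      S0 : Is (S c 0)
      S0 = #-⊇ ℓ S⊂O (≤-trans O≤ (q≤S c f≥1)) 0 0<ℓ (A⊂O 0 0<ℓ (S'→A c {0} (S'0 c 0<ℓ)))
    U-init : ∀ c → # ℓ (U c) ≤ suc q → ∀ i → i < ℓ → i < suc q → Is (U c i)
    U-init c U≤ i i< i≤q = go (closedOr ℓ (U c))
      where
      go : _ ⊎ _ → Is (U c i)
      go (inj₁ cl)                = proj₂ (closed-init ℓ cl i i<) (≤-trans i≤q (≮⇒≥ λ lt → confined c q<D (≤-pred lt) 0<ℓ))
      go (inj₂ (z , z< , u , ¬u)) = ⊥-elim (gap c U≤ z z< u ¬u)
    S< : ∀ c → 1 ≤ fdeg c 0 → ∀ i → i < ℓ → Is (S c i) → Is (i <ᵇ q)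
    S< c f≥1 i i< s = <ᵇ⁺ (≰⇒> λ q≤i → not⁻ (U-init (Mir c) W (ℓ ∸ suc i) (∸suc-< ℓ i i<) (small q≤i))
        (trans (MirNb≡ c (∸suc-< ℓ i i<)) (trans (cong (S c) (∸-invol i<)) s)))
      where
      W : # ℓ (U (Mir c)) ≤ suc q
      W = ≮⇒≥ λ lt → refute (# ℓ (S c) ∷ # ℓ (U (Mir c)) ∷ q ∷ [])
        (ν 2 ≼ ν 0 ∷ κ 2 ⊕ ν 2 ≼ ν 1 ∷ ν 0 ⊕ ν 1 ≼ κ 1 ⊕ (ν 2 ⊕ ν 2) ∷ []) (q≤S c f≥1 ∷ lt ∷ U+S c ∷ []) refl
      small : q ≤ i → ℓ ∸ suc i < suc q
      small q≤i = s≤s (≤-trans (∸-mono (≤-reflexive ℓ≡) (s≤s q≤i)) (≤-reflexive (m+n∸m≡n q q)))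
    noFirst : ∀ c {e} → Free c e → Is (M c e 0) → ⊥
    noFirst c {e} fe e0 = refute (fdeg c 0 ∷ []) (κ 1 ⊕ ν 0 ≼ κ 1 ∷ κ 1 ≼ ν 0 ∷ [])
        (≤-trans (Swap0-bound c (_<ᵇ q) 0<ℓ S0 (S< c f≥1) (λ e0 e1 fe l → freed (link l e0 e1 (inj₂ fe)) fe))
          (bin≤1 (#-below ℓ q)) ∷ f≥1 ∷ []) refl
      where
      f≥1 : 1 ≤ fdeg c 0
      f≥1 = cnt-pos (allFin m) (∈-allFin e) (∧⁺ (fr⁺ c fe) e0)
      S0 : Is (S c 0)
      S0 = #-⊇ ℓ (S< c f≥1) (≤-trans (#-below ℓ q) (q≤S c f≥1)) 0 0<ℓ (<ᵇ⁺ 0<q)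
      freed : (a : Link c 0) → Free c (Link.e a) → ∀ i → i < ℓ → Is (S (Swap c a) i) → Is (i <ᵇ q)
      freed a fe = S< (Swap c a) (cnt-pos (allFin m) (∈-allFin (y c 0)) (∧⁺ (fr⁺ (Swap c a) (Swap-new a fe)) (lkˡ c 0<ℓ)))

  -- The path with its back moved to position j + 1 along a free edge e through j: the
  -- positions behind j are reversed.
  record Back (c : Path) (j : ℕ) (e : Fin m) : Set where
    field
      c′    : Path
      x≡    : ∀ {k} → k ≤ j → x c′ k ≡ x c k
      y≡    : ∀ {k} → k < j → y c′ k ≡ y c k
      xℓ    : x c′ ℓ ≡ x c (suc j)
      keep  : ∀ {z} → Free c z → z ≢ e → Free c′ z
      freed : Free c′ (y c j)

  moveBack : ∀ c {j e} → j < ℓ → Free c e → Is (M c e ℓ) → Is (M c e j) → Back c j e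
  moveBack c {j} {e} j< fe eℓ ej = record
    { c′    = Mir c2
    ; x≡    = λ {k} k≤ → cong (x c) (trans (cong (ℓ ∸_) (ρ> (subst (_≤ ℓ ∸ k) (sym (suc-∸suc j<)) (∸-monoʳ-≤ ℓ k≤)))) (m∸[m∸n]≡n (≤-trans k≤ (<⇒≤ j<))))
    ; y≡    = λ {k} k< → trans (Rot-y> a (subst (_≤ ℓ ∸ suc k) (sym (suc-∸suc j<)) (∸-monoʳ-≤ ℓ k<))) (cong (y c) (∸-invol (<-trans k< j<)))
    ; xℓ    = trans (Mir-xℓ c2) (trans (Rot-x0 a) (cong (x c) (m∸[m∸n]≡n j<)))
    ; keep  = λ fz z≢ → Mir-free c2 (Rot-keep a (Mir-free c fz) z≢)
    ; freed = Mir-free c2 (subst (λ z → Free c2 (y c z)) (∸-invol j<) (Rot-new a (Mir-free c fe)))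
    }
    where
    a : Front (Mir c) (ℓ ∸ suc j)
    a = front (∸suc-< ℓ j j<) eℓ (subst (λ k → Is (M c e k)) (sym (trans (cong (ℓ ∸_) (suc-∸suc j<)) (m∸[m∸n]≡n (<⇒≤ j<)))) ej) (inj₂ (Mir-free c fe))
    c2 = Rot (Mir c) a

  module _ {c j e} (fe : Free c e) (eℓ : Is (M c e ℓ)) (j< : j < ℓ) (b : Back c j e) where
    open Back b

    Back-S : ∀ {k} → k < j → Is (S c k) → Is (S c′ k)
    Back-S {k} k< s = go (Nf⁻ c s)
      where
      go : (Σ (Fin m) λ z → Free c z × Is (M c z 0) × Is (M c z (suc k))) → Is (S c′ k)
      go (z , fz , z0 , zk) = Nf⁺ c′ (keep fz (λ { refl → noHam c fe z0 eℓ })) (subst (λ v → Is (inc z v)) (sym (x≡ z≤n)) z0)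
                                       (subst (λ v → Is (inc z v)) (sym (x≡ k<)) zk)

    Back-A : ∀ {k} → k < j → Is (A c k) → Is (A c′ k)
    Back-A {k} k< h = go (∨⁻ {S c k} h)
      where
      go : Is (S c k) ⊎ Is (S' c k) → Is (A c′ k)
      go (inj₁ s)  = S→A c′ (Back-S k< s)
      go (inj₂ s') = S'→A c′ {k} (subst₂ (λ z v → Is (inc z v)) (sym (y≡ k<)) (sym (x≡ z≤n)) s')

    Back-Nb : ∀ {h k} → Usable c j h → h ≢ e → Is (M c h (suc j)) → k ≤ j → Is (M c h k) → Is (Nb c′ k)
    Back-Nb {h} {k} u h≢ hj k≤ hk = Nb⁺ c′ (free u) (subst (λ v → Is (inc h v)) (sym xℓ) hj) (subst (λ v → Is (inc h v)) (sym (x≡ k≤)) hk)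
      where
      free : Usable c j h → Free c′ h
      free (inj₁ refl) = freed
      free (inj₂ fh)   = keep fh h≢

    Back-T' : ∀ {k} → k < j → Is (M c (y c k) (suc j)) → Is (T' c′ k)
    Back-T' k< h = subst₂ (λ z v → Is (inc z v)) (sym (y≡ k<)) (sym xℓ) h

  -- Even number of vertices: `U` is an initial segment

  module Initial (t : ℕ) (ℓ≡ : ℓ ≡ suc (t + t)) (2≤q : 2 ≤ q) (q<t : q < t) (D≡ : D ≡ suc (bin t q)) (t<ℓ : t < ℓ) (nc : NoCross) where
    open Range t 2≤q q<t D≡ t<ℓ nc

    Init : Path → Set
    Init c = ∀ k → k < ℓ → (Is (U c k) → k ≤ t) × (k ≤ t → Is (U c k))

    below : ℕ → Bool
    below k = k <ᵇ suc t

    A⊂ : ∀ c → Init c → ∀ k → k < ℓ → Is (A c k) → Is (below k)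
    A⊂ c p k k< a = <ᵇ⁺ (s≤s (proj₁ (p k k<) (A⊂U c k< a)))

    Init-Rot : ∀ c → Init c → ∀ {i} (a : Front c i) → i < t → Init (Rot c a)
    Init-Rot c p {i} a i<t k k< with k ≤? i
    ... | yes le = (λ _ → ≤-trans le (<⇒≤ i<t)) , (λ _ → not⁺ (λ n → not⁻ (proj₂ (p (i ∸ k) (≤-trans (s≤s (m∸n≤m i k)) (<-trans i<t t<ℓ)))
                     (≤-trans (m∸n≤m i k) (<⇒≤ i<t))) (subst (λ z → Is (Nb c z)) (ρ≤ le) (Rot-Nb⁻ a n))))
    ... | no gt  = (λ u → proj₁ (p k k<) (not⁺ (λ n → not⁻ u (Rot-Nb⁺ a (subst (λ z → Is (Nb c z)) (sym (ρ> (≰⇒> gt))) n))))) ,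
                   (λ k≤ → not⁺ (λ n → not⁻ (proj₂ (p k k<) k≤) (subst (λ z → Is (Nb c z)) (ρ> (≰⇒> gt)) (Rot-Nb⁻ a n))))

    Init-Swap : ∀ c → Init c → ∀ {e} (l : 0 < ℓ) (e0 : Is (M c e 0)) (e1 : Is (M c e 1)) (fe : Free c e) → Init (Swap c (link l e0 e1 (inj₂ fe)))
    Init-Swap c p l e0 e1 fe k k< = (λ u → proj₁ (p k k<) (not⁺ (λ n → not⁻ u (Swap0-Nb⁺ l e0 e1 fe n)))) ,
                                    (λ k≤ → not⁺ (λ n → not⁻ (proj₂ (p k k<) k≤) (Swap0-Nb⁻ l e0 e1 fe n)))

    backEdge : ∀ c → Init c → ∀ {j} → t < j → j < ℓ → Σ (Fin m) λ e → Free c e × Is (M c e ℓ) × Is (M c e j)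
    backEdge c p {j} t<j j< = Nb⁻ c (stable (λ n → <⇒≱ t<j (proj₁ (p j j<) (not⁺ n))))

    twoHoles : ∀ c → Init c → ∀ {k k'} → k < k' → k' ≤ t → ¬ Is (A c k) → ¬ Is (A c k') → ⊥
    twoHoles c p {k} {k'} k<k' k'≤t ¬a ¬a' = 1+n≰n (≤-trans (s≤s (≤-trans (A≥t c) (#-⊆ ℓ sub))) O≤)
      where
      O₁ O : ℕ → Bool
      O₁ i = below i ∧ not (single k i)
      O i = O₁ i ∧ not (single k' i)
      k'<ℓ : k' < ℓ
      k'<ℓ = ≤-trans (s≤s k'≤t) t<ℓ
      sub : ∀ i → i < ℓ → Is (A c i) → Is (O i)
      sub i i< a = ∧⁺ (∧⁺ (A⊂ c p i i< a) (not⁺ (λ e → ¬a (subst (λ z → Is (A c z)) (⌊⌋⁻ e) a)))) (not⁺ (λ e → ¬a' (subst (λ z → Is (A c z)) (⌊⌋⁻ e) a)))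
      O₁≤ : # ℓ O₁ ≤ t
      O₁≤ = #-drop ℓ {below} (<-trans k<k' k'<ℓ) (<ᵇ⁺ (s≤s (≤-trans (<⇒≤ k<k') k'≤t))) (#-below ℓ (suc t))
      O≤ : suc (# ℓ O) ≤ t
      O≤ = ≤-trans (#-add1 ℓ {O} {O₁} (λ i _ → ∧⁻¹) k'<ℓ (∧⁺ (<ᵇ⁺ (s≤s k'≤t)) (not⁺ (λ e → <⇒≢ k<k' (sym (⌊⌋⁻ e))))) (λ b → not⁻ (∧⁻² {O₁ k'} b) (⌊⌋⁺ refl))) O₁≤

    -- Move the back to `x (j + 1)`. Then `h` is a free edge at the new last vertex and `k` is its
    -- neighbour, while `A` keeps its elements below `j`; so `F1` and `cross` apply.
    blockA : ∀ c → Init c → ∀ {j h} → t < j → j < ℓ → Usable c j h → Is (M c h (suc j)) → ∀ {k} → k ≤ t → Is (M c h k) →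
             ¬ Is (A c k) × (suc k ≤ t → ¬ Is (A c (suc k)))
    blockA c p {j} {h} t<j j< u hj {k} k≤ hk = go (backEdge c p t<j j<)
      where
      go : (Σ (Fin m) λ e → Free c e × Is (M c e ℓ) × Is (M c e j)) → _
      go (e , fe , eℓ , ej) = (λ a → F1 c′ k<ℓ (Back-A fe eℓ j< b k<j a) nb) ,
                              (λ k< a → cross nc c′ (≤-trans (s≤s k<) t<ℓ) (Back-A fe eℓ j< b (≤-trans (s≤s k<) t<j) a) nb)
        where
        b = moveBack c j< fe eℓ ej
        open Back b
        k<j : k < j
        k<j = ≤-trans (s≤s k≤) t<j
        k<ℓ : k < ℓ
        k<ℓ = <-trans k<j j<
        nb : Is (Nb c′ k)
        nb = Back-Nb fe eℓ j< b u (λ { refl → not⁻ (proj₂ (p k k<ℓ) k≤) (Nb⁺ c fe eℓ hk) }) hj (<⇒≤ k<j) hk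

    blockFirst : ∀ c → Init c → ∀ {j h} → t < j → j < ℓ → Usable c j h → Is (M c h (suc j)) → ¬ Is (M c h 0)
    blockFirst c p t<j j< u hj h0 = proj₁ (blockA c p t<j j< u hj z≤n h0) (S'→A c {0} (S'0 c 0<ℓ))

    -- The move of `blockA`; now the edge in question stays on the path, so it gives `T'` instead of
    -- `Nb`, and `F2` excludes only `S` at `k`.
    blockS : ∀ c → Init c → ∀ {j k} → t < j → j < ℓ → k ≤ t → Is (M c (y c k) (suc j)) →
             ¬ Is (S c k) × (suc k ≤ t → ¬ Is (A c (suc k)))
    blockS c p {j} {k} t<j j< k≤ h = go (backEdge c p t<j j<)
      where
      go : (Σ (Fin m) λ e → Free c e × Is (M c e ℓ) × Is (M c e j)) → _
      go (e , fe , eℓ , ej) = (λ s → F2 c′ (<-trans k<j j<) (Back-S fe eℓ j< b k<j s) bk) ,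
                              (λ k< a → nc c′ (≤-trans (s≤s k<) t<ℓ) bk (Back-A fe eℓ j< b (≤-trans (s≤s k<) t<j) a))
        where
        b = moveBack c j< fe eℓ ej
        open Back b
        k<j : k < j
        k<j = ≤-trans (s≤s k≤) t<j
        bk : Is (B c′ k)
        bk = ∨⁺² {Nb c′ k} (Back-T' fe eℓ j< b k<j h)

    -- Edges usable behind position t do not reach the first t + 1 positions:
    -- one through t would exclude the index t at every reachable front.
    apart : ∀ c → Init c → ∀ {j h} → t < j → j < ℓ → Usable c j h → Is (M c h (suc j)) → ∀ {k} → k ≤ t → ¬ Is (M c h k)
    apart c p {j} {h} t<j j< u hj {k} k≤ hk = go (m≤n⇒m<n∨m≡n k≤)
      where
      P : Path → Set
      P c = Init c × Usable c j h × Is (M c h (suc j)) × Is (M c h t)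
      P-A : ∀ c → P c → ∀ {k} → k < ℓ → Is (A c k) → k < t
      P-A c (p , u , hj , ht) {k} k< a = ≤∧≢⇒< (≤-pred (<ᵇ⁻ {k} {suc t} (A⊂ c p k k< a))) (λ { refl → proj₁ (blockA c p t<j j< u hj ≤-refl ht) a })
      P-Rot : ∀ c → P c → ∀ {i} (a : Front c i) → i < t → P (Rot c a)
      P-Rot c (p , u , hj , ht) {i} a i<t = Init-Rot c p a i<t , use u , at (<-trans (<-trans i<t t<j) (n<1+n j)) hj , at i<t ht
        where
        use : Usable c j h → Usable (Rot c a) j h
        use (inj₁ e) = inj₁ (trans e (sym (Rot-y> a (<-trans i<t t<j))))
        use (inj₂ f) = inj₂ (Rot-keep a f (λ { refl → blockFirst c p t<j j< u hj (Front.e0 a) }))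
        at : ∀ {k} → i < k → Is (M c h k) → Is (M (Rot c a) h k)
        at i<k = subst (λ z → Is (inc h (x c z))) (sym (ρ> i<k))
      P-Swap : ∀ c → P c → ∀ {e} (l : 0 < ℓ) (e0 : Is (M c e 0)) (e1 : Is (M c e 1)) (fe : Free c e) → P (Swap c (link l e0 e1 (inj₂ fe)))
      P-Swap c (p , u , hj , ht) {e} l e0 e1 fe = Init-Swap c p l e0 e1 fe , use u , hj , ht
        where
        a : Link c 0
        a = link l e0 e1 (inj₂ fe)
        use : Usable c j h → Usable (Swap c a) j h
        use (inj₁ z) = inj₁ (trans z (sym (Swap-y≢ a (λ e → <⇒≢ (≤-trans (s≤s z≤n) t<j) (sym e)))))
        use (inj₂ f) = inj₂ (Swap-keep a f (λ { refl → blockFirst c p t<j j< u hj e0 }))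
      go : k < t ⊎ k ≡ t → ⊥
      go (inj₁ lt)   = twoHoles c p ≤-refl lt (proj₁ (blockA c p t<j j< u hj k≤ hk)) (proj₂ (blockA c p t<j j< u hj k≤ hk) lt)
      go (inj₂ refl) = Clique.clique P P-A P-Rot P-Swap c (p , u , hj , hk)

    Bridge : Path → ℕ → ℕ → Set
    Bridge c j k = t < j × j < ℓ × k ≤ t × Is (M c (y c k) (suc j))

    -- Otherwise, by `apart`, all edges through `x (j + 1)` avoid the first `t + 1` positions. They
    -- lie among the `t + 1` others, too few for the degree.
    bridge : ∀ c → Init c → ∀ {j} → t < j → j < ℓ → Σ ℕ (Bridge c j)
    bridge c p {j} t<j j< = go (1 ≤? # (suc t) (λ k → M c (y c k) (suc j)))
      where
      go : Dec (1 ≤ # (suc t) (λ k → M c (y c k) (suc j))) → Σ ℕ (Bridge c j)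
      go (yes h) = let (k , k< , hk) = #-wit (suc t) h in k , t<j , j< , ≤-pred k< , hk
      go (no n)  = ⊥-elim (none (backEdge c p t<j j<))
        where
        none : (Σ (Fin m) λ e → Free c e × Is (M c e ℓ) × Is (M c e j)) → ⊥
        none (e , fe , eℓ , ej) = 1+n≰n (≤-trans (≤-trans (≤-reflexive (sym D≡)) (deg (x c′ ℓ)))
            (≤-trans (famL (xinj c′) N (λ h → inc h (x c′ ℓ)) (λ _ h → h) far) (bin-mono q N≤)))
          where
          b = moveBack c j< fe eℓ ej
          open Back b
          N : ℕ → Bool
          N i = not (below i)
          N≤ : # ℓ N ≤ t
          N≤ = ≮⇒≥ λ lt → refute (# ℓ N ∷ # ℓ below ∷ ℓ ∷ t ∷ [])
            (κ 1 ⊕ ν 3 ≼ ν 0 ∷ ν 1 ⊕ ν 0 ≼ ν 2 ∷ ν 2 ≼ κ 1 ⊕ (ν 3 ⊕ ν 3) ∷ κ 1 ⊕ ν 3 ≼ ν 1 ∷ [])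
            (lt ∷ ≤-reflexive (#-not ℓ below) ∷ ≤-reflexive ℓ≡ ∷ #-below≥ ℓ t<ℓ ∷ []) refl
          far' : ∀ h → Is (M c h (suc j)) → ∀ i → i ≤ t → Is (M c h i) → Free c h ⊎ (Σ ℕ λ k → k < ℓ × y c k ≡ h) → ⊥
          far' h hj i i≤ hi (inj₁ f) = apart c p t<j j< (inj₂ f) hj i≤ hi
          far' h hj i i≤ hi (inj₂ (k , k< , refl)) = go' (k ≤? t)
            where
            go' : Dec (k ≤ t) → ⊥
            go' (yes k≤) = n (#-pos (suc t) (s≤s k≤) hj)
            go' (no k≰)  = apart c p (≰⇒> k≰) k< (inj₁ refl) (lkʳ c k<) i≤ hi
          far : ∀ h → Is (inc h (x c′ ℓ)) → ∀ i → i < ℓ → Is (inc h (x c′ i)) → Is (N i)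
          far h hℓ i i< hi = not⁺ (λ lt → far' h (subst (λ v → Is (inc h v)) xℓ hℓ) i (≤-pred (<ᵇ⁻ {i} {suc t} lt))
            (subst (λ v → Is (inc h v)) (x≡ (≤-trans (≤-pred (<ᵇ⁻ {i} {suc t} lt)) (<⇒≤ t<j))) hi) (free? c h))

    -- `A` has at most one hole among `0, …, t`, and each bridge makes one just behind itself, so
    -- `k' = t`. Then `S` consists of all these indices but `k` and `t`; as `k + 1` is a hole,
    -- `k + 1 = t`, and the exchange of `y 0` finishes.
    bridges< : ∀ c → Init c → ∀ {j j' k k'} → Bridge c j k → Bridge c j' k' → k < k' → ⊥
    bridges< c p {j} {j'} {k} {k'} br@(t<j , j< , k≤ , h) br'@(t<j' , j'< , k'≤ , h') k<k' = go (m≤n⇒m<n∨m≡n k'≤)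
      where
      k+1≤ : suc k ≤ t
      k+1≤ = ≤-trans k<k' k'≤
      ¬A : ¬ Is (A c (suc k))
      ¬A = proj₂ (blockS c p t<j j< k≤ h) k+1≤
      O₁ O : ℕ → Bool
      O₁ i = below i ∧ not (single k i)
      O i = O₁ i ∧ not (single k' i)
      k<ℓ : k < ℓ
      k<ℓ = ≤-trans (s≤s k≤) t<ℓ
      k'<ℓ : k' < ℓ
      k'<ℓ = ≤-trans (s≤s k'≤) t<ℓ
      O₁≤ : # ℓ O₁ ≤ t
      O₁≤ = #-drop ℓ {below} k<ℓ (<ᵇ⁺ (s≤s k≤)) (#-below ℓ (suc t))
      O≤ : suc (# ℓ O) ≤ t
      O≤ = ≤-trans (#-add1 ℓ {O} {O₁} (λ i _ → ∧⁻¹) k'<ℓ (∧⁺ (<ᵇ⁺ (s≤s k'≤)) (not⁺ (λ e → <⇒≢ k<k' (sym (⌊⌋⁻ e))))) (λ b → not⁻ (∧⁻² {O₁ k'} b) (⌊⌋⁺ refl))) O₁≤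
      S⊂O : ∀ c' → Init c' → Bridge c' j k → Bridge c' j' k' → ∀ i → i < ℓ → Is (S c' i) → Is (O i)
      S⊂O c' p' (t<j , j< , k≤ , h) (t<j' , j'< , k'≤ , h') i i< s = ∧⁺ (∧⁺ (A⊂ c' p' i i< (S→A c' s))
        (not⁺ (λ e → proj₁ (blockS c' p' t<j j< k≤ h) (subst (λ z → Is (S c' z)) (⌊⌋⁻ e) s))))
        (not⁺ (λ e → proj₁ (blockS c' p' t<j' j'< k'≤ h') (subst (λ z → Is (S c' z)) (⌊⌋⁻ e) s)))
      s'≤ : # ℓ (S' c) ≤ t
      s'≤ = ≤-pred (≤-trans (#-add1 ℓ {S' c} {below} (λ i i< s → A⊂ c p i i< (S'→A c {i} s)) (≤-trans (s≤s k+1≤) t<ℓ) (<ᵇ⁺ (s≤s k+1≤)) (λ s → ¬A (S'→A c {suc k} s))) (#-below ℓ (suc t)))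
      s≥ : t ≤ suc (# ℓ (S c))
      s≥ = ≮⇒≥ λ lt → 1+n≰n (≤-trans (lowS2 c lt) s'≤)
      full : ∀ i → i < ℓ → Is (O i) → Is (S c i)
      full = #-⊇ ℓ (S⊂O c p br br') (≤-pred (≤-trans O≤ s≥))
      inO : ∀ {i} → i ≤ t → i ≢ k → i ≢ k' → Is (O i)
      inO i≤ n n' = ∧⁺ (∧⁺ (<ᵇ⁺ (s≤s i≤)) (not⁺ (λ e → n (⌊⌋⁻ e)))) (not⁺ (λ e → n' (⌊⌋⁻ e)))
      go : k' < t ⊎ k' ≡ t → ⊥
      go (inj₁ lt)   = twoHoles c p (s≤s k<k') lt ¬A (proj₂ (blockS c p t<j' j'< k'≤ h') lt)
      go (inj₂ refl) = go' (suc k ≟ t)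
        where
        go' : Dec (suc k ≡ t) → ⊥
        go' (no n)     = ¬A (S→A c (full (suc k) (≤-trans (s≤s k+1≤) t<ℓ) (inO k+1≤ 1+n≢n n)))
        go' (yes refl) = swapClash c O O≤ s'≤ (full 0 0<ℓ (inO z≤n (λ { refl → k≢0 refl }) (λ ()))) (S⊂O c p br br')
            (λ e0 e1 fe l → S⊂O _ (Init-Swap c p l e0 e1 fe) (still (link l e0 e1 (inj₂ fe)) k≢0 br) (still (link l e0 e1 (inj₂ fe)) (λ ()) br'))
          where
          k≢0 : k ≢ 0
          k≢0 refl = <⇒≱ q<t (≤-trans (s≤s z≤n) 2≤q)
          still : ∀ (a : Link c 0) {j k} → k ≢ 0 → Bridge c j k → Bridge (Swap c a) j k
          still a k≢ (p₁ , p₂ , p₃ , h) = p₁ , p₂ , p₃ , subst (λ z → Is (inc z _)) (sym (Swap-y≢ a k≢)) h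

    -- All bridges are the same path edge, which thus contains the last `t` positions besides
    -- position `k`: more than `q + 1` vertices.
    initial : ∀ c → Init c → ⊥
    initial c p = go (bridge c p ≤-refl t+1<ℓ)
      where
      t+1<ℓ : suc t < ℓ
      t+1<ℓ = ≮⇒≥ λ lt → refute (t ∷ ℓ ∷ q ∷ []) (κ 1 ⊕ ν 1 ≼ κ 2 ⊕ ν 0 ∷ κ 1 ⊕ (ν 0 ⊕ ν 0) ≼ ν 1 ∷ κ 1 ⊕ ν 2 ≼ ν 0 ∷ κ 2 ≼ ν 2 ∷ [])
              (lt ∷ ≤-reflexive (sym ℓ≡) ∷ q<t ∷ 2≤q ∷ []) refl
      go : Σ ℕ (Bridge c (suc t)) → ⊥
      go (k , br) = refute (# (suc ℓ) (M c e) ∷ q ∷ t ∷ # (suc ℓ) near ∷ # (suc ℓ) far ∷ ℓ ∷ [])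
          (ν 0 ≼ κ 1 ⊕ ν 1 ∷ κ 1 ⊕ ν 1 ≼ ν 2 ∷ κ 1 ⊕ ν 4 ≼ ν 0 ∷ ν 3 ≼ κ 2 ⊕ ν 2 ∷ κ 1 ⊕ ν 5 ≼ ν 3 ⊕ ν 4 ∷ κ 1 ⊕ (ν 2 ⊕ ν 2) ≼ ν 5 ∷ [])
          (≤-reflexive (row c e) ∷ q<t ∷
           #-add1 (suc ℓ) {far} {M c e} {k} mem (m≤n⇒m≤1+n k<ℓ) (lkˡ c k<ℓ) (λ f → not⁻ f (<ᵇ⁺ (≤-trans (s≤s k≤) (n≤1+n _)))) ∷
           #-below (suc ℓ) (suc (suc t)) ∷ ≤-reflexive (sym (#-not (suc ℓ) near)) ∷ ≤-reflexive (sym ℓ≡) ∷ []) refl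
        where
        e = y c k
        near far : ℕ → Bool
        near i = i <ᵇ suc (suc t)
        far i = not (near i)
        k≤ : k ≤ t
        k≤ = proj₁ (proj₂ (proj₂ br))
        k<ℓ : k < ℓ
        k<ℓ = ≤-trans (s≤s k≤) t<ℓ
        mem' : ∀ j → t < j → j < ℓ → Is (M c e (suc j))
        mem' j t<j j< = same (bridge c p t<j j<)
          where
          same : Σ ℕ (Bridge c j) → Is (M c e (suc j))
          same (k' , br') = cmp (<-cmp k k')
            where
            cmp : _ → Is (M c e (suc j))
            cmp (tri< lt _ _)   = ⊥-elim (bridges< c p br br' lt)
            cmp (tri> _ _ lt)   = ⊥-elim (bridges< c p br' br lt)
            cmp (tri≈ _ refl _) = proj₂ (proj₂ (proj₂ br'))
        mem : ∀ i → i < suc ℓ → Is (far i) → Is (M c e i)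
        mem zero    _        f = ⊥-elim (not⁻ f refl)
        mem (suc i) (s≤s i<) f = mem' i (≤-pred (≮⇒≥ λ lt → not⁻ f (<ᵇ⁺ lt))) i<

  Rot-Nb≡ : ∀ {c i} (a : Front c i) k → Nb (Rot c a) k ≡ Nb c (ρ i k)
  Rot-Nb≡ a k = b≡ (Rot-Nb⁻ a) (Rot-Nb⁺ a)

  Rot-#U : ∀ {c i} (a : Front c i) → # ℓ (U (Rot c a)) ≡ # ℓ (U c)
  Rot-#U {c} {i} a = trans (#-ext ℓ (λ k _ → cong not (trans (Rot-Nb≡ a k) (cong (Nb c) (ρ≡τ i k))))) (#-τ ℓ (suc i) (U c) (Front.i<ℓ a))

  -- Even number of vertices: `U` has a gap

  module Gapped (t : ℕ) (2≤q : 2 ≤ q) (q<t : q < t) (D≡ : D ≡ suc (bin t q)) (t<ℓ : t < ℓ) (nc : NoCross) where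
    open Range t 2≤q q<t D≡ t<ℓ nc

    -- Here `z + 1` starts a later run of `U`. It is not in `A` by `cross`, so by size `A` equals
    -- the rest `O` of `U`.
    record Gap (c : Path) (z : ℕ) : Set where
      constructor gap
      field
        U≤  : # ℓ (U c) ≤ suc t
        z<  : suc z < ℓ
        uz  : Is (U c (suc z))
        ¬uz : ¬ Is (U c z)

    O : Path → ℕ → ℕ → Bool
    O c z k = U c k ∧ not (single (suc z) k)

    module _ {c z} (g : Gap c z) where
      open Gap g

      A⊂O : ∀ k → k < ℓ → Is (A c k) → Is (O c z k)
      A⊂O = avoid nc c z z< ¬uz c (λ n → n)

      S⊂O : ∀ k → k < ℓ → Is (S c k) → Is (O c z k)
      S⊂O k k< s = A⊂O k k< (S→A c s)

      S'⊂O : ∀ k → k < ℓ → Is (S' c k) → Is (O c z k)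
      S'⊂O k k< s = A⊂O k k< (S'→A c {k} s)

      O≤ : # ℓ (O c z) ≤ t
      O≤ = #-drop ℓ {U c} z< uz U≤

      O→A : ∀ k → k < ℓ → Is (O c z k) → Is (A c k)
      O→A = #-⊇ ℓ A⊂O (≤-trans O≤ (A≥t c))

      O⁺ : ∀ {k} → Is (U c k) → k ≢ suc z → Is (O c z k)
      O⁺ u n = ∧⁺ u (not⁺ (λ e → n (⌊⌋⁻ e)))

      -- Elements of `O` are in `A`, so `cross` applies to them. Hence `U` is an initial segment
      -- together with one later run.
      down : ∀ {i} → suc i < ℓ → Is (U c (suc i)) → i ≢ z → Is (U c i)
      down {i} i< u n = not⁺ (cross nc c i< (O→A (suc i) i< (O⁺ u (λ e → n (suc-injective e)))))

      downs : ∀ {i} → i < ℓ → Is (U c i) → (∀ k → k < i → k ≢ z) → ∀ k → k ≤ i → Is (U c k)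
      downs {i} i< u n k k≤ with m≤n⇒m<n∨m≡n k≤
      downs i< u n k k≤ | inj₂ refl = u
      downs {suc i} i< u n k k≤ | inj₁ (s≤s k≤i) = downs (<⇒≤ i<) (down i< u (n i ≤-refl)) (λ k k< → n k (m≤n⇒m≤1+n k<)) k k≤i

      U0 : Is (U c 0)
      U0 = A⊂U c 0<ℓ (S'→A c {0} (S'0 c 0<ℓ))

      z∉A : ¬ Is (A c (suc z))
      z∉A a = not⁻ (∧⁻² {U c (suc z)} (A⊂O (suc z) z< a)) (⌊⌋⁺ {d = suc z ≟ suc z} refl)

    -- The front is moved just behind the start suc z of the second run of U.
    module Behind {c z} (g : Gap c z) (i< : suc (suc z) < ℓ) (u1 : Is (U c 1)) (u2 : Is (U c 2))
                  (a : Front c (suc (suc z))) (fe : Free c (Front.e a)) where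
      open Gap g
      private
        i : ℕ
        i = suc (suc z)

        c′ : Path
        c′ = Rot c a

        Ui : Is (U c i)
        Ui = A⊂U c i< (S→A c (Nf⁺ c fe (Front.e0 a) (Front.ei a)))

        ¬Sz : ∀ {h} → Free c h → Is (M c h 0) → Is (M c h i) → ⊥
        ¬Sz f p p' = z∉A g (S→A c (Nf⁺ c f p p'))

        U′ : ∀ {k} → k ≤ i → U c′ k ≡ U c (i ∸ k)
        U′ {k} k≤ = cong not (trans (Rot-Nb≡ a k) (cong (Nb c) (ρ≤ k≤)))

        U′i : Is (U c′ i)
        U′i = trans (U′ ≤-refl) (trans (cong (U c) (n∸n≡0 i)) (U0 g))

        U′ζ : Is (U c′ (suc z))
        U′ζ = trans (U′ (n≤1+n _)) (trans (cong (U c) (m+n∸n≡m 1 z)) u1)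

        U′z : Is (U c′ z)
        U′z = trans (U′ (≤-trans (n≤1+n z) (n≤1+n _))) (trans (cong (U c) (m+n∸n≡m 2 z)) u2)

        first : x c′ 0 ≡ x c i
        first = Rot-x0 a

        M0⁻ : ∀ {h} → Is (M c′ h 0) → Is (M c h i)
        M0⁻ {h} = subst (λ v → Is (inc h v)) first

        Mi⁻ : ∀ {h} → Is (M c′ h i) → Is (M c h 0)
        Mi⁻ {h} = subst (λ k → Is (inc h (x c k))) (trans (ρ≤ ≤-refl) (n∸n≡0 i))

        ¬S'i : ¬ Is (S' c′ i)
        ¬S'i s = ¬Sz fe (Front.e0 a) (subst₂ (λ h v → Is (inc h v)) (Rot-y≡ a) first s)

      module _ {z₂} (g′ : Gap c′ z₂) where
        private
          O′ : ℕ → Bool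
          O′ = O c′ z₂

          O′i : Is (O′ i)
          O′i = O⁺ g′ U′i (λ e → Gap.¬uz g′ (subst (λ k → Is (U c′ k)) (suc-injective e) U′ζ))

          O′ζ : Is (O′ (suc z))
          O′ζ = O⁺ g′ U′ζ (λ e → Gap.¬uz g′ (subst (λ k → Is (U c′ k)) (suc-injective e) U′z))

          s'< : suc (# ℓ (S' c′)) ≤ t
          s'< = ≤-trans (#-add1 ℓ {S' c′} {O′} (S'⊂O g′) i< O′i ¬S'i) (O≤ g′)

          s≥ : t ≤ # ℓ (S c′)
          s≥ = ≮⇒≥ λ lt → 1+n≰n (≤-trans s'< (lowS c′ lt))

          full : ∀ k → k < ℓ → Is (O′ k) → Is (S c′ k)
          full = #-⊇ ℓ (S⊂O g′) (≤-trans (O≤ g′) s≥)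

          -- Index `z + 1` is in the new `S`, so a free edge joins `x i` and `x 0`. Any edge other
          -- than the freed `y i` would put `z + 1` into the old `S`.
          yi0 : Is (M c (y c i) 0)
          yi0 = go (Nf⁻ c′ (full (suc z) z< O′ζ))
            where
            go : (Σ (Fin m) λ h → Free c′ h × Is (M c′ h 0) × Is (M c′ h i)) → Is (M c (y c i) 0)
            go (h , fh , h0 , hi) = go' (h FP.≟ y c i)
              where
              go' : Dec (h ≡ y c i) → Is (M c (y c i) 0)
              go' (yes refl) = Mi⁻ {h} hi
              go' (no h≢)    = ⊥-elim (¬Sz (Rot-old a fh h≢) (Mi⁻ {h} hi) (M0⁻ {h} h0))

          -- Putting `h` in place of `y i` would free an edge through `x 0` and `x i`, so that
          -- `z + 1` enters `A` although `z` is still a free neighbour of the last vertex.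
          exchange : ∀ h → Free c h → Is (M c h i) → Is (M c h (suc i)) → ⊥
          exchange h fh hi hi+ = go (Nb⁻ c {z} (stable (λ n → ¬uz (not⁺ n))))
            where
            l : Link c i
            l = link i< hi hi+ (inj₂ fh)
            go : (Σ (Fin m) λ w → Free c w × Is (M c w ℓ) × Is (M c w z)) → ⊥
            go (w , fw , wℓ , wz) = cross nc (Swap c l) z<
              (S→A (Swap c l) (Nf⁺ (Swap c l) (Swap-new l fh) yi0 (lkˡ c i<)))
              (Nb⁺ (Swap c l) (Swap-keep l fw (λ { refl → not⁻ Ui (Nb⁺ c fw wℓ hi) })) wℓ wz)

          N₁ N : ℕ → Bool
          N₁ k = O′ k ∧ not (single i k)
          N k = N₁ k ∧ not (single (suc z) k)

          N≤ : suc (suc (# ℓ N)) ≤ t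
          N≤ = ≤-trans (s≤s (#-add1 ℓ {N} {N₁} (λ k _ → ∧⁻¹) z< (∧⁺ O′ζ (not⁺ (λ e → 1+n≢n (sym (⌊⌋⁻ {d = suc z ≟ i} e)))))
                         (λ b → not⁻ (∧⁻² {N₁ (suc z)} b) (⌊⌋⁺ {d = suc z ≟ suc z} refl))))
              (≤-trans (#-add1 ℓ {N₁} {O′} (λ k _ → ∧⁻¹) i< O′i (λ b → not⁻ (∧⁻² {O′ i} b) (⌊⌋⁺ {d = i ≟ i} refl))) (O≤ g′))

          Q : Fin m → Bool
          Q h = (fr c′ h ∧ M c′ h 0) ∧ not ⌊ y c i FP.≟ h ⌋

          Q0 : ∀ h → Is (Q h) → Is (M c′ h 0)
          Q0 h p = ∧⁻² {fr c′ h} (∧⁻¹ p)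

          Qf′ : ∀ h → Is (Q h) → Free c′ h
          Qf′ h p = fr⁻ c′ (∧⁻¹ {fr c′ h} (∧⁻¹ p))

          Qf : ∀ h → Is (Q h) → Free c h
          Qf h p = Rot-old a (Qf′ h p) (λ e → not⁻ (∧⁻² {fr c′ h ∧ M c′ h 0} p) (⌊⌋⁺ {d = y c i FP.≟ h} (sym e)))

          inN : ∀ h → Is (Q h) → ∀ k → k < ℓ → Is (M c′ h (suc k)) → Is (N k)
          inN h p k k< hk = ∧⁺ (∧⁺ (S⊂O g′ k k< (Nf⁺ c′ (Qf′ h p) (Q0 h p) hk))
              (not⁺ (λ e → exchange h (Qf h p) (M0⁻ {h} (Q0 h p)) (subst (λ j → Is (inc h (x c j))) (ρ> ≤-refl) (at e)))))
              (not⁺ (λ e → ¬Sz (Qf h p) (Mi⁻ {h} (at e)) (M0⁻ {h} (Q0 h p))))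
            where
            at : ∀ {j} → Is (single j k) → Is (M c′ h (suc j))
            at e = subst (λ j → Is (M c′ h (suc j))) (⌊⌋⁻ e) hk

          fdeg≤ : fdeg c′ 0 ≤ cnt (allFin m) Q + 1
          fdeg≤ = ≤-trans (cnt-cov (allFin m) {p = Q} {q = λ h → ⌊ y c i FP.≟ h ⌋} (λ h _ p → cases h p (is? ⌊ y c i FP.≟ h ⌋)))
            (+-monoʳ-≤ (cnt (allFin m) Q) (cnt-sub1 (allFin m) (allFin⁺ m) (λ h h' _ _ p p' → trans (sym (⌊⌋⁻ p)) (⌊⌋⁻ p'))))
            where
            cases : ∀ h → Is (fr c′ h ∧ M c′ h 0) → Dec (Is ⌊ y c i FP.≟ h ⌋) → Is (Q h) ⊎ Is ⌊ y c i FP.≟ h ⌋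
            cases h p (yes e) = inj₂ e
            cases h p (no n)  = inj₁ (∧⁺ p (not⁺ n))

        -- Apart from `y i`, the free edges at the new front live on at most `t ∸ 2` indices, and
        -- `S'` has at most `t ∸ 1`; `binB` shows that this misses `D`.
        behind⊥ : ⊥
        behind⊥ = refute (fdeg c′ 0 ∷ # ℓ (S' c′) ∷ cnt (allFin m) Q ∷ bin (# ℓ N) q ∷ bin t q ∷ t ∷ D ∷ [])
          (ν 6 ≼ ν 0 ⊕ ν 1 ∷ κ 1 ⊕ ν 4 ≼ ν 6 ∷ ν 0 ≼ ν 2 ⊕ κ 1 ∷ ν 2 ≼ ν 3 ∷ ν 3 ⊕ ν 5 ≼ ν 4 ∷ κ 1 ⊕ ν 1 ≼ ν 5 ∷ [])
          (degAt c′ 0 ∷ ≤-reflexive (sym D≡) ∷ fdeg≤ ∷ famF c′ N Q Q0 inN ∷ binB 2≤q q<t N≤ ∷ s'< ∷ []) refl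

      behind : ⊥
      behind = go (closedOr ℓ (U c′))
        where
        go : (∀ k → suc k < ℓ → Is (U c′ (suc k)) → Is (U c′ k)) ⊎ (Σ ℕ λ z → suc z < ℓ × Is (U c′ (suc z)) × ¬ Is (U c′ z)) → ⊥
        -- The reversal puts the old `z` at position `2`, below `i`, so the new `U` has a gap as
        -- well.
        go (inj₁ cl) = ¬uz (trans (sym (U′ {2} (s≤s (s≤s z≤n)))) (proj₂ (closed-init ℓ cl 2 (≤-trans (s≤s (s≤s (s≤s z≤n))) i<))
                          (≤-trans (s≤s (s≤s (s≤s z≤n))) (proj₁ (closed-init ℓ cl i i<) U′i))))
        go (inj₂ (z₂ , z₂< , u , ¬u)) = behind⊥ (gap (≤-trans (≤-reflexive (Rot-#U a)) U≤) z₂< u ¬u)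

    -- All edges through the first vertex stay within O.
    module Short {c z} (g : Gap c z) (i< : suc (suc z) < ℓ) (¬u : Is (U c 1) → Is (U c 2) → ⊥) (s : Is (S c (suc (suc z)))) where
      open Gap g
      private
        -- y i, once freed, would exhibit index i − 1 after the move.
        near : ∀ {i} → i < ℓ → Is (S c i) → Is (S' c i) → i ≤ suc z
        near {zero}        _  _  _  = z≤n
        near {suc zero}    _  _  _  = s≤s z≤n
        near {suc (suc i)} i< si si' = ⊥-elim (go (sFront c i< si))
          where
          go : (Σ (Front c (suc (suc i))) λ a → Free c (Front.e a)) → ⊥
          go (a , fe) = ¬u (at {suc i} (n≤1+n _) (m+n∸n≡m 1 i) (A⊂U c′ (<⇒≤ i<) A′))
                           (at {i} (≤-trans (n≤1+n i) (n≤1+n _)) (m+n∸n≡m 2 i) (not⁺ (cross nc c′ (<⇒≤ i<) A′)))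
            where
            c′ = Rot c a
            A′ : Is (A c′ (suc i))
            A′ = S→A c′ (Freed0 a fe si')
            at : ∀ {k j} → k ≤ suc (suc i) → suc (suc i) ∸ k ≡ j → Is (U c′ k) → Is (U c j)
            at {k} k≤ e u = trans (sym (cong not (trans (Rot-Nb≡ a k) (cong (Nb c) (trans (ρ≤ k≤) e))))) u

        s'< : suc (# ℓ (S' c)) ≤ t
        s'< = ≤-trans (#-add1 ℓ {S' c} {O c z} (S'⊂O g) i< (S⊂O g _ i< s) (λ s' → 1+n≰n (near i< s s'))) (O≤ g)

        full : ∀ k → k < ℓ → Is (O c z k) → Is (S c k)
        full = #-⊇ ℓ (S⊂O g) (≤-trans (O≤ g) (≮⇒≥ λ lt → 1+n≰n (≤-trans s'< (lowS c lt))))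

        inO : ∀ {i} → i < ℓ → Is (S' c i) → ∀ k → k < ℓ → Is (M c (y c i) (suc k)) → Is (O c z k)
        inO {i} i<ℓ s'i k k< hk = go (sFront c i<ℓ (full i i<ℓ (S'⊂O g i i<ℓ s'i)))
          where
          i≤ : i ≤ suc z
          i≤ = near i<ℓ (full i i<ℓ (S'⊂O g i i<ℓ s'i)) s'i
          ui : Is (U c i)
          ui = ∧⁻¹ (S'⊂O g i i<ℓ s'i)
          i≢ : i ≢ suc z
          i≢ e = not⁻ (∧⁻² {U c i} (S'⊂O g i i<ℓ s'i)) (⌊⌋⁺ {d = i ≟ suc z} e)
          i<z : i < z
          i<z = ≤∧≢⇒< (≤-pred (≤∧≢⇒< i≤ i≢)) (λ { refl → ¬uz ui })
          go : (Σ (Front c i) λ a → Free c (Front.e a)) → Is (O c z k)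
          go (a , fe) with k ≤? i
          ... | yes k≤ = O⁺ g (downs g i<ℓ ui (λ j j< → <⇒≢ (<-trans j< i<z)) k k≤) (<⇒≢ (≤-trans (s≤s k≤) (≤-trans i<z (n≤1+n z))))
          ... | no k≰  = O⁺ g (not⁺ (λ n → F1 (Rot c a) k< Ak (nb (≰⇒> k≰) n)))
                              (λ e → cross nc (Rot c a) z< (subst (λ j → Is (A (Rot c a) j)) e Ak) (nb i<z (stable (λ n → ¬uz (not⁺ n)))))
            where
            Ak : Is (A (Rot c a) k)
            Ak = S→A (Rot c a) (subst (λ j → Is (Nf (Rot c a) j)) (ρ> (m≤n⇒m≤1+n (≰⇒> k≰))) (Freed a fe hk))
            nb : ∀ {j} → i < j → Is (Nb c j) → Is (Nb (Rot c a) j)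
            nb {j} i<j n = trans (Rot-Nb≡ a j) (trans (cong (Nb c) (ρ> i<j)) n)

      short : ⊥
      short = leaving c (O c z) (≤-trans (s≤s (bin-mono q (O≤ g))) (≤-reflexive (sym D≡))) (λ h h0 k k< hk → go h h0 k k< hk (free? c h))
        where
        go : ∀ h → Is (M c h 0) → ∀ k → k < ℓ → Is (M c h (suc k)) → Free c h ⊎ (Σ ℕ λ j → j < ℓ × y c j ≡ h) → Is (O c z k)
        go h h0 k k< hk (inj₁ f)               = S⊂O g k k< (Nf⁺ c f h0 hk)
        go h h0 k k< hk (inj₂ (j , j< , refl)) = inO j< h0 k k< hk

    turn : ∀ {c z} → Gap c z → suc (suc z) < ℓ → ¬ Is (S c (suc (suc z)))
    turn {c} {z} g i< s = go (is? (U c 1)) (is? (U c 2))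
      where
      go : Dec (Is (U c 1)) → Dec (Is (U c 2)) → ⊥
      go (yes u1) (yes u2) = let (a , fe) = sFront c i< s in Behind.behind g i< u1 u2 a fe
      go (no n)   _        = Short.short g i< (λ u _ → n u) s
      go (yes _)  (no n)   = Short.short g i< (λ _ u → n u) s

    -- If the later run is `z + 1` alone, the rest of `U` is an initial segment and `isolated`
    -- applies. Otherwise `turn` removes `z + 2` from `S`, also after the exchange of `y 0`, which
    -- gives `swapClash` its room.
    gapped : ∀ c z → Gap c z → ⊥
    gapped c z g = go (suc (suc z) <? ℓ) (is? (U c (suc (suc z))))
      where
      open Gap g
      alone : (suc (suc z) < ℓ → ¬ Is (U c (suc (suc z)))) → ⊥
      alone n = isolated (suc z) (s≤s t≤z) c (λ k k< ¬nb → cases k k< (not⁺ ¬nb) (k ≟ suc z))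
        where
        cl : ∀ i → suc i < ℓ → Is (O c z (suc i)) → Is (O c z i)
        cl i i< o = O⁺ g (down g i< (∧⁻¹ o) (λ { refl → not⁻ (∧⁻² {U c (suc i)} o) (⌊⌋⁺ {d = suc i ≟ suc i} refl) })) (λ { refl → n i< (∧⁻¹ o) })
        cases : ∀ k → k < ℓ → Is (U c k) → Dec (k ≡ suc z) → k < t ⊎ k ≡ suc z
        cases k k< u (yes e) = inj₂ e
        cases k k< u (no k≢) = inj₁ (≤-trans (proj₁ (closed-init ℓ cl k k<) (O⁺ g u k≢)) (O≤ g))
        t≤z : t ≤ z
        t≤z = ≮⇒≥ λ z<t → ¬uz (∧⁻¹ (proj₂ (closed-init ℓ cl z (<⇒≤ z<)) (≤-trans z<t (≤-trans (A≥t c) (#-⊆ ℓ (A⊂O g))))))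
      go : Dec (suc (suc z) < ℓ) → Dec (Is (U c (suc (suc z)))) → ⊥
      go (no n)   _       = alone (λ lt → ⊥-elim (n lt))
      go (yes _)  (no n)  = alone (λ _ → n)
      go (yes i<) (yes u) = swapClash c O₂ O₂≤ (≤-trans (#-⊆ ℓ (S'⊂O g)) (O≤ g)) S0 S⊂O₂ (λ e0 e1 fe l k k< s → in₂ (Gap-Swap l e0 e1 fe) k k< s
          (O⁻ l e0 e1 fe k (S⊂O (Gap-Swap l e0 e1 fe) k k< s)))
        where
        O₂ : ℕ → Bool
        O₂ k = O c z k ∧ not (single (suc (suc z)) k)
        Oi : Is (O c z (suc (suc z)))
        Oi = O⁺ g u 1+n≢n
        O₂≤ : suc (# ℓ O₂) ≤ t
        O₂≤ = ≤-trans (#-add1 ℓ {O₂} {O c z} (λ k _ → ∧⁻¹) i< Oi (λ b → not⁻ (∧⁻² {O c z (suc (suc z))} b) (⌊⌋⁺ {d = suc (suc z) ≟ suc (suc z)} refl))) (O≤ g)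
        in₂ : ∀ {c'} → Gap c' z → ∀ k → k < ℓ → Is (S c' k) → Is (O c z k) → Is (O₂ k)
        in₂ {c'} g' k k< s o = ∧⁺ o (not⁺ (λ e → turn g' i< (subst (λ j → Is (S c' j)) (⌊⌋⁻ e) s)))
        S⊂O₂ : ∀ k → k < ℓ → Is (S c k) → Is (O₂ k)
        S⊂O₂ k k< s = in₂ g k k< s (S⊂O g k k< s)
        s≥ : t ≤ suc (# ℓ (S c))
        s≥ = ≮⇒≥ λ lt → 1+n≰n (≤-trans (lowS2 c lt) (≤-trans (#-⊆ ℓ (S'⊂O g)) (O≤ g)))
        S0 : Is (S c 0)
        S0 = #-⊇ ℓ S⊂O₂ (≤-pred (≤-trans O₂≤ s≥)) 0 0<ℓ (∧⁺ (O⁺ g (U0 g) (λ ())) (not⁺ (λ e → 0≢2 (⌊⌋⁻ {d = 0 ≟ suc (suc z)} e))))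
          where
          0≢2 : 0 ≢ suc (suc z)
          0≢2 ()
        O⁻ : ∀ {e} (l : 0 < ℓ) (e0 : Is (M c e 0)) (e1 : Is (M c e 1)) (fe : Free c e) → ∀ k → Is (O (Swap c (link l e0 e1 (inj₂ fe))) z k) → Is (O c z k)
        O⁻ l e0 e1 fe k o = ∧⁺ (not⁺ (λ n → not⁻ (∧⁻¹ o) (Swap0-Nb⁺ l e0 e1 fe n))) (∧⁻² {U (Swap c (link l e0 e1 (inj₂ fe))) k} o)
        Gap-Swap : ∀ {e} (l : 0 < ℓ) (e0 : Is (M c e 0)) (e1 : Is (M c e 1)) (fe : Free c e) → Gap (Swap c (link l e0 e1 (inj₂ fe))) z
        Gap-Swap l e0 e1 fe = gap (≤-trans (≤-reflexive (#-ext ℓ (λ k _ → cong not (b≡ (Swap0-Nb⁻ l e0 e1 fe) (Swap0-Nb⁺ l e0 e1 fe))))) U≤) z<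
          (not⁺ (λ n → not⁻ uz (Swap0-Nb⁻ l e0 e1 fe n))) (λ u' → ¬uz (not⁺ (λ n → not⁻ u' (Swap0-Nb⁺ l e0 e1 fe n))))

  cnt-two : ∀ {p : Fin m → Bool} {h h'} → Is (p h) → Is (p h') → h ≢ h' → 2 ≤ cnt (allFin m) p
  cnt-two {p} {h} {h'} ph ph' h≢ = ≤-trans (+-mono-≤ (one h) (one h'))
    (cnt-disj (allFin m) {is h} {is h'} {p} (λ a _ e → subst (λ z → Is (p z)) (⌊⌋⁻ e) ph) (λ a _ e → subst (λ z → Is (p z)) (⌊⌋⁻ e) ph')
       (λ a _ e e' → h≢ (trans (⌊⌋⁻ e) (sym (⌊⌋⁻ e')))))
    where
    is : Fin m → Fin m → Bool
    is h a = ⌊ h FP.≟ a ⌋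
    one : ∀ h → 1 ≤ cnt (allFin m) (is h)
    one h = cnt-pos (allFin m) (∈-allFin h) (⌊⌋⁺ {d = h FP.≟ h} refl)

  -- Even number of vertices with `r = t`, when every front has few free neighbours

  module _ (ℓ≡ : ℓ ≡ suc (suc q + suc q)) (2≤q : 2 ≤ q) (D≡ : D ≡ suc (bin (suc q) q)) (nc : NoCross)
           (t<ℓ : suc q < ℓ) where
    open Range (suc q) 2≤q ≤-refl D≡ t<ℓ nc

    module AllBad (bad : ∀ c → # ℓ (S c) < suc q) where
      open Bad bad

      private
        t : ℕ
        t = suc q

        D≡' : D ≡ suc t
        D≡' = trans D≡ (cong suc (bin-pred q))

        s'≤ : ∀ c → # ℓ (S' c) ≤ t
        s'≤ c = ≮⇒≥ λ lt → refute (# ℓ (S' c) ∷ # ℓ (T' c) ∷ t ∷ ℓ ∷ # (suc ℓ) (ends c) ∷ [])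
          (κ 1 ⊕ ν 2 ≼ ν 0 ∷ ν 2 ≼ ν 1 ∷ ν 0 ⊕ ν 1 ≼ ν 4 ∷ κ 1 ⊕ ν 4 ≼ ν 3 ∷ ν 3 ≼ κ 1 ⊕ (ν 2 ⊕ ν 2) ∷ [])
          (lt ∷ T'≥t c ∷ ≤-reflexive (sym (#ends c)) ∷ ends< c ∷ ≤-reflexive ℓ≡ ∷ []) refl

        fdeg≥1 : ∀ c → 1 ≤ fdeg c 0
        fdeg≥1 c = ≮⇒≥ λ lt → refute (fdeg c 0 ∷ # ℓ (S' c) ∷ t ∷ D ∷ []) (κ 1 ⊕ ν 0 ≼ κ 1 ∷ ν 3 ≼ ν 0 ⊕ ν 1 ∷ ν 1 ≼ ν 2 ∷ κ 1 ⊕ ν 2 ≼ ν 3 ∷ [])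
          (lt ∷ degAt c 0 ∷ s'≤ c ∷ ≤-reflexive (sym D≡') ∷ []) refl

        fdeg≤1 : ∀ c → fdeg c 0 ≤ 1
        fdeg≤1 c = ≤-trans (fdeg-bound c) (≤-trans (bin-mono q (≤-pred (bad c))) (≤-reflexive (bin-nn q)))

        s≥ : ∀ c → q ≤ # ℓ (S c)
        s≥ c = ≮⇒≥ λ lt → 1+n≰n (≤-trans (fdeg≥1 c) (≤-trans (fdeg-bound c) (≤-reflexive (bin-zero lt))))

        -- Moving the front to k would leave two free edges there, h and y k.
        avoidS : ∀ c {h k} → k < ℓ → Is (S c k) → Free c h → ¬ Is (M c h 0) → ¬ Is (M c h k)
        avoidS c {h} {k} k< s fh h0 hk = go (sFront c k< s)
          where
          go : (Σ (Front c k) λ a → Free c (Front.e a)) → ⊥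
          go (a , fe) = 1+n≰n (≤-trans (cnt-two {λ e → fr c′ e ∧ M c′ e 0} {h} {y c k}
              (∧⁺ (fr⁺ c′ (Rot-keep a fh (λ { refl → h0 (Front.e0 a) }))) (at hk)) (∧⁺ (fr⁺ c′ (Rot-new a fe)) (at (lkˡ c k<)))
              (λ e → fh k k< (sym e))) (fdeg≤1 c′))
            where
            c′ = Rot c a
            at : ∀ {e} → Is (M c e k) → Is (M c′ e 0)
            at {e} = subst (λ v → Is (inc e v)) (sym (Rot-x0 a))

        -- There are exactly `2t` ends of weight at least `t`; the other two positions have weight
        -- at least 2. So `2t² + 4 ≤ (2t + 1) * t`.
        t≥4 : Path → 4 ≤ t
        t≥4 c = ≮⇒≥ λ lt → 1+n≰n (≤-trans (s≤s (≤-trans (+-monoʳ-≤ ((t + t) * t) (≤-pred lt)) ≤-refl))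
            (≤-trans (≤-reflexive (sym (+-suc ((t + t) * t) 3))) (≤-trans w' (≤-reflexive (trans (cong (_* t) ℓ≡) (+-comm t ((t + t) * t)))))) )
          where
          E : ℕ
          E = # (suc ℓ) (ends c)
          E≡ : E ≡ t + t
          E≡ = ≤-antisym (≤-pred (≤-trans (ends< c) (≤-reflexive ℓ≡))) (ends≥ c)
          two : ∀ k → k < suc ℓ → 2 ≤ pdeg c k
          two zero    _        = ≤-trans (≤-trans 2≤q (n≤1+n q)) (ends≥t c 0 (s≤s z≤n) refl)
          two (suc k) (s≤s k<) = go (m≤n⇒m<n∨m≡n k<)
            where
            go : suc k < ℓ ⊎ suc k ≡ ℓ → 2 ≤ pdeg c (suc k)
            go (inj₁ lt) = pdeg≥2 c (suc k) (s≤s z≤n) lt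
            go (inj₂ e)  = ≤-trans (≤-trans 2≤q (n≤1+n q)) (subst (λ j → t ≤ pdeg c j) (sym e) (T'≥t c))
          w' : (t + t) * t + 4 ≤ ℓ * t
          w' = ≤-trans (≤-reflexive (cong ((t + t) * t +_) (sym (cong (_* 2) (trans (cong (_∸ (t + t)) (cong suc ℓ≡)) (m+n∸n≡m 2 (t + t)))))))
                 (subst (λ E → E * t + (suc ℓ ∸ E) * 2 ≤ ℓ * t) E≡
                   (≤-trans (total-# (suc ℓ) (pdeg c) (ends c) t 2 (≤-trans 2≤q (n≤1+n q)) (ends≥t c) two) (≤-reflexive (sumP c))))

      -- Of at least four free edges, each end is on at most one, so two avoid both ends. By
      -- `avoidS` they also avoid the at least `2q` positions to which an end can be moved along a
      -- free edge. At most four of the `2q + 4` positions remain, too few for two edges of size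
      -- `t ≥ 4`.
      allBad : Path → ⊥
      allBad c = refute (cnt (allFin m) (fr c) ∷ cnt (allFin m) Q ∷ cnt (allFin m) R ∷ fdeg c 0 ∷ fdeg c ℓ ∷ [])
          (κ 4 ≼ ν 0 ∷ ν 0 ≼ ν 3 ⊕ ν 2 ∷ ν 2 ≼ ν 4 ⊕ ν 1 ∷ ν 3 ≼ κ 1 ∷ ν 4 ≼ κ 1 ∷ ν 1 ≼ κ 1 ∷ [])
          (fourUnused (xinj c) (y c) (on c) (λ e → on⁻ c) ℓ≡ (≤-reflexive (sym D≡')) ∷ cnt-cov (allFin m) (λ h _ f → split (M c h 0) f) ∷ cnt-cov (allFin m) (λ h _ f → splitR h f) ∷ fdeg≤1 c ∷
           ≤-trans (cnt-⊆ (allFin m) (λ h _ p → ∧⁺ (fr⁺ (Mir c) (Mir-free c (fr⁻ c (∧⁻¹ p)))) (∧⁻² {fr c h} p))) (fdeg≤1 (Mir c)) ∷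
           ≤-trans (famA c N Q inN) (≤-trans (bin-mono t N≤) (bin4 (t≥4 c))) ∷ []) refl
        where
        R Q : Fin m → Bool
        R h = fr c h ∧ not (M c h 0)
        Q h = R h ∧ not (M c h ℓ)
        split : ∀ {a} b → Is a → Is (a ∧ b) ⊎ Is (a ∧ not b)
        split true  p = inj₁ (∧⁺ p refl)
        split false p = inj₂ (∧⁺ p refl)
        splitR : ∀ h → Is (R h) → Is (fr c h ∧ M c h ℓ) ⊎ Is (Q h)
        splitR h p with split (M c h ℓ) p
        ... | inj₁ a = inj₁ (∧⁺ (∧⁻¹ (∧⁻¹ {R h} a)) (∧⁻² {R h} a))
        ... | inj₂ b = inj₂ b
        p₁ p₂ N : ℕ → Bool
        p₁ k = (k <ᵇ ℓ) ∧ S c k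
        p₂ zero    = false
        p₂ (suc k) = Nb c k
        N k = not (p₁ k ∨ p₂ k)
        disj : ∀ k → k < suc ℓ → Is (p₁ k) → Is (p₂ k) → ⊥
        disj (suc k) _ a b = cross nc c (<ᵇ⁻ (∧⁻¹ a)) (S→A c (∧⁻² {suc k <ᵇ ℓ} a)) b
        P≥ : q + q ≤ # (suc ℓ) (λ k → p₁ k ∨ p₂ k)
        P≥ = ≤-trans (+-mono-≤ (≤-trans (s≥ c) (≤-trans (#-⊆ ℓ {S c} {p₁} (λ k k< s → ∧⁺ (<ᵇ⁺ k<) s)) (m≤n+m _ (b2n (p₁ ℓ)))))
                               (≤-trans (s≥ (Mir c)) (≤-trans (≤-reflexive (trans (#-ext ℓ (λ k → MirS≡ k)) (#-rev ℓ (Nb c)))) (≤-reflexive (sym (#-shift ℓ p₂))))))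
               (#-disj (suc ℓ) {p₁} {p₂} (λ k _ → ∨⁺¹) (λ k _ → ∨⁺² {p₁ k}) disj)
          where
          MirS≡ : ∀ k → k < ℓ → S (Mir c) k ≡ Nb c (ℓ ∸ suc k)
          MirS≡ k k< = b≡ (MirNf⁻ c) (MirNf⁺ c)
        N≤ : # (suc ℓ) N ≤ 4
        N≤ = ≮⇒≥ λ lt → refute (# (suc ℓ) N ∷ # (suc ℓ) (λ k → p₁ k ∨ p₂ k) ∷ ℓ ∷ q ∷ [])
          (κ 5 ≼ ν 0 ∷ ν 3 ⊕ ν 3 ≼ ν 1 ∷ ν 1 ⊕ ν 0 ≼ κ 1 ⊕ ν 2 ∷ ν 2 ≼ κ 1 ⊕ ((κ 1 ⊕ ν 3) ⊕ (κ 1 ⊕ ν 3)) ∷ [])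
          (lt ∷ P≥ ∷ ≤-reflexive (#-not (suc ℓ) (λ k → p₁ k ∨ p₂ k)) ∷ ≤-reflexive ℓ≡ ∷ []) refl
        inN : ∀ h → Is (Q h) → ∀ k → k < suc ℓ → Is (M c h k) → Is (N k)
        inN h p k k< hk = not⁺ (λ o → go k k< hk (∨⁻ {p₁ k} o))
          where
          fh : Free c h
          fh = fr⁻ c (∧⁻¹ {fr c h} (∧⁻¹ p))
          go : ∀ k → k < suc ℓ → Is (M c h k) → Is (p₁ k) ⊎ Is (p₂ k) → ⊥
          go k       _ hk (inj₁ a) = avoidS c (<ᵇ⁻ (∧⁻¹ a)) (∧⁻² {k <ᵇ ℓ} a) fh (not⁻ (∧⁻² {fr c h} (∧⁻¹ p))) hk
          go (suc k) (s≤s k<) hk (inj₂ b) = avoidS (Mir c) (∸suc-< ℓ k k<) (MirNf⁺ c (subst (λ j → Is (Nb c j)) (sym (∸-invol k<)) b)) (Mir-free c fh)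
                           (not⁻ (∧⁻² {R h} p)) (subst (λ j → Is (M c h j)) (sym (m∸[m∸n]≡n k<)) hk)
        bin4 : 4 ≤ t → bin 4 t ≤ 1
        bin4 h with m≤n⇒m<n∨m≡n h
        ... | inj₁ lt = ≤-trans (≤-reflexive (bin-zero lt)) z≤n
        ... | inj₂ e  = ≤-reflexive (cong (bin 4) (sym e))

  evenCase : ∀ t → ℓ ≡ suc (t + t) → 2 ≤ q → q < t → D ≡ suc (bin t q) → NoCross → Path → ⊥
  evenCase t ℓ≡ 2≤q q<t D≡ nc c₀ = go (m≤n⇒m<n∨m≡n q<t)
    where
    t<ℓ : t < ℓ
    t<ℓ = ≤-trans (s≤s (m≤m+n t t)) (≤-reflexive (sym ℓ≡))
    open Range t 2≤q q<t D≡ t<ℓ nc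
    open Initial t ℓ≡ 2≤q q<t D≡ t<ℓ nc
    open Gapped t 2≤q q<t D≡ t<ℓ nc
    good : ∀ c → # ℓ (U c) ≤ suc t → ⊥
    good c U≤ = go (closedOr ℓ (U c))
      where
      go : (∀ k → suc k < ℓ → Is (U c (suc k)) → Is (U c k)) ⊎ (Σ ℕ λ z → suc z < ℓ × Is (U c (suc z)) × ¬ Is (U c z)) → ⊥
      go (inj₁ cl) = initial c (λ k k< → (λ u → ≤-pred (≤-trans (proj₁ (closed-init ℓ cl k k<) u) U≤)) ,
                                         (λ k≤ → proj₂ (closed-init ℓ cl k k<) (≤-trans (s≤s k≤) (≮⇒≥ λ lt → few-Nb c (≤-pred lt)))))
      go (inj₂ (z , z< , u , ¬u)) = gapped c z (gap U≤ z< u ¬u)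
    bad : ∀ c → # ℓ (S c) < t
    bad c = ≰⇒> λ t≤ → good (Mir c) (≮⇒≥ λ lt → refute (# ℓ (S c) ∷ # ℓ (U (Mir c)) ∷ t ∷ ℓ ∷ [])
      (ν 2 ≼ ν 0 ∷ κ 2 ⊕ ν 2 ≼ ν 1 ∷ ν 0 ⊕ ν 1 ≼ ν 3 ∷ ν 3 ≼ κ 1 ⊕ (ν 2 ⊕ ν 2) ∷ [])
      (t≤ ∷ lt ∷ ≤-reflexive (Mir-#U c) ∷ ≤-reflexive ℓ≡ ∷ []) refl)
    open Bad bad
    go : suc q < t ⊎ suc q ≡ t → ⊥
    go (inj₂ refl) = AllBad.allBad ℓ≡ 2≤q D≡ nc t<ℓ bad c₀
    -- The ends alone have weight `2t²`, while `ℓ * (q + 1) + ℓ ≤ ℓ * t = 2t² + t`; this would give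
    -- `ℓ ≤ t`.
    go (inj₁ lt)   = <⇒≱ t<ℓ (+-cancelˡ-≤ ((t + t) * t) ℓ t (≤-trans (+-monoˡ-≤ ℓ (≤-trans (*-monoˡ-≤ t (ends≥ c₀)) (≤-trans (m≤m+n _ _) (weight c₀))))
        (≤-trans (≤-reflexive (trans (+-comm (ℓ * suc q) ℓ) (sym (*-suc ℓ (suc q))))) (≤-trans (*-monoʳ-≤ ℓ lt)
          (≤-reflexive (trans (cong (_* t) ℓ≡) (+-comm t ((t + t) * t))))))))

-- Hypergraphs as settings, and the addition of an edge

open import Data.Fin using (zero; suc; toℕ; fromℕ<; finToFun; funToFin)

data Admissible (ℓ q D : ℕ) : Set where
  kind : ∀ {t} → Kind ℓ q D t → Admissible ℓ q D
  big  : suc q ≤ D → ℓ ≤ q + q → 0 < ℓ → Admissible ℓ q D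

noPath : (G : Setting) → let open Setting G in Admissible ℓ q D → Path → ⊥
noPath G ad = go ad
  where
  open Setting G
  nc : ∀ {t s} → Kind ℓ q D t → ℓ ≡ suc s → Analysis.NoCross G
  nc {s = s} kd e = Analysis.LongCycle.noCross G kd s e
  odd-suc : ∀ {t} → q < t → t + t ≡ suc (t + t ∸ 1)
  odd-suc {suc t} _ = refl
  go : Admissible ℓ q D → Path → ⊥
  go (big q<D ℓ≤ 0<ℓ) = Analysis.bigCase G q<D ℓ≤ 0<ℓ
  go (kind {t} kd@(odd ℓ≡ 2≤q q<t D≡))  = Analysis.oddCase G t ℓ≡ 2≤q q<t D≡ (nc kd (trans ℓ≡ (odd-suc q<t)))
  go (kind {t} kd@(even ℓ≡ 2≤q q<t D≡)) = Analysis.evenCase G t ℓ≡ 2≤q q<t D≡ (nc kd ℓ≡)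
  go (kind {t} kd@(half ℓ≡ 2≤t q≡t D≡)) = Analysis.halfCase G (trans ℓ≡ (cong (λ z → suc (z + z)) (sym q≡t)))
    (≤-trans (s≤s z≤n) (subst (2 ≤_) (sym q≡t) 2≤t)) (trans D≡ (cong suc (sym q≡t))) (nc kd ℓ≡)

cnt-tabulate : ∀ {A : Set} {k} (f : Fin k → A) p → cnt (tabulate f) p ≡ cnt (allFin k) (λ i → p (f i))
cnt-tabulate {k = zero}  f p = refl
cnt-tabulate {k = suc k} f p = cong (b2n (p (f zero)) +_)
  (trans (cnt-tabulate (λ i → f (suc i)) p) (sym (cnt-tabulate suc (λ i → p (f i)))))

cnt-suc : ∀ {k} (p : Fin (suc k) → Bool) → cnt (allFin (suc k)) p ≡ b2n (p zero) + cnt (allFin k) (λ i → p (suc i))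
cnt-suc p = cong (b2n (p zero) +_) (cnt-tabulate suc p)

cnt-not : ∀ {A : Set} (as : List A) p → cnt as p + cnt as (λ a → not (p a)) ≡ length as
cnt-not []       p = refl
cnt-not (a ∷ as) p with p a
... | true  = cong suc (cnt-not as p)
... | false = trans (+-suc _ _) (cong suc (cnt-not as p))

cnt-image : ∀ {N} k (x : ℕ → Fin N) → (∀ {i j} → i < k → j < k → x i ≡ x j → i ≡ j) →
            ∀ p → # k (λ i → p (x i)) ≤ cnt (allFin N) p
cnt-image zero    x inj p = z≤n
cnt-image {N} (suc k) x inj p = ≤-trans (+-mono-≤ top (≤-trans (≤-reflexive (#-ext k same))
    (cnt-image k x (λ i< j< → inj (m≤n⇒m≤1+n i<) (m≤n⇒m≤1+n j<)) p′)))
    (cnt-disj (allFin N) {hit} {p′} {p} (λ v _ → ∧⁻¹) (λ v _ → ∧⁻¹) (λ v _ h h' → not⁻ (∧⁻² {p v} h') (∧⁻² {p v} h)))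
  where
  at : Fin N → Bool
  at v = ⌊ v FP.≟ x k ⌋
  hit p′ : Fin N → Bool
  hit v = p v ∧ at v
  p′ v = p v ∧ not (at v)
  on : ∀ {P : Set} (d : Dec P) → P → Is ⌊ d ⌋
  on (yes _) _ = refl
  on (no n)  h = ⊥-elim (n h)
  off : ∀ {P : Set} (d : Dec P) → ¬ P → not ⌊ d ⌋ ≡ true
  off (yes h) n = ⊥-elim (n h)
  off (no _)  _ = refl
  top : b2n (p (x k)) ≤ cnt (allFin N) hit
  top with is? (p (x k))
  ... | yes h = ≤-trans (b2n-mono {p (x k)} {true} (λ _ → refl)) (cnt-pos (allFin N) (∈-allFin (x k)) (∧⁺ h (on (x k FP.≟ x k) refl)))
  ... | no n  = ≤-trans (b2n-mono {p (x k)} {false} (λ h → ⊥-elim (n h))) z≤n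
  same : ∀ i → i < k → p (x i) ≡ p′ (x i)
  same i i< = b≡ (λ h → ∧⁺ h (off (x i FP.≟ x k) (λ e → <⇒≢ i< (inj (m≤n⇒m≤1+n i<) ≤-refl e)))) ∧⁻¹

-- `cnt-image` gives one inequality for `p` and one for its complement, and the totals agree.
cnt-enum : ∀ {ℓ} (x : ℕ → Fin (suc ℓ)) → (∀ {i j} → i ≤ ℓ → j ≤ ℓ → x i ≡ x j → i ≡ j) →
           ∀ p → # (suc ℓ) (λ i → p (x i)) ≡ cnt (allFin (suc ℓ)) p
cnt-enum {ℓ} x xi p = ≤-antisym (le p) (+-cancelʳ-≤ (# (suc ℓ) (λ i → not (p (x i)))) _ _ (≤-trans (+-monoʳ-≤ (cnt (allFin (suc ℓ)) p) (le (λ v → not (p v))))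
    (≤-reflexive (trans (cnt-not (allFin (suc ℓ)) p) (trans (length-tabulate {n = suc ℓ} (λ i → i)) (sym (#-not (suc ℓ) (λ i → p (x i)))))))))
  where
  le : ∀ p → # (suc ℓ) (λ i → p (x i)) ≤ cnt (allFin (suc ℓ)) p
  le = cnt-image (suc ℓ) x (λ i< j< → xi (≤-pred i<) (≤-pred j<))

record Hyper (ℓ q D : ℕ) : Set where
  field
    m    : ℕ
    inc  : Fin m → Fin (suc ℓ) → Bool
    size : ∀ e → cnt (allFin (suc ℓ)) (inc e) ≡ suc q
    dist : ∀ {e e'} → (∀ v → inc e v ≡ inc e' v) → e ≡ e'
    degr : ∀ v → D ≤ cnt (allFin m) (λ e → inc e v)
  open Paths (Fin (suc ℓ)) m ℓ inc public

  Closed : Set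
  Closed = Σ Path λ c → Σ (Fin m) λ e → Free c e × Is (M c e 0) × Is (M c e ℓ)

module _ {ℓ q D : ℕ} (H : Hyper ℓ q D) where
  open Hyper H

  setting : ¬ Closed → Setting
  setting ¬cl = record
    { V = Fin (suc ℓ) ; m = m ; ℓ = ℓ ; q = q ; D = D ; inc = inc
    ; rowX  = λ {x} xi e → trans (cnt-enum x xi (inc e)) (size e)
    ; sepX  = λ {x} xi h → dist (λ v → sep x xi h v)
    ; deg   = degr
    ; noHam = λ c {e} f p p' → ¬cl (c , e , f , p , p')
    }
    where
    sep : ∀ x → XInj x → ∀ {e e'} → (∀ k → k ≤ ℓ → inc e (x k) ≡ inc e' (x k)) → ∀ v → inc e v ≡ inc e' v
    sep x xi h v with #-wit (suc ℓ) (subst (1 ≤_) (sym (cnt-enum x xi (λ w → ⌊ w FP.≟ v ⌋))) (cnt-pos (allFin (suc ℓ)) (∈-allFin v) (⌊⌋⁺ {d = v FP.≟ v} refl)))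
    ... | k , k< , eq with ⌊⌋⁻ {d = x k FP.≟ v} eq
    ...   | refl = h k (≤-pred k<)

  -- Mir ∘ Rot shifts a closed path by one step.
  toClosing : ∀ s → ℓ ≡ suc s → ∀ d i → i + d ≡ s → ((c , _) : Closed) →
              Σ Path λ c′ → Free c′ (y c i) × Is (M c′ (y c i) 0) × Is (M c′ (y c i) ℓ)
  toClosing s refl d i i+d (c , e , fe , e0 , eℓ) = go d i+d
    where
    a : Front c s
    a = front ≤-refl e0 eℓ (inj₂ fe)
    c₁ = Rot c a
    at0 : Is (M c₁ (y c s) 0)
    at0 = subst (λ k → Is (inc (y c s) (x c k))) (sym (ρ≤ {s} {0} z≤n)) (lkˡ c ≤-refl)
    atℓ : Is (M c₁ (y c s) ℓ)
    atℓ = subst (λ k → Is (inc (y c s) (x c k))) (sym (ρ> ≤-refl)) (lkʳ c ≤-refl)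
    go : ∀ d → i + d ≡ s → Σ Path λ c′ → Free c′ (y c i) × Is (M c′ (y c i) 0) × Is (M c′ (y c i) ℓ)
    go zero    eq with trans (sym (+-identityʳ i)) eq
    ... | refl = c₁ , Rot-new a fe , at0 , atℓ
    go (suc d) eq = subst (λ w → Σ Path λ c′ → Free c′ w × Is (M c′ w 0) × Is (M c′ w ℓ)) same
        (toClosing s refl d (suc i) (trans (sym (+-suc i d)) eq)
          (Mir c₁ , y c s , Mir-free c₁ (Rot-new a fe) , atℓ , subst (λ k → Is (inc (y c s) (x c₁ k))) (sym (n∸n≡0 ℓ)) at0))
      where
      i<s : i < s
      i<s = ≤-trans (s≤s (m≤m+n i d)) (≤-reflexive (trans (sym (+-suc i d)) eq))
      same : y (Mir c₁) (suc i) ≡ y c i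
      same = trans (Rot-y< a (∸suc-< s i i<s)) (cong (y c) (∸-invol i<s))

module Add {ℓ q D : ℕ} (H : Hyper ℓ q D) (E : Fin (suc ℓ) → Bool) (E-size : cnt (allFin (suc ℓ)) E ≡ suc q)
           (new : ∀ e → ¬ (∀ v → Hyper.inc H e v ≡ E v)) where
  open Hyper H

  inc⁺ : Fin (suc m) → Fin (suc ℓ) → Bool
  inc⁺ zero    = E
  inc⁺ (suc e) = inc e

  H⁺ : Hyper ℓ q D
  H⁺ = record
    { m = suc m ; inc = inc⁺
    ; size = λ { zero → E-size ; (suc e) → size e }
    ; dist = λ { {zero} {zero} h → refl ; {zero} {suc e} h → ⊥-elim (new e (λ v → sym (h v)))
               ; {suc e} {zero} h → ⊥-elim (new e h) ; {suc e} {suc e'} h → cong suc (dist h) }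
    ; degr = λ v → ≤-trans (degr v) (≤-trans (m≤n+m _ (b2n (E v))) (≤-reflexive (sym (cnt-suc (λ e → inc⁺ e v)))))
    }

  private module H⁺ = Hyper H⁺

  drop : Fin m → Fin (suc m) → Fin m
  drop d zero    = d
  drop d (suc e) = e

  drop-suc : ∀ (d : Fin m) {e : Fin (suc m)} → e ≢ zero → suc (drop d e) ≡ e
  drop-suc d {zero}  n = ⊥-elim (n refl)
  drop-suc d {suc e} n = refl

  restrict : Fin m → (c : H⁺.Path) → H⁺.Free c zero → Path
  restrict d c f = record
    { x = H⁺.x c ; y = λ i → drop d (H⁺.y c i) ; xinj = H⁺.xinj c
    ; yinj = λ {i} {j} i< j< e → H⁺.yinj c i< j< (trans (sym (drop-suc d (f i i<))) (trans (cong suc e) (drop-suc d (f j j<))))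
    ; lkˡ = λ {i} i< → subst (λ e → Is (inc⁺ e (H⁺.x c i))) (sym (drop-suc d (f i i<))) (H⁺.lkˡ c i<)
    ; lkʳ = λ {i} i< → subst (λ e → Is (inc⁺ e (H⁺.x c (suc i)))) (sym (drop-suc d (f i i<))) (H⁺.lkʳ c i<)
    }

  asPath : 0 < ℓ → (c : H⁺.Path) → H⁺.Free c zero → Path
  asPath 0<ℓ c f = go (H⁺.y c 0) refl
    where
    go : ∀ e → H⁺.y c 0 ≡ e → Path
    go zero    eq = ⊥-elim (f 0 0<ℓ eq)
    go (suc d) _  = restrict d c f

  reduce : 0 < ℓ → H⁺.Closed → Path ⊎ Closed
  reduce 0<ℓ cl@(c , e , fe , e0 , eℓ) = go (H⁺.free? c zero)
    where
    sℓ : Σ ℕ λ s → ℓ ≡ suc s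
    sℓ = go ℓ 0<ℓ
      where
      go : ∀ n → 0 < n → Σ ℕ λ s → n ≡ suc s
      go (suc s) _ = s , refl
    closed : ∀ e → H⁺.Free c zero → H⁺.Free c e → Is (inc⁺ e (H⁺.x c 0)) → Is (inc⁺ e (H⁺.x c ℓ)) → Path ⊎ Closed
    closed zero    f fe e0 eℓ = inj₁ (asPath 0<ℓ c f)
    closed (suc e) f fe e0 eℓ = inj₂ (restrict e c f , e , (λ i i< eq → fe i i< (trans (sym (drop-suc e (f i i<))) (cong suc eq))) , e0 , eℓ)
    go : H⁺.Free c zero ⊎ (Σ ℕ λ i → i < ℓ × H⁺.y c i ≡ zero) → Path ⊎ Closed
    go (inj₁ f)              = closed e f fe e0 eℓ
    go (inj₂ (i , i< , yi)) = inj₁ (go' sℓ)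
      where
      go' : (Σ ℕ λ s → ℓ ≡ suc s) → Path
      go' (s , eq) = let (c′ , f , _) = toClosing H⁺ s eq (s ∸ i) i (m+[n∸m]≡n (≤-pred (subst (i <_) eq i<))) cl in
        asPath 0<ℓ c′ (subst (H⁺.Free c′) yi f)

-- Cyclic intervals and the completion argument

module Interval (ℓ q : ℕ) (q<ℓ : q < ℓ) where

  n r : ℕ
  n = suc ℓ
  r = suc q

  -- The cyclic interval {j, …, j + q} modulo ℓ + 1.
  I : ℕ → ℕ → Bool
  I j a = (not (a <ᵇ j) ∧ (a <ᵇ j + r)) ∨ (a + n <ᵇ j + r)

  private
    #-<ᵇ : ∀ k b → # k (_<ᵇ b) + (b ∸ k) ≡ b
    #-<ᵇ zero    b       = refl
    #-<ᵇ (suc k) zero    = trans (+-identityʳ _) (#-none (suc k) (λ i _ ()))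
    #-<ᵇ (suc k) (suc b) = trans (cong (_+ (b ∸ k)) (#-shift k (_<ᵇ suc b))) (cong suc (#-<ᵇ k b))

  I⁺ : ∀ {j a} → j ≤ a → a < j + r → Is (I j a)
  I⁺ {j} {a} p p' = ∨⁺¹ (∧⁺ (not⁺ (λ h → <⇒≱ (<ᵇ⁻ {a} {j} h) p)) (<ᵇ⁺ p'))

  I⁻ : ∀ {j a} → Is (I j a) → (j ≤ a × a < j + r) ⊎ a + n < j + r
  I⁻ {j} {a} h with ∨⁻ {not (a <ᵇ j) ∧ (a <ᵇ j + r)} h
  ... | inj₁ p = inj₁ (≮⇒≥ (λ lt → not⁻ (∧⁻¹ p) (<ᵇ⁺ lt)) , <ᵇ⁻ {a} {j + r} (∧⁻² {not (a <ᵇ j)} p))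
  ... | inj₂ p = inj₂ (<ᵇ⁻ {a + n} {j + r} p)

  -- An interval is shorter than the circle, so the one from `k` omits `k ∸ 1`. That position
  -- separates the two if the interval from `j` reaches `k`, and `k` itself does otherwise.
  I-inj : ∀ {j k} → j < k → k < ℓ → ¬ (∀ a → a ≤ ℓ → I j a ≡ I k a)
  I-inj {j} {suc k} (s≤s j≤) k< h = go (suc k <? j + r)
    where
    go : Dec (suc k < j + r) → ⊥
    go (yes lt) = bad (I⁻ {suc k} {k} (trans (sym (h k (<⇒≤ (<⇒≤ k<)))) (I⁺ j≤ (<⇒≤ lt))))
      where
      bad : (suc k ≤ k × k < suc k + r) ⊎ k + n < suc k + r → ⊥
      bad (inj₁ (p , _)) = 1+n≰n p
      bad (inj₂ p)       = refute (k ∷ ℓ ∷ q ∷ []) (κ 1 ⊕ (ν 0 ⊕ (κ 1 ⊕ ν 1)) ≼ κ 1 ⊕ (ν 0 ⊕ (κ 1 ⊕ ν 2)) ∷ κ 1 ⊕ ν 2 ≼ ν 1 ∷ []) (p ∷ q<ℓ ∷ []) refl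
    go (no ge)  = bad (I⁻ {j} {suc k} (trans (h (suc k) (<⇒≤ k<)) (I⁺ ≤-refl (m<m+n (suc k) (s≤s z≤n)))))
      where
      bad : (j ≤ suc k × suc k < j + r) ⊎ suc k + n < j + r → ⊥
      bad (inj₁ (_ , p)) = ge p
      bad (inj₂ p)       = ge (≤-trans (s≤s (m≤m+n (suc k) n)) p)

  #I : ∀ {j} → j ≤ ℓ → # n (I j) ≡ r
  #I {j} j≤ = ≤-antisym
      (≮⇒≥ λ lt → refute (# n (I j) ∷ # n P₁ ∷ # n W ∷ # n P ∷ # n R ∷ q ∷ j ∷ (j + r) ∸ n ∷ [])
        (κ 2 ⊕ ν 5 ≼ ν 0 ∷ ν 0 ≼ ν 1 ⊕ ν 2 ∷ ν 3 ⊕ ν 1 ≼ ν 4 ∷ ν 4 ⊕ ν 7 ≼ ν 6 ⊕ (κ 1 ⊕ ν 5) ∷ ν 6 ≼ ν 3 ∷ ν 2 ≼ ν 7 ∷ [])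
        (lt ∷ #-cov n (λ a _ → ∨⁻ {P₁ a}) ∷ #-disj n {P} {P₁} {R} (λ a _ h → <ᵇ⁺ (≤-trans (<ᵇ⁻ {a} {j} h) (m≤m+n j r))) (λ a _ → ∧⁻² {not (P a)}) (λ a _ h h' → not⁻ (∧⁻¹ h') h) ∷
         ≤-reflexive (#-<ᵇ n (j + r)) ∷ ≤-reflexive (sym #P) ∷ ≤-reflexive #W ∷ []) refl)
      (≮⇒≥ λ lt → refute (# n (I j) ∷ # n P₁ ∷ # n W ∷ # n P ∷ # n R ∷ q ∷ j ∷ (j + r) ∸ n ∷ [])
        (κ 1 ⊕ ν 0 ≼ κ 1 ⊕ ν 5 ∷ ν 1 ⊕ ν 2 ≼ ν 0 ∷ ν 4 ≼ ν 3 ⊕ ν 1 ∷ ν 6 ⊕ (κ 1 ⊕ ν 5) ≼ ν 4 ⊕ ν 7 ∷ ν 3 ≼ ν 6 ∷ ν 7 ≼ ν 2 ∷ [])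
        (lt ∷ #-disj n (λ a _ → ∨⁺¹) (λ a _ → ∨⁺² {P₁ a}) (λ a _ h h' → not⁻ (∧⁻¹ h) (W⊂P a h')) ∷ #-cov n (λ a _ h → split a h) ∷
         ≤-reflexive (sym (#-<ᵇ n (j + r))) ∷ ≤-reflexive #P ∷ ≤-reflexive (sym #W) ∷ []) refl)
    where
    P R W P₁ : ℕ → Bool
    P a = a <ᵇ j
    R a = a <ᵇ j + r
    W a = a + n <ᵇ j + r
    P₁ a = not (P a) ∧ R a
    W⊂P : ∀ a → Is (W a) → Is (P a)
    W⊂P a h = <ᵇ⁺ (+-cancelʳ-< n a j (≤-trans (<ᵇ⁻ {a + n} {j + r} h) (+-monoʳ-≤ j (≤-trans q<ℓ (n≤1+n ℓ)))))
    split : ∀ a → Is (R a) → Is (P a) ⊎ Is (P₁ a)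
    split a h with P a
    ... | true  = inj₁ refl
    ... | false = inj₂ h
    #P : # n P ≡ j
    #P = trans (sym (+-identityʳ _)) (trans (cong (# n P +_) (sym (m≤n⇒m∸n≡0 (m≤n⇒m≤1+n j≤)))) (#-<ᵇ n j))
    b : ℕ
    b = (j + r) ∸ n
    b≤n : b ≤ n
    b≤n = ≤-trans (∸-monoˡ-≤ n (+-mono-≤ (m≤n⇒m≤1+n j≤) (≤-trans q<ℓ (n≤1+n ℓ)))) (≤-reflexive (m+n∸n≡m n n))
    #W : # n W ≡ b
    #W = trans (#-ext n (λ a _ → b≡ (λ h → <ᵇ⁺ (fw a (<ᵇ⁻ {a + n} {j + r} h))) (λ h → <ᵇ⁺ (bw a (<ᵇ⁻ {a} {b} h)))))
           (trans (sym (+-identityʳ _)) (trans (cong (# n (_<ᵇ b) +_) (sym (m≤n⇒m∸n≡0 b≤n))) (#-<ᵇ n b)))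
      where
      fw : ∀ a → a + n < j + r → a < b
      fw a h = m+n≤o⇒m≤o∸n (suc a) h
      bw : ∀ a → a < b → a + n < j + r
      bw a h = m≤o∸n⇒m+n≤o (suc a) n≤ h
        where
        n≤ : n ≤ j + r
        n≤ = <⇒≤ (m∸n≢0⇒n<m (λ e → n≮0 (subst (a <_) e h)))

x₀ : ∀ ℓ → ℕ → Fin (suc ℓ)
x₀ ℓ k with k <? suc ℓ
... | yes p = fromℕ< p
... | no _  = zero

toℕ-x₀ : ∀ {ℓ k} → k ≤ ℓ → toℕ (x₀ ℓ k) ≡ k
toℕ-x₀ {ℓ} {k} k≤ with k <? suc ℓ
... | yes p = FP.toℕ-fromℕ< p
... | no n  = ⊥-elim (n (s≤s k≤))

module Completion {ℓ q D : ℕ} (ad : Admissible ℓ q D) (0<q : 0 < q) (q<ℓ : q < ℓ) where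
  open Interval ℓ q q<ℓ

  private
    0<ℓ : 0 < ℓ
    0<ℓ = <-trans 0<q q<ℓ

    x₀-inj : ∀ {i j} → i ≤ ℓ → j ≤ ℓ → x₀ ℓ i ≡ x₀ ℓ j → i ≡ j
    x₀-inj i≤ j≤ e = trans (sym (toℕ-x₀ i≤)) (trans (cong toℕ e) (toℕ-x₀ j≤))

  J : ℕ → Fin (suc ℓ) → Bool
  J j v = I j (toℕ v)

  J-x₀ : ∀ j {k} → k ≤ ℓ → J j (x₀ ℓ k) ≡ I j k
  J-x₀ j k≤ = cong (I j) (toℕ-x₀ k≤)

  J-size : ∀ {j} → j ≤ ℓ → cnt (allFin (suc ℓ)) (J j) ≡ suc q
  J-size {j} j≤ = trans (sym (cnt-enum (x₀ ℓ) x₀-inj (J j))) (trans (#-ext (suc ℓ) (λ k k< → J-x₀ j (≤-pred k<))) (#I j≤))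

  Has : Hyper ℓ q D → ℕ → Set
  Has H j = Σ (Fin (Hyper.m H)) λ e → ∀ v → Hyper.inc H e v ≡ J j v

  has? : ∀ H j → Dec (Has H j)
  has? H j = FP.any? (λ e → FP.all? (λ v → Hyper.inc H e v ≟ᵇ J j v))

  intervalPath : (H : Hyper ℓ q D) → (∀ j → j < ℓ → Has H j) → Hyper.Path H
  intervalPath H has = record
    { x = x₀ ℓ ; y = y ; xinj = x₀-inj
    ; yinj = λ i< j< e → inj i< j< e (<-cmp _ _)
    ; lkˡ = λ {i} i< → trans (at i< (<⇒≤ i<)) (I⁺ ≤-refl (m<m+n i (s≤s z≤n)))
    ; lkʳ = λ {i} i< → trans (at i< i<) (I⁺ (n≤1+n i) (≤-trans (≤-reflexive (+-comm 2 i)) (+-monoʳ-≤ i (s≤s 0<q))))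
    }
    where
    open Hyper H using (inc)
    y : ℕ → Fin (Hyper.m H)
    y j with j <? ℓ
    ... | yes p = proj₁ (has j p)
    ... | no _  = proj₁ (has 0 0<ℓ)
    y-inc : ∀ {j} → j < ℓ → ∀ v → inc (y j) v ≡ J j v
    y-inc {j} j< with j <? ℓ
    ... | yes p = proj₂ (has j p)
    ... | no n  = ⊥-elim (n j<)
    at : ∀ {j k} → j < ℓ → k ≤ ℓ → inc (y j) (x₀ ℓ k) ≡ I j k
    at {j} j< k≤ = trans (y-inc j< _) (J-x₀ j k≤)
    apart : ∀ {i j} → i < j → j < ℓ → y i ≡ y j → ⊥
    apart i<j j< e = I-inj i<j j< (λ a a≤ → trans (sym (at (<-trans i<j j<) a≤)) (trans (cong (λ e → inc e (x₀ ℓ a)) e) (at j< a≤)))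
    inj : ∀ {i j} → i < ℓ → j < ℓ → y i ≡ y j → _ → i ≡ j
    inj i< j< e (tri< lt _ _) = ⊥-elim (apart lt j< e)
    inj i< j< e (tri≈ _ p _)  = p
    inj i< j< e (tri> _ _ lt) = ⊥-elim (apart lt i< (sym e))

  -- Only the intervals from `0, …, k ∸ 1` may still be missing. Adding an edge lowers no degree, so
  -- `noPath` stays applicable at every stage, and it refutes any Hamiltonian path found on the way.
  complete : ∀ k → k ≤ ℓ → (H : Hyper ℓ q D) → (∀ j → k ≤ j → j < ℓ → Has H j) → ¬ ¬ Hyper.Closed H
  complete zero    _  H has ¬cl = noPath (setting H ¬cl) ad (intervalPath H (λ j → has j z≤n))
  complete (suc k) k< H has ¬cl = go (has? H k)
    where
    go : Dec (Has H k) → ⊥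
    go (yes h) = complete k (<⇒≤ k<) H (λ j k≤ j< → cases j j< (m≤n⇒m<n∨m≡n k≤)) ¬cl
      where
      cases : ∀ j → j < ℓ → k < j ⊎ k ≡ j → Has H j
      cases j j< (inj₁ lt)   = has j lt j<
      cases j j< (inj₂ refl) = h
    go (no n)  = complete k (<⇒≤ k<) H⁺ (λ j k≤ j< → cases j j< (m≤n⇒m<n∨m≡n k≤)) (λ cl → done (reduce 0<ℓ cl))
      where
      open Add H (J k) (J-size (<⇒≤ k<)) (λ e h → n (e , h))
      cases : ∀ j → j < ℓ → k < j ⊎ k ≡ j → Has H⁺ j
      cases j j< (inj₁ lt)   = let (e , h) = has j lt j< in suc e , h
      cases j j< (inj₂ refl) = zero , λ v → refl
      done : Hyper.Path H ⊎ Hyper.Closed H → ⊥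
      done (inj₁ c)  = noPath (setting H ¬cl) ad c
      done (inj₂ cl) = ¬cl cl

  hamiltonian : (H : Hyper ℓ q D) → ¬ ¬ Hyper.Closed H
  hamiltonian H = complete ℓ ≤-refl H (λ j ℓ≤ j< → ⊥-elim (<⇒≱ j< ℓ≤))

-- Translation to the statement

open import Data.Fin.Subset using (Subset; ∣_∣)
open import Data.Fin.Subset.Properties using (_∈?_)
open import Data.Vec using ([]; _∷_; lookup)
import Data.Vec as Vec
import Data.Vec.Properties as VP
open import Data.Nat using (_/_; _%_)
open import Data.Nat.DivMod using (m≡m%n+[m/n]*n; m%n<n)
open import Data.Nat.Combinatorics using (_C_; nCk+nC[k+1]≡[n+1]C[k+1]; k>n⇒nCk≡0; nCk≡nC[n∸k]; nCn≡1)
open import Relation.Nullary.Decidable using (map′; _×-dec_; _→-dec_; decidable-stable)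
open import Defs

C≡bin : ∀ n k → n C k ≡ bin n k
C≡bin zero    zero    = refl
C≡bin (suc n) zero    = trans (C0 (suc n)) refl
  where
  C0 : ∀ n → n C 0 ≡ 1
  C0 zero    = refl
  C0 (suc n) = trans (nCk≡nC[n∸k] {0} {suc n} z≤n) (nCn≡1 (suc n))
C≡bin zero    (suc k) = k>n⇒nCk≡0 (s≤s (z≤n {k}))
C≡bin (suc n) (suc k) = trans (sym (nCk+nC[k+1]≡[n+1]C[k+1] n k)) (cong₂ _+_ (C≡bin n k) (C≡bin n (suc k)))

size-cnt : ∀ {k} (p : Subset k) → ∣ p ∣ ≡ cnt (allFin k) (lookup p)
size-cnt []          = refl
size-cnt (true  ∷ p) = trans (cong suc (size-cnt p)) (sym (cnt-suc (lookup (true ∷ p))))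
size-cnt (false ∷ p) = trans (size-cnt p) (sym (cnt-suc (lookup (false ∷ p))))

lookup-ext : ∀ {k} (p p' : Subset k) → (∀ v → lookup p v ≡ lookup p' v) → p ≡ p'
lookup-ext []      []        h = refl
lookup-ext (a ∷ p) (b ∷ p') h = cong₂ _∷_ (h zero) (lookup-ext p p' (λ v → h (suc v)))

hyper : ∀ {ℓ q D} (H : UniformHypergraph (suc ℓ) (suc q)) → MinDegreeAtLeast H D → Hyper ℓ q D
hyper H δ = record
  { m = m H ; inc = λ e → lookup (edge H e)
  ; size = λ e → trans (sym (size-cnt (edge H e))) (uniform H e)
  ; dist = λ h → distinct H (lookup-ext _ _ h)
  ; degr = λ v → ≤-trans (δ v) (≤-reflexive (trans (size-cnt (Vec.tabulate (λ j → lookup (edge H j) v))) (cnt-ext (allFin (m H)) (λ e _ → VP.lookup∘tabulate (λ j → lookup (edge H j) v) e))))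
  }

toℕ-next : ∀ {k} (i : Fin (suc k)) → toℕ (next i) ≡ suc (toℕ i) ⊎ (toℕ i ≡ k × toℕ (next i) ≡ 0)
toℕ-next {zero}  zero    = inj₂ (refl , refl)
toℕ-next {suc k} zero    = inj₁ refl
toℕ-next {suc k} (suc i) with next i | toℕ-next i
... | zero  | inj₁ ()
... | zero  | inj₂ (e , _) = inj₂ (cong suc e , refl)
... | suc j | inj₁ e       = inj₁ (cong suc e)
... | suc j | inj₂ (_ , ())

bergeCycle : ∀ {ℓ q D} (H : UniformHypergraph (suc ℓ) (suc q)) (δ : MinDegreeAtLeast H D) → Hyper.Closed (hyper H δ) → BergeCycle H ℓ
bergeCycle {ℓ} H δ (c , e , fe , e0 , eℓ) = record
  { vtx = λ i → x c (toℕ i) ; edg = λ i → E (toℕ i)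
  ; vtx-inj = λ {i} {j} h → FP.toℕ-injective (xinj c (FP.toℕ≤pred[n] i) (FP.toℕ≤pred[n] j) h)
  ; edg-inj = λ {i} {j} h → FP.toℕ-injective (E-inj (FP.toℕ≤pred[n] i) (FP.toℕ≤pred[n] j) h)
  ; consec = λ i → mem (E-lkˡ (FP.toℕ≤pred[n] i)) , mem (step i (toℕ-next i))
  }
  where
  open Hyper (hyper H δ) hiding (m)
  E : ℕ → Fin (m H)
  E k with k <? ℓ
  ... | yes _ = y c k
  ... | no _  = e
  E-lkˡ : ∀ {k} → k ≤ ℓ → Is (inc (E k) (x c k))
  E-lkˡ {k} k≤ with k <? ℓ
  ... | yes k< = lkˡ c k<
  ... | no k≮  = subst (λ j → Is (inc e (x c j))) (≤-antisym (≮⇒≥ k≮) k≤) eℓ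
  E-inj : ∀ {i j} → i ≤ ℓ → j ≤ ℓ → E i ≡ E j → i ≡ j
  E-inj {i} {j} i≤ j≤ h with i <? ℓ | j <? ℓ
  ... | yes i< | yes j< = yinj c i< j< h
  ... | yes i< | no _   = ⊥-elim (fe i i< h)
  ... | no _   | yes j< = ⊥-elim (fe j j< (sym h))
  ... | no i≮  | no j≮  = trans (≤-antisym i≤ (≮⇒≥ i≮)) (≤-antisym (≮⇒≥ j≮) j≤)
  E-lkʳ : ∀ {k} → suc k ≤ ℓ → Is (inc (E k) (x c (suc k)))
  E-lkʳ {k} k< with k <? ℓ
  ... | yes _  = lkʳ c k<
  ... | no k≮  = ⊥-elim (k≮ k<)
  E-ℓ : E ℓ ≡ e
  E-ℓ with ℓ <? ℓ
  ... | yes p = ⊥-elim (<-irrefl refl p)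
  ... | no _  = refl
  mem : ∀ {v e} → Is (lookup (edge H e) v) → v Data.Fin.Subset.∈ edge H e
  mem {v} {e} = VP.lookup⇒[]= v (edge H e)
  step : ∀ i → _ → Is (inc (E (toℕ i)) (x c (toℕ (next i))))
  step i (inj₁ p)       = subst (λ k → Is (inc (E (toℕ i)) (x c k))) (sym p) (E-lkʳ (subst (_≤ ℓ) p (FP.toℕ≤pred[n] (next i))))
  step i (inj₂ (p , p')) = subst₂ (λ k k' → Is (inc (E k) (x c k'))) (sym p) (sym p') (subst (λ w → Is (inc w (x c 0))) (sym E-ℓ) e0)

module _ {n r : ℕ} (H : UniformHypergraph n r) (k : ℕ) where

  IsCycle : (Fin (suc k) → Fin n) → (Fin (suc k) → Fin (m H)) → Set
  IsCycle v e = (∀ i j → v i ≡ v j → i ≡ j) × (∀ i j → e i ≡ e j → i ≡ j) ×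
                (∀ i → v i Data.Fin.Subset.∈ edge H (e i) × v (next i) Data.Fin.Subset.∈ edge H (e i))

  isCycle? : ∀ v e → Dec (IsCycle v e)
  isCycle? v e = FP.all? (λ i → FP.all? (λ j → (v i FP.≟ v j) →-dec (i FP.≟ j))) ×-dec
                 (FP.all? (λ i → FP.all? (λ j → (e i FP.≟ e j) →-dec (i FP.≟ j))) ×-dec
                  FP.all? (λ i → (v i ∈? edge H (e i)) ×-dec (v (next i) ∈? edge H (e i))))

  -- The vertex and edge sequences are coded as elements of finite sets, so they can be searched;
  -- this removes the double negation left by the argument.
  bergeCycle? : Dec (BergeCycle H k)
  bergeCycle? = map′ to from (FP.any? (λ a → FP.any? (λ b → isCycle? (finToFun a) (finToFun b))))
    where
    to : (Σ (Fin _) λ a → Σ (Fin _) λ b → IsCycle (finToFun a) (finToFun b)) → BergeCycle H k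
    to (a , b , vi , ei , co) = record { vtx = finToFun a ; edg = finToFun b ; vtx-inj = vi _ _ ; edg-inj = ei _ _ ; consec = co }
    from : BergeCycle H k → Σ (Fin _) λ a → Σ (Fin _) λ b → IsCycle (finToFun a) (finToFun b)
    from bc = funToFin vtx , funToFin edg ,
        (λ i j h → vtx-inj (trans (sym (v≗ i)) (trans h (v≗ j)))) , (λ i j h → edg-inj (trans (sym (e≗ i)) (trans h (e≗ j)))) ,
        (λ i → subst₂ (λ v e → v Data.Fin.Subset.∈ edge H e) (sym (v≗ i)) (sym (e≗ i)) (proj₁ (consec i)) ,
               subst₂ (λ v e → v Data.Fin.Subset.∈ edge H e) (sym (v≗ (next i))) (sym (e≗ i)) (proj₂ (consec i)))
      where
      open BergeCycle bc
      v≗ = FP.finToFun-funToFin vtx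
      e≗ = FP.finToFun-funToFin edg

berge : ∀ {ℓ q D} → Admissible ℓ q D → 0 < q → q < ℓ → (H : UniformHypergraph (suc ℓ) (suc q)) → MinDegreeAtLeast H D → BergeCycle H ℓ
berge {ℓ} ad 0<q q<ℓ H δ = decidable-stable (bergeCycle? H ℓ) (λ n → Completion.hamiltonian ad 0<q q<ℓ (hyper H δ) (λ cl → n (bergeCycle H δ cl)))

theorem1p6 : (n r : ℕ) → 3 ≤ r → r < n →
    (H : UniformHypergraph n r) →
    ((r ≤ (n ∸ 1) / 2 × MinDegreeAtLeast H (((n ∸ 1) / 2) C (r ∸ 1) + 1))
      ⊎ (n ≤ 2 * r × MinDegreeAtLeast H r)) →
    HamiltonianBergeCycle H
theorem1p6 (suc ℓ) (suc q) (s≤s 2≤q) (s≤s q<ℓ) H (inj₁ (r≤t , δ)) = berge (kind (parity (ℓ % 2) (m%n<n ℓ 2) ℓ≡)) (≤-trans (s≤s z≤n) 2≤q) q<ℓ H δ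
  where
  t : ℕ
  t = ℓ / 2
  ℓ≡ : ℓ ≡ ℓ % 2 + (t + t)
  ℓ≡ = trans (m≡m%n+[m/n]*n ℓ 2) (cong (ℓ % 2 +_) (trans (*-comm t 2) (cong (t +_) (+-identityʳ t))))
  D≡ : t C q + 1 ≡ suc (bin t q)
  D≡ = trans (+-comm (t C q) 1) (cong suc (C≡bin t q))
  parity : ∀ k → k < 2 → ℓ ≡ k + (t + t) → Kind ℓ q (t C q + 1) t
  parity zero          _ e = odd e 2≤q r≤t D≡
  parity (suc zero)    _ e = even e 2≤q r≤t D≡
  parity (suc (suc _)) (s≤s (s≤s ()))
theorem1p6 (suc ℓ) (suc q) (s≤s 2≤q) (s≤s q<ℓ) H (inj₂ (n≤2r , δ)) = berge (cases (m≤n⇒m<n∨m≡n ℓ≤)) (≤-trans (s≤s z≤n) 2≤q) q<ℓ H δ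
  where
  ℓ≤ : ℓ ≤ suc (q + q)
  ℓ≤ = ≤-pred (≤-trans n≤2r (≤-reflexive (cong suc (trans (cong (q +_) (+-identityʳ (suc q))) (+-suc q q)))))
  cases : ℓ < suc (q + q) ⊎ ℓ ≡ suc (q + q) → Admissible ℓ q (suc q)
  -- Here `n < 2r`; the other case is `n = 2r`, with `t = q`.
  cases (inj₁ lt) = big ≤-refl (≤-pred lt) (≤-trans (s≤s z≤n) q<ℓ)
  cases (inj₂ e)  = kind (half e 2≤q refl refl)
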